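{- Suppose $u,w\in\mathcal{B}_{n+1}$ with $u<_0w$ and $u(p)=w(p)=q$ for some $1\le p\le n+1$. Then for every strict partition $\lambda$, $$b^w_{u\,\lambda}=b^{w/_p}_{u/_p\,\lambda}\qquad\text{and}\qquad c^w_{u\,\lambda}=c^{w/_p}_{u/_p\,\lambda}.$$
   Context: For an integer $i$ write $\bar{\imath}=-i$. $\mathcal{B}_N$ is the group of permutations $w$ of $\{\pm1,\dots,\pm N\}$ with $w(\bar a)=\overline{w(a)}$, length $\ell(w)=\#\{0<i<j: w(i)>w(j)\}+\sum_{i>0>w(i)}|w(i)|$. The $0$-Bruhat order $\le_0$ is generated by covers $u\lessdot_0 w$: $\ell(w)=\ell(u)+1$ and $u^{ -1}w$ equals $(\bar\imath,i)$ or $(\bar\imath,j)(\bar\jmath,i)$, $0<i<j$. For $w\in\mathcal{B}_{n+1}$ and $1\le p\le n+1$, $w/_p\in\mathcal{B}_n$ is obtained by deleting position $p$ (and $\bar p$) and the values $\pm w(p)$: writing $q=w(p)$, for $1\le j\le n$, $w/_p(j)$ is obtained from $w(j)$ (if $j<p$) or $w(j+1)$ (if $j\ge p$) by decreasing its absolute value by one if that absolute value exceeds $|q|$ and leaving it unchanged otherwise. A strict partition is $\lambda_1>\dots>\lambda_k>0$ with Grassmannian permutation $v(\lambda)$: $v(i)=\overline{\lambda_i}$ ($i\le k$), $0<v(k+1)<v(k+2)<\cdots$. With Schubert classes $\mathfrak{B}_w\in H^*(SO_{2N+1}\mathbb{C}/B)$, $\mathfrak{C}_w\in H^*(Sp_{2N}\mathbb{C}/B)$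 (codimension $\ell(w)$), $b^w_{u\,\lambda},c^w_{u\,\lambda}$ are defined by $\mathfrak{B}_u\mathfrak{B}_{v(\lambda)}=\sum_w b^w_{u\,\lambda}\mathfrak{B}_w$ and $\mathfrak{C}_u\mathfrak{C}_{v(\lambda)}=\sum_w c^w_{u\,\lambda}\mathfrak{C}_w$ (these do not depend on $N$ as long as all permutations involved lie in $\mathcal{B}_N$). -}

module Defs where

open import Data.Bool using (Bool; true; false; if_then_else_; not; _∧_; _∨_)
open import Data.Nat as ℕ using (ℕ; zero; suc; _∸_; _≤_; _<_)
open import Data.Integer as ℤ using (ℤ; +_; -[1+_]; ∣_∣)
open import Data.Rational as ℚ using (ℚ; 0ℚ; 1ℚ)
open import Data.Fin as Fin using (Fin; toℕ; fromℕ<)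
open import Data.Vec as Vec using (Vec; lookup; replicate; _[_]≔_)
open import Data.Vec.Properties using (≡-dec)
open import Data.List as List using (List; []; _∷_; _++_; map; concatMap; foldr; length; upTo; allFin; filterᵇ)
open import Data.List.Relation.Binary.Permutation.Propositional using (_↭_)
open import Data.List.Relation.Unary.All using (All)
open import Data.List.Relation.Unary.Linked using (Linked)
open import Data.Maybe using (Maybe; just; nothing)
open import Data.Product using (Σ; _×_; _,_)
open import Relation.Nullary using (does; yes; no)
import Data.Nat.Properties as ℕP
open import Relation.Binary.PropositionalEquality using (_≡_)
open import Relation.Binary.Construct.Closure.Transitive using (TransClosure)

-- Signed permutations.
-- An element w of B_N is represented by the list [w(1), …, w(N)] of
-- integers; positions are 1-based throughout.

at : List ℤ → ℕ → ℤ
at []       _             = + 0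
at (x ∷ xs) zero          = + 0
at (x ∷ xs) (suc zero)    = x
at (x ∷ xs) (suc (suc i)) = at xs (suc i)

setAt : List ℤ → ℕ → ℤ → List ℤ
setAt []       _             _ = []
setAt (x ∷ xs) zero          _ = x ∷ xs
setAt (x ∷ xs) (suc zero)    y = y ∷ xs
setAt (x ∷ xs) (suc (suc i)) y = x ∷ setAt xs (suc i) y

oneToN : ℕ → List ℕ
oneToN N = map suc (upTo N)

IsSPerm : ℕ → List ℤ → Set
IsSPerm N w = map ∣_∣ w ↭ oneToN N

insertEverywhere : ℤ → List ℤ → List (List ℤ)
insertEverywhere y []       = (y ∷ []) ∷ []
insertEverywhere y (x ∷ xs) = (y ∷ x ∷ xs) ∷ map (x ∷_) (insertEverywhere y xs)

signedPerms : ℕ → List (List ℤ)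
signedPerms zero    = [] ∷ []
signedPerms (suc N) =
  concatMap (λ w → insertEverywhere (+ suc N) w ++ insertEverywhere -[1+ N ] w)
            (signedPerms N)

count> : ℤ → List ℤ → ℕ
count> x []       = 0
count> x (y ∷ ys) = (if does (y ℤ.<? x) then 1 else 0) ℕ.+ count> x ys

inversions : List ℤ → ℕ
inversions []       = 0
inversions (x ∷ xs) = count> x xs ℕ.+ inversions xs

negSum : List ℤ → ℕ
negSum []       = 0
negSum (x ∷ xs) = (if does (x ℤ.<? + 0) then ∣ x ∣ else 0) ℕ.+ negSum xs

len : List ℤ → ℕ
len w = inversions w ℕ.+ negSum w

-- The 0-Bruhat order.
-- u⁻¹w = t  ⇔  w = u t, and (u t)(k) = u(t(k)).
-- t = (ī,i) :            (u t)(i) = -u(i).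
-- t = (ī,j)(j̄,i), i<j :  (u t)(i) = -u(j), (u t)(j) = -u(i).

rmulNeg : List ℤ → ℕ → List ℤ
rmulNeg u i = setAt u i (ℤ.- at u i)

rmulPair : List ℤ → ℕ → ℕ → List ℤ
rmulPair u i j = setAt (setAt u i (ℤ.- at u j)) j (ℤ.- at u i)

data _⋖₀_ (u w : List ℤ) : Set where
  cover-neg  : (i : ℕ) → 1 ≤ i → i ≤ List.length u →
               w ≡ rmulNeg u i → len w ≡ suc (len u) → u ⋖₀ w
  cover-pair : (i j : ℕ) → 1 ≤ i → i < j → j ≤ List.length u →
               w ≡ rmulPair u i j → len w ≡ suc (len u) → u ⋖₀ w

_<₀_ : List ℤ → List ℤ → Set
_<₀_ = TransClosure _⋖₀_

removeAt : List ℤ → ℕ → List ℤ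
removeAt []       _             = []
removeAt (x ∷ xs) zero          = x ∷ xs
removeAt (x ∷ xs) (suc zero)    = xs
removeAt (x ∷ xs) (suc (suc i)) = x ∷ removeAt xs (suc i)

shrink : ℕ → ℤ → ℤ
shrink q (+ m)      = if does (q ℕ.<? m) then + (m ∸ 1) else + m
shrink q -[1+ m ]   = if does (q ℕ.<? suc m) then ℤ.- (+ m) else -[1+ m ]

delete/ : List ℤ → ℕ → List ℤ
delete/ w p = map (shrink ∣ at w p ∣) (removeAt w p)

embed : ℕ → List ℤ → List ℤ
embed N w = w ++ map (λ k → + (List.length w ℕ.+ suc k)) (upTo (N ∸ List.length w))

StrictPartition : List ℕ → Set
StrictPartition λ′ = Linked ℕ._>_ λ′ × All (0 <_) λ′

elemᵇ : ℕ → List ℕ → Bool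
elemᵇ k []       = false
elemᵇ k (x ∷ xs) = does (k ℕ.≟ x) ∨ elemᵇ k xs

grass : ℕ → List ℕ → List ℤ
grass N λ′ = map (λ l → ℤ.- (+ l)) λ′ ++
             map +_ (filterᵇ (λ k → not (elemᵇ k λ′)) (oneToN N))

-- Polynomials in x₁,…,x_N over ℚ (Borel presentation of H*(G/B; ℚ)).
-- A polynomial is a finite formal sum of terms (coefficient, exponent
-- vector); two polynomials are equal (≈ᴾ) iff all coefficients agree.

Mono : ℕ → Set
Mono N = Vec ℕ N

Poly : ℕ → Set
Poly N = List (ℚ × Mono N)

module _ {N : ℕ} where

  infixl 6 _+ᴾ_ _-ᴾ_
  infixl 7 _*ᴾ_
  infix 8 -ᴾ_

  constP : ℚ → Poly N
  constP c = (c , replicate N 0) ∷ []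

  varP : Fin N → Poly N
  varP i = (1ℚ , (replicate N 0 [ i ]≔ 1)) ∷ []

  _+ᴾ_ : Poly N → Poly N → Poly N
  f +ᴾ g = f ++ g

  scaleP : ℚ → Poly N → Poly N
  scaleP c = map (λ { (a , m) → (c ℚ.* a , m) })

  -ᴾ_ : Poly N → Poly N
  -ᴾ f = scaleP (ℚ.- 1ℚ) f

  _-ᴾ_ : Poly N → Poly N → Poly N
  f -ᴾ g = f +ᴾ (-ᴾ g)

  _*ᴾ_ : Poly N → Poly N → Poly N
  f *ᴾ g = concatMap (λ { (a , m) → map (λ { (b , n) → (a ℚ.* b , Vec.zipWith ℕ._+_ m n) }) g }) f

  sumP : List (Poly N) → Poly N
  sumP = foldr _+ᴾ_ []

  prodP : List (Poly N) → Poly N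
  prodP = foldr _*ᴾ_ (constP 1ℚ)

  coeff : Mono N → Poly N → ℚ
  coeff m []             = 0ℚ
  coeff m ((a , n) ∷ f) = (if does (≡-dec ℕ._≟_ n m) then a else 0ℚ) ℚ.+ coeff m f

  _≈ᴾ_ : Poly N → Poly N → Set
  f ≈ᴾ g = (m : Mono N) → coeff m f ≡ coeff m g

  -- the ideal generated by e_k(x₁², …, x_N²), 1 ≤ k ≤ N
  -- (the W-invariants of positive degree, for W = B_N, over ℚ)
  esym : ℕ → List (Poly N) → Poly N
  esym zero    _        = constP 1ℚ
  esym (suc k) []       = []
  esym (suc k) (y ∷ ys) = esym (suc k) ys +ᴾ (y *ᴾ esym k ys)

  squares : List (Poly N)
  squares = map (λ i → varP i *ᴾ varP i) (allFin N)

  InIdeal : Poly N → Set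
  InIdeal f = Σ (Fin N → Poly N) λ g →
    f ≈ᴾ sumP (map (λ k → g k *ᴾ esym (suc (toℕ k)) squares) (allFin N))

-- Root systems of type B (SO_{2N+1}) and C (Sp_{2N}), with simple
-- reflections s₀ = (1̄,1) and s_i = (i,i+1)(ī,\overline{i+1}) (1 ≤ i < N).
-- Simple roots: α₀ = x₁ (type B), α₀ = 2x₁ (type C); α_i = x_{i+1} - x_i.
-- Divided differences ∂_i f = (f - s_i f)/α_i, computed termwise.

data RootType : Set where
  typeB typeC : RootType

isOdd : ℕ → Bool
isOdd zero          = false
isOdd (suc zero)    = true
isOdd (suc (suc n)) = isOdd n

-- (x_i^a x_{i+1}^b - x_i^b x_{i+1}^a) / (x_{i+1} - x_i)
ddTerm : {N : ℕ} → Fin N → Fin N → ℚ × Mono N → Poly N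
ddTerm k k′ (c , m) with lookup m k | lookup m k′
... | a | b with does (b ℕ.≤? a)
...   | true  = map (λ t → (ℚ.- c , ((m [ k ]≔ (a ∸ 1 ∸ t)) [ k′ ]≔ (b ℕ.+ t)))) (upTo (a ∸ b))
...   | false = map (λ t → (c , ((m [ k ]≔ (a ℕ.+ t)) [ k′ ]≔ (b ∸ 1 ∸ t)))) (upTo (b ∸ a))

-- (x₁^a - (-x₁)^a) / α₀
dd0Term : RootType → {N : ℕ} → ℚ × Mono N → Poly N
dd0Term t {zero}  _       = []
dd0Term t {suc N} (c , m) =
  if isOdd (lookup m Fin.zero)
  then ((factor t ℚ.* c , (m [ Fin.zero ]≔ (lookup m Fin.zero ∸ 1))) ∷ [])
  else []
  where
  factor : RootType → ℚ
  factor typeB = 1ℚ ℚ.+ 1ℚ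
  factor typeC = 1ℚ

divDiff : RootType → {N : ℕ} → ℕ → Poly N → Poly N
divDiff t {N} zero    f = concatMap (dd0Term t) f
divDiff t {N} (suc i) f with suc i ℕ.<? N
... | yes p = concatMap (ddTerm (fromℕ< (ℕP.<-trans (ℕP.n<1+n i) p)) (fromℕ< p)) f
... | no _  = []

positiveRoots : RootType → (N : ℕ) → List (Poly N)
positiveRoots t N =
  concatMap (λ i → concatMap (λ j →
      if does (toℕ i ℕ.<? toℕ j) then ((varP j -ᴾ varP i) ∷ (varP i +ᴾ varP j) ∷ []) else [])
    (allFin N)) (allFin N)
  ++ map (λ i → short t i) (allFin N)
  where
  short : RootType → Fin N → Poly N
  short typeB i = varP i
  short typeC i = scaleP (1ℚ ℚ.+ 1ℚ) (varP i)

invOrderW : ℕ → ℚ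
invOrderW N = foldr (λ k r → (+ 1 ℚ./ 2) ℚ.* (+ 1 ℚ./ suc k) ℚ.* r) 1ℚ (upTo N)

topClass : RootType → (N : ℕ) → Poly N
topClass t N = scaleP (invOrderW N) (prodP (positiveRoots t N))

rmulS : List ℤ → ℕ → List ℤ
rmulS w zero    = rmulNeg w 1
rmulS w (suc i) = setAt (setAt w (suc i) (at w (suc (suc i)))) (suc (suc i)) (at w (suc i))

-- least i with ℓ(w s_i) > ℓ(w), if any (none iff w = w₀)
firstAscent : List ℤ → Maybe ℕ
firstAscent []       = nothing
firstAscent (x ∷ xs) = if does (+ 0 ℤ.<? x) then just 0 else go 1 (x ∷ xs)
  where
  go : ℕ → List ℤ → Maybe ℕ
  go i (a ∷ b ∷ ys) = if does (a ℤ.<? b) then just i else go (suc i) (b ∷ ys)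
  go i _            = nothing

-- Schubert polynomials (Bernstein–Gelfand–Gelfand):
--   𝔖_{w₀} = class of a point,  𝔖_w = ∂_i 𝔖_{w s_i} whenever ℓ(w s_i) > ℓ(w).
-- The recursion runs for N² - ℓ(w) steps, which is exactly the distance to w₀.
schubertGo : RootType → (N : ℕ) → ℕ → List ℤ → Poly N
schubertGo t N zero    w = topClass t N
schubertGo t N (suc k) w with firstAscent w
... | nothing = topClass t N
... | just i  = divDiff t i (schubertGo t N k (rmulS w i))

schubert : RootType → (N : ℕ) → List ℤ → Poly N
schubert t N w = schubertGo t N (N ℕ.* N ∸ len w) w

-- c : B_N → ℚ is the expansion of 𝔖_u 𝔖_v in the Schubert basis of
-- H*(G/B; ℚ) = ℚ[x₁,…,x_N]/⟨e_k(x²)⟩: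
--   𝔖_u 𝔖_v ≡ Σ_{w ∈ B_N} c(w) 𝔖_w  (mod the ideal)
IsExpansion : RootType → (N : ℕ) → List ℤ → List ℤ → (List ℤ → ℚ) → Set
IsExpansion t N u v c =
  InIdeal (schubert t N u *ᴾ schubert t N v
           -ᴾ sumP (map (λ w → scaleP (c w) (schubert t N w)) (signedPerms N)))

IsBCoeffs : ℕ → List ℤ → List ℕ → (List ℤ → ℚ) → Set
IsBCoeffs N u λ′ c = IsExpansion typeB N u (grass N λ′) c

IsCCoeffs : ℕ → List ℤ → List ℕ → (List ℤ → ℚ) → Set
IsCCoeffs N u λ′ c = IsExpansion typeC N u (grass N λ′) c

{-# OPTIONS --safe #-}
module Submission where

-- The cohomology ring acts on the space H of functions on signed permutations:
-- the variable x_a acts by the Monk–Chevalley operator X a, and the divided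
-- difference of s by the operator D s.  The ideal kills 𝟙 = δ_id, and the BGG
-- recursion shows that 𝔖_w maps 𝟙 to κ₀ δ_w with κ₀ ≠ 0.  Hence c^w_{u λ} is the
-- matrix coefficient at (u , w) of 𝔖_{v(λ)} evaluated at the operators X a.
--
-- A cover in the 0-Bruhat order only lowers values at positive positions, so
-- along a chain from u to w the value at p stays q, and so does the number s of
-- later positions with a smaller value.  On permutations with w(p) = q and fixed
-- s, deleting p preserves covers, and paths in the Bruhat order that leave this
-- set never return to it.  Thus deletion intertwines the operators X a up to a
-- cyclic permutation of the variables.  This permutation is harmless because
-- 𝔖_{v(λ)} is symmetric modulo the ideal: v(λ) has no descent besides s₀.

open import Defs
open import Algebra.Bundles using (CommutativeRing)
open import Algebra.Structures using (IsCommutativeRing)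
open import Data.Bool using (Bool; true; false; if_then_else_; not; _∨_)
open import Data.Bool.Properties using (T?)
open import Data.Empty using (⊥; ⊥-elim)
open import Data.Fin as Fin using (Fin; zero; suc; toℕ; inject₁; fromℕ<; fromℕ)
import Data.Fin.Properties as FinP
open import Data.Integer as ℤ using (ℤ; +_; -[1+_]; +≤+; +<+; ∣_∣; -<-; -<+; -≤-; -≤+)
import Data.Integer.Properties as ℤP
import Data.Integer.Tactic.RingSolver as ℤSolver
open import Data.List using (List; []; _∷_; _++_; length; concatMap; map; upTo; applyUpTo; allFin; foldr; filterᵇ)
open import Data.List.Membership.Propositional using (_∈_)
open import Data.List.Membership.Propositional.Properties using (∈-allFin; ∈-map⁺; ∈-map⁻; ∈-upTo⁻; ∈-upTo⁺; ∈-∃++; ∈-++⁺ˡ; ∈-++⁺ʳ; ∈-filter⁺; ∈-filter⁻; ∈-++⁻)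
open import Data.List.Membership.Propositional.Properties.WithK using (unique∧set⇒bag)
import Data.List.Properties as ListP
open import Data.List.Relation.Binary.BagAndSetEquality using (∼bag⇒↭)
open import Data.List.Relation.Binary.Permutation.Propositional as Perm using (_↭_; ↭-sym; ↭-refl; ↭-reflexive; ↭-trans)
open import Data.List.Relation.Binary.Permutation.Propositional.Properties using (map⁺; ↭-length; ∈-resp-↭; All-resp-↭; drop-∷; ++-comm; ++⁺ʳ)
open import Data.List.Relation.Unary.All as All using (All; []; _∷_)
import Data.List.Relation.Unary.All.Properties as AllP
open import Data.List.Relation.Unary.AllPairs as AllPairs using (AllPairs; []; _∷_)
import Data.List.Relation.Unary.AllPairs.Properties as AllPairsP
open import Data.List.Relation.Unary.Any using (here; there)
import Data.List.Relation.Unary.Linked.Properties as LinkedP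
open import Data.List.Relation.Unary.Unique.Propositional using (Unique)
import Data.List.Relation.Unary.Unique.Propositional.Properties as UniqueP
open import Data.Maybe using (Maybe; just; nothing)
open import Data.Nat as ℕ using (ℕ; zero; suc; z≤n; s≤s; _∸_)
import Data.Nat.Properties as ℕP
import Data.Nat.Tactic.RingSolver as ℕSolver
open import Data.Product using (_×_; _,_; proj₁; proj₂; Σ)
open import Data.Rational as ℚ using (ℚ; 0ℚ; 1ℚ)
import Data.Rational.Properties as ℚP
open import Data.Sum using (_⊎_; inj₁; inj₂)
open import Data.Unit using (tt)
open import Data.Vec using (Vec; lookup; tabulate; []; _∷_; replicate; _[_]≔_; zipWith)
import Data.Vec.Properties as VecP
open import Function using (_∘_; id; mk⇔)
open import Level using (0ℓ)
open import Relation.Binary.Definitions using (tri<; tri≈; tri>)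
open import Relation.Binary.PropositionalEquality as ≡ using (_≡_; _≢_; refl; sym; trans; cong; cong₂; subst; subst₂; module ≡-Reasoning)
open import Relation.Nullary using (Dec; yes; no; does; ¬_)
open import Relation.Nullary.Decidable using (map′; dec-true; dec-false; dec⇒maybe)
open import Tactic.RingSolver.Core.AlmostCommutativeRing using (AlmostCommutativeRing; fromCommutativeRing)

-- No basis theorem and no Chevalley formula is presupposed. Everything rests on one Leibniz rule,
-- `D-X`, for combinatorially defined operators. The value of a function at w is recovered from a
-- divided difference whenever w has a descent, so induction on length turns this rule into
-- commutativity of the `X a`, into the vanishing of the invariants on `𝟙`, and into the symmetry of
-- classes killed by `D s`. Uniqueness of the coefficients follows because the δ_w are independent.
--
-- The number κ₀ is the obstacle on the polynomial side: the recursion starts from a scaled product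
-- of positive roots. On `𝟙` this product collapses to a nonzero multiple of x₁ x₂³ x₃⁵ ⋯, and an
-- explicit word of divided differences brings that monomial down to a nonzero constant.
--
-- On the deletion side both permutations stay in the same B_N: the deleted one receives the value N
-- in the last position, so the same operators act on both. Lengths are compared by `L-formula`,
-- where s enters with coefficient 4 while a cover changes `L` by 2; this forces s to be constant
-- along the chain.

module SignedIndices where

  data SI (N : ℕ) : Set where
    pos neg : Fin N → SI N

  module _ {N : ℕ} where

    pos-injective : {i j : Fin N} → pos i ≡ pos j → i ≡ j
    pos-injective refl = refl

    neg-injective : {i j : Fin N} → neg i ≡ neg j → i ≡ j
    neg-injective refl = refl

    infix 4 _≟S_
    _≟S_ : (x y : SI N) → Dec (x ≡ y)
    pos i ≟S pos j = map′ (cong pos) pos-injective (i FinP.≟ j)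
    pos i ≟S neg j = no λ ()
    neg i ≟S pos j = no λ ()
    neg i ≟S neg j = map′ (cong neg) neg-injective (i FinP.≟ j)

    opp : SI N → SI N
    opp (pos i) = neg i
    opp (neg i) = pos i

    opp-opp : ∀ x → opp (opp x) ≡ x
    opp-opp (pos i) = refl
    opp-opp (neg i) = refl

    opp-injective : ∀ {x y} → opp x ≡ opp y → x ≡ y
    opp-injective {x} {y} e = trans (sym (opp-opp x)) (trans (cong opp e) (opp-opp y))

    opp-≢ : ∀ x → opp x ≢ x
    opp-≢ (pos i) ()
    opp-≢ (neg i) ()

    loc : SI N → ℤ
    loc (pos i) = + suc (toℕ i)
    loc (neg i) = -[1+ toℕ i ]

    loc-injective : ∀ x y → loc x ≡ loc y → x ≡ y
    loc-injective (pos i) (pos j) e = cong pos (FinP.toℕ-injective (ℕP.suc-injective (ℤP.+-injective e)))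
    loc-injective (neg i) (neg j) e = cong neg (FinP.toℕ-injective (ℤP.-[1+-injective e))

    loc-opp : ∀ x → loc (opp x) ≡ ℤ.- loc x
    loc-opp (pos i) = refl
    loc-opp (neg i) = refl

  -- Finite sums and Iverson brackets over a commutative ring.

  module Sums (R : CommutativeRing 0ℓ 0ℓ) where

    open CommutativeRing R hiding (zero) renaming (refl to ≈refl; sym to ≈sym; trans to ≈trans)
    import Algebra.Properties.CommutativeMonoid.Sum +-commutativeMonoid as CMS
    import Algebra.Properties.Semiring.Sum semiring as SRS
    open import Algebra.Properties.CommutativeSemigroup +-commutativeSemigroup using (interchange)
    open import Relation.Binary.Reasoning.Setoid setoid

    iv : {P : Set} → Dec P → Carrier
    iv d = if does d then 1# else 0#

    iv-yes : {P : Set} (d : Dec P) → P → iv d ≡ 1#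
    iv-yes d p rewrite dec-true d p = refl

    iv-no : {P : Set} (d : Dec P) → ¬ P → iv d ≡ 0#
    iv-no d p rewrite dec-false d p = refl

    iv-cong : {P Q : Set} (d : Dec P) (e : Dec Q) → (P → Q) → (Q → P) → iv d ≡ iv e
    iv-cong (yes p) e f g = sym (iv-yes e (f p))
    iv-cong (no ¬p) e f g = sym (iv-no e (λ q → ¬p (g q)))

    opaque
      sum : ∀ {n} → (Fin n → Carrier) → Carrier
      sum = CMS.sum

      sum-suc : ∀ {n} (F : Fin (suc n) → Carrier) → sum F ≡ F zero + sum (F ∘ suc)
      sum-suc F = refl

      sum-empty : (F : Fin 0 → Carrier) → sum F ≡ 0#
      sum-empty F = refl

      sum-cong : ∀ {n} {F G : Fin n → Carrier} → (∀ i → F i ≈ G i) → sum F ≈ sum G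
      sum-cong {n} {F} {G} e = CMS.sum-cong-≋ {n} {F} {G} e

      sum-zero : ∀ {n} (F : Fin n → Carrier) → (∀ i → F i ≈ 0#) → sum F ≈ 0#
      sum-zero {n} F z = ≈trans (CMS.sum-cong-≋ {n} {F} z) (CMS.sum-replicate-zero n)

      sum-+ : ∀ {n} (F G : Fin n → Carrier) → sum (λ i → F i + G i) ≈ sum F + sum G
      sum-+ F G = CMS.∑-distrib-+ F G

      sum-comm : ∀ {m n} (F : Fin m → Fin n → Carrier) → sum (λ i → sum (F i)) ≈ sum (λ j → sum (λ i → F i j))
      sum-comm F = CMS.∑-comm F

      sum-* : ∀ {n} (c : Carrier) (F : Fin n → Carrier) → sum (λ i → c * F i) ≈ c * sum F
      sum-* c F = ≈sym (SRS.*-distribˡ-sum c F)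

      sum-δ : ∀ {n} (a : Fin n) (F : Fin n → Carrier) → sum (λ i → iv (i FinP.≟ a) * F i) ≈ F a
      sum-δ zero F = begin
        1# * F zero + sum (λ i → 0# * F (suc i)) ≈⟨ +-cong (*-identityˡ _) (sum-zero (λ i → 0# * F (suc i)) (λ i → zeroˡ (F (suc i)))) ⟩
        F zero + 0#                              ≈⟨ +-identityʳ _ ⟩
        F zero                                   ∎
      sum-δ (suc a) F = begin
        0# * F zero + sum (λ i → iv (i FinP.≟ a) * F (suc i)) ≈⟨ +-cong (zeroˡ _) (sum-δ a (F ∘ suc)) ⟩
        0# + F (suc a)                                        ≈⟨ +-identityˡ _ ⟩
        F (suc a)                                             ∎

    module _ {N : ℕ} where

      opaque
        sumS : (SI N → Carrier) → Carrier
        sumS F = sum (F ∘ pos) + sum (F ∘ neg)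

        sumS-split : (F : SI N → Carrier) → sumS F ≡ sum (F ∘ pos) + sum (F ∘ neg)
        sumS-split F = refl

        sumS-cong : {F G : SI N → Carrier} → (∀ x → F x ≈ G x) → sumS F ≈ sumS G
        sumS-cong e = +-cong (sum-cong (e ∘ pos)) (sum-cong (e ∘ neg))

        sumS-+ : (F G : SI N → Carrier) → sumS (λ x → F x + G x) ≈ sumS F + sumS G
        sumS-+ F G = ≈trans (+-cong (sum-+ (F ∘ pos) (G ∘ pos)) (sum-+ (F ∘ neg) (G ∘ neg))) (interchange _ _ _ _)

        sumS-* : (c : Carrier) (F : SI N → Carrier) → sumS (λ x → c * F x) ≈ c * sumS F
        sumS-* c F = ≈trans (+-cong (sum-* c (F ∘ pos)) (sum-* c (F ∘ neg))) (≈sym (distribˡ c _ _))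

        sumS-zero : (F : SI N → Carrier) → (∀ x → F x ≈ 0#) → sumS F ≈ 0#
        sumS-zero F z = ≈trans (+-cong (sum-zero _ (z ∘ pos)) (sum-zero _ (z ∘ neg))) (+-identityˡ _)

        sumS-comm : (F : SI N → SI N → Carrier) → sumS (λ x → sumS (F x)) ≈ sumS (λ y → sumS (λ x → F x y))
        sumS-comm F = begin
          sum (λ i → sum (F (pos i) ∘ pos) + sum (F (pos i) ∘ neg)) + sum (λ i → sum (F (neg i) ∘ pos) + sum (F (neg i) ∘ neg))
            ≈⟨ +-cong (sum-+ _ _) (sum-+ _ _) ⟩
          (sum (λ i → sum (F (pos i) ∘ pos)) + sum (λ i → sum (F (pos i) ∘ neg))) + (sum (λ i → sum (F (neg i) ∘ pos)) + sum (λ i → sum (F (neg i) ∘ neg)))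
            ≈⟨ interchange _ _ _ _ ⟩
          (sum (λ i → sum (F (pos i) ∘ pos)) + sum (λ i → sum (F (neg i) ∘ pos))) + (sum (λ i → sum (F (pos i) ∘ neg)) + sum (λ i → sum (F (neg i) ∘ neg)))
            ≈⟨ +-cong (+-cong (sum-comm _) (sum-comm _)) (+-cong (sum-comm _) (sum-comm _)) ⟩
          (sum (λ j → sum (λ i → F (pos i) (pos j))) + sum (λ j → sum (λ i → F (neg i) (pos j)))) + (sum (λ j → sum (λ i → F (pos i) (neg j))) + sum (λ j → sum (λ i → F (neg i) (neg j))))
            ≈⟨ +-cong (sum-+ _ _) (sum-+ _ _) ⟨
          sum (λ j → sum (λ i → F (pos i) (pos j)) + sum (λ i → F (neg i) (pos j))) + sum (λ j → sum (λ i → F (pos i) (neg j)) + sum (λ i → F (neg i) (neg j))) ∎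

        sumS-δ : (a : SI N) (F : SI N → Carrier) → sumS (λ x → iv (x ≟S a) * F x) ≈ F a
        sumS-δ (pos i) F = ≈trans (+-cong (sum-δ i (F ∘ pos)) (sum-zero _ (λ j → zeroˡ (F (neg j))))) (+-identityʳ _)
        sumS-δ (neg i) F = ≈trans (+-cong (sum-zero _ (λ j → zeroˡ (F (pos j)))) (sum-δ i (F ∘ neg))) (+-identityˡ _)

      -- Writing F (σ x) as the sum over y of [y = σ x] F y, exchanging the sums and reading the
      -- bracket as [x = τ y] reduces bijective reindexing to the delta rule.
      sumS-reindex : (σ τ : SI N → SI N) → (∀ x → σ (τ x) ≡ x) → (∀ x → τ (σ x) ≡ x) →
                     (F : SI N → Carrier) → sumS (F ∘ σ) ≈ sumS F
      sumS-reindex σ τ στ τσ F = begin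
        sumS (λ x → F (σ x))
          ≈⟨ sumS-cong (λ x → ≈sym (sumS-δ (σ x) F)) ⟩
        sumS (λ x → sumS (λ y → iv (y ≟S σ x) * F y))
          ≈⟨ sumS-comm _ ⟩
        sumS (λ y → sumS (λ x → iv (y ≟S σ x) * F y))
          ≈⟨ sumS-cong (λ y → sumS-cong (λ x → reflexive (cong (_* F y)
               (iv-cong (y ≟S σ x) (x ≟S τ y) (λ e → trans (sym (τσ x)) (cong τ (sym e))) (λ e → trans (sym (στ y)) (cong σ (sym e))))))) ⟩
        sumS (λ y → sumS (λ x → iv (x ≟S τ y) * F y))
          ≈⟨ sumS-cong (λ y → sumS-δ (τ y) (λ _ → F y)) ⟩
        sumS F ∎

      sumS² : (SI N → SI N → Carrier) → Carrier
      sumS² F = sumS (λ x → sumS (F x))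

      sumS²-cong : {F G : SI N → SI N → Carrier} → (∀ x y → F x y ≈ G x y) → sumS² F ≈ sumS² G
      sumS²-cong e = sumS-cong (λ x → sumS-cong (e x))

      sumS²-+ : (F G : SI N → SI N → Carrier) → sumS² (λ x y → F x y + G x y) ≈ sumS² F + sumS² G
      sumS²-+ F G = ≈trans (sumS-cong (λ x → sumS-+ (F x) (G x))) (sumS-+ _ _)

      sumS²-reindex : (σ τ : SI N → SI N) → (∀ x → σ (τ x) ≡ x) → (∀ x → τ (σ x) ≡ x) →
                      (F : SI N → SI N → Carrier) → sumS² (λ x y → F (σ x) (σ y)) ≈ sumS² F
      sumS²-reindex σ τ στ τσ F =
        ≈trans (sumS-cong (λ x → sumS-reindex σ τ στ τσ (F (σ x)))) (sumS-reindex σ τ στ τσ (λ x → sumS (F x)))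

  module ℤSum = Sums ℤP.+-*-commutativeRing

-- Reflections, signed permutations and the length function.

module SignedPermutations where

  open SignedIndices
  open import Data.Integer using (_+_; _-_; _*_; -_; _≤_; _<_; _<?_; _≤?_)
  open import Data.Integer.Tactic.RingSolver using (solve-∀)
  open ℤSum

  sum-nonneg : ∀ {n} (F : Fin n → ℤ) → (∀ i → + 0 ≤ F i) → + 0 ≤ sum F
  sum-nonneg {zero}  F h = ℤP.≤-reflexive (sym (sum-empty F))
  sum-nonneg {suc n} F h = subst (+ 0 ≤_) (sym (sum-suc F)) (ℤP.+-mono-≤ (h zero) (sum-nonneg (F ∘ suc) (h ∘ suc)))

  sum-positive : ∀ {n} (F : Fin n → ℤ) → (∀ i → + 0 ≤ F i) → ∀ a → + 0 < F a → + 0 < sum F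
  sum-positive F h zero    p = subst (+ 0 <_) (sym (sum-suc F)) (ℤP.+-mono-<-≤ p (sum-nonneg (F ∘ suc) (h ∘ suc)))
  sum-positive F h (suc a) p = subst (+ 0 <_) (sym (sum-suc F)) (ℤP.+-mono-≤-< (h zero) (sum-positive (F ∘ suc) (h ∘ suc) a p))

  iv-nonneg : {P : Set} (d : Dec P) → + 0 ≤ iv d
  iv-nonneg (yes _) = +≤+ ℕ.z≤n
  iv-nonneg (no _)  = +≤+ ℕ.z≤n

  *-nonneg : ∀ {i j} → + 0 ≤ i → + 0 ≤ j → + 0 ≤ i * j
  *-nonneg {+ m} {+ n} _ _ = subst (+ 0 ≤_) (ℤP.pos-* m n) (+≤+ ℕ.z≤n)

  0≤m-n : ∀ {m n} → + 0 ≤ m - n → n ≤ m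
  0≤m-n = ℤP.0≤i-j⇒j≤i

  half-nonneg : ∀ i → + 0 ≤ + 2 * i → + 0 ≤ i
  half-nonneg i h = ℤP.*-cancelˡ-≤-pos (+ 0) i (+ 2) h

  half-positive : ∀ i → + 0 < + 2 * i → + 0 < i
  half-positive i h = ℤP.*-cancelˡ-<-nonNeg {+ 0} {i} (+ 2) h

  0<m-n : ∀ {m n} → + 0 < m - n → n < m
  0<m-n {m} {n} h = subst₂ _<_ (ℤP.+-identityˡ n) (solve m n) (ℤP.+-monoˡ-< n h)
    where
    solve : ∀ m n → m - n + n ≡ m
    solve = solve-∀

  m<n⇒0<n-m : ∀ {m n} → m < n → + 0 < n - m
  m<n⇒0<n-m {m} {n} h = subst (_< n - m) (ℤP.+-inverseʳ m) (ℤP.+-monoˡ-< (- m) h)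

  module _ {N : ℕ} where

    private
      S : Set
      S = SI N

    sumS-nonneg : (F : S → ℤ) → (∀ x → + 0 ≤ F x) → + 0 ≤ sumS F
    sumS-nonneg F h = subst (+ 0 ≤_) (sym (sumS-split F)) (ℤP.+-mono-≤ (sum-nonneg _ (h ∘ pos)) (sum-nonneg _ (h ∘ neg)))

    sumS-positive : (F : S → ℤ) → (∀ x → + 0 ≤ F x) → ∀ a → + 0 < F a → + 0 < sumS F
    sumS-positive F h (pos i) p = subst (+ 0 <_) (sym (sumS-split F)) (ℤP.+-mono-<-≤ (sum-positive _ (h ∘ pos) i p) (sum-nonneg _ (h ∘ neg)))
    sumS-positive F h (neg i) p = subst (+ 0 <_) (sym (sumS-split F)) (ℤP.+-mono-≤-< (sum-nonneg _ (h ∘ pos)) (sum-positive _ (h ∘ neg) i p))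

    sumS-- : (F G : S → ℤ) → sumS (λ x → F x - G x) ≡ sumS F - sumS G
    sumS-- F G = trans (sumS-+ F (λ x → - G x)) (cong (_+_ (sumS F)) (trans (sumS-cong (λ x → sym (ℤP.-1*i≡-i (G x)))) (trans (sumS-* -[1+ 0 ] G) (ℤP.-1*i≡-i _))))

    sumS²-- : (F G : S → S → ℤ) → sumS² (λ x y → F x y - G x y) ≡ sumS² F - sumS² G
    sumS²-- F G = trans (sumS-cong (λ x → sumS-- (F x) (G x))) (sumS-- _ _)

    data Case (a b x : S) : Set where
      case-a  : x ≡ a → Case a b x
      case-b  : x ≡ b → Case a b x
      case-oa : x ≡ opp a → Case a b x
      case-ob : x ≡ opp b → Case a b x
      case-f  : x ≢ a → x ≢ b → x ≢ opp a → x ≢ opp b → Case a b x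

    t-case : ∀ a b x → Case a b x
    t-case a b x with x ≟S a | x ≟S b | x ≟S opp a | x ≟S opp b
    ... | yes e | _     | _     | _     = case-a e
    ... | no _  | yes e | _     | _     = case-b e
    ... | no _  | no _  | yes e | _     = case-oa e
    ... | no _  | no _  | no _  | yes e = case-ob e
    ... | no p  | no q  | no r  | no s  = case-f p q r s

    opaque
      -- The reflection exchanging a with b and -a with -b: a signed transposition in general, the
      -- sign change of a for b = -a, the identity for b = a. Where several tests succeed they
      -- prescribe the same value.
      t : S → S → S → S
      t a b x = if does (x ≟S a) then b else
                if does (x ≟S b) then a else
                if does (x ≟S opp a) then opp b else
                if does (x ≟S opp b) then opp a else x

      t-a : ∀ a b → t a b a ≡ b
      t-a a b with a ≟S a
      ... | yes _ = refl
      ... | no ¬p = ⊥-elim (¬p refl)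

      t-b : ∀ a b → t a b b ≡ a
      t-b a b with b ≟S a | b ≟S b
      ... | yes e | _     = e
      ... | no _  | yes _ = refl
      ... | no _  | no ¬p = ⊥-elim (¬p refl)

      t-oa : ∀ a b → t a b (opp a) ≡ opp b
      t-oa a b with opp a ≟S a | opp a ≟S b | opp a ≟S opp a
      ... | yes e | _     | _     = ⊥-elim (opp-≢ a e)
      ... | no _  | yes e | _     = trans (sym (opp-opp a)) (cong opp e)
      ... | no _  | no _  | yes _ = refl
      ... | no _  | no _  | no ¬p = ⊥-elim (¬p refl)

      t-ob : ∀ a b → t a b (opp b) ≡ opp a
      t-ob a b with opp b ≟S a | opp b ≟S b | opp b ≟S opp a | opp b ≟S opp b
      ... | yes e | _     | _     | _     = trans (sym (opp-opp b)) (cong opp e)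
      ... | no _  | yes e | _     | _     = ⊥-elim (opp-≢ b e)
      ... | no _  | no _  | yes e | _     = e
      ... | no _  | no _  | no _  | yes _ = refl
      ... | no _  | no _  | no _  | no ¬p = ⊥-elim (¬p refl)

      t-f : ∀ a b {x} → x ≢ a → x ≢ b → x ≢ opp a → x ≢ opp b → t a b x ≡ x
      t-f a b {x} p q r s with x ≟S a | x ≟S b | x ≟S opp a | x ≟S opp b
      ... | yes e | _     | _     | _     = ⊥-elim (p e)
      ... | no _  | yes e | _     | _     = ⊥-elim (q e)
      ... | no _  | no _  | yes e | _     = ⊥-elim (r e)
      ... | no _  | no _  | no _  | yes e = ⊥-elim (s e)
      ... | no _  | no _  | no _  | no _  = refl

    Odd : (S → S) → Set
    Odd σ = ∀ x → σ (opp x) ≡ opp (σ x)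

    t-conj : (σ : S → S) → Odd σ → (∀ {x y} → σ x ≡ σ y → x ≡ y) →
             ∀ a b x → t (σ a) (σ b) (σ x) ≡ σ (t a b x)
    t-conj σ odd inj a b x with t-case a b x
    ... | case-a refl = trans (t-a (σ a) (σ b)) (cong σ (sym (t-a a b)))
    ... | case-b refl = trans (t-b (σ a) (σ b)) (cong σ (sym (t-b a b)))
    ... | case-oa refl = trans (cong (t (σ a) (σ b)) (odd a)) (trans (t-oa (σ a) (σ b)) (trans (sym (odd b)) (cong σ (sym (t-oa a b)))))
    ... | case-ob refl = trans (cong (t (σ a) (σ b)) (odd b)) (trans (t-ob (σ a) (σ b)) (trans (sym (odd a)) (cong σ (sym (t-ob a b)))))
    ... | case-f p q r s = trans (t-f (σ a) (σ b) (λ e → p (inj e)) (λ e → q (inj e)) (λ e → r (inj (trans e (sym (odd a))))) (λ e → s (inj (trans e (sym (odd b))))))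
                                 (cong σ (sym (t-f a b p q r s)))

    t-odd : ∀ a b → Odd (t a b)
    t-odd a b x with t-case a b x
    ... | case-a refl = trans (t-oa a b) (cong opp (sym (t-a a b)))
    ... | case-b refl = trans (t-ob a b) (cong opp (sym (t-b a b)))
    ... | case-oa refl = trans (cong (t a b) (opp-opp a)) (trans (t-a a b) (trans (sym (opp-opp b)) (cong opp (sym (t-oa a b)))))
    ... | case-ob refl = trans (cong (t a b) (opp-opp b)) (trans (t-b a b) (trans (sym (opp-opp a)) (cong opp (sym (t-ob a b)))))
    ... | case-f p q r s = trans (t-f a b (λ e → r (trans (sym (opp-opp x)) (cong opp e))) (λ e → s (trans (sym (opp-opp x)) (cong opp e)))
                                          (λ e → p (opp-injective e)) (λ e → q (opp-injective e)))
                                 (cong opp (sym (t-f a b p q r s)))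

    t-t : ∀ a b x → t a b (t a b x) ≡ x
    t-t a b x with t-case a b x
    ... | case-a refl = trans (cong (t a b) (t-a a b)) (t-b a b)
    ... | case-b refl = trans (cong (t a b) (t-b a b)) (t-a a b)
    ... | case-oa refl = trans (cong (t a b) (t-oa a b)) (t-ob a b)
    ... | case-ob refl = trans (cong (t a b) (t-ob a b)) (t-oa a b)
    ... | case-f p q r s = trans (cong (t a b) (t-f a b p q r s)) (t-f a b p q r s)

    t-injective : ∀ a b {x y} → t a b x ≡ t a b y → x ≡ y
    t-injective a b {x} {y} e = trans (sym (t-t a b x)) (trans (cong (t a b) e) (t-t a b y))

    t-opp : ∀ a b x → t (opp a) (opp b) x ≡ t a b x
    t-opp a b x = trans (cong (t (opp a) (opp b)) (sym (opp-opp x)))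
      (trans (t-conj opp (λ _ → refl) opp-injective a b (opp x)) (trans (cong opp (t-odd a b x)) (opp-opp _)))

    t-sym : ∀ a b x → t a b x ≡ t b a x
    t-sym a b x with t-case a b x
    ... | case-a refl = trans (t-a a b) (sym (t-b b a))
    ... | case-b refl = trans (t-b a b) (sym (t-a b a))
    ... | case-oa refl = trans (t-oa a b) (sym (t-ob b a))
    ... | case-ob refl = trans (t-ob a b) (sym (t-oa b a))
    ... | case-f p q r s = trans (t-f a b p q r s) (sym (t-f b a q p s r))

    sumS-t : ∀ a b (F : S → ℤ) → sumS (λ x → F (t a b x)) ≡ sumS F
    sumS-t a b F = sumS-reindex (t a b) (t a b) (t-t a b) (t-t a b) F

    sumS²-t : ∀ a b (F : S → S → ℤ) → sumS² (λ x y → F (t a b x) (t a b y)) ≡ sumS² F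
    sumS²-t a b F = sumS²-reindex (t a b) (t a b) (t-t a b) (t-t a b) F

    W : Set
    W = Vec ℤ N

    ev : W → S → ℤ
    ev w (pos i) = lookup w i
    ev w (neg i) = - lookup w i

    ev-opp : ∀ w x → ev w (opp x) ≡ - ev w x
    ev-opp w (pos i) = refl
    ev-opp w (neg i) = sym (ℤP.neg-involutive _)

    infixl 20 _·_
    _·_ : W → (S → S) → W
    w · σ = tabulate (λ i → ev w (σ (pos i)))

    ev-· : ∀ w σ → Odd σ → ∀ x → ev (w · σ) x ≡ ev w (σ x)
    ev-· w σ odd (pos i) = VecP.lookup∘tabulate _ i
    ev-· w σ odd (neg i) = trans (cong -_ (VecP.lookup∘tabulate _ i)) (trans (sym (ev-opp w (σ (pos i)))) (cong (ev w) (sym (odd (pos i)))))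

    ev-t : ∀ w a b x → ev (w · t a b) x ≡ ev w (t a b x)
    ev-t w a b = ev-· w (t a b) (t-odd a b)

    ev-ext : ∀ {w w′ : W} → (∀ x → ev w x ≡ ev w′ x) → w ≡ w′
    ev-ext {w} {w′} e = trans (sym (VecP.tabulate∘lookup w)) (trans (VecP.tabulate-cong (λ i → e (pos i))) (VecP.tabulate∘lookup w′))

    ·-cong : ∀ w {σ τ : S → S} → (∀ x → σ x ≡ τ x) → w · σ ≡ w · τ
    ·-cong w e = VecP.tabulate-cong (λ i → cong (ev w) (e (pos i)))

    ·-t-t : ∀ w a b → w · t a b · t a b ≡ w
    ·-t-t w a b = ev-ext (λ x → trans (ev-t (w · t a b) a b x) (trans (ev-t w a b (t a b x)) (cong (ev w) (t-t a b x))))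

    -- `card` says that |w(y)| is the rank of w(y) among the absolute values, each occurring twice;
    -- with injectivity the values are then exactly ±1, ..., ±N. In this form the condition is
    -- carried along by reindexing a sum, bounds the values by N and evaluates the negative part of
    -- the length.
    record Valid (w : W) : Set where
      field
        inj  : ∀ x y → ev w x ≡ ev w y → x ≡ y
        card : ∀ y → sumS (λ x → iv (∣ ev w x ∣ ℕP.≤? ∣ ev w y ∣)) ≡ + 2 * + ∣ ev w y ∣
    open Valid public

    Valid-t : ∀ {w} a b → Valid w → Valid (w · t a b)
    Valid-t {w} a b v .inj x y e = t-injective a b (v .inj _ _ (trans (sym (ev-t w a b x)) (trans e (ev-t w a b y))))
    Valid-t {w} a b v .card y rewrite ev-t w a b y =
      trans (sumS-cong (λ x → cong (λ z → iv (∣ z ∣ ℕP.≤? ∣ ev w (t a b y) ∣)) (ev-t w a b x)))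
        (trans (sumS-t a b (λ x → iv (∣ ev w x ∣ ℕP.≤? ∣ ev w (t a b y) ∣))) (v .card (t a b y)))

    -- Twice the length: each inversion of w as a permutation of ±[N] other
    -- than the pairs {−i , i} appears together with its mirror image.
    wt : S → S → ℤ
    wt x y = + 1 + iv (y ≟S opp x)

    lt : S → S → ℤ
    lt x y = iv (loc x <? loc y)

    inv : W → S → S → ℤ
    inv w x y = iv (ev w y <? ev w x)

    opaque
      L : W → ℤ
      L w = sumS² (λ x y → wt x y * lt x y * inv w x y)

      L-def : ∀ w → L w ≡ sumS² (λ x y → wt x y * lt x y * inv w x y)
      L-def w = refl

    -- They express that the reflection shortens or lengthens w. Quantifying over all moved indices
    -- makes the condition invariant under exchanging a with b and under changing both signs, so no
    -- normal form of the reflection has to be chosen.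
    Down Up : W → S → S → Set
    Down w a b = ∀ x → loc x < loc (t a b x) → ev w (t a b x) < ev w x
    Up   w a b = ∀ x → loc x < loc (t a b x) → ev w x < ev w (t a b x)

    wt-t : ∀ a b x y → wt (t a b x) (t a b y) ≡ wt x y
    wt-t a b x y = cong (_+_ (+ 1)) (iv-cong (t a b y ≟S opp (t a b x)) (y ≟S opp x)
      (λ e → t-injective a b (trans e (sym (t-odd a b x)))) (λ e → trans (cong (t a b) e) (t-odd a b x)))

    wt-positive : ∀ x y → + 0 < wt x y
    wt-positive x y = ℤP.+-mono-<-≤ {+ 0} {+ 1} (+<+ (ℕ.s≤s ℕ.z≤n)) (iv-nonneg (y ≟S opp x))

    L-nonneg : ∀ w → + 0 ≤ L w
    L-nonneg w = subst (+ 0 ≤_) (sym (L-def w)) (sumS-nonneg _ (λ x → sumS-nonneg _ (λ y → *-nonneg (*-nonneg (ℤP.<⇒≤ (wt-positive x y)) (iv-nonneg (loc x <? loc y))) (iv-nonneg (ev w y <? ev w x)))))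

    -- Contribution of (x , y) to twice the loss of `L`: it vanishes unless the reflection changes
    -- the order of the pair in position and also changes whether w inverts it. Signs can therefore
    -- be decided pair by pair.
    gap : W → S → S → S → S → ℤ
    gap w a b x y = wt x y * ((lt x y - lt (t a b x) (t a b y)) * (inv w x y - inv w (t a b x) (t a b y)))

    L-t : ∀ w a b → L (w · t a b) ≡ sumS² (λ x y → wt x y * lt x y * inv w (t a b x) (t a b y))
    L-t w a b = trans (L-def (w · t a b)) (sumS²-cong (λ x y → cong (wt x y * lt x y *_) (cong₂ (λ p q → iv (p <? q)) (ev-t w a b y) (ev-t w a b x))))

    -- The involution (x , y) ↦ (t x , t y) symmetrises the difference.
    L-gap : ∀ w a b → sumS² (gap w a b) ≡ + 2 * (L w - L (w · t a b))
    L-gap w a b = begin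
      sumS² (gap w a b)
        ≡⟨ sumS²-cong (λ x y → trans (expand (wt x y) (lt x y) (lt (τ x) (τ y)) (inv w x y) (inv w (τ x) (τ y)))
             (cong (λ z → (A x y - B x y) + (z * lt (τ x) (τ y) * inv w (τ x) (τ y) - z * lt (τ x) (τ y) * inv w x y)) (sym (wt-t a b x y)))) ⟩
      sumS² (λ x y → (A x y - B x y) + (A (τ x) (τ y) - B′ x y))
        ≡⟨ sumS²-+ _ _ ⟩
      sumS² (λ x y → A x y - B x y) + sumS² (λ x y → A (τ x) (τ y) - B′ x y)
        ≡⟨ cong₂ _+_ (sumS²-- A B) (sumS²-- (λ x y → A (τ x) (τ y)) B′) ⟩
      (sumS² A - sumS² B) + (sumS² (λ x y → A (τ x) (τ y)) - sumS² B′)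
        ≡⟨ cong₂ (λ p q → (sumS² A - sumS² B) + (p - q)) (sumS²-t a b A)
             (trans (sumS²-cong (λ x y → cong₂ (λ p q → wt (τ x) (τ y) * lt (τ x) (τ y) * inv w p q) (sym (t-t a b x)) (sym (t-t a b y)))) (sumS²-t a b B)) ⟩
      (sumS² A - sumS² B) + (sumS² A - sumS² B)
        ≡⟨ double (sumS² A - sumS² B) ⟩
      + 2 * (sumS² A - sumS² B)
        ≡⟨ cong₂ (λ y z → + 2 * (y - z)) (sym (L-def w)) (sym (L-t w a b)) ⟩
      + 2 * (L w - L (w · t a b)) ∎
      where
      open ≡-Reasoning
      τ = t a b
      A B B′ : S → S → ℤ
      A x y = wt x y * lt x y * inv w x y
      B x y = wt x y * lt x y * inv w (τ x) (τ y)
      B′ x y = wt (τ x) (τ y) * lt (τ x) (τ y) * inv w x y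
      expand : ∀ c l l′ g g′ → c * ((l - l′) * (g - g′)) ≡ (c * l * g - c * l * g′) + (c * l′ * g′ - c * l′ * g)
      expand = solve-∀
      double : ∀ x → x + x ≡ + 2 * x
      double = solve-∀

    t-shift : ∀ a b x → loc x - loc (t a b x) ≡ loc a - loc b ⊎ loc x - loc (t a b x) ≡ - (loc a - loc b) ⊎ loc x - loc (t a b x) ≡ + 0
    t-shift a b x with t-case a b x
    ... | case-a refl rewrite t-a a b = inj₁ refl
    ... | case-b refl rewrite t-b a b = inj₂ (inj₁ (r (loc b) (loc a)))
      where r : ∀ p q → p - q ≡ - (q - p)
            r = solve-∀
    ... | case-oa refl rewrite t-oa a b | loc-opp a | loc-opp b = inj₂ (inj₁ (r (loc a) (loc b)))
      where r : ∀ p q → - p - - q ≡ - (p - q)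
            r = solve-∀
    ... | case-ob refl rewrite t-ob a b | loc-opp a | loc-opp b = inj₁ (r (loc a) (loc b))
      where r : ∀ p q → - q - - p ≡ p - q
            r = solve-∀
    ... | case-f p q r s rewrite t-f a b p q r s = inj₂ (inj₂ (ℤP.+-inverseʳ (loc x)))

    -- The reflection translates whatever it moves by ±(loc a - loc b), and indices moved to the
    -- left go in the same direction, hence by the same distance.
    t-shift-eq : ∀ a b x y → loc (t a b x) < loc x → loc (t a b y) < loc y → loc x - loc (t a b x) ≡ loc y - loc (t a b y)
    t-shift-eq a b x y p q with t-shift a b x | t-shift a b y
    ... | inj₁ e | inj₁ f = trans e (sym f)
    ... | inj₁ e | inj₂ (inj₁ f) = ⊥-elim (opposite (subst (+ 0 <_) e (m<n⇒0<n-m p)) (subst (+ 0 <_) f (m<n⇒0<n-m q)))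
      where opposite : ∀ {d} → + 0 < d → + 0 < - d → ⊥
            opposite u v = ℤP.<-asym u (subst (_< + 0) (ℤP.neg-involutive _) (ℤP.neg-mono-< v))
    ... | inj₁ e | inj₂ (inj₂ f) = ⊥-elim (ℤP.<-irrefl refl (subst (+ 0 <_) f (m<n⇒0<n-m q)))
    ... | inj₂ (inj₁ e) | inj₁ f = ⊥-elim (opposite (subst (+ 0 <_) f (m<n⇒0<n-m q)) (subst (+ 0 <_) e (m<n⇒0<n-m p)))
      where opposite : ∀ {d} → + 0 < d → + 0 < - d → ⊥
            opposite u v = ℤP.<-asym u (subst (_< + 0) (ℤP.neg-involutive _) (ℤP.neg-mono-< v))
    ... | inj₂ (inj₁ e) | inj₂ (inj₁ f) = trans e (sym f)
    ... | inj₂ (inj₁ e) | inj₂ (inj₂ f) = ⊥-elim (ℤP.<-irrefl refl (subst (+ 0 <_) f (m<n⇒0<n-m q)))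
    ... | inj₂ (inj₂ e) | _ = ⊥-elim (ℤP.<-irrefl refl (subst (+ 0 <_) e (m<n⇒0<n-m p)))

    wider : ∀ {x y x′ y′ : ℤ} → x < y → y′ < x′ → x - x′ ≢ y - y′
    wider p q e = ℤP.<-irrefl e (ℤP.+-mono-< p (ℤP.neg-mono-< q))

    -- When the reflection reverses x < y, x cannot move left: y would then move left as well and by
    -- the same distance. So w(τ x) ≤ w(x), likewise w(y) ≤ w(τ y), and an inversion of the images
    -- is one of the originals.
    Down-misordered : ∀ w a b → Down w a b → ∀ x y → loc x < loc y → ¬ (loc (t a b x) < loc (t a b y)) →
                      ¬ (ev w y < ev w x) → ¬ (ev w (t a b y) < ev w (t a b x))
    Down-misordered w a b down x y x<y ¬τ ¬g g′ = ¬g (ℤP.≤-<-trans (right (ℤP.<-cmp (loc (τ y)) (loc y))) (ℤP.<-≤-trans g′ (left (ℤP.<-cmp (loc x) (loc (τ x))))))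
      where
      τ = t a b
      τy<τx : loc (τ y) < loc (τ x)
      τy<τx with ℤP.<-cmp (loc (τ x)) (loc (τ y))
      ... | tri< p _ _ = ⊥-elim (¬τ p)
      ... | tri≈ _ e _ = ⊥-elim (ℤP.<-irrefl (cong (ev w) (sym (loc-injective _ _ e))) g′)
      ... | tri> _ _ p = p
      left : _ → ev w (τ x) ≤ ev w x
      left (tri< p _ _) = ℤP.<⇒≤ (down x p)
      left (tri≈ _ e _) = ℤP.≤-reflexive (cong (ev w) (sym (loc-injective _ _ e)))
      left (tri> _ _ p) = ⊥-elim (wider x<y τy<τx (t-shift-eq a b x y p (ℤP.<-trans τy<τx (ℤP.<-trans p x<y))))
      right : _ → ev w y ≤ ev w (τ y)
      right (tri< p _ _) = ℤP.<⇒≤ (subst (λ z → ev w z < ev w (τ y)) (t-t a b y) (down (τ y) (subst (λ z → loc (τ y) < loc z) (sym (t-t a b y)) p)))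
      right (tri≈ _ e _) = ℤP.≤-reflexive (cong (ev w) (sym (loc-injective _ _ e)))
      right (tri> _ _ p) = ⊥-elim (wider τy<τx x<y (trans (cong (λ z → loc (τ y) - loc z) (sym (t-t a b y)))
        (trans (t-shift-eq a b (τ y) (τ x) (subst (λ z → loc z < loc (τ y)) (sym (t-t a b y)) p)
                  (subst (λ z → loc z < loc (τ x)) (sym (t-t a b x)) (ℤP.<-trans x<y (ℤP.<-trans p τy<τx))))
               (cong (λ z → loc (τ x) - loc z) (t-t a b x)))))

    gap-nonneg : ∀ w a b → Down w a b → ∀ x y → + 0 ≤ gap w a b x y
    gap-nonneg w a b down x y = *-nonneg (ℤP.<⇒≤ (wt-positive x y)) core
      where
      τ = t a b
      core : + 0 ≤ (lt x y - lt (τ x) (τ y)) * (inv w x y - inv w (τ x) (τ y))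
      core with loc x <? loc y | loc (τ x) <? loc (τ y) | ev w y <? ev w x | ev w (τ y) <? ev w (τ x)
      ... | yes _ | yes _ | _     | _     = ℤP.≤-refl
      ... | no _  | no _  | _     | _     = ℤP.≤-refl
      ... | yes _ | no _  | yes _ | yes _ = ℤP.≤-refl
      ... | yes _ | no _  | yes _ | no _  = +≤+ ℕ.z≤n
      ... | yes _ | no _  | no _  | no _  = ℤP.≤-refl
      ... | yes p | no q  | no r  | yes s = ⊥-elim (Down-misordered w a b down x y p q r s)
      ... | no _  | yes _ | yes _ | yes _ = ℤP.≤-refl
      ... | no _  | yes _ | no _  | yes _ = +≤+ ℕ.z≤n
      ... | no _  | yes _ | no _  | no _  = ℤP.≤-refl
      ... | no p  | yes q | yes r | no s  = ⊥-elim (Down-misordered w a b down (τ x) (τ y) q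
              (λ h → p (subst₂ (λ u v → loc u < loc v) (t-t a b x) (t-t a b y) h)) s
              (subst₂ (λ u v → ev w u < ev w v) (sym (t-t a b y)) (sym (t-t a b x)) r))

    gap-diag : ∀ w a b → Down w a b → ∀ x → loc x < loc (t a b x) → gap w a b x (t a b x) ≡ wt x (t a b x)
    gap-diag w a b down x p
      rewrite t-t a b x
            | iv-yes (loc x <? loc (t a b x)) p
            | iv-no (loc (t a b x) <? loc x) (ℤP.<-asym p)
            | iv-yes (ev w (t a b x) <? ev w x) (down x p)
            | iv-no (ev w x <? ev w (t a b x)) (ℤP.<-asym (down x p)) = ℤP.*-identityʳ _

    -- The pair (x , t x) is reversed and inverted, so its gap is its positive weight, and
    -- `gap-nonneg` prevents the other pairs from cancelling it.
    Down-L : ∀ w a b → Down w a b → ∀ x → loc x < loc (t a b x) → L (w · t a b) < L w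
    Down-L w a b down x p = 0<m-n (half-positive _ (subst (+ 0 <_) (L-gap w a b)
      (sumS-positive _ (λ x → sumS-nonneg _ (gap-nonneg w a b down x)) x
        (sumS-positive _ (gap-nonneg w a b down x) (t a b x) (subst (+ 0 <_) (sym (gap-diag w a b down x p)) (wt-positive x (t a b x)))))))

    Down-intro : ∀ w a b → (loc a < loc b → ev w b < ev w a) → (loc b < loc a → ev w a < ev w b) → Down w a b
    Down-intro w a b p q x h with t-case a b x
    ... | case-a refl rewrite t-a a b = p h
    ... | case-b refl rewrite t-b a b = q h
    ... | case-oa refl rewrite t-oa a b | loc-opp a | loc-opp b | ev-opp w a | ev-opp w b = ℤP.neg-mono-< (q (ℤP.neg-cancel-< h))
    ... | case-ob refl rewrite t-ob a b | loc-opp a | loc-opp b | ev-opp w a | ev-opp w b = ℤP.neg-mono-< (p (ℤP.neg-cancel-< h))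
    ... | case-f c d e f rewrite t-f a b c d e f = ⊥-elim (ℤP.<-irrefl refl h)

    Up-intro : ∀ w a b → (loc a < loc b → ev w a < ev w b) → (loc b < loc a → ev w b < ev w a) → Up w a b
    Up-intro w a b p q x h with t-case a b x
    ... | case-a refl rewrite t-a a b = p h
    ... | case-b refl rewrite t-b a b = q h
    ... | case-oa refl rewrite t-oa a b | loc-opp a | loc-opp b | ev-opp w a | ev-opp w b = ℤP.neg-mono-< (q (ℤP.neg-cancel-< h))
    ... | case-ob refl rewrite t-ob a b | loc-opp a | loc-opp b | ev-opp w a | ev-opp w b = ℤP.neg-mono-< (p (ℤP.neg-cancel-< h))
    ... | case-f c d e f rewrite t-f a b c d e f = ⊥-elim (ℤP.<-irrefl refl h)

    Up⇒Down : ∀ w a b → Up w a b → Down (w · t a b) a b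
    Up⇒Down w a b up x p = subst₂ _<_ (sym (trans (ev-t w a b (t a b x)) (cong (ev w) (t-t a b x)))) (sym (ev-t w a b x)) (up x p)

    moved : ∀ a b → a ≢ b → Σ S λ x → loc x < loc (t a b x)
    moved a b a≢b with ℤP.<-cmp (loc a) (loc b)
    ... | tri< p _ _ = a , subst (λ z → loc a < loc z) (sym (t-a a b)) p
    ... | tri≈ _ e _ = ⊥-elim (a≢b (loc-injective a b e))
    ... | tri> _ _ p = b , subst (λ z → loc b < loc z) (sym (t-b a b)) p

    Down-L′ : ∀ w a b → a ≢ b → Down w a b → L (w · t a b) < L w
    Down-L′ w a b a≢b down = Down-L w a b down (proj₁ m) (proj₂ m)
      where m = moved a b a≢b

    Up-L : ∀ w a b → a ≢ b → Up w a b → L w < L (w · t a b)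
    Up-L w a b a≢b up = subst (λ z → L z < L (w · t a b)) (·-t-t w a b) (Down-L′ (w · t a b) a b a≢b (Up⇒Down w a b up))

    -- Isolated from `Valid` because the images under deletion are compared with only injectivity at
    -- hand.
    Inj : W → Set
    Inj w = ∀ x y → ev w x ≡ ev w y → x ≡ y

    Inj-down-or-up : ∀ {w} → Inj w → ∀ a b → a ≢ b → Down w a b ⊎ Up w a b
    Inj-down-or-up {w} v a b a≢b with ℤP.<-cmp (loc a) (loc b) | ℤP.<-cmp (ev w a) (ev w b)
    ... | tri≈ _ e _ | _ = ⊥-elim (a≢b (loc-injective a b e))
    ... | tri< _ _ _ | tri≈ _ e _ = ⊥-elim (a≢b (v a b e))
    ... | tri> _ _ _ | tri≈ _ e _ = ⊥-elim (a≢b (v a b e))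
    ... | tri< _ _ r | tri< p _ _ = inj₂ (Up-intro w a b (λ _ → p) (λ q → ⊥-elim (r q)))
    ... | tri> r _ _ | tri< p _ _ = inj₁ (Down-intro w a b (λ q → ⊥-elim (r q)) (λ _ → p))
    ... | tri< _ _ r | tri> _ _ p = inj₁ (Down-intro w a b (λ _ → p) (λ q → ⊥-elim (r q)))
    ... | tri> r _ _ | tri> _ _ p = inj₂ (Up-intro w a b (λ q → ⊥-elim (r q)) (λ _ → p))

    down-or-up : ∀ {w} → Valid w → ∀ a b → a ≢ b → Down w a b ⊎ Up w a b
    down-or-up v = Inj-down-or-up (v .inj)

    Inj-L-t⇒Down : ∀ {w} → Inj w → ∀ a b → a ≢ b → L (w · t a b) < L w → Down w a b
    Inj-L-t⇒Down {w} v a b a≢b h with Inj-down-or-up v a b a≢b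
    ... | inj₁ d = d
    ... | inj₂ u = ⊥-elim (ℤP.<-asym h (Up-L w a b a≢b u))

    L-t⇒Down : ∀ {w} → Valid w → ∀ a b → a ≢ b → L (w · t a b) < L w → Down w a b
    L-t⇒Down v = Inj-L-t⇒Down (v .inj)

    L-t⇒Up : ∀ {w} → Valid w → ∀ a b → a ≢ b → L w < L (w · t a b) → Up w a b
    L-t⇒Up {w} v a b a≢b h with down-or-up v a b a≢b
    ... | inj₁ d = ⊥-elim (ℤP.<-asym h (Down-L′ w a b a≢b d))
    ... | inj₂ u = u

    -- An adjacent pair of signed positions. The pair (-1 , 1) gives s₀ and (i , i+1) gives s_i, so
    -- both kinds of simple reflection share all arguments below.
    record Simple : Set where
      field
        lo hi : S
        lo<hi : loc lo < loc hi
        adj   : ∀ (x : S) → loc x ≤ loc lo ⊎ loc hi ≤ loc x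
    open Simple public

    refl-of : Simple → S → S
    refl-of s = t (lo s) (hi s)

    lo≢hi : ∀ s → lo s ≢ hi s
    lo≢hi s e = ℤP.<-irrefl (cong loc e) (lo<hi s)

    module _ (s : Simple) where
      private
        τ = refl-of s
        a = lo s
        b = hi s

      simple-step : ∀ (x y : S) → loc x < loc (τ x) → loc x < loc y → loc y < loc (τ x) → ⊥
      simple-step x y h p q with t-case a b x
      ... | case-a refl rewrite t-a a b with adj s y
      ...   | inj₁ r = ℤP.<⇒≱ p r
      ...   | inj₂ r = ℤP.<⇒≱ q r
      simple-step x y h p q | case-b refl rewrite t-b a b = ℤP.<-asym h (lo<hi s)
      simple-step x y h p q | case-oa refl rewrite t-oa a b | loc-opp a | loc-opp b = ℤP.<-asym (ℤP.neg-cancel-< h) (lo<hi s)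
      simple-step x y h p q | case-ob refl rewrite t-ob a b | loc-opp a | loc-opp b with adj s (opp y)
      ...   | inj₁ r = ℤP.<⇒≱ (subst (loc a <_) (sym (loc-opp y)) (subst (_< - loc y) (ℤP.neg-involutive (loc a)) (ℤP.neg-mono-< q))) r
      ...   | inj₂ r = ℤP.<⇒≱ (subst (_< loc b) (sym (loc-opp y)) (subst (- loc y <_) (ℤP.neg-involutive (loc b)) (ℤP.neg-mono-< p))) r
      simple-step x y h p q | case-f c d e f rewrite t-f a b c d e f = ℤP.<-irrefl refl h

      -- A simple reflection moves an index only to its neighbour in the pair; reversing x < y would
      -- leave some index strictly between a moved index and its image, against `adj`.
      simple-mono : ∀ (x y : S) → loc x < loc y → y ≢ τ x → loc (τ x) < loc (τ y)
      simple-mono x y x<y y≢ with ℤP.<-cmp (loc (τ x)) (loc (τ y))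
      ... | tri< p _ _ = p
      ... | tri≈ _ e _ = ⊥-elim (ℤP.<-irrefl (cong loc (t-injective a b (loc-injective _ _ e))) x<y)
      ... | tri> _ _ p with ℤP.<-cmp (loc x) (loc (τ x))
      ...   | tri< q _ _ with ℤP.<-cmp (loc y) (loc (τ x))
      ...     | tri< r _ _ = ⊥-elim (simple-step x y q x<y r)
      ...     | tri≈ _ e _ = ⊥-elim (y≢ (loc-injective _ _ e))
      ...     | tri> _ _ r = ⊥-elim (simple-step (τ y) (τ x) (subst (λ z → loc (τ y) < loc z) (sym (t-t a b y)) (ℤP.<-trans p r)) p
                                      (subst (λ z → loc (τ x) < loc z) (sym (t-t a b y)) r))
      simple-mono x y x<y y≢ | tri> _ _ p | tri≈ _ e _ =
        ⊥-elim (simple-step (τ y) x (subst (λ z → loc (τ y) < loc z) (sym (t-t a b y)) (ℤP.<-trans p (subst (_< loc y) e x<y)))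
                  (subst (loc (τ y) <_) (sym e) p) (subst (λ z → loc x < loc z) (sym (t-t a b y)) x<y))
      simple-mono x y x<y y≢ | tri> _ _ p | tri> _ _ r =
        ⊥-elim (simple-step (τ y) x (subst (λ z → loc (τ y) < loc z) (sym (t-t a b y)) (ℤP.<-trans p (ℤP.<-trans r x<y)))
                  (ℤP.<-trans p r) (subst (λ z → loc x < loc z) (sym (t-t a b y)) x<y))

      lt-simple : ∀ x y → y ≢ τ x → lt x y ≡ lt (τ x) (τ y)
      lt-simple x y y≢ = iv-cong (loc x <? loc y) (loc (τ x) <? loc (τ y)) (λ p → simple-mono x y p y≢)
        (λ p → subst₂ (λ u v → loc u < loc v) (t-t a b x) (t-t a b y)
                 (simple-mono (τ x) (τ y) p (λ e → y≢ (t-injective a b e))))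

      -- Only pairs (x , τ x) with x among ±lo, ±hi are reversed. For s₀ the four brackets coincide
      -- in pairs, which accounts for the weight 2 of (-1 , 1).
      gap-simple : ∀ w → Down w a b → ∀ x y →
        gap w a b x y ≡ iv (y ≟S τ x) * ((iv (x ≟S a) + iv (x ≟S opp b)) + (iv (x ≟S b) + iv (x ≟S opp a)))
      gap-simple w down x y with y ≟S τ x
      ... | no y≢ rewrite lt-simple x y y≢ | ℤP.+-inverseʳ (lt (τ x) (τ y)) = ℤP.*-zeroʳ (wt x y)
      ... | yes refl = trans (diag (t-case a b x)) (sym (ℤP.*-identityˡ _))
        where
        a≢b : a ≢ b
        a≢b = lo≢hi s
        oa≢ob : opp a ≢ opp b
        oa≢ob e = a≢b (opp-injective e)
        swap : ∀ {u v : S} → u ≡ opp v → v ≡ opp u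
        swap {u} {v} e = trans (sym (opp-opp v)) (cong opp (sym e))
        dz : ∀ z → loc (τ z) < loc z → ev w z < ev w (τ z)
        dz z p = subst (λ u → ev w u < ev w (τ z)) (t-t a b z) (down (τ z) (subst (λ u → loc (τ z) < loc u) (sym (t-t a b z)) p))
        back : ∀ z → loc (τ z) < loc z → gap w a b z (τ z) ≡ wt z (τ z)
        back z p rewrite t-t a b z
            | iv-no (loc z <? loc (τ z)) (ℤP.<-asym p)
            | iv-yes (loc (τ z) <? loc z) p
            | iv-no (ev w (τ z) <? ev w z) (ℤP.<-asym (dz z p))
            | iv-yes (ev w z <? ev w (τ z)) (dz z p) = ℤP.*-identityʳ _
        la : loc a < loc (τ a)
        la = subst (λ z → loc a < loc z) (sym (t-a a b)) (lo<hi s)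
        lb : loc (τ b) < loc b
        lb = subst (λ z → loc z < loc b) (sym (t-b a b)) (lo<hi s)
        loa : loc (τ (opp a)) < loc (opp a)
        loa = subst₂ _<_ (sym (trans (cong loc (t-oa a b)) (loc-opp b))) (sym (loc-opp a)) (ℤP.neg-mono-< (lo<hi s))
        lob : loc (opp b) < loc (τ (opp b))
        lob = subst₂ _<_ (sym (loc-opp b)) (sym (trans (cong loc (t-ob a b)) (loc-opp a))) (ℤP.neg-mono-< (lo<hi s))
        r₁ : ∀ p → + 1 + p ≡ (+ 1 + p) + (+ 0 + + 0)
        r₁ = solve-∀
        r₂ : ∀ p → + 1 + p ≡ (+ 0 + + 0) + (+ 1 + p)
        r₂ = solve-∀
        r₃ : ∀ p → + 1 + p ≡ (+ 0 + + 0) + (p + + 1)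
        r₃ = solve-∀
        r₄ : ∀ p → + 1 + p ≡ (p + + 1) + (+ 0 + + 0)
        r₄ = solve-∀
        diag : Case a b x → gap w a b x (τ x) ≡ (iv (x ≟S a) + iv (x ≟S opp b)) + (iv (x ≟S b) + iv (x ≟S opp a))
        diag (case-a refl) rewrite gap-diag w a b down a la | t-a a b | iv-yes (a ≟S a) refl | iv-no (a ≟S b) a≢b | iv-no (a ≟S opp a) (λ e → opp-≢ a (sym e))
          | iv-cong (b ≟S opp a) (a ≟S opp b) swap swap = r₁ (iv (a ≟S opp b))
        diag (case-b refl) rewrite back b lb | t-b a b | iv-yes (b ≟S b) refl | iv-no (b ≟S a) (λ e → a≢b (sym e)) | iv-no (b ≟S opp b) (λ e → opp-≢ b (sym e))
          | iv-cong (a ≟S opp b) (b ≟S opp a) swap swap = r₂ (iv (b ≟S opp a))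
        diag (case-oa refl) rewrite back (opp a) loa | t-oa a b | iv-yes (opp a ≟S opp a) refl | iv-no (opp a ≟S a) (opp-≢ a) | iv-no (opp a ≟S opp b) oa≢ob
          | iv-cong (opp b ≟S opp (opp a)) (opp a ≟S b) (λ e → sym (opp-injective e)) (λ e → cong opp (sym e)) = r₃ (iv (opp a ≟S b))
        diag (case-ob refl) rewrite gap-diag w a b down (opp b) lob | t-ob a b | iv-yes (opp b ≟S opp b) refl | iv-no (opp b ≟S b) (opp-≢ b) | iv-no (opp b ≟S opp a) (λ e → oa≢ob (sym e))
          | iv-cong (opp a ≟S opp (opp b)) (opp b ≟S a) (λ e → sym (opp-injective e)) (λ e → cong opp (sym e)) = r₄ (iv (opp b ≟S a))
        diag (case-f c d e f) rewrite t-f a b c d e f | t-f a b c d e f | iv-no (x ≟S a) c | iv-no (x ≟S b) d | iv-no (x ≟S opp a) e | iv-no (x ≟S opp b) f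
          | ℤP.+-inverseʳ (lt x x) = ℤP.*-zeroʳ (wt x x)

      -- The brackets add up to 4, and this is twice the difference by `L-gap`: one unit of length
      -- is 2 in `L`.
      L-simple-Down : ∀ w → Down w a b → L w ≡ L (w · τ) + + 2
      L-simple-Down w down = fin (L w) (L (w · τ)) (ℤP.*-cancelˡ-≡ (+ 2) (L w - L (w · τ)) (+ 2) (begin
        + 2 * (L w - L (w · τ)) ≡⟨ sym (L-gap w a b) ⟩
        sumS² (gap w a b) ≡⟨ sumS²-cong (gap-simple w down) ⟩
        sumS² (λ x y → iv (y ≟S τ x) * G x) ≡⟨ sumS-cong (λ x → sumS-δ (τ x) (λ _ → G x)) ⟩
        sumS G ≡⟨ trans (sumS-+ _ _) (cong₂ _+_ (trans (sumS-+ _ _) (cong₂ _+_ (one a) (one (opp b)))) (trans (sumS-+ _ _) (cong₂ _+_ (one b) (one (opp a))))) ⟩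
        + 4 ∎))
        where
        open ≡-Reasoning
        G : S → ℤ
        G x = (iv (x ≟S a) + iv (x ≟S opp b)) + (iv (x ≟S b) + iv (x ≟S opp a))
        one : ∀ c → sumS (λ x → iv (x ≟S c)) ≡ + 1
        one c = trans (sumS-cong (λ x → sym (ℤP.*-identityʳ _))) (sumS-δ c (λ _ → + 1))
        fin : ∀ m n → m - n ≡ + 2 → m ≡ n + + 2
        fin m n e = trans (r m n) (cong (_+_ n) e)
          where r : ∀ m n → m ≡ n + (m - n)
                r = solve-∀

      L-simple-Up : ∀ w → Up w a b → L (w · τ) ≡ L w + + 2
      L-simple-Up w up = trans (L-simple-Down (w · τ) (Up⇒Down w a b up)) (cong (λ z → L z + + 2) (·-t-t w a b))

-- The field of rational numbers.

module RationalField where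

  ring : AlmostCommutativeRing 0ℓ 0ℓ
  ring = fromCommutativeRing ℚP.+-*-commutativeRing (λ x → dec⇒maybe (0ℚ ℚP.≟ x))

  infixl 6 _+_ _-_
  infixl 7 _*_
  infix 8 -_

  -- Opaque copies of the operations of ℚ, so that unification never
  -- inspects the normalised representation.
  opaque
    _+_ _*_ : ℚ → ℚ → ℚ
    _+_ = ℚ._+_
    _*_ = ℚ._*_

    -_ : ℚ → ℚ
    -_ = ℚ.-_

    0# 1# : ℚ
    0# = 0ℚ
    1# = 1ℚ

  _-_ : ℚ → ℚ → ℚ
  x - y = x + - y

  opaque
    unfolding _+_

    isCommutativeRing : IsCommutativeRing _≡_ _+_ _*_ -_ 0# 1#
    isCommutativeRing = ℚP.+-*-isCommutativeRing

    0#-def : 0# ≡ 0ℚ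
    0#-def = refl

    1#-def : 1# ≡ 1ℚ
    1#-def = refl

    +-def : ∀ x y → x ℚ.+ y ≡ x + y
    +-def x y = refl

    *-def : ∀ x y → x ℚ.* y ≡ x * y
    *-def x y = refl

    neg-def : ∀ x → ℚ.- x ≡ - x
    neg-def x = refl

    *-cancelˡ : ∀ x {y z} → x ≢ 0# → x * y ≡ x * z → y ≡ z
    *-cancelˡ x {y} {z} x≢0 e =
      trans (sym (inv y)) (trans (cong (ℚ.1/_ x {{nz}} *_) e) (inv z))
      where
      nz : ℚ.NonZero x
      nz = ℚ.≢-nonZero x≢0
      inv : ∀ y → ℚ.1/_ x {{nz}} * (x * y) ≡ y
      inv y = trans (sym (ℚP.*-assoc (ℚ.1/_ x {{nz}}) x y)) (trans (cong (ℚ._* y) (ℚP.*-inverseˡ x {{nz}})) (ℚP.*-identityˡ y))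

    1≢0 : 1# ≢ 0#
    1≢0 ()

  𝔽 : CommutativeRing 0ℓ 0ℓ
  𝔽 = record { isCommutativeRing = isCommutativeRing }

  open CommutativeRing 𝔽 public using (+-assoc; +-comm; +-identityˡ; +-identityʳ; *-assoc; *-comm; *-identityˡ; *-identityʳ; zeroˡ; zeroʳ; distribˡ; distribʳ) renaming (-‿inverseʳ to +-inverseʳ; -‿inverseˡ to +-inverseˡ)

-- Monk-Chevalley operators, divided differences and the Leibniz rule.

module ChevalleyOperators where

  open SignedIndices
  open SignedPermutations
  open RationalField
  open import Tactic.RingSolver using (solve-∀)

  module ℚSum = Sums 𝔽
  open ℚSum

  opaque
    unfolding _+_

    neg-minus : ∀ p q → p - q ≡ - (q - p)
    neg-minus = solve-∀ ring

    minus-zero : ∀ p → p - 0# ≡ p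
    minus-zero = solve-∀ ring

    neg-neg : ∀ p → - (- p) ≡ p
    neg-neg = solve-∀ ring

    neg-zero : - 0# ≡ 0#
    neg-zero = refl

    *-swap : ∀ p c h → p * (c * h) ≡ c * (p * h)
    *-swap = solve-∀ ring

    -1* : ∀ x → (- 1#) * x ≡ - x
    -1* = solve-∀ ring

    neg-*ʳ : ∀ x y → x * (- y) ≡ - (x * y)
    neg-*ʳ = solve-∀ ring

    neg-term : ∀ k g c x → k * (- g) * c * x ≡ (- 1#) * (k * g * c * x)
    neg-term = solve-∀ ring

    term-zero : ∀ A k k′ c c′ y y′ → A * (k * 0# * c * y) ≡ k′ * 0# * c′ * y′ + 0#
    term-zero = solve-∀ ring

    term-generic₁ : ∀ A k g c x → A * (k * g * c * x) ≡ k * g * (A * c) * x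
    term-generic₁ = solve-∀ ring

    term-generic₂ : ∀ k g c A x → k * g * (c * A) * x ≡ k * g * c * (A * x) + 0#
    term-generic₂ = solve-∀ ring

    term-up : ∀ k k′ g g′ y y′ → 1# * (k * g * 1# * y) ≡ k′ * g′ * 0# * y′ + 1# * (k * g * y)
    term-up = solve-∀ ring

    term-down : ∀ k g c y y′ γ → 0# * (k * g * c * y) ≡ k * (- γ) * 1# * (1# * y′) + 1# * (k * γ * y′)
    term-down = solve-∀ ring

  iv-*-cong : {P Q P′ Q′ : Set} (d : Dec P) (e : Dec Q) (d′ : Dec P′) (e′ : Dec Q′) →
              (P → Q → P′ × Q′) → (P′ → Q′ → P × Q) → iv d * iv e ≡ iv d′ * iv e′
  iv-*-cong (yes p) (yes q) d′ e′ f g = sym (cong₂ _*_ (iv-yes d′ (proj₁ (f p q))) (iv-yes e′ (proj₂ (f p q))))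
  iv-*-cong (no ¬p) e (no ¬p′) e′ f g = trans (zeroˡ (iv e)) (sym (zeroˡ (iv e′)))
  iv-*-cong (no ¬p) e (yes p′) (no ¬q′) f g = trans (zeroˡ (iv e)) (sym (zeroʳ 1#))
  iv-*-cong (no ¬p) e (yes p′) (yes q′) f g = ⊥-elim (¬p (proj₁ (g p′ q′)))
  iv-*-cong (yes p) (no ¬q) (no ¬p′) e′ f g = trans (zeroʳ 1#) (sym (zeroˡ (iv e′)))
  iv-*-cong (yes p) (no ¬q) (yes p′) (no ¬q′) f g = refl
  iv-*-cong (yes p) (no ¬q) (yes p′) (yes q′) f g = ⊥-elim (¬q (proj₂ (g p′ q′)))

  sg : ℤ → ℤ → ℚ
  sg i j = iv (i ℤ.<? j) - iv (j ℤ.<? i)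

  sg-same : ∀ i → sg i i ≡ 0#
  sg-same i = +-inverseʳ (iv (i ℤ.<? i))

  sg-< : ∀ {i j} → i ℤ.< j → sg i j ≡ 1#
  sg-< {i} {j} p = trans (cong₂ _-_ (iv-yes (i ℤ.<? j) p) (iv-no (j ℤ.<? i) (ℤP.<-asym p))) (minus-zero 1#)

  sg-swap : ∀ i j → sg i j ≡ - sg j i
  sg-swap i j = neg-minus (iv (i ℤ.<? j)) (iv (j ℤ.<? i))

  sg-> : ∀ {i j} → j ℤ.< i → sg i j ≡ - 1#
  sg-> {i} {j} p = trans (sg-swap i j) (cong -_ (sg-< p))

  sg-neg : ∀ i j → sg (ℤ.- i) (ℤ.- j) ≡ - sg i j
  sg-neg i j = trans (cong₂ _-_ (iv-cong (ℤ.- i ℤ.<? ℤ.- j) (j ℤ.<? i) ℤP.neg-cancel-< ℤP.neg-mono-<)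
                                (iv-cong (ℤ.- j ℤ.<? ℤ.- i) (i ℤ.<? j) ℤP.neg-cancel-< ℤP.neg-mono-<)) (sg-swap j i)

  +2-cancel : ∀ {i j} → i ℤ.+ + 2 ≡ j ℤ.+ + 2 → i ≡ j
  +2-cancel {i} {j} e = trans (r i) (trans (cong (ℤ._- + 2) e) (sym (r j)))
    where r : ∀ i → i ≡ i ℤ.+ + 2 ℤ.- + 2
          r = ℤSolver.solve-∀

  <+2 : ∀ i → i ℤ.< i ℤ.+ + 2
  <+2 i = subst (ℤ._< i ℤ.+ + 2) (ℤP.+-identityʳ i) (ℤP.+-monoʳ-< i (ℤ.+<+ (ℕ.s≤s ℕ.z≤n)))

  -- The coroot of the root along e_i is 2 e_i in type B and e_i in type C, so x_i pairs with it to
  -- 1 + `extra`; with all other coroots involving e_i the pairing is ±1.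
  extra : RootType → ℚ
  extra typeB = 1#
  extra typeC = 0#

  module Operators (ty : RootType) {N : ℕ} where

    private
      S : Set
      S = SI N

    -- h stands for the class Σ_w h(w) 𝔖_w. Vectors that are not signed permutations are ignored by
    -- `≐` instead of being excluded from the domain.
    H : Set
    H = W {N} → ℚ

    infix 4 _≐_
    _≐_ : H → H → Set
    h ≐ h′ = ∀ w → Valid w → h w ≡ h′ w

    infixl 6 _⊕_
    infixr 7 _⊙_
    _⊕_ : H → H → H
    (h ⊕ h′) w = h w + h′ w
    _⊙_ : ℚ → H → H
    (c ⊙ h) w = c * h w

    κ : S → S → ℚ
    κ a b = 1# + extra ty * iv (b ≟S opp a)

    κ-cong : ∀ {a b a′ b′} → (b ≡ opp a → b′ ≡ opp a′) → (b′ ≡ opp a′ → b ≡ opp a) → κ a b ≡ κ a′ b′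
    κ-cong {a} {b} {a′} {b′} f g = cong (λ z → 1# + extra ty * z) (iv-cong (b ≟S opp a) (b′ ≟S opp a′) f g)

    κ-σ : ∀ (σ : S → S) → Odd σ → (∀ {x y} → σ x ≡ σ y → x ≡ y) → ∀ a b → κ (σ a) (σ b) ≡ κ a b
    κ-σ σ odd inj a b = κ-cong {σ a} {σ b} {a} {b} (λ e → inj (trans e (sym (odd a)))) (λ e → trans (cong σ e) (odd a))

    κ-sym : ∀ a b → κ a b ≡ κ b a
    κ-sym a b = κ-cong {a} {b} {b} {a} sw sw
      where sw : ∀ {u v : S} → u ≡ opp v → v ≡ opp u
            sw {u} {v} e = trans (sym (opp-opp v)) (cong opp (sym e))

    cov : W {N} → S → S → ℚ
    cov w a b = iv (L (w · t a b) ℤ.+ + 2 ℤP.≟ L w)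

    Xterm : S → H → W {N} → S → ℚ
    Xterm a h w b = κ a b * sg (ev w a) (ev w b) * cov w a b * h (w · t a b)

    -- The Monk–Chevalley operator of multiplication by x_a.
    opaque
      X : S → H → H
      X a h w = sumS (Xterm a h w)

      X-def : ∀ a h w → X a h w ≡ sumS (Xterm a h w)
      X-def a h w = refl

    asc : W {N} → Simple → ℚ
    asc w s = iv (L w ℤ.<? L (w · refl-of s))

    -- In coordinates ∂_s 𝔖_{ws} = 𝔖_w if ws is longer than w, and ∂_s kills every other Schubert
    -- class; so the new coefficient at w is the old one at ws.
    D : Simple → H → H
    D s h w = asc w s * h (w · refl-of s)

    X-cong : ∀ a {h h′} → h ≐ h′ → X a h ≐ X a h′
    X-cong a {h} {h′} e w v = trans (X-def a h w) (trans (sumS-cong (λ b → cong (κ a b * sg (ev w a) (ev w b) * cov w a b *_) (e _ (Valid-t a b v)))) (sym (X-def a h′ w)))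

    X-⊕ : ∀ a h h′ w → X a (h ⊕ h′) w ≡ X a h w + X a h′ w
    X-⊕ a h h′ w = trans (X-def a (h ⊕ h′) w) (trans (sumS-cong (λ b → distribˡ (κ a b * sg (ev w a) (ev w b) * cov w a b) (h (w · t a b)) (h′ (w · t a b)))) (trans (sumS-+ _ _) (sym (cong₂ _+_ (X-def a h w) (X-def a h′ w)))))

    X-⊙ : ∀ a c h w → X a (c ⊙ h) w ≡ c * X a h w
    X-⊙ a c h w = trans (X-def a (c ⊙ h) w) (trans (sumS-cong (λ b → *-swap (κ a b * sg (ev w a) (ev w b) * cov w a b) c (h (w · t a b)))) (trans (sumS-* c _) (cong (c *_) (sym (X-def a h w)))))

    D-cong : ∀ s {h h′} → h ≐ h′ → D s h ≐ D s h′
    D-cong s e w v = cong (asc w s *_) (e _ (Valid-t (lo s) (hi s) v))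

    D-⊕ : ∀ s h h′ w → D s (h ⊕ h′) w ≡ D s h w + D s h′ w
    D-⊕ s h h′ w = distribˡ (asc w s) _ _

    D-⊙ : ∀ s c h w → D s (c ⊙ h) w ≡ c * D s h w
    D-⊙ s c h w = *-swap (asc w s) c (h (w · refl-of s))

    X-opp : ∀ a h w → X (opp a) h w ≡ - X a h w
    X-opp a h w = begin
      X (opp a) h w ≡⟨ X-def (opp a) h w ⟩
      sumS (Xterm (opp a) h w) ≡⟨ sym (sumS-reindex opp opp opp-opp opp-opp (Xterm (opp a) h w)) ⟩
      sumS (λ b → Xterm (opp a) h w (opp b)) ≡⟨ sumS-cong term ⟩
      sumS (λ b → (- 1#) * Xterm a h w b) ≡⟨ trans (sumS-* (- 1#) (Xterm a h w)) (cong ((- 1#) *_) (sym (X-def a h w))) ⟩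
      (- 1#) * X a h w ≡⟨ -1* (X a h w) ⟩
      - X a h w ∎
      where
      open ≡-Reasoning
      r₁ : ∀ {k k′ g g′ c c′ x x′} → k′ ≡ k → g′ ≡ - g → c′ ≡ c → x′ ≡ x → k′ * g′ * c′ * x′ ≡ (- 1#) * (k * g * c * x)
      r₁ {k} {_} {g} {_} {c} {_} {x} refl refl refl refl = neg-term k g c x
      term : ∀ b → Xterm (opp a) h w (opp b) ≡ (- 1#) * Xterm a h w b
      term b = r₁ (κ-σ opp (λ _ → refl) opp-injective a b) (trans (cong₂ sg (ev-opp w a) (ev-opp w b)) (sg-neg (ev w a) (ev w b)))
                  (cong (λ z → iv (L z ℤ.+ + 2 ℤP.≟ L w)) (·-cong w (t-opp a b))) (cong h (·-cong w (t-opp a b)))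

    module _ (s : Simple {N}) where
      private
        τ = refl-of s
        τ-odd = t-odd (lo s) (hi s)
        τ-inj = t-injective (lo s) (hi s)
        ττ = t-t (lo s) (hi s)

      -- ∂_s x_a, that is, the pairing of x_a with the simple coroot of s; positive for hi and
      -- negative for lo.
      coroot : S → ℚ
      coroot a = κ a (τ a) * sg (loc (τ a)) (loc a)

      coroot-opp : ∀ a → coroot (opp a) ≡ - coroot a
      coroot-opp a = trans (cong₂ _*_ (trans (cong (κ (opp a)) (τ-odd a)) (κ-σ opp (λ _ → refl) opp-injective a (τ a)))
                              (trans (cong₂ sg (trans (cong loc (τ-odd a)) (loc-opp (τ a))) (loc-opp a)) (sg-neg (loc (τ a)) (loc a))))
                           ((neg-*ʳ (κ a (τ a)) (sg (loc (τ a)) (loc a))))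

      coroot-τ : ∀ a → coroot (τ a) ≡ - coroot a
      coroot-τ a = trans (cong₂ _*_ (trans (cong (κ (τ a)) (ττ a)) (κ-sym (τ a) a)) (trans (cong (λ z → sg (loc z) (loc (τ a))) (ττ a)) (sg-swap (loc a) (loc (τ a)))))
                         ((neg-*ʳ (κ a (τ a)) (sg (loc (τ a)) (loc a))))

      coroot-fixed : ∀ a → τ a ≡ a → coroot a ≡ 0#
      coroot-fixed a e = trans (cong (κ a (τ a) *_) (trans (cong (λ z → sg (loc z) (loc a)) e) (sg-same (loc a)))) (zeroʳ (κ a (τ a)))

      τ-moved : ∀ a x → τ a ≢ a → τ x ≢ x → x ≡ a ⊎ x ≡ τ a ⊎ x ≡ opp a ⊎ x ≡ opp (τ a)
      τ-moved a x ma mx with t-case (lo s) (hi s) a | t-case (lo s) (hi s) x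
      ... | case-f c d e f | _ = ⊥-elim (ma (t-f (lo s) (hi s) c d e f))
      ... | _ | case-f c d e f = ⊥-elim (mx (t-f (lo s) (hi s) c d e f))
      ... | case-a refl | case-a refl = inj₁ refl
      ... | case-a refl | case-b refl = inj₂ (inj₁ (sym (t-a _ _)))
      ... | case-a refl | case-oa refl = inj₂ (inj₂ (inj₁ refl))
      ... | case-a refl | case-ob refl = inj₂ (inj₂ (inj₂ (cong opp (sym (t-a _ _)))))
      ... | case-b refl | case-a refl = inj₂ (inj₁ (sym (t-b _ _)))
      ... | case-b refl | case-b refl = inj₁ refl
      ... | case-b refl | case-oa refl = inj₂ (inj₂ (inj₂ (cong opp (sym (t-b _ _)))))
      ... | case-b refl | case-ob refl = inj₂ (inj₂ (inj₁ refl))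
      ... | case-oa refl | case-a refl = inj₂ (inj₂ (inj₁ (sym (opp-opp _))))
      ... | case-oa refl | case-b refl = inj₂ (inj₂ (inj₂ (trans (sym (opp-opp _)) (cong opp (sym (t-oa _ _))))))
      ... | case-oa refl | case-oa refl = inj₁ refl
      ... | case-oa refl | case-ob refl = inj₂ (inj₁ (sym (t-oa _ _)))
      ... | case-ob refl | case-a refl = inj₂ (inj₂ (inj₂ (trans (sym (opp-opp _)) (cong opp (sym (t-ob _ _))))))
      ... | case-ob refl | case-b refl = inj₂ (inj₂ (inj₁ (sym (opp-opp _))))
      ... | case-ob refl | case-oa refl = inj₂ (inj₁ (sym (t-ob _ _)))
      ... | case-ob refl | case-ob refl = inj₁ refl

      τ-as-t : ∀ a → τ a ≢ a → ∀ x → t a (τ a) x ≡ τ x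
      τ-as-t a ma x with t-case a (τ a) x
      ... | case-a refl = t-a a (τ a)
      ... | case-b refl = trans (t-b a (τ a)) (sym (ττ a))
      ... | case-oa refl = trans (t-oa a (τ a)) (sym (τ-odd a))
      ... | case-ob refl = trans (t-ob a (τ a)) (trans (cong opp (sym (ττ a))) (sym (τ-odd (τ a))))
      ... | case-f c d e f with τ x ≟S x
      ...   | yes fx = trans (t-f a (τ a) c d e f) (sym fx)
      ...   | no mx with τ-moved a x ma mx
      ...     | inj₁ p = ⊥-elim (c p)
      ...     | inj₂ (inj₁ p) = ⊥-elim (d p)
      ...     | inj₂ (inj₂ (inj₁ p)) = ⊥-elim (e p)
      ...     | inj₂ (inj₂ (inj₂ p)) = ⊥-elim (f p)

      t-agrees : ∀ a b x → loc x ℤ.< loc (t a b x) → t a b x ≡ τ x → b ≡ τ a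
      t-agrees a b x m e with t-case a b x
      ... | case-a refl = trans (sym (t-a a b)) e
      ... | case-b refl = trans (sym (ττ b)) (cong τ (trans (sym e) (t-b a b)))
      ... | case-oa refl = opp-injective (trans (sym (t-oa a b)) (trans e (τ-odd a)))
      ... | case-ob refl = trans (sym (ττ b)) (cong τ (sym (opp-injective (trans (sym (t-ob a b)) (trans e (τ-odd b))))))
      ... | case-f p q r u = ⊥-elim (ℤP.<-irrefl (cong loc (sym (t-f a b p q r u))) m)

      -- Every positive root other than the simple one stays positive under τ.
      Down-conj : ∀ w a b → b ≢ τ a → Down w (τ a) (τ b) → Down (w · τ) a b
      Down-conj w a b b≢ down x m =
        subst₂ ℤ._<_ (trans (cong (ev w) (t-conj τ τ-odd τ-inj a b x)) (sym (ev-t w (lo s) (hi s) (t a b x)))) (sym (ev-t w (lo s) (hi s) x))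
          (down (τ x) (subst (λ z → loc (τ x) ℤ.< loc z) (sym (t-conj τ τ-odd τ-inj a b x))
            (simple-mono s x (t a b x) m (λ e → b≢ (t-agrees a b x m e)))))

      conj-· : ∀ w a b → w · t (τ a) (τ b) · τ ≡ w · τ · t a b
      conj-· w a b = ev-ext (λ x → trans (ev-t (w · t (τ a) (τ b)) (lo s) (hi s) x) (trans (ev-t w (τ a) (τ b) (τ x))
        (trans (cong (ev w) (t-conj τ τ-odd τ-inj a b x)) (sym (trans (ev-t (w · τ) a b x) (ev-t w (lo s) (hi s) (t a b x)))))))

      conj-·′ : ∀ w a b → w · t (τ a) (τ b) ≡ w · τ · t a b · τ
      conj-·′ w a b = trans (sym (·-t-t _ (lo s) (hi s))) (cong (_· τ) (conj-· w a b))

      -- Diamond property: put w′ = w t(τ a, τ b) and y = w′ s = w s t(a, b). Either side says that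
      -- y has the length of w, with w′ one step below both and ws one step above both. A shortening
      -- by a reflection other than s survives conjugation with s, which transfers the conditions.
      cover-exchange : ∀ {w} → Valid w → ∀ a b → a ≢ b → b ≢ τ a →
        asc w s * cov (w · τ) a b ≡ cov w (τ a) (τ b) * asc (w · t (τ a) (τ b)) s
      cover-exchange {w} v a b a≢b b≢ = iv-*-cong (L w ℤ.<? L ws) (L (ws · t a b) ℤ.+ + 2 ℤP.≟ L ws)
          (L w′ ℤ.+ + 2 ℤP.≟ L w) (L w′ ℤ.<? L (w′ · τ)) P⇒Q Q⇒P
        where
        ws w′ : W
        ws = w · τ
        w′ = w · t (τ a) (τ b)
        vs : Valid ws
        vs = Valid-t (lo s) (hi s) v
        v′ : Valid w′
        v′ = Valid-t (τ a) (τ b) v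
        τa≢τb : τ a ≢ τ b
        τa≢τb e = a≢b (τ-inj e)
        y≡ : w′ · τ ≡ ws · t a b
        y≡ = conj-· w a b
        P⇒Q : L w ℤ.< L ws → L (ws · t a b) ℤ.+ + 2 ≡ L ws → L w′ ℤ.+ + 2 ≡ L w × L w′ ℤ.< L (w′ · τ)
        P⇒Q p q = go (down-or-up v′ (lo s) (hi s) (lo≢hi s))
          where
          Ly : L (w′ · τ) ≡ L w
          Ly = trans (cong L y≡) (+2-cancel (trans q (L-simple-Up s w (L-t⇒Up v (lo s) (hi s) (lo≢hi s) p))))
          d : Down ws a b
          d = L-t⇒Down vs a b a≢b (subst (L (ws · t a b) ℤ.<_) q (<+2 _))
          d′ : Down w (τ a) (τ b)
          d′ = subst (λ z → Down z (τ a) (τ b)) (·-t-t w (lo s) (hi s))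
                 (Down-conj ws (τ a) (τ b) (λ e → b≢ (τ-inj e)) (subst₂ (Down ws) (sym (ττ a)) (sym (ττ b)) d))
          lt′ : L w′ ℤ.< L w
          lt′ = Down-L′ w (τ a) (τ b) τa≢τb d′
          go : Down w′ (lo s) (hi s) ⊎ Up w′ (lo s) (hi s) → L w′ ℤ.+ + 2 ≡ L w × L w′ ℤ.< L (w′ · τ)
          go (inj₁ dn) = ⊥-elim (ℤP.<-asym lt′ (subst (ℤ._< L w′) Ly (Down-L′ w′ (lo s) (hi s) (lo≢hi s) dn)))
          go (inj₂ up) = trans (sym (L-simple-Up s w′ up)) Ly , Up-L w′ (lo s) (hi s) (lo≢hi s) up
        Q⇒P : L w′ ℤ.+ + 2 ≡ L w → L w′ ℤ.< L (w′ · τ) → L w ℤ.< L ws × L (ws · t a b) ℤ.+ + 2 ≡ L ws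
        Q⇒P p q = go (down-or-up v (lo s) (hi s) (lo≢hi s))
          where
          Ly : L (ws · t a b) ≡ L w
          Ly = trans (cong L (sym y≡)) (trans (L-simple-Up s w′ (L-t⇒Up v′ (lo s) (hi s) (lo≢hi s) q)) p)
          d : Down w (τ a) (τ b)
          d = L-t⇒Down v (τ a) (τ b) τa≢τb (subst (L w′ ℤ.<_) p (<+2 _))
          go : Down w (lo s) (hi s) ⊎ Up w (lo s) (hi s) → L w ℤ.< L ws × L (ws · t a b) ℤ.+ + 2 ≡ L ws
          go (inj₁ dn) = ⊥-elim (ℤP.<-irrefl Ly (ℤP.<-trans (Down-L′ ws a b a≢b (Down-conj w a b b≢ d)) (Down-L′ w (lo s) (hi s) (lo≢hi s) dn)))
          go (inj₂ up) = Up-L w (lo s) (hi s) (lo≢hi s) up , trans (cong (ℤ._+ + 2) Ly) (sym (L-simple-Up s w up))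

      sg-Up : ∀ {w} → Up w (lo s) (hi s) → ∀ a → sg (ev w (τ a)) (ev w a) ≡ sg (loc (τ a)) (loc a)
      sg-Up {w} up a with ℤP.<-cmp (loc a) (loc (τ a))
      ... | tri< p _ _ = trans (sg-> (up a p)) (sym (sg-> p))
      ... | tri≈ _ e _ = trans (cong (λ z → sg (ev w z) (ev w a)) (sym (loc-injective _ _ e))) (trans (sg-same (ev w a)) (sym (trans (cong (λ z → sg z (loc a)) (sym e)) (sg-same (loc a)))))
      ... | tri> _ _ p = trans (sg-< (subst (λ z → ev w (τ a) ℤ.< ev w z) (ττ a) (up (τ a) (subst (λ z → loc (τ a) ℤ.< loc z) (sym (ττ a)) p)))) (sym (sg-< p))

      sg-Down : ∀ {w} → Down w (lo s) (hi s) → ∀ a → sg (ev w (τ a)) (ev w a) ≡ - sg (loc (τ a)) (loc a)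
      sg-Down {w} down a with ℤP.<-cmp (loc a) (loc (τ a))
      ... | tri< p _ _ = trans (sg-< (down a p)) (trans (sym (neg-neg 1#)) (cong -_ (sym (sg-> p))))
      ... | tri≈ _ e _ = trans (cong (λ z → sg (ev w z) (ev w a)) (sym (loc-injective _ _ e))) (trans (sg-same (ev w a)) (trans (sym neg-zero) (cong -_ (sym (trans (cong (λ z → sg z (loc a)) (sym e)) (sg-same (loc a)))))))
      ... | tri> _ _ p = trans (sg-> (subst (λ z → ev w z ℤ.< ev w (τ a)) (ττ a) (down (τ a) (subst (λ z → loc (τ a) ℤ.< loc z) (sym (ττ a)) p)))) (cong -_ (sym (sg-< p)))

      -- Leibniz rule ∂_s(x_a h) = x_{τ a} ∂_s h + ∂_s(x_a) h. Summands with b ≠ τ a match through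
      -- `cover-exchange`. For b = τ a the reflection is s itself: it contributes on the left if ws
      -- is longer and on the right if ws is shorter, the difference being the last term.
      D-X : ∀ a h w → Valid w → D s (X a h) w ≡ X (τ a) (D s h) w + coroot a * h w
      D-X a h w v = begin
        asc w s * X a h (w · τ)
          ≡⟨ trans (cong (asc w s *_) (X-def a h (w · τ))) (sym (sumS-* (asc w s) (Xterm a h (w · τ)))) ⟩
        sumS (λ b → asc w s * Xterm a h (w · τ) b)
          ≡⟨ sumS-cong term ⟩
        sumS (λ b → Xterm (τ a) (D s h) w (τ b) + iv (b ≟S τ a) * (coroot a * h w))
          ≡⟨ sumS-+ _ _ ⟩
        sumS (λ b → Xterm (τ a) (D s h) w (τ b)) + sumS (λ b → iv (b ≟S τ a) * (coroot a * h w))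
          ≡⟨ cong₂ _+_ (trans (sumS-reindex τ τ ττ ττ (Xterm (τ a) (D s h) w)) (sym (X-def (τ a) (D s h) w))) (sumS-δ (τ a) (λ _ → coroot a * h w)) ⟩
        X (τ a) (D s h) w + coroot a * h w ∎
        where
        open ≡-Reasoning
        kS : ∀ b → κ (τ a) (τ b) ≡ κ a b
        kS = κ-σ τ τ-odd τ-inj a
        zero-lemma : ∀ {A k k′ g g′ c c′ y y′ z} → g ≡ 0# → g′ ≡ 0# → z ≡ 0# → A * (k * g * c * y) ≡ k′ * g′ * c′ * y′ + z
        zero-lemma {A} {k} {k′} {_} {_} {c} {c′} {y} {y′} refl refl refl = term-zero A k k′ c c′ y y′
        generic-lemma : ∀ {A k k′ g g′ c c′ A′ y y′ z} → k′ ≡ k → g ≡ g′ → y ≡ y′ → A * c ≡ c′ * A′ → z ≡ 0# →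
          A * (k * g * c * y) ≡ k′ * g′ * c′ * (A′ * y′) + z
        generic-lemma {A} {k} {_} {g} {_} {c} {c′} {A′} {y} refl refl refl e refl =
          trans (term-generic₁ A k g c y) (trans (cong (λ z → k * g * z * y) e) (term-generic₂ k g c′ A′ y))
        up-lemma : ∀ {A k k′ g g′ c c′ y y′ i γ x} → A ≡ 1# → c ≡ 1# → g ≡ γ → y ≡ x → c′ ≡ 0# → i ≡ 1# →
          A * (k * g * c * y) ≡ k′ * g′ * c′ * y′ + i * (k * γ * x)
        up-lemma {_} {k} {k′} {g} {g′} {_} {_} {y} {y′} refl refl refl refl refl refl = term-up k k′ g g′ y y′
        down-lemma : ∀ {A k k′ g g′ c c′ A′ y y′ i γ x} → A ≡ 0# → k′ ≡ k → g′ ≡ - γ → c′ ≡ 1# → A′ ≡ 1# → y′ ≡ x → i ≡ 1# →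
          A * (k * g * c * y) ≡ k′ * g′ * c′ * (A′ * y′) + i * (k * γ * x)
        down-lemma {_} {k} {_} {g} {_} {c} {_} {_} {y} {y′} {_} {γ} refl refl refl refl refl refl refl = term-down k g c y y′ γ
        sg-· : ∀ b → sg (ev (w · τ) a) (ev (w · τ) b) ≡ sg (ev w (τ a)) (ev w (τ b))
        sg-· b = cong₂ sg (ev-t w (lo s) (hi s) a) (ev-t w (lo s) (hi s) b)
        special : τ a ≢ a → asc w s * Xterm a h (w · τ) (τ a) ≡ Xterm (τ a) (D s h) w (τ (τ a)) + iv (τ a ≟S τ a) * (coroot a * h w)
        special ma with down-or-up v (lo s) (hi s) (lo≢hi s)
        ... | inj₂ up = up-lemma (iv-yes (L w ℤ.<? L (w · τ)) (Up-L w (lo s) (hi s) (lo≢hi s) up))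
                          (iv-yes (L (w · τ · t a (τ a)) ℤ.+ + 2 ℤP.≟ L (w · τ)) (trans (cong (λ z → L z ℤ.+ + 2) back) (sym (L-simple-Up s w up))))
                          (trans (sg-· (τ a)) (trans (cong (λ z → sg (ev w (τ a)) (ev w z)) (ττ a)) (sg-Up up a)))
                          (cong h back)
                          (iv-no (L (w · t (τ a) (τ (τ a))) ℤ.+ + 2 ℤP.≟ L w)
                            (λ e → ℤP.<-asym (Up-L w (lo s) (hi s) (lo≢hi s) up) (subst (L (w · τ) ℤ.<_) (trans (cong (λ z → L z ℤ.+ + 2) (sym fwd)) e) (<+2 _))))
                          (iv-yes (τ a ≟S τ a) refl)
          where
          back : w · τ · t a (τ a) ≡ w
          back = trans (·-cong (w · τ) (τ-as-t a ma)) (·-t-t w (lo s) (hi s))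
          fwd : w · t (τ a) (τ (τ a)) ≡ w · τ
          fwd = trans (conj-·′ w a (τ a)) (cong (_· τ) back)
        ... | inj₁ dn = down-lemma (iv-no (L w ℤ.<? L (w · τ)) (ℤP.<-asym (Down-L′ w (lo s) (hi s) (lo≢hi s) dn)))
                          (kS (τ a))
                          (trans (cong (λ z → sg (ev w (τ a)) (ev w z)) (ττ a)) (sg-Down dn a))
                          (iv-yes (L (w · t (τ a) (τ (τ a))) ℤ.+ + 2 ℤP.≟ L w) (trans (cong (λ z → L z ℤ.+ + 2) fwd) (sym (L-simple-Down s w dn))))
                          (iv-yes (L (w · t (τ a) (τ (τ a))) ℤ.<? L (w · t (τ a) (τ (τ a)) · τ))
                            (subst (λ z → L z ℤ.< L (z · τ)) (sym fwd) (subst (λ z → L (w · τ) ℤ.< L z) (sym (·-t-t w (lo s) (hi s))) (Down-L′ w (lo s) (hi s) (lo≢hi s) dn))))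
                          (cong h (trans (cong (_· τ) fwd) (·-t-t w (lo s) (hi s))))
                          (iv-yes (τ a ≟S τ a) refl)
          where
          back : w · τ · t a (τ a) ≡ w
          back = trans (·-cong (w · τ) (τ-as-t a ma)) (·-t-t w (lo s) (hi s))
          fwd : w · t (τ a) (τ (τ a)) ≡ w · τ
          fwd = trans (conj-·′ w a (τ a)) (cong (_· τ) back)
        off : ∀ b → b ≢ τ a → iv (b ≟S τ a) * (coroot a * h w) ≡ 0#
        off b ne = trans (cong (_* (coroot a * h w)) (iv-no (b ≟S τ a) ne)) (zeroˡ (coroot a * h w))
        fixed : τ a ≡ a → ∀ b → iv (b ≟S τ a) * (coroot a * h w) ≡ 0#
        fixed e b = trans (cong (λ z → iv (b ≟S τ a) * (z * h w)) (coroot-fixed a e)) (trans (cong (iv (b ≟S τ a) *_) (zeroˡ (h w))) (zeroʳ (iv (b ≟S τ a))))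
        term : ∀ b → asc w s * Xterm a h (w · τ) b ≡ Xterm (τ a) (D s h) w (τ b) + iv (b ≟S τ a) * (coroot a * h w)
        term b = go (a ≟S b) (b ≟S τ a)
          where
          go : Dec (a ≡ b) → Dec (b ≡ τ a) → asc w s * Xterm a h (w · τ) b ≡ Xterm (τ a) (D s h) w (τ b) + iv (b ≟S τ a) * (coroot a * h w)
          go (yes refl) (yes e) = zero-lemma (sg-same (ev (w · τ) a)) (sg-same (ev w (τ a))) (fixed (sym e) a)
          go (yes refl) (no ne) = zero-lemma (sg-same (ev (w · τ) a)) (sg-same (ev w (τ a))) (off a ne)
          go (no a≢b) (no ne) = generic-lemma (kS b) (sg-· b) (cong h (sym (conj-· w a b))) (cover-exchange v a b a≢b ne) (off b ne)
          go (no a≢b) (yes refl) = special (λ e → a≢b (sym e))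

-- Induction on descents and commutativity of the operators.

module SimpleReflections where

  open SignedIndices
  open SignedPermutations
  open ChevalleyOperators
  open RationalField
  open import Tactic.RingSolver using (solve-∀)
  open ℚSum

  opaque
    unfolding _+_

    cross-fixed : ∀ c x y z → c * x + 0# * y ≡ 0# * z + c * x
    cross-fixed = solve-∀ ring

    cross-fixed′ : ∀ c x y z → 0# * y + c * x ≡ c * x + 0# * z
    cross-fixed′ = solve-∀ ring

    cross-τ : ∀ c x y → - c * x + c * x ≡ c * y + - c * y
    cross-τ = solve-∀ ring

    cross-opp : ∀ c x y → - c * x + c * - y ≡ c * - x + - c * y
    cross-opp = solve-∀ ring

    cross-oppτ : ∀ c x y → - (- c) * x + c * - x ≡ c * - y + - (- c) * y
    cross-oppτ = solve-∀ ring

    one-* : ∀ x → 1# * x ≡ x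
    one-* = solve-∀ ring

    zero-coeff : ∀ k g x → k * g * 0# * x ≡ 0#
    zero-coeff = solve-∀ ring

  mono-Fin : ∀ {n} (f : Fin (suc n) → ℤ) → (∀ j → f (inject₁ j) ℤ.< f (suc j)) → ∀ i j → toℕ i ℕ.< toℕ j → f i ℤ.< f j
  mono-Fin {suc n} f st zero    (suc zero)    _       = st zero
  mono-Fin {suc n} f st zero    (suc (suc j)) _       = ℤP.<-trans (st zero) (mono-Fin (f ∘ suc) (st ∘ suc) zero (suc j) (s≤s z≤n))
  mono-Fin {suc n} f st (suc i) (suc j)       (s≤s p) = mono-Fin (f ∘ suc) (st ∘ suc) i j p

  module _ {n : ℕ} where

    private
      N = suc n
      S = SI N

    s₀ : Simple {N}
    s₀ = record { lo = neg zero ; hi = pos zero ; lo<hi = -<+ ; adj = λ { (pos i) → inj₂ (+≤+ (s≤s z≤n)) ; (neg i) → inj₁ (-≤- z≤n) } }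

    sᵢ : (k k′ : Fin N) → toℕ k′ ≡ suc (toℕ k) → Simple {N}
    sᵢ k k′ e = record { lo = pos k ; hi = pos k′ ; lo<hi = +<+ (s≤s (ℕP.≤-reflexive (sym e)))
      ; adj = λ { (pos i) → [_] i (ℕP.≤-<-connex (toℕ i) (toℕ k)) ; (neg i) → inj₁ -≤+ } }
      where
      [_] : ∀ i → toℕ i ℕ.≤ toℕ k ⊎ toℕ k ℕ.< toℕ i → loc (pos i) ℤ.≤ loc (pos k) ⊎ loc (pos k′) ℤ.≤ loc (pos i)
      [_] i (inj₁ p) = inj₁ (+≤+ (s≤s p))
      [_] i (inj₂ p) = inj₂ (+≤+ (s≤s (ℕP.≤-trans (ℕP.≤-reflexive e) p)))

    simple : Fin N → Simple {N}
    simple zero    = s₀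
    simple (suc j) = sᵢ (inject₁ j) (suc j) (cong suc (sym (FinP.toℕ-inject₁ j)))

    Increasing : W {N} → Set
    Increasing w = ∀ x y → loc x ℤ.< loc y → ev w x ℤ.< ev w y

    pos-increasing : ∀ w → + 0 ℤ.< ev w (pos zero) → (∀ i j → toℕ i ℕ.< toℕ j → ev w (pos i) ℤ.< ev w (pos j)) → Increasing w
    pos-increasing w p m (pos i) (pos j) (+<+ (s≤s q)) = m i j q
    pos-increasing w p m (neg i) (neg j) (-<- q) = ℤP.neg-mono-< (m j i q)
    pos-increasing w p m (neg i) (pos j) _ = ℤP.<-trans (ℤP.neg-mono-< (positive i)) (positive j)
      where
      positive : ∀ i → + 0 ℤ.< ev w (pos i)
      positive zero    = p
      positive (suc i) = ℤP.<-trans p (m zero (suc i) (s≤s z≤n))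

    Up-increasing : ∀ w → (∀ i → Up w (lo (simple i)) (hi (simple i))) → Increasing w
    Up-increasing w up = pos-increasing w positive (mono-Fin (λ i → ev w (pos i)) step)
      where
      at-lo : ∀ s → Up w (lo s) (hi s) → ev w (lo s) ℤ.< ev w (hi s)
      at-lo s u = subst (λ z → ev w (lo s) ℤ.< ev w z) (t-a (lo s) (hi s)) (u (lo s) (subst (λ z → loc (lo s) ℤ.< loc z) (sym (t-a (lo s) (hi s))) (lo<hi s)))
      step : ∀ j → ev w (pos (inject₁ j)) ℤ.< ev w (pos (suc j))
      step j = at-lo (simple (suc j)) (up (suc j))
      positive : + 0 ℤ.< ev w (pos zero)
      positive with ev w (pos zero) | at-lo s₀ (up zero)
      ... | + suc m | _ = +<+ (s≤s z≤n)
      ... | + 0 | +<+ ()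
      ... | -[1+ m ] | ()

    increasing-L : ∀ w → Increasing w → L w ≡ + 0
    increasing-L w inc = trans (L-def w) (ℤSum.sumS-zero _ (λ x → ℤSum.sumS-zero _ (λ y → term x y)))
      where
      term : ∀ x y → wt x y ℤ.* lt x y ℤ.* inv w x y ≡ + 0
      term x y with loc x ℤ.<? loc y
      ... | no _ = trans (cong (ℤ._* inv w x y) (ℤP.*-zeroʳ (wt x y))) (ℤP.*-zeroˡ (inv w x y))
      ... | yes p = trans (cong (wt x y ℤ.* + 1 ℤ.*_) (ℤSum.iv-no (ev w y ℤ.<? ev w x) (ℤP.<-asym (inc x y p)))) (ℤP.*-zeroʳ (wt x y ℤ.* + 1))

    has-descent : ∀ {w} → Valid w → L w ≡ + 0 ⊎ Σ (Fin N) λ i → Down w (lo (simple i)) (hi (simple i))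
    has-descent {w} v with FinP.any? (λ i → L (w · refl-of (simple i)) ℤP.<? L w)
    ... | yes (i , p) = inj₂ (i , L-t⇒Down v (lo (simple i)) (hi (simple i)) (lo≢hi (simple i)) p)
    ... | no ¬d = inj₁ (increasing-L w (Up-increasing w up))
      where
      up : ∀ i → Up w (lo (simple i)) (hi (simple i))
      up i with down-or-up v (lo (simple i)) (hi (simple i)) (lo≢hi (simple i))
      ... | inj₁ d = ⊥-elim (¬d (i , Down-L′ w (lo (simple i)) (hi (simple i)) (lo≢hi (simple i)) d))
      ... | inj₂ u = u

    module Commute (ty : RootType) where
      open Operators ty {N} public

      𝟘 : H
      𝟘 _ = 0#

      -- At a descent, D s g determines g w; identities between functions can thus be proved by
      -- induction on length after applying D s.
      D-descent : ∀ s g {w} → Down w (lo s) (hi s) → D s g (w · refl-of s) ≡ g w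
      D-descent s g {w} d = trans (cong₂ _*_ (iv-yes (L (w · refl-of s) ℤ.<? L (w · refl-of s · refl-of s))
          (subst (λ z → L (w · refl-of s) ℤ.< L z) (sym (·-t-t w (lo s) (hi s))) (Down-L′ w (lo s) (hi s) (lo≢hi s) d)))
          (cong g (·-t-t w (lo s) (hi s)))) (one-* (g w))

      X-bottom : ∀ a h w → L w ≡ + 0 → X a h w ≡ 0#
      X-bottom a h w e = trans (X-def a h w) (sumS-zero (Xterm a h w) (λ b → trans (cong (λ z → κ a b * sg (ev w a) (ev w b) * z * h (w · t a b))
          (iv-no (L (w · t a b) ℤ.+ + 2 ℤP.≟ L w) (λ q → ℤP.<-irrefl (sym (trans q e)) (ℤP.+-mono-≤-< (L-nonneg (w · t a b)) (+<+ (s≤s z≤n))))))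
        (zero-coeff (κ a b) (sg (ev w a) (ev w b)) (h (w · t a b)))))

      -- Since x_{τ a} = x_a - ∂_s(x_a) α_s, either side is ∂_s(x_b) x_a + ∂_s(x_a) x_b - ∂_s(x_a)
      -- ∂_s(x_b) α_s. The proof avoids α_s: if s fixes a or b one coefficient vanishes, otherwise b
      -- is ±a or ±τ a.
      cross : ∀ s a b h w → coroot s b * X (refl-of s a) h w + coroot s a * X b h w ≡ coroot s a * X (refl-of s b) h w + coroot s b * X a h w
      cross s a b h w with refl-of s a ≟S a | refl-of s b ≟S b
      ... | yes fa | _ = trans (cong₂ _+_ (cong (λ z → coroot s b * X z h w) fa) (cong (_* X b h w) (coroot-fixed s a fa)))
                          (trans (cross-fixed (coroot s b) (X a h w) (X b h w) (X (refl-of s b) h w))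
                            (cong (λ z → z * X (refl-of s b) h w + coroot s b * X a h w) (sym (coroot-fixed s a fa))))
      ... | no _ | yes fb = trans (cong (λ z → z * X (refl-of s a) h w + coroot s a * X b h w) (coroot-fixed s b fb))
                          (trans (cross-fixed′ (coroot s a) (X b h w) (X (refl-of s a) h w) (X a h w))
                            (cong₂ _+_ (cong (λ z → coroot s a * X z h w) (sym fb)) (cong (_* X a h w) (sym (coroot-fixed s b fb)))))
      ... | no ma | no mb with τ-moved s a b ma mb
      ...   | inj₁ refl = refl
      ...   | inj₂ (inj₁ refl) = trans (cong (λ z → z * X (refl-of s a) h w + coroot s a * X (refl-of s a) h w) (coroot-τ s a))
                (trans (cross-τ (coroot s a) (X (refl-of s a) h w) (X a h w))
                  (cong₂ _+_ (cong (λ z → coroot s a * X z h w) (sym (t-t (lo s) (hi s) a))) (cong (_* X a h w) (sym (coroot-τ s a)))))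
      ...   | inj₂ (inj₂ (inj₁ refl)) = trans (cong₂ (λ z y → z * X (refl-of s a) h w + coroot s a * y) (coroot-opp s a) (X-opp a h w))
                (trans (cross-opp (coroot s a) (X (refl-of s a) h w) (X a h w))
                  (cong₂ (λ y z → coroot s a * y + z * X a h w) (sym (trans (cong (λ z → X z h w) (t-odd (lo s) (hi s) a)) (X-opp (refl-of s a) h w))) (sym (coroot-opp s a))))
      ...   | inj₂ (inj₂ (inj₂ refl)) = trans (cong₂ (λ z y → z * X (refl-of s a) h w + coroot s a * y) cc (X-opp (refl-of s a) h w))
                (trans (cross-oppτ (coroot s a) (X (refl-of s a) h w) (X a h w))
                  (cong₂ (λ y z → coroot s a * y + z * X a h w)
                    (sym (trans (cong (λ z → X z h w) (trans (t-odd (lo s) (hi s) (refl-of s a)) (cong opp (t-t (lo s) (hi s) a)))) (X-opp a h w))) (sym cc)))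
        where cc : coroot s (opp (refl-of s a)) ≡ - (- coroot s a)
              cc = trans (coroot-opp s (refl-of s a)) (cong -_ (coroot-τ s a))

      D-X-X : ∀ s a b h w → Valid w → D s (X a (X b h)) w ≡ X (refl-of s a) (X (refl-of s b) (D s h)) w + (coroot s b * X (refl-of s a) h w + coroot s a * X b h w)
      D-X-X s a b h w v = begin
        D s (X a (X b h)) w
          ≡⟨ D-X s a (X b h) w v ⟩
        X (refl-of s a) (D s (X b h)) w + coroot s a * X b h w
          ≡⟨ cong (_+ coroot s a * X b h w) (X-cong (refl-of s a) {D s (X b h)} {X (refl-of s b) (D s h) ⊕ (coroot s b ⊙ h)} (D-X s b h) w v) ⟩
        X (refl-of s a) (X (refl-of s b) (D s h) ⊕ (coroot s b ⊙ h)) w + coroot s a * X b h w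
          ≡⟨ cong (_+ coroot s a * X b h w) (trans (X-⊕ (refl-of s a) (X (refl-of s b) (D s h)) (coroot s b ⊙ h) w)
               (cong (_+_ (X (refl-of s a) (X (refl-of s b) (D s h)) w)) (X-⊙ (refl-of s a) (coroot s b) h w))) ⟩
        (X (refl-of s a) (X (refl-of s b) (D s h)) w + coroot s b * X (refl-of s a) h w) + coroot s a * X b h w
          ≡⟨ +-assoc _ _ _ ⟩
        X (refl-of s a) (X (refl-of s b) (D s h)) w + (coroot s b * X (refl-of s a) h w + coroot s a * X b h w) ∎
        where open ≡-Reasoning

      -- At a descent both products are recovered from D s; applying the Leibniz rule twice leaves
      -- products at a shorter element, covered by induction, and first-order terms, which agree by
      -- `cross`. At length 0 both sides vanish.
      X-comm-below : ∀ k a b h w → Valid w → L w ℤ.< + k → X a (X b h) w ≡ X b (X a h) w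
      X-comm-below zero a b h w v p = ⊥-elim (ℤP.<⇒≱ p (L-nonneg w))
      X-comm-below (suc k) a b h w v p with has-descent v
      ... | inj₁ z = trans (X-bottom a (X b h) w z) (sym (X-bottom b (X a h) w z))
      ... | inj₂ (i , d) = begin
        X a (X b h) w ≡⟨ sym (D-descent s (X a (X b h)) d) ⟩
        D s (X a (X b h)) w′ ≡⟨ D-X-X s a b h w′ v′ ⟩
        X (τ a) (X (τ b) (D s h)) w′ + (coroot s b * X (τ a) h w′ + coroot s a * X b h w′)
          ≡⟨ cong₂ _+_ (X-comm-below k (τ a) (τ b) (D s h) w′ v′ (ℤP.<-≤-trans (Down-L′ w (lo s) (hi s) (lo≢hi s) d) (ℤP.i<j⇒i≤pred[j] p))) (cross s a b h w′) ⟩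
        X (τ b) (X (τ a) (D s h)) w′ + (coroot s a * X (τ b) h w′ + coroot s b * X a h w′) ≡⟨ sym (D-X-X s b a h w′ v′) ⟩
        D s (X b (X a h)) w′ ≡⟨ D-descent s (X b (X a h)) d ⟩
        X b (X a h) w ∎
        where
        open ≡-Reasoning
        s = simple i
        τ = refl-of s
        w′ = w · τ
        v′ = Valid-t (lo s) (hi s) v

      X-comm : ∀ a b h → X a (X b h) ≐ X b (X a h)
      X-comm a b h w v = X-comm-below (suc ℤ.∣ L w ∣) a b h w v (subst (ℤ._< + suc ℤ.∣ L w ∣) (ℤP.0≤i⇒+∣i∣≡i (L-nonneg w)) (+<+ ℕP.≤-refl))

      -- Uniqueness principle: a class with all divided differences zero is a multiple of the unit,
      -- and the value at length 0 fixes the multiple.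
      D-vanish : ∀ g → (∀ i → D (simple i) g ≐ 𝟘) → (∀ w → Valid w → L w ≡ + 0 → g w ≡ 0#) → g ≐ 𝟘
      D-vanish g dz z w v with has-descent v
      ... | inj₁ e = z w v e
      ... | inj₂ (i , d) = trans (sym (D-descent (simple i) g d)) (dz i _ (Valid-t (lo (simple i)) (hi (simple i)) v))

-- Polynomials acting on functions on signed permutations.

module PolynomialAction where

  open SignedIndices
  open SignedPermutations
  open ChevalleyOperators
  open SimpleReflections
  open RationalField
  open import Tactic.RingSolver using (solve-∀)

  opaque
    unfolding _+_

    +-interchange : ∀ a b c d → (a + b) + (c + d) ≡ (a + c) + (b + d)
    +-interchange = solve-∀ ring

    *-+-swap : ∀ c a x y → c * (a * x) + c * y ≡ c * (a * x + y)
    *-+-swap = solve-∀ ring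

    *-assoc′ : ∀ c a x → (c * a) * x ≡ c * (a * x)
    *-assoc′ = solve-∀ ring

    zero-*-+ : ∀ x y → 0# * x + y ≡ y
    zero-*-+ = solve-∀ ring

    +-neg-cancel : ∀ x → x + (- 1#) * x ≡ 0#
    +-neg-cancel = solve-∀ ring

    lin-split : ∀ c a x y → c * x + (a * x + y) ≡ (c + a) * x + y
    lin-split = solve-∀ ring

    lin-split′ : ∀ a c x z y → c * z + (a * x + y) ≡ (0# + a) * x + (c * z + y)
    lin-split′ = solve-∀ ring

    *-+0 : ∀ x → 1# * x + 0# ≡ x
    *-+0 = solve-∀ ring

    *-+0′ : ∀ c x → c * x + 0# ≡ c * x
    *-+0′ = solve-∀ ring

    eq-from-diff : ∀ x y → x ≡ (x + (- 1#) * y) + y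
    eq-from-diff = solve-∀ ring

  linear : ∀ {N} → (Mono N → ℚ) → Poly N → ℚ
  linear φ []            = 0#
  linear φ ((c , m) ∷ f) = c * φ m + linear φ f

  module _ {N : ℕ} where

    infix 4 _≟M_
    _≟M_ : (m m′ : Mono N) → Dec (m ≡ m′)
    _≟M_ = VecP.≡-dec ℕ._≟_

    linear-++ : ∀ (φ : Mono N → ℚ) f g → linear φ (f ++ g) ≡ linear φ f + linear φ g
    linear-++ φ [] g = sym (+-identityˡ _)
    linear-++ φ ((c , m) ∷ f) g = trans (cong (_+_ (c * φ m)) (linear-++ φ f g)) (sym (+-assoc _ _ _))

    linear-scale : ∀ (φ : Mono N → ℚ) c f → linear φ (scaleP c f) ≡ c * linear φ f
    linear-scale φ c [] = sym (zeroʳ c)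
    linear-scale φ c ((a , m) ∷ f) = trans (cong₂ _+_ (trans (cong (_* φ m) (*-def c a)) (*-assoc′ c a (φ m))) (linear-scale φ c f)) (*-+-swap c a (φ m) (linear φ f))

    coeff-cons : ∀ (n m : Mono N) c f → coeff m ((c , n) ∷ f) ≡ (if does (n ≟M m) then c else 0#) + coeff m f
    coeff-cons n m c f = trans (+-def _ _) (cong (λ z → (if does (n ≟M m) then c else z) + coeff m f) (sym 0#-def))

    remove : Mono N → Poly N → Poly N
    remove m [] = []
    remove m ((c , n) ∷ f) = if does (n ≟M m) then remove m f else (c , n) ∷ remove m f

    remove-linear : ∀ (φ : Mono N → ℚ) m f → linear φ f ≡ coeff m f * φ m + linear φ (remove m f)
    remove-linear φ m [] = sym (trans (cong (λ z → z * φ m + 0#) (sym 0#-def)) (zero-*-+ (φ m) 0#))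
    remove-linear φ m ((c , n) ∷ f) with n ≟M m | coeff-cons n m c f
    ... | yes refl | e = trans (trans (cong (_+_ (c * φ n)) (remove-linear φ n f)) (lin-split c (coeff n f) (φ n) (linear φ (remove n f)))) (cong (λ z → z * φ n + linear φ (remove n f)) (sym e))
    ... | no _ | e = trans (trans (cong (_+_ (c * φ n)) (remove-linear φ m f)) (lin-split′ (coeff m f) c (φ m) (φ n) (linear φ (remove m f)))) (cong (λ z → z * φ m + (c * φ n + linear φ (remove m f))) (sym e))

    remove-coeff-same : ∀ m f → coeff m (remove m f) ≡ 0#
    remove-coeff-same m [] = sym 0#-def
    remove-coeff-same m ((c , n) ∷ f) with n ≟M m
    ... | yes _ = remove-coeff-same m f
    ... | no ne = trans (coeff-cons n m c (remove m f)) (trans (cong (λ b → (if b then c else 0#) + coeff m (remove m f)) (dec-false (n ≟M m) ne)) (trans (+-identityˡ _) (remove-coeff-same m f)))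

    remove-coeff-other : ∀ m m′ f → m ≢ m′ → coeff m′ (remove m f) ≡ coeff m′ f
    remove-coeff-other m m′ [] ne = refl
    remove-coeff-other m m′ ((c , n) ∷ f) ne with n ≟M m
    ... | yes refl = trans (remove-coeff-other n m′ f ne) (sym (trans (coeff-cons n m′ c f) (trans (cong (λ b → (if b then c else 0#) + coeff m′ f) (dec-false (n ≟M m′) ne)) (+-identityˡ _))))
    ... | no _ = trans (coeff-cons n m′ c (remove m f)) (trans (cong (_+_ _) (remove-coeff-other m m′ f ne)) (sym (coeff-cons n m′ c f)))

    remove-length : ∀ m f → length (remove m f) ℕ.≤ length f
    remove-length m [] = z≤n
    remove-length m ((c , n) ∷ f) with n ≟M m
    ... | yes _ = ℕP.m≤n⇒m≤1+n (remove-length m f)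
    ... | no _ = s≤s (remove-length m f)

    -- Discarding all terms with the first monomial changes the value by its total coefficient,
    -- which is 0. The discarded terms may be scattered through the list, so the recursion is on a
    -- bound k for its length.
    linear-zero : ∀ (φ : Mono N → ℚ) k f → length f ℕ.≤ k → (∀ m → coeff m f ≡ 0#) → linear φ f ≡ 0#
    linear-zero φ k [] _ _ = refl
    linear-zero φ (suc k) ((c , n) ∷ f) (s≤s p) z = begin
      linear φ ((c , n) ∷ f) ≡⟨ remove-linear φ n ((c , n) ∷ f) ⟩
      coeff n ((c , n) ∷ f) * φ n + linear φ (remove n ((c , n) ∷ f)) ≡⟨ cong (λ y → y * φ n + linear φ (remove n ((c , n) ∷ f))) (z n) ⟩
      0# * φ n + linear φ (remove n ((c , n) ∷ f)) ≡⟨ zero-*-+ (φ n) _ ⟩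
      linear φ (remove n ((c , n) ∷ f)) ≡⟨ linear-zero φ k (remove n ((c , n) ∷ f)) (subst (ℕ._≤ k) (sym (cong length remove-head)) (ℕP.≤-trans (remove-length n f) p)) z′ ⟩
      0# ∎
      where
      open ≡-Reasoning
      remove-head : remove n ((c , n) ∷ f) ≡ remove n f
      remove-head = cong (λ b → if b then remove n f else (c , n) ∷ remove n f) (dec-true (n ≟M n) refl)
      z′ : ∀ m → coeff m (remove n ((c , n) ∷ f)) ≡ 0#
      z′ m with n ≟M m
      ... | yes refl = remove-coeff-same n ((c , n) ∷ f)
      ... | no ne = trans (remove-coeff-other n m ((c , n) ∷ f) ne) (z m)

    coeff-linear : ∀ m (f : Poly N) → coeff m f ≡ linear (λ n → if does (n ≟M m) then 1# else 0#) f
    coeff-linear m [] = sym 0#-def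
    coeff-linear m ((c , n) ∷ f) = trans (coeff-cons n m c f) (cong₂ _+_ unit (coeff-linear m f))
      where
      unit : (if does (n ≟M m) then c else 0#) ≡ c * (if does (n ≟M m) then 1# else 0#)
      unit with n ≟M m
      ... | yes _ = sym (*-identityʳ c)
      ... | no _ = sym (zeroʳ c)

    -- Each coefficient is itself a functional of the form `linear`, so the difference f - g has all
    -- coefficients zero and `linear-zero` applies.
    linear-≈ : ∀ (φ : Mono N → ℚ) f g → f ≈ᴾ g → linear φ f ≡ linear φ g
    linear-≈ φ f g e = trans (eq-from-diff (linear φ f) (linear φ g)) (trans (cong (_+ linear φ g) (trans (sym (diff φ)) z)) (+-identityˡ _))
      where
      diff : ∀ ψ → linear ψ (f ++ scaleP (- 1#) g) ≡ linear ψ f + (- 1#) * linear ψ g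
      diff ψ = trans (linear-++ ψ f (scaleP (- 1#) g)) (cong (_+_ (linear ψ f)) (linear-scale ψ (- 1#) g))
      z : linear φ (f ++ scaleP (- 1#) g) ≡ 0#
      z = linear-zero φ _ (f ++ scaleP (- 1#) g) ℕP.≤-refl (λ m → trans (coeff-linear m (f ++ scaleP (- 1#) g)) (trans (diff (λ n → if does (n ≟M m) then 1# else 0#))
        (trans (cong₂ (λ x y → x + (- 1#) * y) (sym (coeff-linear m f)) (trans (sym (coeff-linear m g)) (sym (e m)))) (+-neg-cancel (coeff m f)))))

  module Evaluation (ty : RootType) {n : ℕ} where
    open Commute {n} ty public

    private
      N = suc n
      S = SI N

    -- Endomorphisms of `H` as a module over the polynomial ring. For P an `X a`, the field `X-hom`
    -- is the commutativity of the operators; hence every evaluated polynomial qualifies and any two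
    -- of them commute.
    record Linear (P : H → H) : Set where
      field
        ≐-cong : ∀ {h h′} → h ≐ h′ → P h ≐ P h′
        ⊕-hom : ∀ h h′ → P (h ⊕ h′) ≐ P h ⊕ P h′
        ⊙-hom : ∀ c h → P (c ⊙ h) ≐ c ⊙ P h
        X-hom : ∀ a h → P (X a h) ≐ X a (P h)
    open Linear public

    ≐-refl : ∀ {h} → h ≐ h
    ≐-refl w v = refl

    ≐-sym : ∀ {h h′} → h ≐ h′ → h′ ≐ h
    ≐-sym e w v = sym (e w v)

    ≐-trans : ∀ {h h′ h″} → h ≐ h′ → h′ ≐ h″ → h ≐ h″
    ≐-trans e e′ w v = trans (e w v) (e′ w v)

    id-Linear : Linear id
    id-Linear .≐-cong e = e
    id-Linear .⊕-hom h h′ = ≐-refl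
    id-Linear .⊙-hom c h = ≐-refl
    id-Linear .X-hom a h = ≐-refl

    X-Linear : ∀ a → Linear (X a)
    X-Linear a .≐-cong = X-cong a
    X-Linear a .⊕-hom h h′ w v = X-⊕ a h h′ w
    X-Linear a .⊙-hom c h w v = X-⊙ a c h w
    X-Linear a .X-hom b h = X-comm a b h

    ∘-Linear : ∀ {P R} → Linear P → Linear R → Linear (P ∘ R)
    ∘-Linear p r .≐-cong e = p .≐-cong (r .≐-cong e)
    ∘-Linear p r .⊕-hom h h′ = ≐-trans (p .≐-cong (r .⊕-hom h h′)) (p .⊕-hom _ _)
    ∘-Linear p r .⊙-hom c h = ≐-trans (p .≐-cong (r .⊙-hom c h)) (p .⊙-hom c _)
    ∘-Linear p r .X-hom a h = ≐-trans (p .≐-cong (r .X-hom a h)) (p .X-hom a _)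

    pow : S → ℕ → H → H
    pow a zero h = h
    pow a (suc k) h = X a (pow a k h)

    pow-Linear : ∀ a k → Linear (pow a k)
    pow-Linear a zero = id-Linear
    pow-Linear a (suc k) = ∘-Linear (X-Linear a) (pow-Linear a k)

    pow-+ : ∀ a j k h → pow a (j ℕ.+ k) h ≐ pow a j (pow a k h)
    pow-+ a zero k h = ≐-refl
    pow-+ a (suc j) k h = X-cong a (pow-+ a j k h)

    pow-comm : ∀ {P} → Linear P → ∀ a k h → P (pow a k h) ≐ pow a k (P h)
    pow-comm l a zero h = ≐-refl
    pow-comm l a (suc k) h = ≐-trans (l .X-hom a _) (X-cong a (pow-comm l a k h))

    mev : ∀ {k} → (Fin k → S) → Vec ℕ k → H → H
    mev τ [] h = h
    mev τ (e ∷ m) h = pow (τ zero) e (mev (τ ∘ suc) m h)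

    mev-Linear : ∀ {k} (τ : Fin k → S) m → Linear (mev τ m)
    mev-Linear τ [] = id-Linear
    mev-Linear τ (e ∷ m) = ∘-Linear (pow-Linear (τ zero) e) (mev-Linear (τ ∘ suc) m)

    mev-comm : ∀ {P} → Linear P → ∀ {k} (τ : Fin k → S) m h → P (mev τ m h) ≐ mev τ m (P h)
    mev-comm l τ [] h = ≐-refl
    mev-comm l τ (e ∷ m) h = ≐-trans (pow-comm l (τ zero) e _) (pow-Linear (τ zero) e .≐-cong (mev-comm l (τ ∘ suc) m h))

    mev-+ : ∀ {k} (τ : Fin k → S) m m′ h → mev τ (zipWith ℕ._+_ m m′) h ≐ mev τ m (mev τ m′ h)
    mev-+ τ [] [] h = ≐-refl
    mev-+ τ (e ∷ m) (e′ ∷ m′) h = ≐-trans (pow-+ (τ zero) e e′ _) (pow-Linear (τ zero) e .≐-cong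
      (≐-trans (pow-Linear (τ zero) e′ .≐-cong (mev-+ (τ ∘ suc) m m′ h)) (≐-sym (pow-comm (mev-Linear (τ ∘ suc) m) (τ zero) e′ _))))

    mev-0 : ∀ {k} (τ : Fin k → S) h → mev τ (replicate k 0) h ≐ h
    mev-0 {zero} τ h = ≐-refl
    mev-0 {suc k} τ h = mev-0 (τ ∘ suc) h

    mev-var : ∀ {k} (τ : Fin k → S) i h → mev τ (replicate k 0 [ i ]≔ 1) h ≐ X (τ i) h
    mev-var τ zero h = X-cong (τ zero) (mev-0 (τ ∘ suc) h)
    mev-var τ (suc i) h = mev-var (τ ∘ suc) i h

    -- f with x_i replaced by the operator of the signed index τ i. Besides `pos`, substitutions
    -- composed with a simple reflection, where signs occur, and with a cyclic permutation are
    -- needed.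
    ev⟨_⟩ : (Fin N → S) → Poly N → H → H
    ev⟨ τ ⟩ f h w = linear (λ m → mev τ m h w) f

    ev-Linear : ∀ τ f → Linear (ev⟨ τ ⟩ f)
    ev-Linear τ [] .≐-cong e w v = refl
    ev-Linear τ [] .⊕-hom h h′ w v = sym (+-identityˡ 0#)
    ev-Linear τ [] .⊙-hom c h w v = sym (zeroʳ c)
    ev-Linear τ [] .X-hom a h w v = sym (trans (X-cong a {h = 𝟘} {h′ = 0# ⊙ 𝟘} (λ _ _ → sym (zeroˡ 0#)) w v) (trans (X-⊙ a 0# 𝟘 w) (zeroˡ _)))
    ev-Linear τ ((c , m) ∷ f) .≐-cong e w v = cong₂ _+_ (cong (c *_) (mev-Linear τ m .≐-cong e w v)) (ev-Linear τ f .≐-cong e w v)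
    ev-Linear τ ((c , m) ∷ f) .⊕-hom h h′ w v = trans (cong₂ _+_ (trans (cong (c *_) (mev-Linear τ m .⊕-hom h h′ w v)) (distribˡ c _ _)) (ev-Linear τ f .⊕-hom h h′ w v)) (+-interchange _ _ _ _)
    ev-Linear τ ((c , m) ∷ f) .⊙-hom d h w v = trans (cong₂ _+_ (cong (c *_) (mev-Linear τ m .⊙-hom d h w v)) (ev-Linear τ f .⊙-hom d h w v))
       (trans (cong (_+ d * ev⟨ τ ⟩ f h w) (*-swap c d (mev τ m h w))) (*-+-swap d c _ _))
    ev-Linear τ ((c , m) ∷ f) .X-hom a h w v = sym (trans (X-⊕ a (c ⊙ mev τ m h) (ev⟨ τ ⟩ f h) w)
       (cong₂ _+_ (trans (X-⊙ a c _ w) (cong (c *_) (sym (mev-Linear τ m .X-hom a h w v)))) (sym (ev-Linear τ f .X-hom a h w v))))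

    ev-comm : ∀ {P} → Linear P → ∀ τ f h → P (ev⟨ τ ⟩ f h) ≐ ev⟨ τ ⟩ f (P h)
    ev-comm {P} l τ [] h w v = trans (l .≐-cong {h = 𝟘} {h′ = 0# ⊙ 𝟘} (λ _ _ → sym (zeroˡ 0#)) w v) (trans (l .⊙-hom 0# 𝟘 w v) (zeroˡ _))
    ev-comm {P} l τ ((c , m) ∷ f) h w v = trans (l .⊕-hom (c ⊙ mev τ m h) (ev⟨ τ ⟩ f h) w v)
       (cong₂ _+_ (trans (l .⊙-hom c _ w v) (cong (c *_) (mev-comm l τ m h w v))) (ev-comm l τ f h w v))

    ev-++ : ∀ τ f g h w → ev⟨ τ ⟩ (f +ᴾ g) h w ≡ ev⟨ τ ⟩ f h w + ev⟨ τ ⟩ g h w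
    ev-++ τ f g h w = linear-++ _ f g

    ev-scale : ∀ τ c f h w → ev⟨ τ ⟩ (scaleP c f) h w ≡ c * ev⟨ τ ⟩ f h w
    ev-scale τ c f h w = linear-scale _ c f

    ev-neg : ∀ τ f h w → ev⟨ τ ⟩ (-ᴾ f) h w ≡ - ev⟨ τ ⟩ f h w
    ev-neg τ f h w = trans (ev-scale τ _ f h w) (trans (cong (_* ev⟨ τ ⟩ f h w) (trans (neg-def ℚ.1ℚ) (cong -_ (sym 1#-def)))) (-1* _))

    ev-≈ : ∀ τ f g h w → f ≈ᴾ g → ev⟨ τ ⟩ f h w ≡ ev⟨ τ ⟩ g h w
    ev-≈ τ f g h w e = linear-≈ _ f g e

    ev-term-* : ∀ τ a m g h → ev⟨ τ ⟩ (((a , m) ∷ []) *ᴾ g) h ≐ a ⊙ mev τ m (ev⟨ τ ⟩ g h)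
    ev-term-* τ a m [] h w v = sym (trans (cong (a *_) (trans (mev-Linear τ m .≐-cong {h = 𝟘} {h′ = 0# ⊙ 𝟘} (λ _ _ → sym (zeroˡ 0#)) w v) (trans (mev-Linear τ m .⊙-hom 0# 𝟘 w v) (zeroˡ _)))) (zeroʳ a))
    ev-term-* τ a m ((b , m′) ∷ g) h w v = trans (cong₂ _+_
        (trans (cong₂ _*_ (*-def a b) (mev-+ τ m m′ h w v)) (trans (*-assoc′ a b _) (cong (a *_) (sym (mev-Linear τ m .⊙-hom b (mev τ m′ h) w v)))))
        (ev-term-* τ a m g h w v))
      (trans (sym (distribˡ a _ _)) (cong (a *_) (sym (mev-Linear τ m .⊕-hom (b ⊙ mev τ m′ h) (ev⟨ τ ⟩ g h) w v))))

    *ᴾ-cons : ∀ a m f (g : Poly N) → ((a , m) ∷ f) *ᴾ g ≡ (((a , m) ∷ []) *ᴾ g) ++ (f *ᴾ g)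
    *ᴾ-cons a m f g = cong (_++ (f *ᴾ g)) (sym (ListP.++-identityʳ _))

    ev-* : ∀ τ f g h → ev⟨ τ ⟩ (f *ᴾ g) h ≐ ev⟨ τ ⟩ f (ev⟨ τ ⟩ g h)
    ev-* τ [] g h w v = refl
    ev-* τ ((a , m) ∷ f) g h w v = trans (cong (λ z → ev⟨ τ ⟩ z h w) (*ᴾ-cons a m f g))
      (trans (ev-++ τ (((a , m) ∷ []) *ᴾ g) (f *ᴾ g) h w) (cong₂ _+_ (ev-term-* τ a m g h w v) (ev-* τ f g h w v)))

    ev-const : ∀ τ c h → ev⟨ τ ⟩ (constP c) h ≐ c ⊙ h
    ev-const τ c h w v = trans (*-+0′ c _) (cong (c *_) (mev-0 τ h w v))

    ev-one : ∀ τ h → ev⟨ τ ⟩ (constP ℚ.1ℚ) h ≐ h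
    ev-one τ h w v = trans (ev-const τ ℚ.1ℚ h w v) (trans (cong (_* h w) (sym 1#-def)) (one-* (h w)))

    ev-var : ∀ τ i h → ev⟨ τ ⟩ (varP i) h ≐ X (τ i) h
    ev-var τ i h w v = trans (cong (λ z → z * mev τ (replicate N 0 [ i ]≔ 1) h w + 0#) (sym 1#-def)) (trans (*-+0 _) (mev-var τ i h w v))

    ev-zero : ∀ τ f → ev⟨ τ ⟩ f 𝟘 ≐ 𝟘
    ev-zero τ f w v = trans (ev-Linear τ f .≐-cong {h = 𝟘} {h′ = 0# ⊙ 𝟘} (λ _ _ → sym (zeroˡ 0#)) w v) (trans (ev-Linear τ f .⊙-hom 0# 𝟘 w v) (zeroˡ _))

    act : Poly N → H → H
    act = ev⟨ pos ⟩

    act-cong : ∀ f {h h′} → h ≐ h′ → act f h ≐ act f h′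
    act-cong f = ev-Linear pos f .≐-cong

    act-comm : ∀ f g h → act f (act g h) ≐ act g (act f h)
    act-comm f g h = ev-comm (ev-Linear pos f) pos g h

    -- Polynomials modulo the annihilator of h. The axioms reduce to commutativity of the operators;
    -- for h = `𝟙` computations modulo the invariants become ring identities.
    polyRing : H → CommutativeRing 0ℓ 0ℓ
    polyRing h = record
      { Carrier = Poly N ; _≈_ = λ f g → act f h ≐ act g h ; _+_ = _+ᴾ_ ; _*_ = _*ᴾ_ ; -_ = -ᴾ_ ; 0# = [] ; 1# = constP ℚ.1ℚ
      ; isCommutativeRing = record
        { isRing = record
          { +-isAbelianGroup = record
            { isGroup = record
              { isMonoid = record
                { isSemigroup = record
                  { isMagma = record
                    { isEquivalence = record { refl = ≐-refl ; sym = ≐-sym ; trans = ≐-trans }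
                    ; ∙-cong = λ {f} {f′} {g} {g′} e e′ w v → trans (ev-++ pos f g h w) (trans (cong₂ _+_ (e w v) (e′ w v)) (sym (ev-++ pos f′ g′ h w))) }
                  ; assoc = λ f g k w v → cong (λ z → act z h w) (ListP.++-assoc f g k) }
                ; identity = (λ f w v → refl) , (λ f w v → cong (λ z → act z h w) (ListP.++-identityʳ f)) }
              ; inverse = (λ f w v → trans (ev-++ pos (-ᴾ f) f h w) (trans (cong (_+ act f h w) (ev-neg pos f h w)) (+-inverseˡ _)))
                        , (λ f w v → trans (ev-++ pos f (-ᴾ f) h w) (trans (cong (_+_ (act f h w)) (ev-neg pos f h w)) (+-inverseʳ _)))
              ; ⁻¹-cong = λ {f} {g} e w v → trans (ev-neg pos f h w) (trans (cong -_ (e w v)) (sym (ev-neg pos g h w))) }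
            ; comm = λ f g w v → trans (ev-++ pos f g h w) (trans (+-comm _ _) (sym (ev-++ pos g f h w))) }
          ; *-cong = λ {f} {f′} {g} {g′} e e′ → ≐-trans (ev-* pos f g h) (≐-trans (act-cong f e′) (≐-trans (act-comm f g′ h)
                       (≐-trans (act-cong g′ e) (≐-trans (act-comm g′ f′ h) (≐-sym (ev-* pos f′ g′ h))))))
          ; *-assoc = λ f g k → ≐-trans (ev-* pos (f *ᴾ g) k h) (≐-trans (ev-* pos f g (act k h)) (≐-trans (act-cong f (≐-sym (ev-* pos g k h))) (≐-sym (ev-* pos f (g *ᴾ k) h))))
          ; *-identity = (λ f → ≐-trans (ev-* pos (constP ℚ.1ℚ) f h) (ev-one pos (act f h)))
                       , (λ f → ≐-trans (ev-* pos f (constP ℚ.1ℚ) h) (act-cong f (ev-one pos h)))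
          ; distrib = (λ f g k w v → trans (ev-* pos f (g +ᴾ k) h w v) (trans (act-cong f (λ w′ v′ → ev-++ pos g k h w′) w v)
                         (trans (ev-Linear pos f .⊕-hom (act g h) (act k h) w v) (trans (sym (cong₂ _+_ (ev-* pos f g h w v) (ev-* pos f k h w v))) (sym (ev-++ pos (f *ᴾ g) (f *ᴾ k) h w))))))
                    , (λ f g k w v → trans (ev-* pos (g +ᴾ k) f h w v) (trans (ev-++ pos g k (act f h) w)
                         (trans (sym (cong₂ _+_ (ev-* pos g f h w v) (ev-* pos k f h w v))) (sym (ev-++ pos (g *ᴾ f) (k *ᴾ f) h w))))) }
        ; *-comm = λ f g → ≐-trans (ev-* pos f g h) (≐-trans (act-comm f g h) (≐-sym (ev-* pos g f h))) } }

-- Divided differences of polynomials versus the operators `D`.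

module DividedDifferences where

  open SignedIndices
  open SignedPermutations
  open ChevalleyOperators
  open SimpleReflections
  open PolynomialAction
  open RationalField
  open import Tactic.RingSolver using (solve-∀)
  open ℚSum

  opaque
    unfolding _+_

    plus-zero* : ∀ x y → x + 0# * y ≡ x
    plus-zero* = solve-∀ ring

    xy-cancel : ∀ x ε y → (x + - ε * y) + ε * y ≡ x
    xy-cancel = solve-∀ ring

    sq-cancel : ∀ x c y → (- (- x) + c * - y) + c * y ≡ x
    sq-cancel = solve-∀ ring

    factor-out : ∀ e x y → e * x + e * y ≡ e * (y + x)
    factor-out = solve-∀ ring

    neg-coeff : ∀ c x → - c * x ≡ c * (- 1# * x)
    neg-coeff = solve-∀ ring

    one-coeff : ∀ c x → c * x ≡ c * (1# * x)
    one-coeff = solve-∀ ring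

    coeff-+0 : ∀ f c x → (f * c) * x + 0# ≡ c * (f * x)
    coeff-+0 = solve-∀ ring

    kappa-one : ∀ e → 1# + e * 0# ≡ 1#
    kappa-one = solve-∀ ring

    kappa-two : ∀ e → (1# + e * 1#) * 1# ≡ 1# + e
    kappa-two = solve-∀ ring

  two : RootType → ℚ
  two typeB = ℚ.1ℚ ℚ.+ ℚ.1ℚ
  two typeC = ℚ.1ℚ

  opaque
    unfolding _+_

    two-def : ∀ t → two t ≡ 1# + extra t
    two-def typeB = refl
    two-def typeC = refl

  dd0Term-odd : ∀ t {n} c (m : Mono (suc n)) → isOdd (lookup m zero) ≡ true →
                dd0Term t (c , m) ≡ (two t ℚ.* c , m [ zero ]≔ (lookup m zero ∸ 1)) ∷ []
  dd0Term-odd typeB c m o rewrite o = refl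
  dd0Term-odd typeC c m o rewrite o = refl

  dd0Term-even : ∀ t {n} c (m : Mono (suc n)) → isOdd (lookup m zero) ≡ false → dd0Term t (c , m) ≡ []
  dd0Term-even t c m o rewrite o = refl

  module DividedDifference (ty : RootType) {n : ℕ} where
    open Evaluation ty {n} public

    private
      N = suc n
      S = SI N

    sumH : (ℕ → H) → ℕ → H
    sumH F zero = 𝟘
    sumH F (suc k) = F 0 ⊕ sumH (F ∘ suc) k

    sumH-cong : ∀ {F G : ℕ → H} k → (∀ i → i ℕ.< k → F i ≐ G i) → sumH F k ≐ sumH G k
    sumH-cong zero e w v = refl
    sumH-cong (suc k) e w v = cong₂ _+_ (e 0 (s≤s z≤n) w v) (sumH-cong k (λ i p → e (suc i) (s≤s p)) w v)

    Linear-𝟘 : ∀ {P} → Linear P → P 𝟘 ≐ 𝟘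
    Linear-𝟘 {P} l w v = trans (l .≐-cong {h = 𝟘} {h′ = 0# ⊙ 𝟘} (λ _ _ → sym (zeroˡ 0#)) w v) (trans (l .⊙-hom 0# 𝟘 w v) (zeroˡ _))

    sumH-Linear : ∀ {P} → Linear P → ∀ F k → P (sumH F k) ≐ sumH (P ∘ F) k
    sumH-Linear l F zero = Linear-𝟘 l
    sumH-Linear l F (suc k) w v = trans (l .⊕-hom (F 0) (sumH (F ∘ suc) k) w v) (cong (_+_ _) (sumH-Linear l (F ∘ suc) k w v))

    D-𝟘 : ∀ s → D s 𝟘 ≐ 𝟘
    D-𝟘 s w v = zeroʳ (asc w s)

    D-X-fixed : ∀ s a → refl-of s a ≡ a → ∀ h → D s (X a h) ≐ X a (D s h)
    D-X-fixed s a e h w v = trans (D-X s a h w v) (trans (cong₂ (λ z y → X z (D s h) w + y * h w) e (coroot-fixed s a e)) (plus-zero* _ _))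

    D-pow-fixed : ∀ s a → refl-of s a ≡ a → ∀ k h → D s (pow a k h) ≐ pow a k (D s h)
    D-pow-fixed s a e zero h = ≐-refl
    D-pow-fixed s a e (suc k) h = ≐-trans (D-X-fixed s a e (pow a k h)) (X-cong a (D-pow-fixed s a e k h))

    D-mev-fixed : ∀ s {k} (τ : Fin k → S) m → (∀ j → lookup m j ≡ 0 ⊎ refl-of s (τ j) ≡ τ j) → ∀ h → D s (mev τ m h) ≐ mev τ m (D s h)
    D-mev-fixed s τ [] fx h = ≐-refl
    D-mev-fixed s τ (e ∷ m) fx h with fx zero
    ... | inj₁ refl = D-mev-fixed s (τ ∘ suc) m (fx ∘ suc) h
    ... | inj₂ f = ≐-trans (D-pow-fixed s (τ zero) f e _) (pow-Linear (τ zero) e .≐-cong (D-mev-fixed s (τ ∘ suc) m (fx ∘ suc) h))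

    D-concatMap : ∀ s h (G : ℚ × Mono N → Poly N) → (∀ c m → act (G (c , m)) h ≐ c ⊙ D s (mev pos m h)) →
                  ∀ f → act (concatMap G f) h ≐ D s (act f h)
    D-concatMap s h G e [] w v = sym (D-𝟘 s w v)
    D-concatMap s h G e ((c , m) ∷ f) w v = trans (ev-++ pos (G (c , m)) (concatMap G f) h w)
      (trans (cong₂ _+_ (trans (e c m w v) (sym (D-⊙ s c (mev pos m h) w))) (D-concatMap s h G e f w v))
             (sym (D-⊕ s (c ⊙ mev pos m h) (act f h) w)))

    -- x is the variable of larger exponent, y its partner and ε the divided difference of x; the
    -- two cases of `ddTerm` are (lo, hi, -1) and (hi, lo, 1).
    module Pair (s : Simple {N}) (x y : S) (ε : ℚ)
      (Dx : ∀ p → D s (X x p) ≐ X y (D s p) ⊕ ε ⊙ p) (Dy : ∀ p → D s (X y p) ≐ X x (D s p) ⊕ - ε ⊙ p) where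

      D-pow : ∀ k r → D s r ≐ 𝟘 → D s (pow x k r) ≐ ε ⊙ sumH (λ i → pow y i (pow x (k ∸ 1 ∸ i) r)) k
      D-pow zero r z w v = trans (z w v) (sym (zeroʳ ε))
      D-pow (suc k) r z w v = begin
        D s (X x (pow x k r)) w ≡⟨ Dx (pow x k r) w v ⟩
        X y (D s (pow x k r)) w + ε * pow x k r w ≡⟨ cong (_+ ε * pow x k r w) (X-cong y (D-pow k r z) w v) ⟩
        X y (ε ⊙ sumH F k) w + ε * pow x k r w ≡⟨ cong (_+ ε * pow x k r w) (trans (X-⊙ y ε (sumH F k) w) (cong (ε *_) (sumH-Linear (X-Linear y) F k w v))) ⟩
        ε * sumH (X y ∘ F) k w + ε * pow x k r w ≡⟨ factor-out ε _ _ ⟩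
        ε * (pow x k r w + sumH (X y ∘ F) k w) ≡⟨ cong (λ z → ε * (pow x k r w + z)) (sumH-cong k (λ i _ w v → cong (λ e → X y (pow y i (pow x e r)) w) (ℕP.∸-+-assoc k 1 i)) w v) ⟩
        ε * sumH (λ i → pow y i (pow x (k ∸ i) r)) (suc k) w ∎
        where
        open ≡-Reasoning
        F : ℕ → H
        F i = pow y i (pow x (k ∸ 1 ∸ i) r)

      D-xy : ∀ p → D s (X x (X y p)) ≐ X x (X y (D s p))
      D-xy p w v = begin
        D s (X x (X y p)) w ≡⟨ Dx (X y p) w v ⟩
        X y (D s (X y p)) w + ε * X y p w ≡⟨ cong (_+ ε * X y p w) (trans (X-cong y (Dy p) w v) (trans (X-⊕ y (X x (D s p)) (- ε ⊙ p) w) (cong (_+_ _) (X-⊙ y (- ε) p w)))) ⟩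
        (X y (X x (D s p)) w + - ε * X y p w) + ε * X y p w ≡⟨ xy-cancel _ ε _ ⟩
        X y (X x (D s p)) w ≡⟨ X-comm y x (D s p) w v ⟩
        X x (X y (D s p)) w ∎
        where open ≡-Reasoning

      unzip : ∀ b p → pow x (suc b) (pow y (suc b) p) ≐ X x (X y (pow x b (pow y b p)))
      unzip b p = X-cong x (≐-sym (pow-comm (X-Linear y) x b (pow y b p)))

      D-xyᵇ : ∀ b p → D s (pow x b (pow y b p)) ≐ pow x b (pow y b (D s p))
      D-xyᵇ zero p = ≐-refl
      D-xyᵇ (suc b) p = ≐-trans (D-cong s (unzip b p)) (≐-trans (D-xy (pow x b (pow y b p))) (≐-trans (X-cong x (X-cong y (D-xyᵇ b p))) (≐-sym (unzip b (D s p)))))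

      -- (x y)^b is invariant under s and passes through D, leaving the power x^(a-b), whose divided
      -- difference is a geometric sum.
      D-monomial : ∀ a b r → b ℕ.≤ a → D s r ≐ 𝟘 →
        D s (pow x a (pow y b r)) ≐ ε ⊙ sumH (λ i → pow x (a ∸ 1 ∸ i) (pow y (b ℕ.+ i) r)) (a ∸ b)
      D-monomial a b r b≤a z = ≐-trans (D-cong s split) (≐-trans (D-xyᵇ b (pow x k r))
          (≐-trans (pxy .≐-cong (D-pow k r z)) (≐-trans (pxy .⊙-hom ε _) (λ w v → cong (ε *_)
            (trans (sumH-Linear pxy _ k w v) (sumH-cong k term w v))))))
        where
        k = a ∸ b
        pxy : Linear (λ h → pow x b (pow y b h))
        pxy = ∘-Linear (pow-Linear x b) (pow-Linear y b)
        split : pow x a (pow y b r) ≐ pow x b (pow y b (pow x k r))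
        split = ≐-trans (λ w v → cong (λ e → pow x e (pow y b r) w) (sym (ℕP.m+[n∸m]≡n b≤a)))
          (≐-trans (pow-+ x b k (pow y b r)) (pow-Linear x b .≐-cong (pow-comm (pow-Linear x k) y b r)))
        arith : ∀ i → i ℕ.< k → b ℕ.+ (k ∸ 1 ∸ i) ≡ a ∸ 1 ∸ i
        arith i p = trans (cong (b ℕ.+_) (ℕP.∸-+-assoc k 1 i)) (trans (sym (ℕP.+-∸-assoc b p)) (trans (cong (_∸ suc i) (ℕP.m+[n∸m]≡n b≤a)) (sym (ℕP.∸-+-assoc a 1 i))))
        term : ∀ i → i ℕ.< k → pow x b (pow y b (pow y i (pow x (k ∸ 1 ∸ i) r))) ≐ pow x (a ∸ 1 ∸ i) (pow y (b ℕ.+ i) r)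
        term i p = ≐-trans (pow-Linear x b .≐-cong (≐-trans (≐-sym (pow-+ y b i _)) (pow-comm (pow-Linear y (b ℕ.+ i)) x (k ∸ 1 ∸ i) r)))
          (≐-trans (≐-sym (pow-+ x b (k ∸ 1 ∸ i) _)) (λ w v → cong (λ e → pow x e (pow y (b ℕ.+ i) r) w) (arith i p)))

    mev-update : ∀ {k} (τ : Fin k → S) m j e h → mev τ (m [ j ]≔ e) h ≐ pow (τ j) e (mev τ (m [ j ]≔ 0) h)
    mev-update τ (_ ∷ m) zero e h = ≐-refl
    mev-update τ (d ∷ m) (suc j) e h = ≐-trans (pow-Linear (τ zero) d .≐-cong (mev-update (τ ∘ suc) m j e h)) (pow-comm (pow-Linear (τ zero) d) (τ (suc j)) e _)

    mev-update₂ : ∀ {N′} (τ : Fin N′ → S) m k k′ → k ≢ k′ → ∀ d e h →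
      mev τ ((m [ k ]≔ d) [ k′ ]≔ e) h ≐ pow (τ k) d (pow (τ k′) e (mev τ ((m [ k ]≔ 0) [ k′ ]≔ 0) h))
    mev-update₂ τ m k k′ ne d e h = ≐-trans (mev-update τ (m [ k ]≔ d) k′ e h)
      (≐-trans (pow-Linear (τ k′) e .≐-cong (≐-trans (λ w v → cong (λ z → mev τ z h w) (VecP.[]≔-commutes m k k′ ne))
        (≐-trans (mev-update τ (m [ k′ ]≔ 0) k d h) (pow-Linear (τ k) d .≐-cong (λ w v → cong (λ z → mev τ z h w) (sym (VecP.[]≔-commutes m k k′ ne)))))))
        (pow-comm (pow-Linear (τ k′) e) (τ k) d _))

    mev-pair : ∀ {N′} (τ : Fin N′ → S) m k k′ → k ≢ k′ → ∀ h →
      mev τ m h ≐ pow (τ k) (lookup m k) (pow (τ k′) (lookup m k′) (mev τ ((m [ k ]≔ 0) [ k′ ]≔ 0) h))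
    mev-pair τ m k k′ ne h = ≐-trans (λ w v → cong (λ z → mev τ z h w) (sym (trans (cong (_[ k′ ]≔ lookup m k′) (VecP.[]≔-lookup m k)) (VecP.[]≔-lookup m k′))))
      (mev-update₂ τ m k k′ ne (lookup m k) (lookup m k′) h)

    act-applyUpTo : ∀ c (M : ℕ → Mono N) k h → act (applyUpTo (λ i → c , M i) k) h ≐ c ⊙ sumH (λ i → mev pos (M i) h) k
    act-applyUpTo c M zero h w v = sym (zeroʳ c)
    act-applyUpTo c M (suc k) h w v = trans (cong (_+_ _) (act-applyUpTo c (M ∘ suc) k h w v)) (sym (distribˡ c _ _))

    act-upTo : ∀ c (M : ℕ → Mono N) k h → act (map (λ i → c , M i) (upTo k)) h ≐ c ⊙ sumH (λ i → mev pos (M i) h) k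
    act-upTo c M k h w v = trans (cong (λ z → act z h w) (ListP.map-applyUpTo id (λ i → c , M i) k)) (act-applyUpTo c M k h w v)

    module _ (k k′ : Fin N) (adjacent : toℕ k′ ≡ suc (toℕ k)) where
      private
        s = sᵢ k k′ adjacent

      k≢k′ : k ≢ k′
      k≢k′ e = ℕP.<-irrefl (cong toℕ e) (ℕP.≤-reflexive (sym adjacent))

      coroot-hi : coroot s (pos k′) ≡ 1#
      coroot-hi = trans (cong (λ z → κ (pos k′) z * sg (loc z) (loc (pos k′))) (t-b (pos k) (pos k′)))
        (trans (cong₂ _*_ (kappa-one (extra ty)) (sg-< (lo<hi s))) (*-identityˡ 1#))

      coroot-lo : coroot s (pos k) ≡ - 1#
      coroot-lo = trans (cong (coroot s) (sym (t-b (pos k) (pos k′)))) (trans (coroot-τ s (pos k′)) (cong -_ coroot-hi))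

      D-lo : ∀ p → D s (X (pos k) p) ≐ X (pos k′) (D s p) ⊕ - 1# ⊙ p
      D-lo p w v = trans (D-X s (pos k) p w v) (cong₂ (λ z y → X z (D s p) w + y * p w) (t-a (pos k) (pos k′)) coroot-lo)

      D-hi : ∀ p → D s (X (pos k′) p) ≐ X (pos k) (D s p) ⊕ 1# ⊙ p
      D-hi p w v = trans (D-X s (pos k′) p w v) (cong₂ (λ z y → X z (D s p) w + y * p w) (t-b (pos k) (pos k′)) coroot-hi)

      rest-fixed : ∀ m j → lookup ((m [ k ]≔ 0) [ k′ ]≔ 0) j ≡ 0 ⊎ refl-of s (pos j) ≡ pos j
      rest-fixed m j with j FinP.≟ k′ | j FinP.≟ k
      ... | yes refl | _ = inj₁ (VecP.lookup∘updateAt k′ (m [ k ]≔ 0))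
      ... | no ne | yes refl = inj₁ (trans (VecP.lookup∘updateAt′ j k′ ne (m [ j ]≔ 0)) (VecP.lookup∘updateAt j m))
      ... | no ne | no ne′ = inj₂ (t-f (pos k) (pos k′) (λ e → ne′ (pos-injective e)) (λ e → ne (pos-injective e)) (λ ()) (λ ()))

      ddTerm-≥ : ∀ c (m : Mono N) → lookup m k′ ℕ.≤ lookup m k → ddTerm k k′ (c , m) ≡
        map (λ i → ℚ.- c , ((m [ k ]≔ (lookup m k ∸ 1 ∸ i)) [ k′ ]≔ (lookup m k′ ℕ.+ i))) (upTo (lookup m k ∸ lookup m k′))
      ddTerm-≥ c m p with does (lookup m k′ ℕ.≤? lookup m k) | dec-true (lookup m k′ ℕ.≤? lookup m k) p
      ... | true | refl = refl

      ddTerm-< : ∀ c (m : Mono N) → ¬ (lookup m k′ ℕ.≤ lookup m k) → ddTerm k k′ (c , m) ≡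
        map (λ i → c , ((m [ k ]≔ (lookup m k ℕ.+ i)) [ k′ ]≔ (lookup m k′ ∸ 1 ∸ i))) (upTo (lookup m k′ ∸ lookup m k))
      ddTerm-< c m p with does (lookup m k′ ℕ.≤? lookup m k) | dec-false (lookup m k′ ℕ.≤? lookup m k) p
      ... | false | refl = refl

      -- Since D s kills h, the Leibniz rule never differentiates h, and the formal division of
      -- monomials agrees with D. The other variables are collected in r, which D kills because s
      -- fixes them.
      act-ddTerm : ∀ h → D s h ≐ 𝟘 → ∀ c m → act (ddTerm k k′ (c , m)) h ≐ c ⊙ D s (mev pos m h)
      act-ddTerm h z c m with lookup m k′ ℕ.≤? lookup m k
      ... | yes p = ≐-trans (λ w v → cong (λ f → act f h w) (ddTerm-≥ c m p))
        (≐-trans (act-upTo (ℚ.- c) _ (lookup m k ∸ lookup m k′) h)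
         (λ w v → trans (cong₂ _*_ (neg-def c) (sumH-cong (lookup m k ∸ lookup m k′) (λ i _ → mev-update₂ pos m k k′ k≢k′ _ _ h) w v))
           (trans (neg-coeff c _) (cong (c *_) (sym (trans (D-cong s (mev-pair pos m k k′ k≢k′ h) w v) (P.D-monomial (lookup m k) (lookup m k′) r p zr w v)))))))
        where
        r = mev pos ((m [ k ]≔ 0) [ k′ ]≔ 0) h
        zr : D s r ≐ 𝟘
        zr = ≐-trans (D-mev-fixed s pos ((m [ k ]≔ 0) [ k′ ]≔ 0) (rest-fixed m) h) (≐-trans (mev-Linear pos ((m [ k ]≔ 0) [ k′ ]≔ 0) .≐-cong z) (Linear-𝟘 (mev-Linear pos ((m [ k ]≔ 0) [ k′ ]≔ 0))))
        module P = Pair s (pos k) (pos k′) (- 1#) D-lo (λ p w v → trans (D-hi p w v) (cong (λ z → X (pos k) (D s p) w + z * p w) (sym (neg-neg 1#))))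
      ... | no p = ≐-trans (λ w v → cong (λ f → act f h w) (ddTerm-< c m p))
        (≐-trans (act-upTo c _ (lookup m k′ ∸ lookup m k) h)
         (λ w v → trans (cong (c *_) (sumH-cong (lookup m k′ ∸ lookup m k) (λ i _ → ≐-trans (mev-update₂ pos m k k′ k≢k′ _ _ h) (pow-comm (pow-Linear (pos k) (lookup m k ℕ.+ i)) (pos k′) (lookup m k′ ∸ 1 ∸ i) r)) w v))
           (trans (one-coeff c _) (cong (c *_) (sym (trans (D-cong s (≐-trans (mev-pair pos m k k′ k≢k′ h) (pow-comm (pow-Linear (pos k) (lookup m k)) (pos k′) (lookup m k′) r)) w v)
              (P.D-monomial (lookup m k′) (lookup m k) r (ℕP.<⇒≤ (ℕP.≰⇒> p)) zr w v)))))))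
        where
        r = mev pos ((m [ k ]≔ 0) [ k′ ]≔ 0) h
        zr : D s r ≐ 𝟘
        zr = ≐-trans (D-mev-fixed s pos ((m [ k ]≔ 0) [ k′ ]≔ 0) (rest-fixed m) h) (≐-trans (mev-Linear pos ((m [ k ]≔ 0) [ k′ ]≔ 0) .≐-cong z) (Linear-𝟘 (mev-Linear pos ((m [ k ]≔ 0) [ k′ ]≔ 0))))
        module P = Pair s (pos k′) (pos k) 1# D-hi D-lo

    coroot-s₀ : coroot s₀ (pos zero) ≡ 1# + extra ty
    coroot-s₀ = trans (cong (λ z → κ (pos zero) z * sg (loc z) (loc (pos {N} zero))) (t-b (neg zero) (pos zero)))
      (trans (cong ((1# + extra ty * 1#) *_) (sg-< (lo<hi (s₀ {n})))) (kappa-two (extra ty)))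

    private
      x₁ : S
      x₁ = pos zero
      c₀ : ℚ
      c₀ = coroot s₀ x₁

    D-x₁² : ∀ p → D s₀ (X x₁ (X x₁ p)) ≐ X x₁ (X x₁ (D s₀ p))
    D-x₁² p w v = begin
      D s₀ (X x₁ (X x₁ p)) w ≡⟨ D-X s₀ x₁ (X x₁ p) w v ⟩
      X (refl-of s₀ x₁) (D s₀ (X x₁ p)) w + c₀ * X x₁ p w ≡⟨ cong (λ z → X z (D s₀ (X x₁ p)) w + c₀ * X x₁ p w) (t-b (neg zero) (pos zero)) ⟩
      X (neg zero) (D s₀ (X x₁ p)) w + c₀ * X x₁ p w
        ≡⟨ cong (_+ c₀ * X x₁ p w) (trans (X-cong (neg zero) (D-X s₀ x₁ p) w v) (trans (X-⊕ (neg zero) (X (refl-of s₀ x₁) (D s₀ p)) (c₀ ⊙ p) w)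
             (cong₂ _+_ (trans (cong (λ z → X (neg zero) (X z (D s₀ p)) w) (t-b (neg zero) (pos zero))) inner) (trans (X-⊙ (neg zero) c₀ p w) (cong (c₀ *_) (X-opp x₁ p w)))))) ⟩
      (- (- X x₁ (X x₁ (D s₀ p)) w) + c₀ * - X x₁ p w) + c₀ * X x₁ p w ≡⟨ sq-cancel _ c₀ _ ⟩
      X x₁ (X x₁ (D s₀ p)) w ∎
      where
      open ≡-Reasoning
      q = D s₀ p
      inner : X (neg zero) (X (neg zero) q) w ≡ - (- X x₁ (X x₁ q) w)
      inner = trans (X-opp x₁ (X (neg zero) q) w) (cong -_ (trans (X-cong x₁ {h = X (neg zero) q} {h′ = (- 1#) ⊙ X x₁ q} (λ w v → trans (X-opp x₁ q w) (sym (-1* _))) w v)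
        (trans (X-⊙ x₁ (- 1#) (X x₁ q) w) (-1* _))))

    -- x₁² is invariant under s₀, so only the parity of the exponent matters.
    D-pow-x₁ : ∀ a g → D s₀ g ≐ 𝟘 → D s₀ (pow x₁ a g) ≐ (if isOdd a then c₀ ⊙ pow x₁ (a ∸ 1) g else 𝟘)
    D-pow-x₁ zero g z = z
    D-pow-x₁ (suc zero) g z w v = trans (D-X s₀ x₁ g w v) (trans (cong (_+ c₀ * g w) (trans (X-cong (refl-of s₀ x₁) z w v) (Linear-𝟘 (X-Linear (refl-of s₀ x₁)) w v))) (+-identityˡ _))
    D-pow-x₁ (suc (suc a)) g z = ≐-trans (D-x₁² (pow x₁ a g)) (≐-trans (X-cong x₁ (X-cong x₁ (D-pow-x₁ a g z))) (shift a))
      where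
      shift : ∀ a → X x₁ (X x₁ (if isOdd a then c₀ ⊙ pow x₁ (a ∸ 1) g else 𝟘)) ≐ (if isOdd a then c₀ ⊙ pow x₁ (suc a) g else 𝟘)
      shift zero = Linear-𝟘 (∘-Linear (X-Linear x₁) (X-Linear x₁))
      shift (suc a) with isOdd (suc a)
      ... | true = ∘-Linear (X-Linear x₁) (X-Linear x₁) .⊙-hom c₀ (pow x₁ a g)
      ... | false = Linear-𝟘 (∘-Linear (X-Linear x₁) (X-Linear x₁))

    s₀-fixed : ∀ (m : Vec ℕ n) j → lookup m j ≡ 0 ⊎ refl-of s₀ (pos (suc j)) ≡ pos (suc j)
    s₀-fixed m j = inj₂ (t-f (neg zero) (pos zero) (λ ()) (λ ()) (λ ()) (λ ()))

    act-dd0Term : ∀ h → D s₀ h ≐ 𝟘 → ∀ c (m : Mono N) → act (dd0Term ty (c , m)) h ≐ c ⊙ D s₀ (mev pos m h)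
    act-dd0Term h z c (a ∷ m) = go (isOdd a) refl (D-pow-x₁ a (mev (pos ∘ suc) m h) zr)
      where
      zr : D s₀ (mev (pos ∘ suc) m h) ≐ 𝟘
      zr = ≐-trans (D-mev-fixed s₀ (pos ∘ suc) m (s₀-fixed m) h) (≐-trans (mev-Linear (pos ∘ suc) m .≐-cong z) (Linear-𝟘 (mev-Linear (pos ∘ suc) m)))
      go : ∀ b → isOdd a ≡ b → D s₀ (pow x₁ a (mev (pos ∘ suc) m h)) ≐ (if isOdd a then c₀ ⊙ pow x₁ (a ∸ 1) (mev (pos ∘ suc) m h) else 𝟘) →
           act (dd0Term ty (c , a ∷ m)) h ≐ c ⊙ D s₀ (pow x₁ a (mev (pos ∘ suc) m h))
      go false o e w v = trans (cong (λ f → act f h w) (dd0Term-even ty c (a ∷ m) o))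
        (sym (trans (cong (c *_) (trans (e w v) (cong (λ b → (if b then c₀ ⊙ pow x₁ (a ∸ 1) (mev (pos ∘ suc) m h) else 𝟘) w) o))) (zeroʳ c)))
      go true o e w v = trans (cong (λ f → act f h w) (dd0Term-odd ty c (a ∷ m) o))
        (trans (cong (λ y → y * pow x₁ (a ∸ 1) (mev (pos ∘ suc) m h) w + 0#) (trans (*-def (two ty) c) (cong (_* c) (trans (two-def ty) (sym coroot-s₀)))))
        (trans (coeff-+0 c₀ c _) (cong (c *_) (sym (trans (e w v) (cong (λ b → (if b then c₀ ⊙ pow x₁ (a ∸ 1) (mev (pos ∘ suc) m h) else 𝟘) w) o))))))

    divDiff-0 : ∀ h → D s₀ h ≐ 𝟘 → ∀ f → act (divDiff ty 0 f) h ≐ D s₀ (act f h)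
    divDiff-0 h z = D-concatMap s₀ h (dd0Term ty) (act-dd0Term h z)

    divDiff-suc : ∀ i (p : suc i ℕ.< N) (k k′ : Fin N) → toℕ k ≡ i → toℕ k′ ≡ suc i → (e : toℕ k′ ≡ suc (toℕ k)) → ∀ h → D (sᵢ k k′ e) h ≐ 𝟘 →
      ∀ f → act (divDiff ty (suc i) f) h ≐ D (sᵢ k k′ e) (act f h)
    divDiff-suc i p k k′ ek ek′ e h z f with suc i ℕ.<? N
    ... | no ¬p = ⊥-elim (¬p p)
    ... | yes q = subst₂ (λ a b → act (concatMap (ddTerm a b) f) h ≐ D (sᵢ k k′ e) (act f h))
        (FinP.toℕ-injective (trans ek (sym (FinP.toℕ-fromℕ< (ℕP.<-trans (ℕP.n<1+n i) q))))) (FinP.toℕ-injective (trans ek′ (sym (FinP.toℕ-fromℕ< q))))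
        (D-concatMap (sᵢ k k′ e) h (ddTerm k k′) (act-ddTerm k k′ e h z) f)

-- Reflections on functions; the ideal of invariants annihilates the unit.

module InvariantIdeal where

  open SignedIndices
  open SignedPermutations
  open ChevalleyOperators
  open SimpleReflections
  open PolynomialAction
  open DividedDifferences
  open RationalField
  open import Data.List.Relation.Binary.Permutation.Propositional using (prep; swap)
  open import Tactic.RingSolver using (solve-∀)
  open ℚSum

  opaque
    unfolding _+_

    sum₀ : ∀ x → x - x ≡ 0#
    sum₀ = solve-∀ ring

    Š-X-lemma : ∀ c xa τa ca h l P R → c * τa + ca * h ≡ ca * l + c * xa → c * xa - ((P + ca * h) - (R + ca * l)) ≡ c * τa - (P - R)
    Š-X-lemma c xa τa ca h l P R e = trans (r c xa ca h l P R) (trans (cong (λ z → z - ca * h - (P - R)) (sym e)) (r′ c τa ca h P R))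
      where
      r : ∀ c xa ca h l P R → c * xa - ((P + ca * h) - (R + ca * l)) ≡ (ca * l + c * xa) - ca * h - (P - R)
      r = solve-∀ ring
      r′ : ∀ c τa ca h P R → (c * τa + ca * h) - ca * h - (P - R) ≡ c * τa - (P - R)
      r′ = solve-∀ ring

    Š-⊕-lemma : ∀ c a b p q r u → c * (a + b) - ((p + q) - (r + u)) ≡ (c * a - (p - r)) + (c * b - (q - u))
    Š-⊕-lemma = solve-∀ ring

    Š-⊙-lemma : ∀ c a b p q → c * (a * b) - (a * p - a * q) ≡ a * (c * b - (p - q))
    Š-⊙-lemma = solve-∀ ring

    minus-*ʳ : ∀ c a b → c * a - c * b ≡ c * (a - b)
    minus-*ʳ = solve-∀ ring

    D-hi-lo-lemma : ∀ c q → (0# + c * q) - (0# + - c * q) ≡ (c + c) * q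
    D-hi-lo-lemma = solve-∀ ring

    minus-self : ∀ c b p → c * b - p ≡ c * b → p ≡ 0#
    minus-self c b p e = trans (r (c * b) p) (trans (cong (λ z → c * b - z) e) (sum₀ (c * b)))
      where r : ∀ x p → p ≡ x - (x - p)
            r = solve-∀ ring

    double≢0 : ∀ t {P : Set} (d : Dec P) → ((1# + extra t * iv d) * 1#) + ((1# + extra t * iv d) * 1#) ≢ 0#
    double≢0 typeB (yes _) ()
    double≢0 typeB (no _) ()
    double≢0 typeC (yes _) ()
    double≢0 typeC (no _) ()

  module Elementary (R : CommutativeRing 0ℓ 0ℓ) where
    open CommutativeRing R hiding (zero) renaming (refl to ≈refl; sym to ≈sym; trans to ≈trans; _+_ to _+R_; _*_ to _*R_; 0# to 0R; 1# to 1R)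

    acr : AlmostCommutativeRing 0ℓ 0ℓ
    acr = fromCommutativeRing R (λ _ → nothing)

    open import Tactic.RingSolver.NonReflective acr using (solve; _⊕_; _⊗_; Κ)

    -- Same recursion as `esym`, over any commutative ring: the symmetry proved here is used in
    -- `polyRing 𝟙`, where products of formal sums commute up to their action.
    e : ℕ → List Carrier → Carrier
    e zero    _        = 1R
    e (suc k) []       = 0R
    e (suc k) (y ∷ ys) = e (suc k) ys +R (y *R e k ys)

    e-cons : ∀ k y {ys ys′} → (∀ j → e j ys ≈ e j ys′) → e k (y ∷ ys) ≈ e k (y ∷ ys′)
    e-cons zero y p = ≈refl
    e-cons (suc k) y p = +-cong (p (suc k)) (*-cong ≈refl (p k))

    private
      swap₁ : ∀ a b u → (u +R b *R 1R) +R a *R 1R ≈ (u +R a *R 1R) +R b *R 1R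
      swap₁ = solve 3 (λ a b u → ((u ⊕ b ⊗ Κ 1R) ⊕ a ⊗ Κ 1R) , ((u ⊕ a ⊗ Κ 1R) ⊕ b ⊗ Κ 1R)) ≈refl
      swap₂ : ∀ a b u v x → (u +R b *R v) +R a *R (v +R b *R x) ≈ (u +R a *R v) +R b *R (v +R a *R x)
      swap₂ = solve 5 (λ a b u v x → ((u ⊕ b ⊗ v) ⊕ a ⊗ (v ⊕ b ⊗ x)) , ((u ⊕ a ⊗ v) ⊕ b ⊗ (v ⊕ a ⊗ x))) ≈refl

    e-swap : ∀ k a b ys → e k (a ∷ b ∷ ys) ≈ e k (b ∷ a ∷ ys)
    e-swap zero a b ys = ≈refl
    e-swap (suc zero) a b ys = swap₁ a b (e 1 ys)
    e-swap (suc (suc k)) a b ys = swap₂ a b (e (suc (suc k)) ys) (e (suc k) ys) (e k ys)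

    e-↭ : ∀ k {ys ys′} → ys ↭ ys′ → e k ys ≈ e k ys′
    e-↭ k Perm.refl = ≈refl
    e-↭ k (prep y p) = e-cons k y (λ j → e-↭ j p)
    e-↭ k (swap {xs} {ys} a b p) = ≈trans (e-swap k a b xs) (e-cons k b {a ∷ xs} {a ∷ ys} (λ j → e-cons j a {xs} {ys} (λ i → e-↭ i p)))
    e-↭ k (Perm.trans p q) = ≈trans (e-↭ k p) (e-↭ k q)

  idx : ∀ {N} → SI N → Fin N
  idx (pos i) = i
  idx (neg i) = i

  allFin-↭ : ∀ {N} (σ : Fin N → Fin N) → (∀ i → σ (σ i) ≡ i) → map σ (allFin N) ↭ allFin N
  allFin-↭ {N} σ σσ = ∼bag⇒↭ (unique∧set⇒bag (UniqueP.map⁺ (λ {i} {j} e → trans (sym (σσ i)) (trans (cong σ e) (σσ j))) (UniqueP.allFin⁺ N)) (UniqueP.allFin⁺ N)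
    (λ {i} → mk⇔ (λ _ → ∈-allFin i) (λ _ → subst (λ z → z ∈ map σ (allFin N)) (σσ i) (∈-map⁺ σ (∈-allFin (σ i))))))

  module Ideal (ty : RootType) {n : ℕ} where
    open DividedDifference ty {n} public

    private
      N = suc n
      S = SI N

    -- Equal to 2 for s₀ in type B and to 1 otherwise. In both types cₕ α_s = x_hi - x_lo, so
    -- multiplying the reflection f - α_s ∂_s f by cₕ removes the simple root from the formula.
    cₕ : Simple {N} → ℚ
    cₕ s = coroot s (hi s)

    -- cₕ times the action of the reflection on H.
    Š : Simple {N} → H → H
    Š s h w = cₕ s * h w - (X (hi s) (D s h) w - X (lo s) (D s h) w)

    Š-cong : ∀ s {h h′} → h ≐ h′ → Š s h ≐ Š s h′
    Š-cong s e w v = cong₂ _-_ (cong (cₕ s *_) (e w v)) (cong₂ _-_ (X-cong (hi s) (D-cong s e) w v) (X-cong (lo s) (D-cong s e) w v))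

    Š-⊕ : ∀ s h h′ → Š s (h ⊕ h′) ≐ Š s h ⊕ Š s h′
    Š-⊕ s h h′ w v = trans (cong (λ z → cₕ s * (h w + h′ w) - z) (cong₂ _-_ (part (hi s)) (part (lo s)))) (Š-⊕-lemma (cₕ s) _ _ _ _ _ _)
      where
      part : ∀ a → X a (D s (h ⊕ h′)) w ≡ X a (D s h) w + X a (D s h′) w
      part a = trans (X-cong a {h = D s (h ⊕ h′)} {h′ = D s h ⊕ D s h′} (λ w v → D-⊕ s h h′ w) w v) (X-⊕ a _ _ w)

    Š-⊙ : ∀ s c h → Š s (c ⊙ h) ≐ c ⊙ Š s h
    Š-⊙ s c h w v = trans (cong (λ z → cₕ s * (c * h w) - z) (cong₂ _-_ (part (hi s)) (part (lo s)))) (Š-⊙-lemma (cₕ s) _ _ _ _)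
      where
      part : ∀ a → X a (D s (c ⊙ h)) w ≡ c * X a (D s h) w
      part a = trans (X-cong a {h = D s (c ⊙ h)} {h′ = c ⊙ D s h} (λ w v → D-⊙ s c h w) w v) (X-⊙ a c _ w)

    -- The reflection is a ring automorphism. After the Leibniz rule the remaining linear terms
    -- cancel by `cross` with b = hi s, because cₕ is the divided difference of x_hi.
    Š-X : ∀ s a h → Š s (X a h) ≐ X (refl-of s a) (Š s h)
    Š-X s a h w v = trans (cong (λ z → cₕ s * X a h w - z) (cong₂ _-_ (part (hi s)) (part (lo s))))
      (trans (Š-X-lemma (cₕ s) (X a h w) (X (refl-of s a) h w) (coroot s a) (X (hi s) h w) (X (lo s) h w) _ _
               (trans (cross s a (hi s) h w) (cong (λ z → coroot s a * X z h w + cₕ s * X a h w) (t-b (lo s) (hi s)))))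
        (sym expand))
      where
      τ = refl-of s
      part : ∀ b → X b (D s (X a h)) w ≡ X (τ a) (X b (D s h)) w + coroot s a * X b h w
      part b = trans (X-cong b {h = D s (X a h)} {h′ = X (τ a) (D s h) ⊕ coroot s a ⊙ h} (D-X s a h) w v)
        (trans (X-⊕ b _ _ w) (cong₂ _+_ (X-comm b (τ a) (D s h) w v) (X-⊙ b (coroot s a) h w)))
      expand : X (τ a) (Š s h) w ≡ cₕ s * X (τ a) h w - (X (τ a) (X (hi s) (D s h)) w - X (τ a) (X (lo s) (D s h)) w)
      expand = trans (X-cong (τ a) {h = Š s h} {h′ = (cₕ s ⊙ h) ⊕ (- 1# ⊙ (X (hi s) (D s h) ⊕ - 1# ⊙ X (lo s) (D s h)))}
                 (λ w v → cong (_+_ (cₕ s * h w)) (trans (sym (-1* _)) (cong (- 1# *_) (cong (_+_ _) (sym (-1* _)))))) w v)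
        (trans (X-⊕ (τ a) _ _ w) (cong₂ _+_ (X-⊙ (τ a) _ _ w) (trans (X-⊙ (τ a) _ _ w) (trans (-1* _) (cong -_ (trans (X-⊕ (τ a) _ _ w) (cong (_+_ _) (trans (X-⊙ (τ a) _ _ w) (-1* _)))))))))

    Š-pow : ∀ s a k h → Š s (pow a k h) ≐ pow (refl-of s a) k (Š s h)
    Š-pow s a zero h = ≐-refl
    Š-pow s a (suc k) h = ≐-trans (Š-X s a (pow a k h)) (X-cong (refl-of s a) (Š-pow s a k h))

    Š-mev : ∀ s {k} (τ : Fin k → S) m h → Š s (mev τ m h) ≐ mev (refl-of s ∘ τ) m (Š s h)
    Š-mev s τ [] h = ≐-refl
    Š-mev s τ (e ∷ m) h = ≐-trans (Š-pow s (τ zero) e _) (pow-Linear (refl-of s (τ zero)) e .≐-cong (Š-mev s (τ ∘ suc) m h))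

    Š-𝟘 : ∀ s → Š s 𝟘 ≐ 𝟘
    Š-𝟘 s w v = trans (Š-cong s {h = 𝟘} {h′ = 0# ⊙ 𝟘} (λ _ _ → sym (zeroˡ 0#)) w v) (trans (Š-⊙ s 0# 𝟘 w v) (zeroˡ _))

    Š-ev : ∀ s τ f h → Š s (ev⟨ τ ⟩ f h) ≐ ev⟨ refl-of s ∘ τ ⟩ f (Š s h)
    Š-ev s τ [] h = Š-𝟘 s
    Š-ev s τ ((c , m) ∷ f) h w v = trans (Š-⊕ s (c ⊙ mev τ m h) (ev⟨ τ ⟩ f h) w v)
      (cong₂ _+_ (trans (Š-⊙ s c (mev τ m h) w v) (cong (c *_) (Š-mev s τ m h w v))) (Š-ev s τ f h w v))

    D-D : ∀ s h → D s (D s h) ≐ 𝟘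
    D-D s h w v with L w ℤ.<? L (w · refl-of s)
    ... | no _ = zeroˡ _
    ... | yes p = trans (one-* _) (trans (cong (_* h (w · refl-of s · refl-of s)) (iv-no (L (w · refl-of s) ℤ.<? L (w · refl-of s · refl-of s))
        (λ q → ℤP.<-asym p (subst (λ z → L (w · refl-of s) ℤ.< L z) (·-t-t w (lo s) (hi s)) q)))) (zeroˡ _))

    cₕ-def : ∀ s → cₕ s ≡ (1# + extra ty * iv (lo s ≟S opp (hi s))) * 1#
    cₕ-def s = trans (cong (λ z → κ (hi s) z * sg (loc z) (loc (hi s))) (t-b (lo s) (hi s))) (cong (κ (hi s) (lo s) *_) (sg-< (lo<hi s)))

    cₕ+cₕ≢0 : ∀ s → cₕ s + cₕ s ≢ 0#
    cₕ+cₕ≢0 s e = double≢0 ty (lo s ≟S opp (hi s)) (trans (sym (cong₂ _+_ (cₕ-def s) (cₕ-def s))) e)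

    coroot-lo-hi : ∀ s → coroot s (lo s) ≡ - cₕ s
    coroot-lo-hi s = trans (cong (coroot s) (sym (t-b (lo s) (hi s)))) (coroot-τ s (hi s))

    D-zero⇒Š : ∀ s g → D s g ≐ 𝟘 → Š s g ≐ cₕ s ⊙ g
    D-zero⇒Š s g z w v = trans (cong (λ y → cₕ s * g w - y) (trans (cong₂ _-_ (part (hi s)) (part (lo s))) (sum₀ 0#))) (minus-zero _)
      where
      part : ∀ a → X a (D s g) w ≡ 0#
      part a = trans (X-cong a z w v) (Linear-𝟘 (X-Linear a) w v)

    -- Apply D to (x_hi − x_lo) D g = 0 and use D D = 0.
    Š⇒D-zero : ∀ s g → Š s g ≐ cₕ s ⊙ g → D s g ≐ 𝟘
    Š⇒D-zero s g e w v = *-cancelˡ (cₕ s + cₕ s) (cₕ+cₕ≢0 s) (trans (sym (D-hi-lo-lemma (cₕ s) (q w))) (trans (sym parts) (trans DΔ (sym (zeroʳ _)))))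
      where
      q = D s g
      Δ : H
      Δ w = X (hi s) q w - X (lo s) q w
      Δ-zero : Δ ≐ 𝟘
      Δ-zero w v = minus-self (cₕ s) (g w) (Δ w) (e w v)
      DΔ : D s Δ w ≡ 0#
      DΔ = trans (D-cong s Δ-zero w v) (D-𝟘 s w v)
      DX : ∀ a c → coroot s a ≡ c → D s (X a q) w ≡ 0# + c * q w
      DX a c ec = trans (D-X s a q w v) (cong₂ _+_ (trans (X-cong (refl-of s a) (D-D s g) w v) (Linear-𝟘 (X-Linear (refl-of s a)) w v)) (cong (_* q w) ec))
      parts : D s Δ w ≡ (0# + cₕ s * q w) - (0# + - cₕ s * q w)
      parts = trans (sym (minus-*ʳ (asc w s) (X (hi s) q (w · refl-of s)) (X (lo s) q (w · refl-of s)))) (cong₂ _-_ (DX (hi s) _ refl) (DX (lo s) _ (coroot-lo-hi s)))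

    δ : W {N} → H
    δ u w = iv (VecP.≡-dec ℤP._≟_ w u)

    δ-self : ∀ u → δ u u ≡ 1#
    δ-self u = iv-yes (VecP.≡-dec ℤP._≟_ u u) refl

    δ-other : ∀ {u w} → w ≢ u → δ u w ≡ 0#
    δ-other {u} {w} = iv-no (VecP.≡-dec ℤP._≟_ w u)

    idW : W {N}
    idW = tabulate (λ i → + suc (toℕ i))

    ev-idW : ∀ x → ev idW x ≡ loc x
    ev-idW (pos i) = VecP.lookup∘tabulate (λ i → + suc (toℕ i)) i
    ev-idW (neg i) = cong ℤ.-_ (VecP.lookup∘tabulate (λ i → + suc (toℕ i)) i)

    L-idW : L idW ≡ + 0
    L-idW = increasing-L idW (λ x y p → subst₂ ℤ._<_ (sym (ev-idW x)) (sym (ev-idW y)) p)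

    𝟙 : H
    𝟙 = δ idW

    D-𝟙 : ∀ s → D s 𝟙 ≐ 𝟘
    D-𝟙 s w v = go (VecP.≡-dec ℤP._≟_ (w · refl-of s) idW)
      where
      go : Dec (w · refl-of s ≡ idW) → D s 𝟙 w ≡ 0#
      go (no ne) = trans (cong (asc w s *_) (δ-other ne)) (zeroʳ _)
      go (yes e) = trans (cong (_* 𝟙 (w · refl-of s)) (iv-no (L w ℤ.<? L (w · refl-of s)) (λ p → ℤP.<⇒≱ (subst (L w ℤ.<_) (trans (cong L e) L-idW) p) (L-nonneg w)))) (zeroˡ _)

    Š-𝟙 : ∀ s → Š s 𝟙 ≐ cₕ s ⊙ 𝟙
    Š-𝟙 s = D-zero⇒Š s 𝟙 (D-𝟙 s)

    open Elementary (polyRing 𝟙) public using (e; e-↭)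

    sq : Fin N → Poly N
    sq j = varP j *ᴾ varP j

    ev-sq : ∀ τ j h → ev⟨ τ ⟩ (sq j) h ≐ X (τ j) (X (τ j) h)
    ev-sq τ j h = ≐-trans (ev-* τ (varP j) (varP j) h) (≐-trans (ev-var τ j _) (X-cong (τ j) (ev-var τ j h)))

    X-idx : ∀ a h → X a (X a h) ≐ X (pos (idx a)) (X (pos (idx a)) h)
    X-idx (pos i) h = ≐-refl
    X-idx (neg i) h w v = trans (X-opp (pos i) (X (neg i) h) w) (trans (cong -_ (trans (X-cong (pos i) {h = X (neg i) h} {h′ = - 1# ⊙ X (pos i) h} (λ w v → trans (X-opp (pos i) h w) (sym (-1* _))) w v)
      (trans (X-⊙ (pos i) (- 1#) _ w) (-1* _)))) (neg-neg _))

    -- Squares forget signs: X (opp a) and X a have the same square, so only the underlying index ρ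
    -- j matters.
    esym-transfer : ∀ τ k js (ρ : Fin N → Fin N) → (∀ j → idx (τ j) ≡ ρ j) → ∀ h → ev⟨ τ ⟩ (esym k (map sq js)) h ≐ act (esym k (map sq (map ρ js))) h
    esym-transfer τ zero js ρ r h = ≐-trans (ev-one τ h) (≐-sym (ev-one pos h))
    esym-transfer τ (suc k) [] ρ r h = ≐-refl
    esym-transfer τ (suc k) (j ∷ js) ρ r h w v = trans (ev-++ τ (esym (suc k) (map sq js)) (sq j *ᴾ esym k (map sq js)) h w)
      (trans (cong₂ _+_ (esym-transfer τ (suc k) js ρ r h w v)
         (trans (ev-* τ (sq j) (esym k (map sq js)) h w v) (trans (ev-sq τ j _ w v) (trans (X-idx (τ j) _ w v)
           (trans (cong (λ z → X (pos z) (X (pos z) (ev⟨ τ ⟩ (esym k (map sq js)) h)) w) (r j))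
            (trans (X-cong (pos (ρ j)) (X-cong (pos (ρ j)) (esym-transfer τ k js ρ r h)) w v)
             (sym (trans (ev-* pos (sq (ρ j)) (esym k (map sq (map ρ js))) h w v) (ev-sq pos (ρ j) _ w v)))))))))
       (sym (ev-++ pos (esym (suc k) (map sq (map ρ js))) (sq (ρ j) *ᴾ esym k (map sq (map ρ js))) h w)))

    esym-e : ∀ k ys → esym k ys ≡ e k ys
    esym-e zero ys = refl
    esym-e (suc k) [] = refl
    esym-e (suc k) (y ∷ ys) = cong₂ (λ p q → p +ᴾ (y *ᴾ q)) (esym-e (suc k) ys) (esym-e k ys)

    esym-↭ : ∀ k {ys ys′} → ys ↭ ys′ → act (esym k ys) 𝟙 ≐ act (esym k ys′) 𝟙
    esym-↭ k {ys} {ys′} p = subst₂ (λ f g → act f 𝟙 ≐ act g 𝟙) (sym (esym-e k ys)) (sym (esym-e k ys′)) (e-↭ k p)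

    esym-bottom : ∀ k js h w → Valid w → L w ≡ + 0 → act (esym (suc k) (map sq js)) h w ≡ 0#
    esym-bottom k [] h w v z = refl
    esym-bottom k (j ∷ js) h w v z = trans (ev-++ pos (esym (suc k) (map sq js)) (sq j *ᴾ esym k (map sq js)) h w)
      (trans (cong₂ _+_ (esym-bottom k js h w v z) (trans (ev-* pos (sq j) (esym k (map sq js)) h w v) (trans (ev-sq pos j _ w v) (X-bottom (pos j) _ w z)))) (+-identityˡ 0#))

    σ-idx : Simple {N} → Fin N → Fin N
    σ-idx s j = idx (refl-of s (pos j))

    σ-idx-involutive : ∀ s j → σ-idx s (σ-idx s j) ≡ j
    σ-idx-involutive s j with refl-of s (pos j) in eq
    ... | pos i = cong idx (trans (cong (refl-of s) (sym eq)) (t-t (lo s) (hi s) (pos j)))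
    ... | neg i = cong idx (trans (t-odd (lo s) (hi s) (neg i)) (cong opp (trans (cong (refl-of s) (sym eq)) (t-t (lo s) (hi s) (pos j)))))

    -- The reflections permute the squares x_i², so they fix this vector and every simple D s kills
    -- it; at length 0 only a constant term could survive, and there is none. `D-vanish` then
    -- applies.
    esym-𝟙 : ∀ k → act (esym (suc k) squares) 𝟙 ≐ 𝟘
    esym-𝟙 k = D-vanish g (λ i → Š⇒D-zero (simple i) g (inv′ (simple i))) (λ w v z → esym-bottom k (allFin N) 𝟙 w v z)
      where
      g = act (esym (suc k) squares) 𝟙
      inv′ : ∀ s → Š s g ≐ cₕ s ⊙ g
      inv′ s = ≐-trans (Š-ev s pos (esym (suc k) squares) 𝟙) (≐-trans (ev-Linear _ (esym (suc k) squares) .≐-cong (Š-𝟙 s))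
        (≐-trans (ev-Linear _ (esym (suc k) squares) .⊙-hom (cₕ s) 𝟙) (λ w v → cong (cₕ s *_)
          (trans (esym-transfer (refl-of s ∘ pos) (suc k) (allFin N) (σ-idx s) (λ _ → refl) 𝟙 w v)
                 (esym-↭ (suc k) (map⁺ sq (allFin-↭ (σ-idx s) (σ-idx-involutive s))) w v)))))

    act-sumP-zero : ∀ {A : Set} (F : A → Poly N) js h → (∀ j → act (F j) h ≐ 𝟘) → act (sumP (map F js)) h ≐ 𝟘
    act-sumP-zero F [] h z w v = refl
    act-sumP-zero F (j ∷ js) h z w v = trans (ev-++ pos (F j) (sumP (map F js)) h w) (trans (cong₂ _+_ (z j w v) (act-sumP-zero F js h z w v)) (+-identityˡ 0#))

    ideal-𝟙 : ∀ f → InIdeal f → act f 𝟙 ≐ 𝟘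
    ideal-𝟙 f (g , eq) w v = trans (ev-≈ pos f (sumP (map (λ k → g k *ᴾ esym (suc (toℕ k)) squares) (allFin N))) 𝟙 w eq)
      (act-sumP-zero (λ k → g k *ᴾ esym (suc (toℕ k)) squares) (allFin N) 𝟙
        (λ k → ≐-trans (ev-* pos (g k) (esym (suc (toℕ k)) squares) 𝟙) (≐-trans (act-cong (g k) (esym-𝟙 (toℕ k))) (ev-zero pos (g k)))) w v)

-- The product of positive roots modulo the invariants.

module RootProducts where

  open InvariantIdeal using (module Elementary)
  open import Data.List.Relation.Binary.Permutation.Propositional using (prep; swap)

  module Products (R : CommutativeRing 0ℓ 0ℓ) where
    open CommutativeRing R hiding (zero) renaming (refl to ≈-refl; sym to ≈-sym; trans to ≈-trans)
    open Elementary R using (e; acr)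
    open import Algebra.Properties.Ring ring using (-‿distribˡ-*; -‿distribʳ-*; -‿involutive)
    open import Algebra.Properties.AbelianGroup +-abelianGroup using () renaming (⁻¹-∙-comm to -‿+-comm)
    open import Algebra.Properties.CommutativeSemigroup *-commutativeSemigroup using () renaming (x∙yz≈y∙xz to *-left-comm; interchange to *-interchange)
    open import Tactic.RingSolver.NonReflective acr using (solve; _⊕_; _⊗_; Κ)
    import Algebra.Solver.CommutativeMonoid *-commutativeMonoid as CM
    import Algebra.Solver.CommutativeMonoid +-commutativeMonoid as AM
    open import Relation.Binary.Reasoning.Setoid setoid

    prod : List Carrier → Carrier
    prod = foldr _*_ 1#

    prod-++ : ∀ l l′ → prod (l ++ l′) ≈ prod l * prod l′
    prod-++ [] l′ = ≈-sym (*-identityˡ _)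
    prod-++ (x ∷ l) l′ = ≈-trans (*-congˡ (prod-++ l l′)) (≈-sym (*-assoc _ _ _))

    ∏ : {A : Set} → List A → (A → Carrier) → Carrier
    ∏ [] F = 1#
    ∏ (a ∷ as) F = F a * ∏ as F

    ∏-cong : {A : Set} (as : List A) {F G : A → Carrier} → (∀ a → F a ≈ G a) → ∏ as F ≈ ∏ as G
    ∏-cong [] p = ≈-refl
    ∏-cong (a ∷ as) p = *-cong (p a) (∏-cong as p)

    ∏-* : {A : Set} (as : List A) (F G : A → Carrier) → ∏ as (λ a → F a * G a) ≈ ∏ as F * ∏ as G
    ∏-* [] F G = ≈-sym (*-identityˡ _)
    ∏-* (a ∷ as) F G = ≈-trans (*-congˡ (∏-* as F G)) (*-interchange _ _ _ _)

    ∏-↭ : {A : Set} {as bs : List A} (F : A → Carrier) → as ↭ bs → ∏ as F ≈ ∏ bs F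
    ∏-↭ F Perm.refl = ≈-refl
    ∏-↭ F (prep a p) = *-congˡ (∏-↭ F p)
    ∏-↭ F (swap a b p) = ≈-trans (*-left-comm _ _ _) (*-congˡ (*-congˡ (∏-↭ F p)))
    ∏-↭ F (Perm.trans p q) = ≈-trans (∏-↭ F p) (∏-↭ F q)

    ∏-one : {A : Set} (as : List A) {F : A → Carrier} → All (λ a → F a ≈ 1#) as → ∏ as F ≈ 1#
    ∏-one [] [] = ≈-refl
    ∏-one (a ∷ as) (p ∷ ps) = ≈-trans (*-cong p (∏-one as ps)) (*-identityˡ 1#)

    ∏-congAll : {A : Set} (as : List A) {F G : A → Carrier} → All (λ a → F a ≈ G a) as → ∏ as F ≈ ∏ as G
    ∏-congAll [] [] = ≈-refl
    ∏-congAll (a ∷ as) (p ∷ ps) = *-cong p (∏-congAll as ps)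

    prod-concatMap : {A : Set} (F : A → List Carrier) (as : List A) → prod (concatMap F as) ≈ ∏ as (λ a → prod (F a))
    prod-concatMap F [] = ≈-refl
    prod-concatMap F (a ∷ as) = ≈-trans (prod-++ (F a) (concatMap F as)) (*-congˡ (prod-concatMap F as))

    prod-map : {A : Set} (F : A → Carrier) (as : List A) → prod (map F as) ≈ ∏ as F
    prod-map F [] = ≈-refl
    prod-map F (a ∷ as) = *-congˡ (prod-map F as)

    pw : Carrier → ℕ → Carrier
    pw x zero = 1#
    pw x (suc k) = x * pw x k

    pw-+ : ∀ x j k → pw x j * pw x k ≈ pw x (j ℕ.+ k)
    pw-+ x zero k = *-identityˡ _
    pw-+ x (suc j) k = ≈-trans (*-assoc _ _ _) (*-congˡ (pw-+ x j k))

    nat : ℕ → Carrier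
    nat zero = 0#
    nat (suc k) = 1# + nat k

    sgn : ℕ → Carrier
    sgn zero = 1#
    sgn (suc k) = - sgn k

    neg² : ∀ x y → - x * - y ≈ x * y
    neg² x y = ≈-trans (≈-sym (-‿distribˡ-* x (- y))) (≈-trans (-‿cong (≈-sym (-‿distribʳ-* x y))) (-‿involutive _))

    sgn² : ∀ k → sgn k * sgn k ≈ 1#
    sgn² zero = *-identityˡ 1#
    sgn² (suc k) = ≈-trans (neg² (sgn k) (sgn k)) (sgn² k)

    diff-squares : ∀ a b → (a + - b) * ((b + a) * 1#) ≈ a * a + - (b * b)
    diff-squares a b = begin
      (a + - b) * ((b + a) * 1#) ≈⟨ *-congˡ (*-identityʳ _) ⟩
      (a + - b) * (b + a) ≈⟨ distribʳ _ _ _ ⟩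
      a * (b + a) + - b * (b + a) ≈⟨ +-cong (distribˡ _ _ _) (≈-trans (≈-sym (-‿distribˡ-* _ _)) (≈-trans (-‿cong (distribˡ _ _ _)) (≈-sym (-‿+-comm _ _)))) ⟩
      (a * b + a * a) + (- (b * b) + - (b * a)) ≈⟨ AM.solve 4 (λ p q r s → ((p AM.⊕ q) AM.⊕ (r AM.⊕ s)) AM.⊜ ((q AM.⊕ r) AM.⊕ (p AM.⊕ s))) ≈-refl (a * b) (a * a) (- (b * b)) (- (b * a)) ⟩
      (a * a + - (b * b)) + (a * b + - (b * a)) ≈⟨ +-congˡ (≈-trans (+-congˡ (-‿cong (*-comm b a))) (-‿inverseʳ _)) ⟩
      (a * a + - (b * b)) + 0# ≈⟨ +-identityʳ _ ⟩
      a * a + - (b * b) ∎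

    e-overflow : ∀ k ys → length ys ℕ.< k → e k ys ≈ 0#
    e-overflow (suc k) [] p = ≈-refl
    e-overflow (suc k) (y ∷ ys) (s≤s p) = ≈-trans (+-cong (e-overflow (suc k) ys (ℕP.m≤n⇒m≤1+n p)) (≈-trans (*-congˡ (e-overflow k ys p)) (zeroʳ y))) (+-identityˡ 0#)

    module Peel (T : Carrier) where

      -- Horner form of Σ_j (-1)^j T^(k-j) e_j(ys); for k = length ys it is the product of all T -
      -- y.
      q : ℕ → List Carrier → Carrier
      q zero ys = 1#
      q (suc k) ys = T * q k ys + sgn (suc k) * e (suc k) ys

      private
        step₀ : ∀ t e y m → t * 1# + m * (e + y * 1#) ≈ (t * 1# + m * e) + m * (y * 1#)
        step₀ = solve 4 (λ t e y m → (t ⊗ Κ 1# ⊕ m ⊗ (e ⊕ y ⊗ Κ 1#)) , ((t ⊗ Κ 1# ⊕ m ⊗ e) ⊕ m ⊗ (y ⊗ Κ 1#))) ≈-refl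
        step₁ : ∀ t p m e′ y n e → t * (p + y * n) + m * (e′ + y * e) ≈ (t * p + m * e′) + y * (t * n + m * e)
        step₁ = solve 7 (λ t p m e′ y n e → (t ⊗ (p ⊕ y ⊗ n) ⊕ m ⊗ (e′ ⊕ y ⊗ e)) , ((t ⊗ p ⊕ m ⊗ e′) ⊕ y ⊗ (t ⊗ n ⊕ m ⊗ e))) ≈-refl

      q-cons : ∀ k y ys → q (suc k) (y ∷ ys) ≈ q (suc k) ys + y * - q k ys
      q-cons zero y ys = ≈-trans (step₀ T (e 1 ys) y (- 1#)) (+-congˡ (≈-trans (≈-sym (-‿distribˡ-* _ _)) (≈-trans (-‿cong (*-identityˡ _)) (-‿distribʳ-* y 1#))))
      q-cons (suc k) y ys = begin
        T * q (suc k) (y ∷ ys) + sgn (suc (suc k)) * (e (suc (suc k)) ys + y * e (suc k) ys)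
          ≈⟨ +-congʳ (*-congˡ (q-cons k y ys)) ⟩
        T * (q (suc k) ys + y * - q k ys) + sgn (suc (suc k)) * (e (suc (suc k)) ys + y * e (suc k) ys)
          ≈⟨ step₁ T (q (suc k) ys) (sgn (suc (suc k))) (e (suc (suc k)) ys) y (- q k ys) (e (suc k) ys) ⟩
        q (suc (suc k)) ys + y * (T * - q k ys + - sgn (suc k) * e (suc k) ys)
          ≈⟨ +-congˡ (*-congˡ (≈-trans (+-cong (≈-sym (-‿distribʳ-* _ _)) (≈-sym (-‿distribˡ-* _ _))) (-‿+-comm _ _))) ⟩
        q (suc (suc k)) ys + y * - q (suc k) ys ∎

      ∏-q : ∀ ys → ∏ ys (λ y → T + - y) ≈ q (length ys) ys
      ∏-q [] = ≈-refl
      ∏-q (y ∷ ys) = begin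
        (T + - y) * ∏ ys (λ y → T + - y) ≈⟨ *-congˡ (∏-q ys) ⟩
        (T + - y) * q (length ys) ys ≈⟨ distribʳ _ _ _ ⟩
        T * q (length ys) ys + - y * q (length ys) ys ≈⟨ +-cong (≈-sym (≈-trans (+-congˡ (≈-trans (*-congˡ (e-overflow (suc (length ys)) ys ℕP.≤-refl)) (zeroʳ _))) (+-identityʳ _))) (≈-trans (≈-sym (-‿distribˡ-* _ _)) (-‿distribʳ-* _ _)) ⟩
        q (suc (length ys)) ys + y * - q (length ys) ys ≈⟨ ≈-sym (q-cons (length ys) y ys) ⟩
        q (suc (length ys)) (y ∷ ys) ∎

      module _ (ys : List Carrier) (h : Carrier) (rel : ∀ k → e (suc k) (T ∷ ys) * h ≈ 0#) where

        -- If e_j(T, ys) acts as 0 on h for all j ≥ 1, then ∏(1 + y z) is inverse to 1 + T z, whence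
        -- e_k(ys) = (-T)^k on h.
        e-peel : ∀ k → e k ys * h ≈ sgn k * (pw T k * h)
        e-peel zero = *-congˡ (≈-sym (*-identityˡ h))
        e-peel (suc k) = begin
          e (suc k) ys * h ≈⟨ ≈-sym (+-identityʳ _) ⟩
          e (suc k) ys * h + 0# ≈⟨ +-congˡ (≈-sym (-‿inverseʳ (T * e k ys * h))) ⟩
          e (suc k) ys * h + (T * e k ys * h + - (T * e k ys * h)) ≈⟨ ≈-sym (+-assoc _ _ _) ⟩
          (e (suc k) ys * h + T * e k ys * h) + - (T * e k ys * h) ≈⟨ +-congʳ (≈-trans (≈-sym (distribʳ _ _ _)) (rel k)) ⟩
          0# + - (T * e k ys * h) ≈⟨ +-identityˡ _ ⟩
          - (T * e k ys * h) ≈⟨ -‿cong (≈-trans (*-assoc _ _ _) (≈-trans (*-congˡ (e-peel k)) (*-left-comm _ _ _))) ⟩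
          - (sgn k * (T * (pw T k * h))) ≈⟨ -‿distribˡ-* _ _ ⟩
          - sgn k * (T * (pw T k * h)) ≈⟨ *-congˡ (≈-sym (*-assoc _ _ _)) ⟩
          - sgn k * (pw T (suc k) * h) ∎

        -- By `e-peel` each of the k + 1 summands (-1)^j T^(k-j) e_j(ys) acts on h as T^k.
        q-peel : ∀ k → q k ys * h ≈ nat (suc k) * (pw T k * h)
        q-peel zero = ≈-sym (≈-trans (*-congʳ (+-identityʳ 1#)) (≈-trans (*-identityˡ _) ≈-refl))
        q-peel (suc k) = begin
          (T * q k ys + sgn (suc k) * e (suc k) ys) * h ≈⟨ distribʳ _ _ _ ⟩
          T * q k ys * h + sgn (suc k) * e (suc k) ys * h
            ≈⟨ +-cong (≈-trans (*-assoc _ _ _) (≈-trans (*-congˡ (q-peel k)) (≈-trans (*-left-comm _ _ _) (*-congˡ (≈-sym (*-assoc _ _ _))))))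
                      (≈-trans (*-assoc _ _ _) (≈-trans (*-congˡ (e-peel (suc k))) (≈-trans (≈-sym (*-assoc _ _ _)) (*-congʳ (sgn² (suc k)))))) ⟩
          nat (suc k) * (pw T (suc k) * h) + 1# * (pw T (suc k) * h) ≈⟨ +-comm _ _ ⟩
          1# * (pw T (suc k) * h) + nat (suc k) * (pw T (suc k) * h) ≈⟨ ≈-sym (distribʳ _ _ _) ⟩
          nat (suc (suc k)) * (pw T (suc k) * h) ∎

        ∏-peel : ∏ ys (λ y → T + - y) * h ≈ nat (suc (length ys)) * (pw T (length ys) * h)
        ∏-peel = ≈-trans (*-congʳ (∏-q ys)) (q-peel (length ys))

        top-zero : pw T (suc (length ys)) * h ≈ 0#
        top-zero = begin
          pw T k * h ≈⟨ ≈-sym (*-identityˡ _) ⟩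
          1# * (pw T k * h) ≈⟨ *-congʳ (≈-sym (sgn² k)) ⟩
          sgn k * sgn k * (pw T k * h) ≈⟨ ≈-trans (*-assoc _ _ _) (*-congˡ (≈-sym (e-peel k))) ⟩
          sgn k * (e k ys * h) ≈⟨ *-congˡ (≈-trans (*-congʳ (e-overflow k ys ℕP.≤-refl)) (zeroˡ h)) ⟩
          sgn k * 0# ≈⟨ zeroʳ _ ⟩
          0# ∎
          where k = suc (length ys)

        -- Lets the peeling continue: on z T^l h the remaining squares again satisfy the invariant
        -- relations, since e_(k+1)(ys) turns T^l into ±T^(l+k+1), which acts as 0 by `top-zero`.
        e-next : ∀ z k → e (suc k) ys * (z * (pw T (length ys) * h)) ≈ 0#
        e-next z k = begin
          e (suc k) ys * (z * (pw T l * h)) ≈⟨ ≈-trans (*-left-comm _ _ _) (*-congˡ (≈-trans (*-left-comm _ _ _) (*-congˡ (e-peel (suc k))))) ⟩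
          z * (pw T l * (sgn (suc k) * (pw T (suc k) * h))) ≈⟨ *-congˡ (≈-trans (*-left-comm _ _ _) (*-congˡ (≈-sym (*-assoc _ _ _)))) ⟩
          z * (sgn (suc k) * (pw T l * pw T (suc k) * h)) ≈⟨ *-congˡ (*-congˡ (≈-trans (*-congʳ (≈-trans (pw-+ T l (suc k)) (≈-trans (reflexive (≡.cong (pw T) (≡.trans (ℕP.+-suc l k) (ℕP.+-comm (suc l) k)))) (≈-sym (pw-+ T k (suc l)))))) (*-assoc _ _ _))) ⟩
          z * (sgn (suc k) * (pw T k * (pw T (suc l) * h))) ≈⟨ *-congˡ (*-congˡ (≈-trans (*-congˡ top-zero) (zeroʳ _))) ⟩
          z * (sgn (suc k) * 0#) ≈⟨ ≈-trans (*-congˡ (zeroʳ _)) (zeroʳ z) ⟩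
          0# ∎
          where l = length ys

    module Weyl {I : Set} (x : I → Carrier) (c : Carrier) where

      Δ : List I → Carrier
      Δ [] = 1#
      Δ (m ∷ vs) = (c * x m * ∏ (map (λ i → x i * x i) vs) (λ y → x m * x m + - y)) * Δ vs

      M K : List I → Carrier
      M [] = 1#
      M (m ∷ vs) = x m * (pw (x m * x m) (length vs) * M vs)
      K [] = 1#
      K (m ∷ vs) = (c * nat (suc (length vs))) * K vs

      -- The roots whose larger index is m act as c (l + 1) x_m^(2l+1), where l is the number of
      -- remaining indices, by `∏-peel`; `e-next` supplies the hypothesis for the rest. The scalar
      -- factors are collected in `K`.
      Δ-M : ∀ ms h → (∀ k → e (suc k) (map (λ i → x i * x i) ms) * h ≈ 0#) → Δ ms * h ≈ K ms * (M ms * h)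
      Δ-M [] h rel = ≈-trans (*-identityˡ h) (≈-sym (≈-trans (*-identityˡ _) (*-identityˡ h)))
      Δ-M (m ∷ vs) h rel = begin
        (c * x m * Pm) * Δ vs * h ≈⟨ shuffle₁ c (x m) Pm (Δ vs) h ⟩
        c * (x m * (Δ vs * (Pm * h))) ≈⟨ *-congˡ (*-congˡ (*-congˡ (≈-trans (∏-peel ys h rel) (*-congʳ (reflexive (≡.cong (λ z → nat (suc z)) len-ys)))))) ⟩
        c * (x m * (Δ vs * (nat (suc (length vs)) * (pw T (length ys) * h)))) ≈⟨ shuffle₂ c (x m) (Δ vs) (nat (suc (length vs))) (pw T (length ys) * h) ⟩
        (c * nat (suc (length vs))) * (Δ vs * (x m * (pw T (length ys) * h))) ≈⟨ *-congˡ (Δ-M vs _ (e-next ys h rel (x m))) ⟩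
        (c * nat (suc (length vs))) * (K vs * (M vs * (x m * (pw T (length ys) * h)))) ≈⟨ *-congˡ (*-congˡ (*-congˡ (*-congˡ (*-congʳ (reflexive (≡.cong (pw T) len-ys)))))) ⟩
        (c * nat (suc (length vs))) * (K vs * (M vs * (x m * (pw T (length vs) * h)))) ≈⟨ shuffle₃ (c * nat (suc (length vs))) (K vs) (M vs) (x m) (pw T (length vs)) h ⟩
        K (m ∷ vs) * (M (m ∷ vs) * h) ∎
        where
        T = x m * x m
        open Peel T
        ys = map (λ i → x i * x i) vs
        Pm = ∏ ys (λ y → T + - y)
        len-ys : length ys ≡ length vs
        len-ys = ListP.length-map (λ i → x i * x i) vs
        shuffle₁ : ∀ c x P D h → (c * x * P) * D * h ≈ c * (x * (D * (P * h)))
        shuffle₁ = CM.solve 5 (λ c x P D h → ((((c CM.⊕ x) CM.⊕ P) CM.⊕ D) CM.⊕ h) CM.⊜ (c CM.⊕ (x CM.⊕ (D CM.⊕ (P CM.⊕ h))))) ≈-refl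
        shuffle₂ : ∀ c x D n h → c * (x * (D * (n * h))) ≈ (c * n) * (D * (x * h))
        shuffle₂ = CM.solve 5 (λ c x D n h → (c CM.⊕ (x CM.⊕ (D CM.⊕ (n CM.⊕ h)))) CM.⊜ ((c CM.⊕ n) CM.⊕ (D CM.⊕ (x CM.⊕ h)))) ≈-refl
        shuffle₃ : ∀ a k m x p h → a * (k * (m * (x * (p * h)))) ≈ (a * k) * ((x * (p * m)) * h)
        shuffle₃ = CM.solve 6 (λ a k m x p h → (a CM.⊕ (k CM.⊕ (m CM.⊕ (x CM.⊕ (p CM.⊕ h))))) CM.⊜ ((a CM.⊕ k) CM.⊕ ((x CM.⊕ (p CM.⊕ m)) CM.⊕ h))) ≈-refl

      module _ (_<_ : I → I → Set) (B : I → I → Carrier)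
               (B-< : ∀ i j → i < j → B i j ≈ x j * x j + - (x i * x i)) (B-≮ : ∀ i j → ¬ (i < j) → B i j ≈ 1#)
               (irr : ∀ i → ¬ (i < i)) (asym : ∀ i j → i < j → ¬ (j < i)) where

        DP : List I → Carrier
        DP vs = ∏ vs (λ i → ∏ vs (B i))

        -- In a descending list the head m is larger than all others, so B m i is trivial for every
        -- i, and m adds only the factors B i m = x_m² - x_i².
        DP-Δ : ∀ vs → AllPairs (λ m i → i < m) vs → DP vs * ∏ vs (λ i → c * x i) ≈ Δ vs
        DP-Δ [] [] = *-identityˡ 1#
        DP-Δ (m ∷ vs) (p ∷ ps) = begin
          ((B m m * ∏ vs (B m)) * ∏ vs (λ i → B i m * ∏ vs (B i))) * (c * x m * ∏ vs (λ i → c * x i))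
            ≈⟨ *-congʳ (*-cong (≈-trans (*-cong (B-≮ m m (irr m)) (∏-one vs (ones vs p))) (*-identityˡ 1#)) (≈-trans (∏-* vs (λ i → B i m) (λ i → ∏ vs (B i))) (*-congʳ (≈-trans (∏-congAll vs (facs vs p)) (≈-sym (∏-map vs)))))) ⟩
          (1# * (Pm * DP vs)) * (c * x m * ∏ vs (λ i → c * x i)) ≈⟨ shuffle Pm (DP vs) (c * x m) (∏ vs (λ i → c * x i)) ⟩
          (c * x m * Pm) * (DP vs * ∏ vs (λ i → c * x i)) ≈⟨ *-congˡ (DP-Δ vs ps) ⟩
          Δ (m ∷ vs) ∎
          where
          Pm = ∏ (map (λ i → x i * x i) vs) (λ y → x m * x m + - y)
          shuffle : ∀ p d a b → (1# * (p * d)) * (a * b) ≈ (a * p) * (d * b)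
          shuffle = CM.solve 4 (λ p d a b → ((CM.id CM.⊕ (p CM.⊕ d)) CM.⊕ (a CM.⊕ b)) CM.⊜ ((a CM.⊕ p) CM.⊕ (d CM.⊕ b))) ≈-refl
          ones : ∀ vs → All (λ i → i < m) vs → All (λ j → B m j ≈ 1#) vs
          ones [] [] = []
          ones (i ∷ vs) (q ∷ qs) = B-≮ m i (asym i m q) ∷ ones vs qs
          facs : ∀ vs → All (λ i → i < m) vs → All (λ i → B i m ≈ x m * x m + - (x i * x i)) vs
          facs [] [] = []
          facs (i ∷ vs) (q ∷ qs) = B-< i m q ∷ facs vs qs
          ∏-map : ∀ vs → ∏ (map (λ i → x i * x i) vs) (λ y → x m * x m + - y) ≈ ∏ vs (λ i → x m * x m + - (x i * x i))
          ∏-map [] = ≈-refl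
          ∏-map (i ∷ vs) = *-congˡ (∏-map vs)

      roots-product : (_<_ : I → I → Set) (lr : I → I → List Carrier) (sr : I → Carrier) →
        (∀ i j → i < j → prod (lr i j) ≈ x j * x j + - (x i * x i)) → (∀ i j → ¬ (i < j) → prod (lr i j) ≈ 1#) →
        (∀ i → ¬ (i < i)) → (∀ i j → i < j → ¬ (j < i)) → (∀ i → sr i ≈ c * x i) →
        ∀ as ds → ds ↭ as → AllPairs (λ m i → i < m) ds →
        prod (concatMap (λ i → concatMap (lr i) as) as ++ map sr as) ≈ Δ ds
      roots-product _<_ lr sr b< b≮ irr asym sr≈ as ds p sorted = begin
        prod (concatMap (λ i → concatMap (lr i) as) as ++ map sr as)
          ≈⟨ prod-++ (concatMap (λ i → concatMap (lr i) as) as) (map sr as) ⟩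
        prod (concatMap (λ i → concatMap (lr i) as) as) * prod (map sr as)
          ≈⟨ *-cong (≈-trans (prod-concatMap _ as) (∏-cong as (λ i → prod-concatMap (lr i) as))) (≈-trans (prod-map sr as) (∏-cong as sr≈)) ⟩
        ∏ as (λ i → ∏ as (λ j → prod (lr i j))) * ∏ as (λ i → c * x i)
          ≈⟨ *-cong (≈-trans (∏-cong as (λ i → ≈-sym (∏-↭ (λ j → prod (lr i j)) p))) (≈-sym (∏-↭ (λ i → ∏ ds (λ j → prod (lr i j))) p))) (≈-sym (∏-↭ (λ i → c * x i) p)) ⟩
        ∏ ds (λ i → ∏ ds (λ j → prod (lr i j))) * ∏ ds (λ i → c * x i)
          ≈⟨ DP-Δ _<_ (λ i j → prod (lr i j)) b< b≮ irr asym ds sorted ⟩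
        Δ ds ∎

-- The top class as a multiple of a monomial.

module TopMonomials where

  open SignedIndices
  open ChevalleyOperators
  open SimpleReflections
  open PolynomialAction
  open InvariantIdeal
  open RootProducts
  open RationalField
  import Algebra.Bundles
  open import Tactic.RingSolver using (solve-∀)
  open ℚSum

  natq : ℕ → ℚ
  natq zero = 0#
  natq (suc k) = 1# + natq k

  shortCoeff : RootType → ℚ
  shortCoeff typeB = ℚ.1ℚ
  shortCoeff typeC = ℚ.1ℚ ℚ.+ ℚ.1ℚ

  invOrder-positive : (l : List ℕ) → ℚ.Positive (foldr (λ k r → (+ 1 ℚ./ 2) ℚ.* (+ 1 ℚ./ suc k) ℚ.* r) ℚ.1ℚ l)
  invOrder-positive [] = _
  invOrder-positive (k ∷ l) = ℚP.pos*pos⇒pos ((+ 1 ℚ./ 2) ℚ.* (+ 1 ℚ./ suc k)) {{ℚP.pos*pos⇒pos (+ 1 ℚ./ 2) (+ 1 ℚ./ suc k) {{ℚP.normalize-pos 1 (suc k)}}}}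
    (foldr (λ k r → (+ 1 ℚ./ 2) ℚ.* (+ 1 ℚ./ suc k) ℚ.* r) ℚ.1ℚ l) {{invOrder-positive l}}

  opaque
    unfolding _+_

    natq-nonneg : ∀ k → 0# ℚ.≤ natq k
    natq-nonneg zero = ℚP.≤-refl
    natq-nonneg (suc k) = ℚP.+-mono-≤ {0#} {1#} (ℚP.nonNegative⁻¹ 1#) (natq-nonneg k)

    natq≢0 : ∀ k → natq (suc k) ≢ 0#
    natq≢0 k e = ℚP.<-irrefl (sym e) (ℚP.+-mono-<-≤ {0#} {1#} (ℚP.positive⁻¹ 1#) (natq-nonneg k))

    shortCoeff≢0 : ∀ t → shortCoeff t ≢ 0#
    shortCoeff≢0 typeB ()
    shortCoeff≢0 typeC ()

    invOrderW≢0 : ∀ N → invOrderW N ≢ 0#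
    invOrderW≢0 N e = ℚP.<-irrefl (sym e) (ℚP.positive⁻¹ (invOrderW N) {{invOrder-positive (upTo N)}})

    *-+1 : ∀ q x → x + q * x ≡ (1# + q) * x
    *-+1 = solve-∀ ring

  *-≢0 : ∀ {x y} → x ≢ 0# → y ≢ 0# → x * y ≢ 0#
  *-≢0 {x} {y} p q e = q (*-cancelˡ x p (trans e (sym (zeroʳ x))))

  shortRoot : RootType → ∀ {N} → Fin N → Poly N
  shortRoot typeB i = varP i
  shortRoot typeC i = scaleP (ℚ.1ℚ ℚ.+ ℚ.1ℚ) (varP i)

  longRoots : ∀ {N} → Fin N → Fin N → List (Poly N)
  longRoots i j = if does (toℕ i ℕ.<? toℕ j) then ((varP j -ᴾ varP i) ∷ (varP i +ᴾ varP j) ∷ []) else []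

  positiveRoots-split : ∀ t N → positiveRoots t N ≡ concatMap (λ i → concatMap (longRoots i) (allFin N)) (allFin N) ++ map (shortRoot t) (allFin N)
  positiveRoots-split typeB N = refl
  positiveRoots-split typeC N = refl

  module TopMonomial (ty : RootType) {n : ℕ} where
    open Ideal ty {n} public

    private
      N = suc n
      S = SI N

    ι : ℕ → Fin N
    ι i with i ℕ.<? N
    ... | yes p = fromℕ< p
    ... | no _  = zero

    toℕ-ι : ∀ {i} → i ℕ.< N → toℕ (ι i) ≡ i
    toℕ-ι {i} p with i ℕ.<? N
    ... | yes q = FinP.toℕ-fromℕ< q
    ... | no ¬p = ⊥-elim (¬p p)

    desc : ℕ → List (Fin N)
    desc zero = []
    desc (suc k) = ι k ∷ desc k

    length-desc : ∀ k → length (desc k) ≡ k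
    length-desc zero = refl
    length-desc (suc k) = cong suc (length-desc k)

    desc-below : ∀ k → k ℕ.≤ N → All (λ i → toℕ i ℕ.< k) (desc k)
    desc-below zero p = []
    desc-below (suc k) p = ℕP.≤-reflexive (cong suc (toℕ-ι p)) ∷ All.map ℕP.m≤n⇒m≤1+n (desc-below k (ℕP.<⇒≤ p))

    desc-sorted : ∀ k → k ℕ.≤ N → AllPairs (λ m i → toℕ i ℕ.< toℕ m) (desc k)
    desc-sorted zero p = []
    desc-sorted (suc k) p = All.map (λ q → subst (_ ℕ.<_) (sym (toℕ-ι p)) q) (desc-below k (ℕP.<⇒≤ p)) ∷ desc-sorted k (ℕP.<⇒≤ p)

    ∈-desc : ∀ k → k ℕ.≤ N → ∀ i → toℕ i ℕ.< k → i ∈ desc k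
    ∈-desc (suc k) p i (s≤s q) with ℕP.m≤n⇒m<n∨m≡n q
    ... | inj₁ r = there (∈-desc k (ℕP.<⇒≤ p) i r)
    ... | inj₂ r = here (FinP.toℕ-injective (trans r (sym (toℕ-ι p))))

    desc-↭ : desc N ↭ allFin N
    desc-↭ = ∼bag⇒↭ (unique∧set⇒bag (AllPairs.map (λ q e → ℕP.<-irrefl (cong toℕ (sym e)) q) (desc-sorted N ℕP.≤-refl)) (UniqueP.allFin⁺ N)
      (λ {i} → mk⇔ (λ _ → ∈-allFin i) (λ _ → ∈-desc N ℕP.≤-refl i (FinP.toℕ<n i))))

    module P𝟙 = Products (polyRing 𝟙)
    open P𝟙 using (nat; pw; diff-squares)
    open P𝟙.Weyl {Fin N} varP (constP (shortCoeff ty)) public using (Δ; M; K; Δ-M; roots-product)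

    shortRoot-act : ∀ i h → act (shortRoot ty i) h ≐ act (constP (shortCoeff ty) *ᴾ varP i) h
    shortRoot-act i h w v = trans (lemma ty) (sym (trans (ev-* pos (constP (shortCoeff ty)) (varP i) h w v) (ev-const pos (shortCoeff ty) (act (varP i) h) w v)))
      where
      lemma : ∀ t → act (shortRoot t i) h w ≡ shortCoeff t * act (varP i) h w
      lemma typeB = sym (trans (cong (_* act (varP i) h w) (sym 1#-def)) (one-* _))
      lemma typeC = ev-scale pos (ℚ.1ℚ ℚ.+ ℚ.1ℚ) (varP i) h w

    B : Fin N → Fin N → Poly N
    B i j = prodP (longRoots i j)

    B-< : ∀ i j → toℕ i ℕ.< toℕ j → act (B i j) 𝟙 ≐ act (varP j *ᴾ varP j -ᴾ varP i *ᴾ varP i) 𝟙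
    B-< i j p = subst (λ b → act (prodP (if b then ((varP j -ᴾ varP i) ∷ (varP i +ᴾ varP j) ∷ []) else [])) 𝟙 ≐ act (varP j *ᴾ varP j -ᴾ varP i *ᴾ varP i) 𝟙)
      (sym (dec-true (toℕ i ℕ.<? toℕ j) p)) (diff-squares (varP j) (varP i))

    B-≮ : ∀ i j → ¬ (toℕ i ℕ.< toℕ j) → act (B i j) 𝟙 ≐ act (constP ℚ.1ℚ) 𝟙
    B-≮ i j p = subst (λ b → act (prodP (if b then ((varP j -ᴾ varP i) ∷ (varP i +ᴾ varP j) ∷ []) else [])) 𝟙 ≐ act (constP ℚ.1ℚ) 𝟙)
      (sym (dec-false (toℕ i ℕ.<? toℕ j) p)) ≐-refl

    roots-Δ : act (prodP (positiveRoots ty N)) 𝟙 ≐ act (Δ (desc N)) 𝟙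
    roots-Δ = ≐-trans (λ w v → cong (λ l → act (prodP l) 𝟙 w) (positiveRoots-split ty N))
      (roots-product (λ i j → toℕ i ℕ.< toℕ j) longRoots (shortRoot ty) B-< B-≮ (λ i → ℕP.<-irrefl refl) (λ i j → ℕP.<-asym)
        (λ i → shortRoot-act i 𝟙) (allFin N) (desc N) desc-↭ (desc-sorted N ℕP.≤-refl))

    Scalar : Poly N → Set
    Scalar f = Σ ℚ λ q → q ≢ 0# × (∀ h → act f h ≐ q ⊙ h)

    const-Scalar : ∀ c → c ≢ 0# → Scalar (constP c)
    const-Scalar c ne = c , ne , ev-const pos c

    *-Scalar : ∀ f g → Scalar f → Scalar g → Scalar (f *ᴾ g)
    *-Scalar f g (p , p≢ , pa) (q , q≢ , qa) = p * q , *-≢0 p≢ q≢ , λ h w v → trans (ev-* pos f g h w v) (trans (pa (act g h) w v) (trans (cong (p *_) (qa h w v)) (sym (*-assoc p q (h w)))))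

    nat-act : ∀ k h → act (nat k) h ≐ natq k ⊙ h
    nat-act zero h w v = sym (zeroˡ _)
    nat-act (suc k) h w v = trans (ev-++ pos (constP ℚ.1ℚ) (nat k) h w) (trans (cong₂ _+_ (ev-one pos h w v) (nat-act k h w v)) (*-+1 (natq k) (h w)))

    K-Scalar : ∀ vs → Scalar (K vs)
    K-Scalar [] = const-Scalar ℚ.1ℚ (λ e → 1≢0 (trans 1#-def e))
    K-Scalar (m ∷ vs) = *-Scalar (constP (shortCoeff ty) *ᴾ nat (suc (length vs))) (K vs)
      (*-Scalar (constP (shortCoeff ty)) (nat (suc (length vs))) (const-Scalar (shortCoeff ty) (shortCoeff≢0 ty)) (natq (suc (length vs)) , natq≢0 (length vs) , nat-act (suc (length vs)))) (K-Scalar vs)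

    -- M (desc N) is the monomial x₁ x₂³ x₃⁵ ⋯.
    top-monomial : Σ ℚ λ q → q ≢ 0# × (act (topClass ty N) 𝟙 ≐ q ⊙ act (M (desc N)) 𝟙)
    top-monomial = invOrderW N * proj₁ k , *-≢0 (invOrderW≢0 N) (proj₁ (proj₂ k)) , λ w v →
      trans (ev-scale pos (invOrderW N) (prodP (positiveRoots ty N)) 𝟙 w)
        (trans (cong (invOrderW N *_) (trans (roots-Δ w v) (trans (sym (Rg.*-identityʳ (Δ (desc N)) w v)) (trans (Δ-M (desc N) (constP ℚ.1ℚ) rel w v)
          (trans (ev-* pos (K (desc N)) (M (desc N) *ᴾ constP ℚ.1ℚ) 𝟙 w v) (trans (proj₂ (proj₂ k) _ w v) (cong (proj₁ k *_) (Rg.*-identityʳ (M (desc N)) w v))))))))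
          (sym (*-assoc (invOrderW N) (proj₁ k) _)))
      where
      module Rg = Algebra.Bundles.CommutativeRing (polyRing 𝟙)
      k = K-Scalar (desc N)
      rel : ∀ j → act (e (suc j) (map sq (desc N)) *ᴾ constP ℚ.1ℚ) 𝟙 ≐ act [] 𝟙
      rel j = ≐-trans (Rg.*-identityʳ (e (suc j) (map sq (desc N)))) (≐-trans (e-↭ (suc j) (map⁺ sq desc-↭))
        (≐-trans (λ w v → cong (λ f → act f 𝟙 w) (sym (esym-e (suc j) squares))) (esym-𝟙 j)))

    act-pw : ∀ i k h → act (pw (varP i *ᴾ varP i) k) h ≐ pow (pos i) (k ℕ.+ k) h
    act-pw i zero h = ev-one pos h
    act-pw i (suc k) h = ≐-trans (ev-* pos (varP i *ᴾ varP i) (pw (varP i *ᴾ varP i) k) h) (≐-trans (ev-sq pos i _)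
      (≐-trans (X-cong (pos i) (X-cong (pos i) (act-pw i k h))) (λ w v → cong (λ j → X (pos i) (pow (pos i) j h) w) (sym (ℕP.+-suc k k)))))

    act-M : ∀ k → act (M (desc (suc k))) 𝟙 ≐ pow (pos (ι k)) (suc (k ℕ.+ k)) (act (M (desc k)) 𝟙)
    act-M k = ≐-trans (ev-* pos (varP (ι k)) (pw (varP (ι k) *ᴾ varP (ι k)) (length (desc k)) *ᴾ M (desc k)) 𝟙) (≐-trans (ev-var pos (ι k) _) (X-cong (pos (ι k))
      (≐-trans (ev-* pos (pw (varP (ι k) *ᴾ varP (ι k)) (length (desc k))) (M (desc k)) 𝟙)
      (≐-trans (act-pw (ι k) (length (desc k)) _) (λ w v → cong (λ j → pow (pos (ι k)) (j ℕ.+ j) (act (M (desc k)) 𝟙) w) (length-desc k))))))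

-- Divided differences carrying the top monomial to a constant.

module TopClasses where

  open SignedIndices
  open SignedPermutations
  open ChevalleyOperators
  open SimpleReflections
  open PolynomialAction
  open DividedDifferences
  open InvariantIdeal
  open TopMonomials
  open RationalField
  open import Tactic.RingSolver using (solve-∀)
  open ℚSum

  opaque
    unfolding _+_

    1+extra≢0 : ∀ t → 1# + extra t ≢ 0#
    1+extra≢0 typeB ()
    1+extra≢0 typeC ()

    hs-step : ∀ c x y → 0# + (c * x + c * y) ≡ c * (y + x)
    hs-step = solve-∀ ring

    hs-base : ∀ c x → 0# + (0# + c * x) ≡ c * x
    hs-base = solve-∀ ring

  module TopClass (ty : RootType) {n : ℕ} where
    open TopMonomial ty {n} public

    private
      N = suc n
      S = SI N

    -- Complete symmetric polynomials of signed variables, applied to 𝟙.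
    hs : ℕ → List S → H
    hs zero    A       = 𝟙
    hs (suc k) []      = 𝟘
    hs (suc k) (a ∷ A) = hs (suc k) A ⊕ X a (hs k (a ∷ A))

    hs-single : ∀ k a → hs k (a ∷ []) ≐ pow a k 𝟙
    hs-single zero a = ≐-refl
    hs-single (suc k) a w v = trans (+-identityˡ _) (X-cong a (hs-single k a) w v)

    Killed : Simple {N} → List S → Set
    Killed s A = ∀ k → D s (hs k A) ≐ 𝟘

    killed-[] : ∀ s → Killed s []
    killed-[] s zero = D-𝟙 s
    killed-[] s (suc k) = D-𝟘 s

    killed-fixed : ∀ s {b A} → refl-of s b ≡ b → Killed s A → Killed s (b ∷ A)
    killed-fixed s fx z zero = D-𝟙 s
    killed-fixed s {b} {A} fx z (suc k) w v = trans (D-⊕ s (hs (suc k) A) (X b (hs k (b ∷ A))) w)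
      (trans (cong₂ _+_ (z (suc k) w v) (trans (D-X-fixed s b fx (hs k (b ∷ A)) w v) (trans (X-cong b (killed-fixed s fx z k) w v) (Linear-𝟘 (X-Linear b) w v)))) (+-identityˡ 0#))

    -- In generating series h(a, A) = h(A)/(1 - a z). The divided difference of 1/(1 - a z) is c
    -- z/((1 - τ a z)(1 - a z)) with c = ∂_s(a), while D s passes over h(A).
    D-hs : ∀ s a {A} → Killed s A → ∀ k → D s (hs (suc k) (a ∷ A)) ≐ coroot s a ⊙ hs k (refl-of s a ∷ a ∷ A)
    D-hs s a {A} z zero w v = trans (D-⊕ s (hs 1 A) (X a 𝟙) w)
      (trans (cong₂ _+_ (z 1 w v) (trans (D-X s a 𝟙 w v) (cong (_+ coroot s a * 𝟙 w) (trans (X-cong (refl-of s a) (D-𝟙 s) w v) (Linear-𝟘 (X-Linear (refl-of s a)) w v))))) (hs-base _ _))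
    D-hs s a {A} z (suc k) w v = trans (D-⊕ s (hs (suc (suc k)) A) (X a (hs (suc k) (a ∷ A))) w)
      (trans (cong₂ _+_ (z (suc (suc k)) w v) (trans (D-X s a (hs (suc k) (a ∷ A)) w v)
         (cong (_+ coroot s a * hs (suc k) (a ∷ A) w) (trans (X-cong (refl-of s a) (D-hs s a z k) w v) (X-⊙ (refl-of s a) (coroot s a) _ w)))))
       (hs-step (coroot s a) _ _))

    -- The vector is itself a divided difference up to the nonzero factor `coroot s a`, and D s
    -- applied twice is 0.
    killed-pair : ∀ s a {A} → coroot s a ≢ 0# → Killed s A → Killed s (refl-of s a ∷ a ∷ A)
    killed-pair s a {A} c≢0 z k w v = *-cancelˡ (coroot s a) c≢0 (trans (sym (D-⊙ s (coroot s a) (hs k (refl-of s a ∷ a ∷ A)) w))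
      (trans (sym (D-cong s (D-hs s a z k) w v)) (trans (D-D s (hs (suc k) (a ∷ A)) w v) (sym (zeroʳ _)))))

    D* : List (Simple {N}) → H → H
    D* [] g = g
    D* (s ∷ ω) g = D* ω (D s g)

    D*-cong : ∀ ω {g g′} → g ≐ g′ → D* ω g ≐ D* ω g′
    D*-cong [] e = e
    D*-cong (s ∷ ω) e = D*-cong ω (D-cong s e)

    D*-⊙ : ∀ ω c g → D* ω (c ⊙ g) ≐ c ⊙ D* ω g
    D*-⊙ [] c g = ≐-refl
    D*-⊙ (s ∷ ω) c g = ≐-trans (D*-cong ω (λ w v → D-⊙ s c g w)) (D*-⊙ ω c (D s g))

    D*-++ : ∀ ω ω′ g → D* (ω ++ ω′) g ≡ D* ω′ (D* ω g)
    D*-++ [] ω′ g = refl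
    D*-++ (s ∷ ω) ω′ g = D*-++ ω ω′ (D s g)

    Below : ℕ → Simple {N} → Set
    Below k s = ∀ j → k ℕ.≤ toℕ j → refl-of s (pos j) ≡ pos j

    D*-pow : ∀ {k} ω → All (Below k) ω → ∀ j → k ℕ.≤ toℕ j → ∀ m g → D* ω (pow (pos j) m g) ≐ pow (pos j) m (D* ω g)
    D*-pow [] [] j p m g = ≐-refl
    D*-pow (s ∷ ω) (b ∷ bs) j p m g = ≐-trans (D*-cong ω (D-pow-fixed s (pos j) (b j p) m g)) (D*-pow ω bs j p m (D s g))

    -- Witness that g is nonzero: a word of divided differences taking it to a nonzero multiple of
    -- `𝟙`. The letters fix the positions from k on, so the corresponding variables pass through as
    -- constants.
    record Reach (k : ℕ) (g : H) : Set where
      field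
        word  : List (Simple {N})
        below : All (Below k) word
        value : ℚ
        ≢0    : value ≢ 0#
        eq    : D* word g ≐ value ⊙ 𝟙
    open Reach

    reach-𝟙 : ∀ k → Reach k 𝟙
    reach-𝟙 k = record { word = [] ; below = [] ; value = 1# ; ≢0 = 1≢0 ; eq = λ w v → sym (one-* _) }

    reach-cong : ∀ {k g g′} → g ≐ g′ → Reach k g′ → Reach k g
    reach-cong e r = record { word = r .word ; below = r .below ; value = r .value ; ≢0 = r .≢0 ; eq = ≐-trans (D*-cong (r .word) e) (r .eq) }

    reach-D : ∀ {k g g′} s c → Below k s → c ≢ 0# → D s g ≐ c ⊙ g′ → Reach k g′ → Reach k g
    reach-D {g = g} {g′} s c b c≢0 e r = record { word = s ∷ r .word ; below = b ∷ r .below ; value = c * r .value ; ≢0 = *-≢0 c≢0 (r .≢0)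
      ; eq = ≐-trans (D*-cong (r .word) e) (≐-trans (D*-⊙ (r .word) c g′) (λ w v → trans (cong (c *_) (r .eq w v)) (sym (*-assoc c (r .value) (𝟙 w))))) }

    reach-pow : ∀ {k g} j m → k ℕ.≤ toℕ j → Reach k g → Reach (suc k) (pow (pos j) m 𝟙) → Reach (suc k) (pow (pos j) m g)
    reach-pow {k} {g} j m p r r′ = record { word = r .word ++ r′ .word ; below = AllP.++⁺ (All.map (λ b i q → b i (ℕP.<⇒≤ q)) (r .below)) (r′ .below)
      ; value = r .value * r′ .value ; ≢0 = *-≢0 (r .≢0) (r′ .≢0)
      ; eq = λ w v → trans (cong (λ z → z w) (D*-++ (r .word) (r′ .word) _))
          (trans (D*-cong (r′ .word) (≐-trans (D*-pow (r .word) (r .below) j p m g) (≐-trans (pow-Linear (pos j) m .≐-cong (r .eq)) (pow-Linear (pos j) m .⊙-hom (r .value) 𝟙))) w v)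
            (trans (D*-⊙ (r′ .word) (r .value) _ w v) (trans (cong (r .value *_) (r′ .eq w v)) (sym (*-assoc (r .value) (r′ .value) (𝟙 w)))))) }

    ι-injective : ∀ {i j} → i ℕ.< N → j ℕ.< N → ι i ≡ ι j → i ≡ j
    ι-injective p q e = trans (sym (toℕ-ι p)) (trans (cong toℕ e) (toℕ-ι q))

    module Sw (i : ℕ) (p : suc i ℕ.< N) where
      i<N : i ℕ.< N
      i<N = ℕP.<-trans (ℕP.n<1+n i) p

      adjacent : toℕ (ι (suc i)) ≡ suc (toℕ (ι i))
      adjacent = trans (toℕ-ι p) (cong suc (sym (toℕ-ι i<N)))

      sw : Simple {N}
      sw = sᵢ (ι i) (ι (suc i)) adjacent

      fixed : ∀ j → j ℕ.< N → j ≢ i → j ≢ suc i → refl-of sw (pos (ι j)) ≡ pos (ι j)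
      fixed j q ne ne′ = t-f (pos (ι i)) (pos (ι (suc i))) (λ e → ne (ι-injective q i<N (pos-injective e))) (λ e → ne′ (ι-injective q p (pos-injective e))) (λ ()) (λ ())

      fixed-neg : ∀ j → j ℕ.< N → j ≢ i → j ≢ suc i → refl-of sw (neg (ι j)) ≡ neg (ι j)
      fixed-neg j q ne ne′ = trans (t-odd (lo sw) (hi sw) (pos (ι j))) (cong opp (fixed j q ne ne′))

      below-sw : ∀ {k} → suc i ℕ.< k → Below k sw
      below-sw q j r = t-f (pos (ι i)) (pos (ι (suc i)))
        (λ e → ℕP.<⇒≢ (ℕP.<-≤-trans (ℕP.<-trans (ℕP.n<1+n i) q) r) (sym (trans (cong toℕ (pos-injective e)) (toℕ-ι i<N))))
        (λ e → ℕP.<⇒≢ (ℕP.<-≤-trans q r) (sym (trans (cong toℕ (pos-injective e)) (toℕ-ι p)))) (λ ()) (λ ())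

      c-hi : coroot sw (pos (ι (suc i))) ≡ 1#
      c-hi = coroot-hi (ι i) (ι (suc i)) adjacent

      c-neg : coroot sw (neg (ι i)) ≡ 1#
      c-neg = trans (coroot-opp sw (pos (ι i))) (trans (cong -_ (coroot-lo (ι i) (ι (suc i)) adjacent)) (neg-neg 1#))

      c≢0 : ∀ {c} → c ≡ 1# → c ≢ 0#
      c≢0 e z = 1≢0 (trans (sym e) z)

    posL : ℕ → ℕ → List S
    posL j zero = []
    posL j (suc l) = pos (ι j) ∷ posL (suc j) l

    negL : ℕ → List S → List S
    negL zero A = A
    negL (suc i) A = neg (ι i) ∷ negL i A

    killed-above : ∀ s j l → (∀ r → j ℕ.≤ r → r ℕ.< j ℕ.+ l → refl-of s (pos (ι r)) ≡ pos (ι r)) → Killed s (posL j l)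
    killed-above s j zero f = killed-[] s
    killed-above s j (suc l) f = killed-fixed s (f j ℕP.≤-refl (subst (j ℕ.<_) (sym (ℕP.+-suc j l)) (s≤s (ℕP.m≤m+n j l))))
      (killed-above s (suc j) l (λ r p q → f r (ℕP.<⇒≤ p) (subst (r ℕ.<_) (sym (ℕP.+-suc j l)) q)))

    -- The list pos j, …, pos (j + d + 1 + l) straddles the pair exchanged by sw (j + d).
    killed-straddle : ∀ d j l (p : suc (j ℕ.+ d) ℕ.< N) → j ℕ.+ (d ℕ.+ suc (suc l)) ℕ.≤ N → Killed (Sw.sw (j ℕ.+ d) p) (posL j (d ℕ.+ suc (suc l)))
    killed-straddle zero j l p q = subst (λ z → Killed s (z ∷ posL (suc j) (suc l))) τhi
        (killed-pair s (pos (ι (suc j))) (subst (λ z → coroot s (pos (ι (suc z))) ≢ 0#) (ℕP.+-identityʳ j) (c≢0 c-hi)) (killed-above s (suc (suc j)) l fix))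
      where
      open Sw (j ℕ.+ 0) p
      s = sw
      τhi : refl-of s (pos (ι (suc j))) ≡ pos (ι j)
      τhi = trans (cong (λ z → refl-of s (pos (ι (suc z)))) (sym (ℕP.+-identityʳ j))) (trans (t-b (pos (ι (j ℕ.+ 0))) (pos (ι (suc (j ℕ.+ 0))))) (cong (λ z → pos (ι z)) (ℕP.+-identityʳ j)))
      fix : ∀ r → suc (suc j) ℕ.≤ r → r ℕ.< suc (suc j) ℕ.+ l → refl-of s (pos (ι r)) ≡ pos (ι r)
      fix r a b = fixed r (ℕP.<-≤-trans b (subst (ℕ._≤ N) (trans (ℕP.+-suc j (suc l)) (cong suc (ℕP.+-suc j l))) q))
        (λ e → ℕP.<⇒≢ (ℕP.<-trans (ℕP.n<1+n j) a) (sym (trans e (ℕP.+-identityʳ j)))) (λ e → ℕP.<⇒≢ a (sym (trans e (cong suc (ℕP.+-identityʳ j)))))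
    killed-straddle (suc d) j l p q = killed-fixed (Sw.sw (j ℕ.+ suc d) p)
        (Sw.fixed (j ℕ.+ suc d) p j (ℕP.≤-<-trans (ℕP.m≤m+n j (suc d)) (ℕP.<-trans (ℕP.n<1+n _) p)) (ℕP.<⇒≢ j<j+) (ℕP.<⇒≢ (ℕP.m≤n⇒m≤1+n j<j+)))
        (rec (ℕP.+-suc j d) p)
      where
      j<j+ : j ℕ.< j ℕ.+ suc d
      j<j+ = subst (j ℕ.<_) (sym (ℕP.+-suc j d)) (s≤s (ℕP.m≤m+n j d))
      rec : ∀ {i} → i ≡ suc j ℕ.+ d → (p : suc i ℕ.< N) → Killed (Sw.sw i p) (posL (suc j) (d ℕ.+ suc (suc l)))
      rec refl p = killed-straddle d (suc j) l p (subst (ℕ._≤ N) (ℕP.+-suc j (d ℕ.+ suc (suc l))) q)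

    killed-negL : ∀ s i {A} → (∀ j → j ℕ.< i → refl-of s (neg (ι j)) ≡ neg (ι j)) → Killed s A → Killed s (negL i A)
    killed-negL s zero f z = z
    killed-negL s (suc i) f z = killed-fixed s (f i ℕP.≤-refl) (killed-negL s i (λ j p → f j (ℕP.m≤n⇒m≤1+n p)) z)

    -- Second half of the word s_m ⋯ s_1 s_0 s_1 ⋯ s_m for the variable x_(m+1): the positive
    -- variables are already complete, and each letter lowers the degree k by one while adjoining
    -- the next negative variable, until the degree is 0.
    chain₂ : ∀ m → m ℕ.< N → ∀ k i → i ℕ.+ k ≡ m → Reach (suc m) (hs k (negL (suc i) (posL 0 (suc m))))
    chain₂ m m<N zero i e = reach-𝟙 (suc m)
    chain₂ m m<N (suc k) i e = reach-D sw 1# (below-sw (s≤s si≤m)) 1≢0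
        (≐-trans (D-hs sw (neg (ι i)) killed k) (λ w v → cong₂ _*_ c-neg (cong (λ z → hs k (z ∷ neg (ι i) ∷ negL i (posL 0 (suc m))) w) τa)))
        (chain₂ m m<N k (suc i) (trans (sym (ℕP.+-suc i k)) e))
      where
      si≤m : suc i ℕ.≤ m
      si≤m = subst (suc i ℕ.≤_) (trans (sym (ℕP.+-suc i k)) e) (ℕP.m≤m+n (suc i) k)
      p : suc i ℕ.< N
      p = ℕP.≤-<-trans si≤m m<N
      open Sw i p
      m≡i+2+k : suc m ≡ i ℕ.+ suc (suc k)
      m≡i+2+k = trans (cong suc (sym e)) (sym (ℕP.+-suc i (suc k)))
      killed : Killed sw (negL i (posL 0 (suc m)))
      killed = killed-negL sw i (λ j q → fixed-neg j (ℕP.<-trans q i<N) (ℕP.<⇒≢ q) (ℕP.<⇒≢ (ℕP.m≤n⇒m≤1+n q)))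
        (subst (λ l → Killed sw (posL 0 l)) (sym m≡i+2+k) (killed-straddle i 0 k p (subst (ℕ._≤ N) m≡i+2+k m<N)))
      τa : refl-of sw (neg (ι i)) ≡ neg (ι (suc i))
      τa = t-oa (pos (ι i)) (pos (ι (suc i)))

    ι-zero : ι 0 ≡ zero
    ι-zero = FinP.toℕ-injective (toℕ-ι (s≤s z≤n))

    -- First half of the word: starting from x_(m+1)^(2m+1), regarded as a complete symmetric
    -- polynomial in one variable, each letter adjoins the neighbouring smaller variable; s₀ then
    -- adjoins -x₁. The 2m + 1 letters use up the degree exactly.
    chain₁ : ∀ m → m ℕ.< N → ∀ i l → i ℕ.+ l ≡ m → Reach (suc m) (hs (suc (m ℕ.+ i)) (posL i (suc l)))
    chain₁ m m<N zero l e = reach-D s₀ (coroot s₀ (pos zero)) below₀ (λ z → 1+extra≢0 ty (trans (sym coroot-s₀) z))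
        (λ w v → trans (cong (λ j → D s₀ (hs (suc (m ℕ.+ 0)) (pos j ∷ posL 1 l)) w) ι-zero) (trans (D-hs s₀ (pos zero) (killed-above s₀ 1 l fix) (m ℕ.+ 0) w v)
           (cong (coroot s₀ (pos zero) *_) (trans (cong₂ (λ a b → hs a (b ∷ pos zero ∷ posL 1 l) w) (ℕP.+-identityʳ m) (t-b (neg zero) (pos zero)))
              (cong (λ j → hs m (neg j ∷ pos j ∷ posL 1 l) w) (sym ι-zero))))))
        (subst (λ z → Reach (suc m) (hs m (negL 1 (posL 0 (suc z))))) (sym e) (chain₂ m m<N m 0 refl))
      where
      below₀ : Below (suc m) s₀
      below₀ (suc j) _ = t-f (neg zero) (pos zero) (λ ()) (λ ()) (λ ()) (λ ())
      below₀ zero ()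
      fix : ∀ r → 1 ℕ.≤ r → r ℕ.< 1 ℕ.+ l → refl-of s₀ (pos (ι r)) ≡ pos (ι r)
      fix r a b = t-f (neg zero) (pos zero) (λ ()) ne ne (λ ())
        where
        r<N : r ℕ.< N
        r<N = ℕP.<-≤-trans b (subst (λ z → suc z ℕ.≤ N) (sym e) m<N)
        ne : pos (ι r) ≢ pos zero
        ne q = ℕP.<⇒≢ a (sym (trans (sym (toℕ-ι r<N)) (cong toℕ (pos-injective q))))
    chain₁ m m<N (suc i) l e = reach-D sw 1# (below-sw (s≤s si≤m)) 1≢0
        (λ w v → trans (cong (λ z → D sw (hs (suc z) (posL (suc i) (suc l))) w) (ℕP.+-suc m i)) (trans (D-hs sw (pos (ι (suc i))) (killed-above sw (suc (suc i)) l fix) (suc (m ℕ.+ i)) w v)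
           (cong₂ _*_ c-hi (cong (λ z → hs (suc (m ℕ.+ i)) (z ∷ pos (ι (suc i)) ∷ posL (suc (suc i)) l) w) (t-b (pos (ι i)) (pos (ι (suc i))))))))
        (chain₁ m m<N i (suc l) (trans (ℕP.+-suc i l) e))
      where
      si≤m : suc i ℕ.≤ m
      si≤m = subst (suc i ℕ.≤_) e (ℕP.m≤m+n (suc i) l)
      p : suc i ℕ.< N
      p = ℕP.≤-<-trans si≤m m<N
      open Sw i p
      fix : ∀ r → suc (suc i) ℕ.≤ r → r ℕ.< suc (suc i) ℕ.+ l → refl-of sw (pos (ι r)) ≡ pos (ι r)
      fix r a b = fixed r (ℕP.<-≤-trans b (subst (λ z → suc z ℕ.≤ N) (sym e) m<N)) (λ q → ℕP.<⇒≢ (ℕP.<-trans (ℕP.n<1+n i) a) (sym q)) (λ q → ℕP.<⇒≢ a (sym q))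

    -- x_(k+1) enters the monomial with exponent 2k + 1. The word for the smaller variables leaves
    -- it untouched, and `chain₁` then disposes of its power.
    reach-M : ∀ k → k ℕ.≤ N → Reach k (act (M (desc k)) 𝟙)
    reach-M zero p = reach-cong (ev-one pos 𝟙) (reach-𝟙 0)
    reach-M (suc k) p = reach-cong (act-M k) (reach-pow (ι k) (suc (k ℕ.+ k)) (ℕP.≤-reflexive (sym (toℕ-ι p))) (reach-M k (ℕP.<⇒≤ p))
      (reach-cong (≐-sym (hs-single (suc (k ℕ.+ k)) (pos (ι k)))) (chain₁ k p k 0 (ℕP.+-identityʳ k))))

    Level : ℕ → H → Set
    Level d g = ∀ w → Valid w → L w ≢ + 2 ℤ.* + d → g w ≡ 0#

    X-Level : ∀ {d} a g → Level d g → Level (suc d) (X a g)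
    X-Level {d} a g lv w v ne = trans (X-def a g w) (sumS-zero (Xterm a g w) term)
      where
      shift : ∀ d → + 2 ℤ.* d ℤ.+ + 2 ≡ + 2 ℤ.* (+ 1 ℤ.+ d)
      shift = ℤSolver.solve-∀
      term : ∀ b → Xterm a g w b ≡ 0#
      term b with L (w · t a b) ℤ.+ + 2 ℤP.≟ L w
      ... | no _ = zero-coeff (κ a b) (sg (ev w a) (ev w b)) (g (w · t a b))
      ... | yes e = trans (cong (κ a b * sg (ev w a) (ev w b) * 1# *_) (lv (w · t a b) (Valid-t a b v) (λ q → ne (trans (sym e) (trans (cong (ℤ._+ + 2) q) (shift (+ d))))))) (zeroʳ _)

    pow-Level : ∀ {d} a k g → Level d g → Level (k ℕ.+ d) (pow a k g)
    pow-Level a zero g lv = lv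
    pow-Level a (suc k) g lv = X-Level a (pow a k g) (pow-Level a k g lv)

    Level-cong : ∀ {d g g′} → g ≐ g′ → Level d g′ → Level d g
    Level-cong e lv w v ne = trans (e w v) (lv w v ne)

    𝟙-Level : Level 0 𝟙
    𝟙-Level w v ne = δ-other (λ e → ne (trans (cong L e) L-idW))

    -- The exponents 1, 3, ..., 2k - 1 add up to k². For k = N this is the maximal length, which
    -- leaves w₀ as the only possible point of the support.
    M-Level : ∀ k → Level (k ℕ.* k) (act (M (desc k)) 𝟙)
    M-Level zero = Level-cong {0} (ev-one pos 𝟙) 𝟙-Level
    M-Level (suc k) = Level-cong {suc k ℕ.* suc k} (act-M k) (subst (λ d → Level d (pow (pos (ι k)) (suc (k ℕ.+ k)) (act (M (desc k)) 𝟙))) (arith k)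
      (pow-Level (pos (ι k)) (suc (k ℕ.+ k)) _ (M-Level k)))
      where
      arith : ∀ k → suc (k ℕ.+ k) ℕ.+ k ℕ.* k ≡ suc k ℕ.* suc k
      arith = ℕSolver.solve-∀

-- The longest element and the point class.

module LongestElement where

  open SignedIndices
  open SignedPermutations
  open ChevalleyOperators
  open SimpleReflections
  open PolynomialAction
  open DividedDifferences
  open InvariantIdeal
  open TopMonomials
  open TopClasses
  open RationalField
  open ℤSum

  sum-ones : ∀ k → sum {k} (λ _ → + 1) ≡ + k
  sum-ones zero = sum-empty _
  sum-ones (suc k) = trans (sum-suc _) (cong (ℤ._+_ (+ 1)) (sum-ones k))

  gap-first : ∀ {n} (f : Fin (suc n) → ℤ) → (∀ j → f (inject₁ j) ℤ.< f (suc j)) → ∀ j → f zero ℤ.+ + toℕ j ℤ.≤ f j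
  gap-first f st zero = ℤP.≤-reflexive (ℤP.+-identityʳ (f zero))
  gap-first {suc n} f st (suc j) = ℤP.≤-trans (ℤP.≤-reflexive (r (f zero) (+ toℕ j)))
    (ℤP.≤-trans (ℤP.+-monoˡ-≤ (+ toℕ j) (ℤP.i<j⇒suc[i]≤j (st zero))) (gap-first (f ∘ suc) (st ∘ suc) j))
    where r : ∀ a b → a ℤ.+ (+ 1 ℤ.+ b) ≡ (+ 1 ℤ.+ a) ℤ.+ b
          r = ℤSolver.solve-∀

  gap-last : ∀ {n} (f : Fin (suc n) → ℤ) → (∀ j → f (inject₁ j) ℤ.< f (suc j)) → ∀ i → f i ℤ.+ (+ n ℤ.- + toℕ i) ℤ.≤ f (fromℕ n)
  gap-last {n} f st zero = ℤP.≤-trans (ℤP.≤-reflexive (cong (ℤ._+_ (f zero)) (trans (ℤP.+-identityʳ (+ n)) (cong +_ (sym (FinP.toℕ-fromℕ n)))))) (gap-first f st (fromℕ n))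
  gap-last {suc n} f st (suc i) = ℤP.≤-trans (ℤP.≤-reflexive (cong (ℤ._+_ (f (suc i))) (r (+ n) (+ toℕ i)))) (gap-last (f ∘ suc) (st ∘ suc) i)
    where r : ∀ a b → (+ 1 ℤ.+ a) ℤ.- (+ 1 ℤ.+ b) ≡ a ℤ.- b
          r = ℤSolver.solve-∀

  module _ {N : ℕ} where
    private
      S = SI N

    sumS-ones : sumS {N} (λ _ → + 1) ≡ + 2 ℤ.* + N
    sumS-ones = trans (sumS-split _) (trans (cong₂ ℤ._+_ (sum-ones N) (sum-ones N)) (r (+ N)))
      where r : ∀ x → x ℤ.+ x ≡ + 2 ℤ.* x
            r = ℤSolver.solve-∀

    sumS-mono : (F G : S → ℤ) → (∀ x → F x ℤ.≤ G x) → sumS F ℤ.≤ sumS G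
    sumS-mono F G p = 0≤m-n (subst (+ 0 ℤ.≤_) (sumS-- G F) (sumS-nonneg _ (λ x → ℤP.i≤j⇒0≤j-i (p x))))

    iv≤1 : {P : Set} (d : Dec P) → iv d ℤ.≤ + 1
    iv≤1 (yes _) = ℤP.≤-refl
    iv≤1 (no _)  = +≤+ z≤n

    Valid-bounded : ∀ {w : W {N}} → Valid w → ∀ y → ∣ ev w y ∣ ℕ.≤ N
    Valid-bounded {w} v y = ℤP.drop‿+≤+ (ℤP.*-cancelˡ-≤-pos (+ ∣ ev w y ∣) (+ N) (+ 2)
      (subst₂ ℤ._≤_ (v .card y) sumS-ones (sumS-mono _ _ (λ x → iv≤1 (∣ ev w x ∣ ℕP.≤? ∣ ev w y ∣)))))

    total : ℤ
    total = sumS² (λ x y → wt {N} x y ℤ.* lt x y)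

    -- Adding the transposed sum counts every ordered pair x ≠ y; the double weight of (x , -x)
    -- compensates the missing diagonal, so twice the total is (2N)².
    total-value : total ≡ + 2 ℤ.* (+ N ℤ.* + N)
    total-value = ℤP.*-cancelˡ-≡ (+ 2) total (+ 2 ℤ.* (+ N ℤ.* + N)) (begin
      + 2 ℤ.* total ≡⟨ r₁ total ⟩
      total ℤ.+ total ≡⟨ cong (ℤ._+_ total) (sumS-comm (λ x y → wt x y ℤ.* lt x y)) ⟩
      total ℤ.+ sumS² (λ x y → wt y x ℤ.* lt y x) ≡⟨ sym (sumS²-+ (λ x y → wt x y ℤ.* lt x y) (λ x y → wt y x ℤ.* lt y x)) ⟩
      sumS² (λ x y → wt x y ℤ.* lt x y ℤ.+ wt y x ℤ.* lt y x) ≡⟨ sumS²-cong pointwise ⟩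
      sumS² (λ x y → + 1 ℤ.+ (iv (y ≟S opp x) ℤ.- iv (y ≟S x))) ≡⟨ sumS-cong row ⟩
      sumS (λ x → + 2 ℤ.* + N) ≡⟨ trans (sumS-cong (λ x → sym (ℤP.*-identityʳ (+ 2 ℤ.* + N)))) (trans (sumS-* (+ 2 ℤ.* + N) (λ _ → + 1)) (cong (+ 2 ℤ.* + N ℤ.*_) sumS-ones)) ⟩
      + 2 ℤ.* + N ℤ.* (+ 2 ℤ.* + N) ≡⟨ r₂ (+ N) ⟩
      + 2 ℤ.* (+ 2 ℤ.* (+ N ℤ.* + N)) ∎)
      where
      open ≡-Reasoning
      r₁ : ∀ x → + 2 ℤ.* x ≡ x ℤ.+ x
      r₁ = ℤSolver.solve-∀
      r₂ : ∀ x → + 2 ℤ.* x ℤ.* (+ 2 ℤ.* x) ≡ + 2 ℤ.* (+ 2 ℤ.* (x ℤ.* x))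
      r₂ = ℤSolver.solve-∀
      one : ∀ c → sumS (λ y → iv (y ≟S c)) ≡ + 1
      one c = trans (sumS-cong (λ x → sym (ℤP.*-identityʳ _))) (sumS-δ c (λ _ → + 1))
      row : ∀ x → sumS (λ y → + 1 ℤ.+ (iv (y ≟S opp x) ℤ.- iv (y ≟S x))) ≡ + 2 ℤ.* + N
      row x = trans (sumS-+ (λ _ → + 1) (λ y → iv (y ≟S opp x) ℤ.- iv (y ≟S x))) (trans (cong₂ ℤ._+_ sumS-ones (trans (sumS-- _ _) (cong₂ ℤ._-_ (one (opp x)) (one x)))) (ℤP.+-identityʳ _))
      wt-sym : ∀ x y → wt y x ≡ wt x y
      wt-sym x y = cong (ℤ._+_ (+ 1)) (iv-cong (x ≟S opp y) (y ≟S opp x) sw sw)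
        where sw : ∀ {u v : S} → u ≡ opp v → v ≡ opp u
              sw {u} {v} e = trans (sym (opp-opp v)) (cong opp (sym e))
      r₃ : ∀ p → (+ 1 ℤ.+ p) ℤ.* + 1 ℤ.+ (+ 1 ℤ.+ p) ℤ.* + 0 ≡ + 1 ℤ.+ (p ℤ.- + 0)
      r₃ = ℤSolver.solve-∀
      r₄ : ∀ p → (+ 1 ℤ.+ p) ℤ.* + 0 ℤ.+ (+ 1 ℤ.+ p) ℤ.* + 1 ≡ + 1 ℤ.+ (p ℤ.- + 0)
      r₄ = ℤSolver.solve-∀
      pointwise : ∀ x y → wt x y ℤ.* lt x y ℤ.+ wt y x ℤ.* lt y x ≡ + 1 ℤ.+ (iv (y ≟S opp x) ℤ.- iv (y ≟S x))
      pointwise x y rewrite wt-sym x y with ℤP.<-cmp (loc x) (loc y)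
      ... | tri< p ne q rewrite iv-yes (loc x ℤ.<? loc y) p | iv-no (loc y ℤ.<? loc x) q | iv-no (y ≟S x) (λ e → ne (cong loc (sym e))) = r₃ (iv (y ≟S opp x))
      ... | tri> p ne q rewrite iv-no (loc x ℤ.<? loc y) p | iv-yes (loc y ℤ.<? loc x) q | iv-no (y ≟S x) (λ e → ne (cong loc (sym e))) = r₄ (iv (y ≟S opp x))
      ... | tri≈ p e q rewrite iv-no (loc x ℤ.<? loc y) p | iv-no (loc y ℤ.<? loc x) q | loc-injective x y e | iv-yes (y ≟S y) refl | iv-no (y ≟S opp y) (λ r → opp-≢ y (sym r)) = refl

    Decreasing : W {N} → Set
    Decreasing w = ∀ x y → loc x ℤ.< loc y → ev w y ℤ.< ev w x

    -- Weight of the non-inversions, that is, what w lacks in `L`. Since every term is nonnegative,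
    -- the sum vanishes only for decreasing w.
    deficit : W {N} → S → S → ℤ
    deficit w x y = wt x y ℤ.* lt x y ℤ.* (+ 1 ℤ.- inv w x y)

    total-L : ∀ w → sumS² (deficit w) ≡ total ℤ.- L w
    total-L w = trans (sumS²-cong (λ x y → r (wt x y ℤ.* lt x y) (inv w x y))) (trans (sumS²-- _ _) (cong (ℤ._-_ total) (sym (L-def w))))
      where r : ∀ a g → a ℤ.* (+ 1 ℤ.- g) ≡ a ℤ.- a ℤ.* g
            r = ℤSolver.solve-∀

    deficit-nonneg : ∀ w x y → + 0 ℤ.≤ deficit w x y
    deficit-nonneg w x y = *-nonneg (*-nonneg (ℤP.<⇒≤ (wt-positive x y)) (iv-nonneg (loc x ℤ.<? loc y))) (ℤP.i≤j⇒0≤j-i (iv≤1 (ev w y ℤ.<? ev w x)))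

    L-bound : ∀ w → L w ℤ.≤ total
    L-bound w = 0≤m-n (subst (+ 0 ℤ.≤_) (total-L w) (sumS-nonneg _ (λ x → sumS-nonneg _ (deficit-nonneg w x))))

    decreasing-max : ∀ w → Decreasing w → L w ≡ total
    decreasing-max w dec = sym (ℤP.i-j≡0⇒i≡j total (L w) (trans (sym (total-L w)) (sumS-zero _ (λ x → sumS-zero _ (λ y → zero-term x y)))))
      where
      zero-term : ∀ x y → deficit w x y ≡ + 0
      zero-term x y with loc x ℤ.<? loc y
      ... | no _ = trans (cong (ℤ._* (+ 1 ℤ.- inv w x y)) (ℤP.*-zeroʳ (wt x y))) (ℤP.*-zeroˡ (+ 1 ℤ.- inv w x y))
      ... | yes p rewrite iv-yes (ev w y ℤ.<? ev w x) (dec x y p) = ℤP.*-zeroʳ (wt x y ℤ.* + 1)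

    max-decreasing : ∀ w → L w ≡ total → Decreasing w
    max-decreasing w e x y p with ev w y ℤ.<? ev w x
    ... | yes q = q
    ... | no q = ⊥-elim (ℤP.<-irrefl (sym (trans (total-L w) (trans (cong (ℤ._-_ total) e) (ℤP.+-inverseʳ total))))
        (sumS-positive _ (λ x → sumS-nonneg _ (deficit-nonneg w x)) x (sumS-positive _ (deficit-nonneg w x) y positive)))
      where
      positive : + 0 ℤ.< deficit w x y
      positive rewrite iv-yes (loc x ℤ.<? loc y) p | iv-no (ev w y ℤ.<? ev w x) q | ℤP.*-identityʳ (wt x y) | ℤP.*-identityʳ (wt x y) = wt-positive x y

  module _ {n : ℕ} where
    private
      N = suc n

    w₀ : W {N}
    w₀ = tabulate (λ i → -[1+ toℕ i ])

    -- Strict monotonicity and the bound N pin down every value.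
    max-unique : ∀ {w : W {N}} → Valid w → L w ≡ total → w ≡ w₀
    max-unique {w} v e = ev-ext (λ { (pos i) → value i ; (neg i) → cong ℤ.-_ (value i) })
      where
      dec = max-decreasing w e
      g : Fin N → ℤ
      g i = ev w (neg i)
      st : ∀ j → g (inject₁ j) ℤ.< g (suc j)
      st j = ℤP.neg-mono-< (dec (pos (inject₁ j)) (pos (suc j)) (+<+ (s≤s (s≤s (ℕP.≤-reflexive (FinP.toℕ-inject₁ j))))))
      g₀ : + 1 ℤ.≤ g zero
      g₀ with ev w (pos zero) | dec (neg zero) (pos zero) -<+
      ... | -[1+ m ] | _ = +≤+ (s≤s z≤n)
      ... | + 0 | +<+ ()
      ... | + suc m | ()
      g-last : g (fromℕ n) ℤ.≤ + N
      g-last = bound (g (fromℕ n)) (subst (ℕ._≤ N) refl (Valid-bounded v (neg (fromℕ n))))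
        where
        bound : ∀ z → ∣ z ∣ ℕ.≤ N → z ℤ.≤ + N
        bound (+ m) p = +≤+ p
        bound -[1+ m ] p = ℤ.-≤+
      lower : ∀ i → + 1 ℤ.+ + toℕ i ℤ.≤ g i
      lower i = ℤP.≤-trans (ℤP.+-monoˡ-≤ (+ toℕ i) g₀) (gap-first g st i)
      upper : ∀ i → g i ℤ.≤ + 1 ℤ.+ + toℕ i
      upper i = 0≤m-n (subst (+ 0 ℤ.≤_) (r (+ n) (+ toℕ i) (g i)) (ℤP.i≤j⇒0≤j-i (ℤP.≤-trans (gap-last g st i) g-last)))
        where r : ∀ n i z → (+ 1 ℤ.+ n) ℤ.- (z ℤ.+ (n ℤ.- i)) ≡ (+ 1 ℤ.+ i) ℤ.- z
              r = ℤSolver.solve-∀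
      value : ∀ i → lookup w i ≡ lookup w₀ i
      value i = trans (sym (ℤP.neg-involutive (lookup w i))) (trans (cong ℤ.-_ (ℤP.≤-antisym (upper i) (lower i))) (sym (VecP.lookup∘tabulate (λ i → -[1+ toℕ i ]) i)))

    module Point (ty : RootType) where
      open TopClass ty {n} public
      private
        module ℚS = ℚSum

      κ₀ : ℚ
      κ₀ = act (topClass ty N) 𝟙 w₀

      total-level : total {N} ≡ + 2 ℤ.* + (N ℕ.* N)
      total-level = trans (total-value {N}) (cong (+ 2 ℤ.*_) (sym (ℤP.pos-* N N)))

      top-δ : ∀ u → Valid u → L u ≡ total → act (topClass ty N) 𝟙 ≐ κ₀ ⊙ δ u
      top-δ u vu eu w v with L w ℤP.≟ total
      ... | yes e = trans (cong (act (topClass ty N) 𝟙) (max-unique v e)) (sym (trans (cong (κ₀ *_) (trans (cong (δ u) (trans (max-unique v e) (sym (max-unique vu eu)))) (δ-self u))) (*-identityʳ κ₀)))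
      ... | no ne = trans (trans (proj₂ (proj₂ top-monomial) w v) (trans (cong (proj₁ top-monomial *_) (M-Level N w v (λ e → ne (trans e (sym total-level))))) (zeroʳ _)))
        (sym (trans (cong (κ₀ *_) (δ-other (λ e → ne (trans (cong L e) eu)))) (zeroʳ κ₀)))

      -- Were κ₀ zero, the top monomial would vanish on w₀ and, by degree, everywhere; but `reach-M`
      -- carries it to a nonzero multiple of `𝟙`.
      κ₀≢0 : Valid idW → κ₀ ≢ 0#
      κ₀≢0 vid z = R.≢0 (*-cancelˡ 1# 1≢0 (trans (one-* R.value) (trans (sym value-𝟙) (sym (zeroʳ 1#)))))
        where
        module R = Reach (reach-M N ℕP.≤-refl)
        q = proj₁ top-monomial
        g : H
        g = act (M (desc N)) 𝟙
        g-zero : g ≐ 𝟘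
        g-zero w v with L w ℤP.≟ total
        ... | no ne = M-Level N w v (λ e → ne (trans e (sym total-level)))
        ... | yes e = *-cancelˡ q (proj₁ (proj₂ top-monomial)) (trans (sym (proj₂ (proj₂ top-monomial) w v)) (trans (cong (act (topClass ty N) 𝟙) (max-unique v e)) (trans z (sym (zeroʳ q)))))
        D*-zero : ∀ ω → D* ω 𝟘 ≐ 𝟘
        D*-zero [] = ≐-refl
        D*-zero (s ∷ ω) = ≐-trans (D*-cong ω (D-𝟘 s)) (D*-zero ω)
        value-𝟙 : 0# ≡ R.value
        value-𝟙 = trans (sym (≐-trans (D*-cong R.word g-zero) (D*-zero R.word) idW vid)) (trans (R.eq idW vid) (trans (cong (R.value *_) (δ-self idW)) (*-identityʳ R.value)))

-- From one-line notation to vectors of values.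

module OneLineNotation where

  open SignedIndices
  open SignedPermutations
  open import Data.List.Relation.Binary.Permutation.Propositional using (prep; swap)
  open ℤSum

  sumL : List ℤ → ℤ
  sumL = foldr ℤ._+_ (+ 0)

  sumL-↭ : ∀ {l l′} → l ↭ l′ → sumL l ≡ sumL l′
  sumL-↭ Perm.refl = refl
  sumL-↭ (prep x p) = cong (ℤ._+_ x) (sumL-↭ p)
  sumL-↭ (swap {xs} {ys} x y p) = trans (cong (λ z → x ℤ.+ (y ℤ.+ z)) (sumL-↭ p)) (r x y (sumL ys))
    where r : ∀ a b c → a ℤ.+ (b ℤ.+ c) ≡ b ℤ.+ (a ℤ.+ c)
          r = ℤSolver.solve-∀
  sumL-↭ (Perm.trans p q) = trans (sumL-↭ p) (sumL-↭ q)

  Unique-resp-↭ : ∀ {A : Set} {xs ys : List A} → xs ↭ ys → Unique xs → Unique ys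
  Unique-resp-↭ Perm.refl u = u
  Unique-resp-↭ (prep x p) (a ∷ u) = All-resp-↭ p a ∷ Unique-resp-↭ p u
  Unique-resp-↭ (swap x y p) ((x≢y ∷ a) ∷ b ∷ u) = ((λ e → x≢y (sym e)) ∷ All-resp-↭ p b) ∷ All-resp-↭ p a ∷ Unique-resp-↭ p u
  Unique-resp-↭ (Perm.trans p q) u = Unique-resp-↭ q (Unique-resp-↭ p u)

  sum-at : ∀ (F : ℤ → ℤ) l {N} → length l ≡ N → sum {N} (λ i → F (at l (suc (toℕ i)))) ≡ sumL (map F l)
  sum-at F [] refl = sum-empty _
  sum-at F (x ∷ l) refl = trans (sum-suc _) (cong (ℤ._+_ (F x)) (sum-at F l refl))

  count-upTo : ∀ N m → m ℕ.≤ N → sumL (applyUpTo (λ i → iv (suc i ℕP.≤? m)) N) ≡ + m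
  count-upTo zero zero z≤n = refl
  count-upTo (suc N) zero z≤n = trans (cong (ℤ._+ sumL (applyUpTo (λ i → iv (suc (suc i) ℕP.≤? 0)) N)) (iv-no (1 ℕP.≤? 0) λ ())) (trans (ℤP.+-identityˡ _) (zeros N (λ i → suc (suc i)) (λ i ())))
    where
    zeros : ∀ N (f : ℕ → ℕ) → (∀ i → ¬ (f i ℕ.≤ 0)) → sumL (applyUpTo (λ i → iv (f i ℕP.≤? 0)) N) ≡ + 0
    zeros zero f h = refl
    zeros (suc N) f h = trans (cong (ℤ._+ sumL (applyUpTo (λ i → iv (f (suc i) ℕP.≤? 0)) N)) (iv-no (f 0 ℕP.≤? 0) (h 0))) (trans (ℤP.+-identityˡ _) (zeros N (f ∘ suc) (h ∘ suc)))
  count-upTo (suc N) (suc m) (s≤s p) = cong₂ ℤ._+_ (iv-yes (1 ℕP.≤? suc m) (s≤s z≤n))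
    (trans (cong sumL (applyUpTo-cong N (λ i → iv-cong (suc (suc i) ℕP.≤? suc m) (suc i ℕP.≤? m) ℕP.≤-pred s≤s))) (count-upTo N m p))
    where
    applyUpTo-cong : ∀ N {f g : ℕ → ℤ} → (∀ i → f i ≡ g i) → applyUpTo f N ≡ applyUpTo g N
    applyUpTo-cong zero e = refl
    applyUpTo-cong (suc N) e = cong₂ _∷_ (e 0) (applyUpTo-cong N (e ∘ suc))

  module _ {N : ℕ} where

    V : List ℤ → W {N}
    V l = tabulate (λ i → at l (suc (toℕ i)))

    ev-V : ∀ l i → ev (V l) (pos i) ≡ at l (suc (toℕ i))
    ev-V l i = VecP.lookup∘tabulate (λ i → at l (suc (toℕ i))) i

    V-injective : ∀ l l′ → length l ≡ N → length l′ ≡ N → V l ≡ V l′ → l ≡ l′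
    V-injective l l′ p q e = go l l′ (trans p (sym q)) (λ i h → trans (sym (ev-V l (fromℕ< (subst (i ℕ.<_) p h) ) ) ) (trans (cong (λ w → ev w (pos (fromℕ< (subst (i ℕ.<_) p h)))) e) (ev-V l′ _)) ) (λ i h → cong suc (FinP.toℕ-fromℕ< (subst (i ℕ.<_) p h)))
      where
      go : ∀ l l′ → length l ≡ length l′ → {f : ∀ i → i ℕ.< length l → ℕ} → (∀ i h → at l (f i h) ≡ at l′ (f i h)) → (∀ i h → f i h ≡ suc i) → l ≡ l′
      go [] [] _ _ _ = refl
      go (x ∷ l) (y ∷ l′) e {f} h k = cong₂ _∷_ (subst (λ z → at (x ∷ l) z ≡ at (y ∷ l′) z) (k 0 (s≤s z≤n)) (h 0 (s≤s z≤n)))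
        (go l l′ (ℕP.suc-injective e) {λ i _ → suc i} (λ i q → subst (λ z → at (x ∷ l) z ≡ at (y ∷ l′) z) (k (suc i) (s≤s q)) (h (suc i) (s≤s q))) (λ _ _ → refl))

    ∣ev-opp∣ : ∀ (w : W {N}) x → ∣ ev w (opp x) ∣ ≡ ∣ ev w x ∣
    ∣ev-opp∣ w x = trans (cong ∣_∣ (ev-opp w x)) (ℤP.∣-i∣≡∣i∣ (ev w x))

    ∣ev∣-idx : ∀ (w : W {N}) x → Σ (Fin N) λ i → ∣ ev w x ∣ ≡ ∣ ev w (pos i) ∣
    ∣ev∣-idx w (pos i) = i , refl
    ∣ev∣-idx w (neg i) = i , ∣ev-opp∣ w (pos i)

    module FromPerm (l : List ℤ) (sp : IsSPerm N l) where

      len-l : length l ≡ N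
      len-l = trans (sym (ListP.length-map ∣_∣ l)) (trans (↭-length sp) (trans (ListP.length-map suc (upTo N)) (ListP.length-upTo N)))

      at-∈ : ∀ l i → i ℕ.< length l → ∣ at l (suc i) ∣ ∈ map ∣_∣ l
      at-∈ (x ∷ l) zero p = here refl
      at-∈ (x ∷ l) (suc i) (s≤s p) = there (at-∈ l i p)

      bounds : ∀ {k} → k ∈ map ∣_∣ l → 1 ℕ.≤ k × k ℕ.≤ N
      bounds p with ∈-map⁻ suc (∈-resp-↭ sp p)
      ... | j , q , refl = s≤s z≤n , ∈-upTo⁻ q

      at-injective : ∀ l → Unique (map ∣_∣ l) → ∀ i j → i ℕ.< length l → j ℕ.< length l → ∣ at l (suc i) ∣ ≡ ∣ at l (suc j) ∣ → i ≡ j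
      at-injective (x ∷ l) u zero zero p q e = refl
      at-injective (x ∷ l) (a ∷ u) zero (suc j) p (s≤s q) e = ⊥-elim (All.lookup a (at-∈ l j q) e)
      at-injective (x ∷ l) (a ∷ u) (suc i) zero (s≤s p) q e = ⊥-elim (All.lookup a (at-∈ l i p) (sym e))
      at-injective (x ∷ l) (a ∷ u) (suc i) (suc j) (s≤s p) (s≤s q) e = cong suc (at-injective l u i j p q e)

      unique : Unique (map ∣_∣ l)
      unique = Unique-resp-↭ (↭-sym sp) (UniqueP.map⁺ ℕP.suc-injective (UniqueP.upTo⁺ N))

      toℕ< : ∀ (i : Fin N) → toℕ i ℕ.< length l
      toℕ< i = subst (toℕ i ℕ.<_) (sym len-l) (FinP.toℕ<n i)

      w = V l

      ∣w∣-bounds : ∀ x → 1 ℕ.≤ ∣ ev w x ∣ × ∣ ev w x ∣ ℕ.≤ N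
      ∣w∣-bounds x with ∣ev∣-idx w x
      ... | i , e rewrite e | ev-V l i = bounds (at-∈ l (toℕ i) (toℕ< i))

      inj-pos : ∀ i j → ∣ ev w (pos i) ∣ ≡ ∣ ev w (pos j) ∣ → i ≡ j
      inj-pos i j e = FinP.toℕ-injective (at-injective l unique (toℕ i) (toℕ j) (toℕ< i) (toℕ< j) (trans (cong ∣_∣ (sym (ev-V l i))) (trans e (cong ∣_∣ (ev-V l j)))))

      nonzero : ∀ x → ev w x ≢ ℤ.- ev w x
      nonzero x e with ev w x | proj₁ (∣w∣-bounds x)
      ... | + 0 | ()
      nonzero x () | + suc m | _
      nonzero x () | -[1+ m ] | _

      inj-all : ∀ x y → ev w x ≡ ev w y → x ≡ y
      inj-all (pos i) (pos j) e = cong pos (inj-pos i j (cong ∣_∣ e))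
      inj-all (neg i) (neg j) e = cong neg (inj-pos i j (cong ∣_∣ (ℤP.neg-injective e)))
      inj-all (pos i) (neg j) e with inj-pos i j (trans (cong ∣_∣ e) (∣ev-opp∣ w (pos j)))
      ... | refl = ⊥-elim (nonzero (pos i) e)
      inj-all (neg i) (pos j) e with inj-pos i j (trans (sym (∣ev-opp∣ w (pos i))) (cong ∣_∣ e))
      ... | refl = ⊥-elim (nonzero (pos i) (sym e))

      -- |w(1)|, ..., |w(N)| rearrange 1, ..., N, and m of these are at most m. The negative
      -- positions repeat the count, whence the factor 2 in `card`.
      count-pos : ∀ m → m ℕ.≤ N → sum {N} (λ i → iv (∣ ev w (pos i) ∣ ℕP.≤? m)) ≡ + m
      count-pos m p = begin
        sum (λ i → iv (∣ ev w (pos i) ∣ ℕP.≤? m)) ≡⟨ sum-cong (λ i → cong (λ z → iv (∣ z ∣ ℕP.≤? m)) (ev-V l i)) ⟩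
        sum (λ i → iv (∣ at l (suc (toℕ i)) ∣ ℕP.≤? m)) ≡⟨ sum-at (λ z → iv (∣ z ∣ ℕP.≤? m)) l len-l ⟩
        sumL (map (λ z → iv (∣ z ∣ ℕP.≤? m)) l) ≡⟨ cong sumL (ListP.map-∘ {g = λ k → iv (k ℕP.≤? m)} {f = ∣_∣} l) ⟩
        sumL (map (λ k → iv (k ℕP.≤? m)) (map ∣_∣ l)) ≡⟨ sumL-↭ (map⁺ (λ k → iv (k ℕP.≤? m)) sp) ⟩
        sumL (map (λ k → iv (k ℕP.≤? m)) (map suc (upTo N))) ≡⟨ cong sumL (trans (sym (ListP.map-∘ {g = λ k → iv (k ℕP.≤? m)} {f = suc} (upTo N))) (ListP.map-applyUpTo id (λ i → iv (suc i ℕP.≤? m)) N)) ⟩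
        sumL (applyUpTo (λ i → iv (suc i ℕP.≤? m)) N) ≡⟨ count-upTo N m p ⟩
        + m ∎
        where open ≡-Reasoning

      valid : Valid w
      valid .inj = inj-all
      valid .card y = trans (sumS-split _) (trans (cong₂ ℤ._+_ (count-pos m mN) (trans (sum-cong (λ i → cong (λ z → iv (z ℕP.≤? m)) (∣ev-opp∣ w (pos i)))) (count-pos m mN))) (r (+ m)))
        where
        m = ∣ ev w y ∣
        mN = proj₂ (∣w∣-bounds y)
        r : ∀ x → x ℤ.+ x ≡ + 2 ℤ.* x
        r = ℤSolver.solve-∀

-- Agreement of `L` with twice the length of a list.

module LengthFormula where

  open SignedIndices
  open SignedPermutations
  open OneLineNotation
  open ℤSum

  count-sum : ∀ x l {N} → length l ≡ N → + count> x l ≡ sum {N} (λ j → iv (at l (suc (toℕ j)) ℤ.<? x))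
  count-sum x [] refl = sym (sum-empty _)
  count-sum x (y ∷ l) refl = trans (trans (ℤP.pos-+ (if does (y ℤ.<? x) then 1 else 0) (count> x l)) (cong₂ ℤ._+_ (unit (y ℤ.<? x)) (count-sum x l refl))) (sym (sum-suc _))
    where unit : ∀ {P : Set} (d : Dec P) → + (if does d then 1 else 0) ≡ iv d
          unit (yes _) = refl
          unit (no _) = refl

  inversions-sum : ∀ l {N} → length l ≡ N →
    + inversions l ≡ sum {N} (λ i → sum {N} (λ j → iv (toℕ i ℕP.<? toℕ j) ℤ.* iv (at l (suc (toℕ j)) ℤ.<? at l (suc (toℕ i)))))
  inversions-sum [] refl = sym (sum-empty _)
  inversions-sum (x ∷ l) refl = begin
    + (count> x l ℕ.+ inversions l) ≡⟨ ℤP.pos-+ (count> x l) (inversions l) ⟩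
    + count> x l ℤ.+ + inversions l ≡⟨ cong₂ ℤ._+_ (count-sum x l refl) (inversions-sum l refl) ⟩
    sum (λ j → iv (at l (suc (toℕ j)) ℤ.<? x)) ℤ.+ sum (λ i → sum (λ j → iv (toℕ i ℕP.<? toℕ j) ℤ.* iv (at l (suc (toℕ j)) ℤ.<? at l (suc (toℕ i)))))
      ≡⟨ cong₂ ℤ._+_ (sym (trans (sum-suc (row zero)) (trans (cong (ℤ._+ sum (row zero ∘ suc)) (ℤP.*-zeroˡ (iv (x ℤ.<? x)))) (trans (ℤP.+-identityˡ _) (sum-cong (λ j → trans (cong (ℤ._* iv (at l (suc (toℕ j)) ℤ.<? x)) (iv-yes (0 ℕP.<? suc (toℕ j)) (s≤s z≤n))) (ℤP.*-identityˡ (iv (at l (suc (toℕ j)) ℤ.<? x)))))))))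
           (sum-cong (λ i → sym (trans (sum-suc (row (suc i))) (trans (cong₂ ℤ._+_ (trans (cong (ℤ._* iv (x ℤ.<? at l (suc (toℕ i)))) (iv-no (suc (toℕ i) ℕP.<? 0) (λ ()))) (ℤP.*-zeroˡ (iv (x ℤ.<? at l (suc (toℕ i)))))) (sum-cong (λ j → cong (ℤ._* iv (at l (suc (toℕ j)) ℤ.<? at l (suc (toℕ i)))) (iv-cong (suc (toℕ i) ℕP.<? suc (toℕ j)) (toℕ i ℕP.<? toℕ j) ℕP.≤-pred s≤s)))) (ℤP.+-identityˡ _))))) ⟩
    sum (row zero) ℤ.+ sum (λ i → sum (row (suc i))) ≡⟨ sym (sum-suc (λ i → sum (row i))) ⟩
    sum (λ i → sum (row i)) ∎
    where
    open ≡-Reasoning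
    row : Fin (suc (length l)) → Fin (suc (length l)) → ℤ
    row i j = iv (toℕ i ℕP.<? toℕ j) ℤ.* iv (at (x ∷ l) (suc (toℕ j)) ℤ.<? at (x ∷ l) (suc (toℕ i)))

  negSum-sum : ∀ l {N} → length l ≡ N → + negSum l ≡ sum {N} (λ i → iv (at l (suc (toℕ i)) ℤ.<? + 0) ℤ.* + ∣ at l (suc (toℕ i)) ∣)
  negSum-sum [] refl = sym (sum-empty _)
  negSum-sum (x ∷ l) refl = trans (ℤP.pos-+ (if does (x ℤ.<? + 0) then ∣ x ∣ else 0) (negSum l)) (trans (cong₂ ℤ._+_ (unit (x ℤ.<? + 0)) (negSum-sum l refl)) (sym (sum-suc _)))
    where unit : ∀ {P : Set} (d : Dec P) → + (if does d then ∣ x ∣ else 0) ≡ iv d ℤ.* + ∣ x ∣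
          unit (yes _) = sym (ℤP.*-identityˡ (+ ∣ x ∣))
          unit (no _) = sym (ℤP.*-zeroˡ (+ ∣ x ∣))

  abs-≡ : ∀ x y → ∣ x ∣ ≡ ∣ y ∣ → x ≡ y ⊎ x ≡ ℤ.- y
  abs-≡ (+ m) (+ .m) refl = inj₁ refl
  abs-≡ (+ .(suc k)) -[1+ k ] refl = inj₂ refl
  abs-≡ -[1+ m ] (+ .(suc m)) refl = inj₂ refl
  abs-≡ -[1+ m ] -[1+ .m ] refl = inj₁ refl

  -- The sign of a + b is that of the summand of larger absolute value. This turns pairs with
  -- negative sum into negative entries dominating another entry.
  neg-dominates : ∀ a b → ∣ b ∣ ℕ.< ∣ a ∣ → (b ℤ.< ℤ.- a → a ℤ.< + 0) × (a ℤ.< + 0 → b ℤ.< ℤ.- a)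
  neg-dominates (+ suc m) (+ k) p = (λ ()) , λ { (+<+ ()) }
  neg-dominates (+ suc m) -[1+ k ] (s≤s p) = (λ { (-<- q) → ⊥-elim (ℕP.<⇒≱ q (ℕP.<⇒≤ p)) }) , λ { (+<+ ()) }
  neg-dominates -[1+ m ] (+ k) p = (λ _ → -<+) , λ _ → +<+ p
  neg-dominates -[1+ m ] -[1+ k ] p = (λ _ → -<+) , λ _ → -<+

  module _ {N : ℕ} where
    private
      S = SI N

    -- |a| counts the values of absolute value at most |a|, so the negative
    -- entries contribute the pairs with negative sum.
    L-len : ∀ (l : List ℤ) → length l ≡ N → Valid {N} (V l) → + 2 ℤ.* + len l ≡ L {N} (V l)
    L-len l e v = sym (begin
      L w ≡⟨ L-def w ⟩
      sumS (λ x → sumS (F x)) ≡⟨ sumS-split _ ⟩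
      sum (λ i → sumS (F (pos i))) ℤ.+ sum (λ i → sumS (F (neg i)))
        ≡⟨ cong₂ ℤ._+_ (sum-cong (λ i → trans (sumS-split _) (trans (cong₂ ℤ._+_ (sum-cong (λ j → pp i j)) (sum-zero _ (λ j → pm i j))) (ℤP.+-identityʳ _))))
                       (trans (sum-cong (λ i → trans (sumS-split _) (cong₂ ℤ._+_ (sum-cong (λ j → mp i j)) (sum-cong (λ j → mm i j))))) (sum-+ _ _)) ⟩
      Iv ℤ.+ (sum (λ i → sum (λ j → A i j ℤ.+ A j i)) ℤ.+ sum (λ i → sum (λ j → I j i)))
        ≡⟨ cong₂ (λ p q → Iv ℤ.+ (p ℤ.+ q)) (trans (sum-cong (λ i → sum-+ (λ j → A i j) (λ j → A j i))) (trans (sum-+ _ _) (cong (ℤ._+_ Ng) (sym (sum-comm A))))) (sym (sum-comm I)) ⟩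
      Iv ℤ.+ ((Ng ℤ.+ Ng) ℤ.+ Iv) ≡⟨ r Iv Ng ⟩
      + 2 ℤ.* (Iv ℤ.+ Ng) ≡⟨ cong (+ 2 ℤ.*_) (sym (trans (ℤP.pos-+ (inversions l) (negSum l)) (cong₂ ℤ._+_ inv-eq neg-eq))) ⟩
      + 2 ℤ.* + len l ∎)
      where
      open ≡-Reasoning
      w = V {N} l
      a : Fin N → ℤ
      a i = ev w (pos i)
      F : S → S → ℤ
      F x y = wt x y ℤ.* lt x y ℤ.* inv w x y
      I A : Fin N → Fin N → ℤ
      I i j = iv (toℕ i ℕP.<? toℕ j) ℤ.* iv (a j ℤ.<? a i)
      A i j = iv (a i ℤ.<? + 0) ℤ.* iv (∣ a j ∣ ℕP.≤? ∣ a i ∣)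
      Iv Ng : ℤ
      Iv = sum (λ i → sum (λ j → I i j))
      Ng = sum (λ i → sum (λ j → A i j))
      r : ∀ p q → p ℤ.+ ((q ℤ.+ q) ℤ.+ p) ≡ + 2 ℤ.* (p ℤ.+ q)
      r = ℤSolver.solve-∀
      pp : ∀ i j → F (pos i) (pos j) ≡ I i j
      pp i j = cong (ℤ._* iv (a j ℤ.<? a i)) (trans (ℤP.*-identityˡ (lt {N} (pos i) (pos j))) (iv-cong (loc {N} (pos i) ℤ.<? loc {N} (pos j)) (toℕ i ℕP.<? toℕ j) (λ { (+<+ (s≤s p)) → p }) (λ p → +<+ (s≤s p))))
      pm : ∀ i j → F (pos i) (neg j) ≡ + 0
      pm i j = trans (cong (ℤ._* inv w (pos i) (neg j)) (trans (cong (wt {N} (pos i) (neg j) ℤ.*_) (iv-no (loc {N} (pos i) ℤ.<? loc {N} (neg j)) (λ ()))) (ℤP.*-zeroʳ (wt {N} (pos i) (neg j))))) (ℤP.*-zeroˡ (inv w (pos i) (neg j)))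
      mm : ∀ i j → F (neg i) (neg j) ≡ I j i
      mm i j = cong₂ ℤ._*_ (trans (ℤP.*-identityˡ (lt {N} (neg i) (neg j))) (iv-cong (loc {N} (neg i) ℤ.<? loc {N} (neg j)) (toℕ j ℕP.<? toℕ i) (λ { (-<- p) → p }) -<-))
        (iv-cong (ℤ.- a j ℤ.<? ℤ.- a i) (a i ℤ.<? a j) ℤP.neg-cancel-< ℤP.neg-mono-<)
      abs-inj : ∀ i j → ∣ a i ∣ ≡ ∣ a j ∣ → i ≡ j
      abs-inj i j q with abs-≡ (a i) (a j) q
      ... | inj₁ p = pos-injective (v .inj (pos i) (pos j) p)
      ... | inj₂ p with v .inj (pos i) (neg j) p
      ...   | ()
      neg-self : ∀ z → (z ℤ.< ℤ.- z → z ℤ.< + 0) × (z ℤ.< + 0 → z ℤ.< ℤ.- z)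
      neg-self (+ 0) = (λ { (+<+ ()) }) , λ { (+<+ ()) }
      neg-self (+ suc m) = (λ ()) , λ { (+<+ ()) }
      neg-self -[1+ m ] = (λ _ → -<+) , λ _ → -<+
      mp : ∀ i j → F (neg i) (pos j) ≡ A i j ℤ.+ A j i
      mp i j = trans (cong (ℤ._* inv w (neg i) (pos j)) (trans (cong (wt {N} (neg i) (pos j) ℤ.*_) (iv-yes (loc {N} (neg i) ℤ.<? loc {N} (pos j)) -<+)) (ℤP.*-identityʳ (wt {N} (neg i) (pos j))))) (go (ℕP.<-cmp ∣ a i ∣ ∣ a j ∣))
        where
        go : _ → (+ 1 ℤ.+ iv (pos j ≟S pos i)) ℤ.* iv (a j ℤ.<? ℤ.- a i) ≡ A i j ℤ.+ A j i
        go (tri≈ _ q _) with abs-inj i j q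
        ... | refl = trans (cong₂ (λ p q → (+ 1 ℤ.+ p) ℤ.* q) (iv-yes (pos i ≟S pos i) refl) (iv-cong (a i ℤ.<? ℤ.- a i) (a i ℤ.<? + 0) (proj₁ (neg-self (a i))) (proj₂ (neg-self (a i)))))
              (trans (r₂ (iv (a i ℤ.<? + 0))) (cong (λ p → iv (a i ℤ.<? + 0) ℤ.* p ℤ.+ iv (a i ℤ.<? + 0) ℤ.* p) (sym (iv-yes (∣ a i ∣ ℕP.≤? ∣ a i ∣) ℕP.≤-refl))))
          where r₂ : ∀ q → (+ 1 ℤ.+ + 1) ℤ.* q ≡ q ℤ.* + 1 ℤ.+ q ℤ.* + 1
                r₂ = ℤSolver.solve-∀
        go (tri< p ne _) = trans (cong₂ (λ x y → (+ 1 ℤ.+ x) ℤ.* y) (iv-no (pos j ≟S pos i) (λ e → ne (cong (λ k → ∣ a k ∣) (sym (pos-injective e)))))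
            (iv-cong (a j ℤ.<? ℤ.- a i) (a j ℤ.<? + 0) (λ h → proj₁ (neg-dominates (a j) (a i) p) (flip h)) (λ h → flip (proj₂ (neg-dominates (a j) (a i) p) h))))
          (trans (r₃ (iv (a j ℤ.<? + 0)) (iv (a i ℤ.<? + 0))) (cong₂ (λ x y → iv (a i ℤ.<? + 0) ℤ.* x ℤ.+ iv (a j ℤ.<? + 0) ℤ.* y) (sym (iv-no (∣ a j ∣ ℕP.≤? ∣ a i ∣) (ℕP.<⇒≱ p))) (sym (iv-yes (∣ a i ∣ ℕP.≤? ∣ a j ∣) (ℕP.<⇒≤ p)))))
          where
          r₃ : ∀ q s → (+ 1 ℤ.+ + 0) ℤ.* q ≡ s ℤ.* + 0 ℤ.+ q ℤ.* + 1
          r₃ = ℤSolver.solve-∀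
          flip : ∀ {x y} → x ℤ.< ℤ.- y → y ℤ.< ℤ.- x
          flip {x} {y} h = subst (ℤ._< ℤ.- x) (ℤP.neg-involutive y) (ℤP.neg-mono-< h)
        go (tri> _ ne p) = trans (cong₂ (λ x y → (+ 1 ℤ.+ x) ℤ.* y) (iv-no (pos j ≟S pos i) (λ e → ne (cong (λ k → ∣ a k ∣) (sym (pos-injective e)))))
            (iv-cong (a j ℤ.<? ℤ.- a i) (a i ℤ.<? + 0) (proj₁ (neg-dominates (a i) (a j) p)) (proj₂ (neg-dominates (a i) (a j) p))))
          (trans (r₃ (iv (a i ℤ.<? + 0)) (iv (a j ℤ.<? + 0))) (cong₂ (λ x y → iv (a i ℤ.<? + 0) ℤ.* x ℤ.+ iv (a j ℤ.<? + 0) ℤ.* y) (sym (iv-yes (∣ a j ∣ ℕP.≤? ∣ a i ∣) (ℕP.<⇒≤ p))) (sym (iv-no (∣ a i ∣ ℕP.≤? ∣ a j ∣) (ℕP.<⇒≱ p)))))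
          where
          r₃ : ∀ q s → (+ 1 ℤ.+ + 0) ℤ.* q ≡ q ℤ.* + 1 ℤ.+ s ℤ.* + 0
          r₃ = ℤSolver.solve-∀
      a-at : ∀ i → a i ≡ at l (suc (toℕ i))
      a-at = ev-V l
      inv-eq : + inversions l ≡ Iv
      inv-eq = trans (inversions-sum l e) (sum-cong (λ i → sum-cong (λ j → cong₂ (λ p q → iv (toℕ i ℕP.<? toℕ j) ℤ.* iv (p ℤ.<? q)) (sym (a-at j)) (sym (a-at i)))))
      half : ∀ i → sum (λ j → iv (∣ a j ∣ ℕP.≤? ∣ a i ∣)) ≡ + ∣ a i ∣
      half i = ℤP.*-cancelˡ-≡ (+ 2) _ _ (trans (r₂ _) (trans (cong (ℤ._+_ (sum (λ j → iv (∣ a j ∣ ℕP.≤? ∣ a i ∣)))) (sum-cong (λ j → cong (λ z → iv (z ℕP.≤? ∣ a i ∣)) (sym (∣ev-opp∣ w (pos j)))))) (trans (sym (sumS-split _)) (v .card (pos i)))))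
        where r₂ : ∀ x → + 2 ℤ.* x ≡ x ℤ.+ x
              r₂ = ℤSolver.solve-∀
      neg-eq : + negSum l ≡ Ng
      neg-eq = trans (negSum-sum l e) (sum-cong (λ i → trans (cong (λ z → iv (z ℤ.<? + 0) ℤ.* + ∣ z ∣) (sym (a-at i))) (trans (cong (iv (a i ℤ.<? + 0) ℤ.*_) (sym (half i))) (sym (sum-* (iv (a i ℤ.<? + 0)) _)))))

-- Reflections and ascents in one-line notation.

module ListReflections where

  open SignedIndices
  open SignedPermutations
  open OneLineNotation

  length-setAt : ∀ l i x → length (setAt l i x) ≡ length l
  length-setAt [] i x = refl
  length-setAt (y ∷ l) zero x = refl
  length-setAt (y ∷ l) (suc zero) x = refl
  length-setAt (y ∷ l) (suc (suc i)) x = cong suc (length-setAt l (suc i) x)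

  at-setAt : ∀ l i x → i ℕ.< length l → at (setAt l (suc i) x) (suc i) ≡ x
  at-setAt (y ∷ l) zero x p = refl
  at-setAt (y ∷ l) (suc i) x (s≤s p) = at-setAt l i x p

  at-setAt-other : ∀ l i j x → i ≢ j → at (setAt l (suc i) x) (suc j) ≡ at l (suc j)
  at-setAt-other [] i j x ne = refl
  at-setAt-other (y ∷ l) zero zero x ne = ⊥-elim (ne refl)
  at-setAt-other (y ∷ l) zero (suc j) x ne = refl
  at-setAt-other (y ∷ l) (suc i) zero x ne = refl
  at-setAt-other (y ∷ l) (suc i) (suc j) x ne = at-setAt-other l i j x (λ e → ne (cong suc e))

  module _ {N : ℕ} (l : List ℤ) (len-l : length l ≡ N) where

    private
      bound : ∀ (i : Fin N) → toℕ i ℕ.< length l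
      bound i = subst (toℕ i ℕ.<_) (sym len-l) (FinP.toℕ<n i)

    V-rmulNeg : ∀ I → V {N} (rmulNeg l (suc (toℕ I))) ≡ V l · t (pos I) (neg I)
    V-rmulNeg I = VecP.tabulate-cong go
      where
      go : ∀ k → at (rmulNeg l (suc (toℕ I))) (suc (toℕ k)) ≡ ev (V l) (t (pos I) (neg I) (pos k))
      go k with k FinP.≟ I
      ... | yes refl = trans (at-setAt l (toℕ k) _ (bound k)) (sym (trans (cong (ev (V l)) (t-a (pos k) (neg k))) (cong ℤ.-_ (ev-V l k))))
      ... | no ne = trans (at-setAt-other l (toℕ I) (toℕ k) _ (λ e → ne (sym (FinP.toℕ-injective e))))
        (sym (trans (cong (ev (V l)) (t-f (pos I) (neg I) (λ e → ne (pos-injective e)) (λ ()) (λ ()) (λ e → ne (pos-injective e)))) (ev-V l k)))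

    -- b = pos J is the plain transposition and b = neg J the signed one; positive positions other
    -- than I and J are neither ±I nor ±b, hence fixed.
    V-set₂ : ∀ I J b x y → I ≢ J → x ≡ ev (V {N} l) b → y ≡ ev (V l) (t (pos I) b (pos J)) → pos J ≡ b ⊎ pos J ≡ opp b →
      V {N} (setAt (setAt l (suc (toℕ I)) x) (suc (toℕ J)) y) ≡ V l · t (pos I) b
    V-set₂ I J b x y I≢J ex ey Jb = VecP.tabulate-cong go
      where
      l′ = setAt l (suc (toℕ I)) x
      go : ∀ k → at (setAt l′ (suc (toℕ J)) y) (suc (toℕ k)) ≡ ev (V l) (t (pos I) b (pos k))
      go k with k FinP.≟ J | k FinP.≟ I
      ... | yes refl | _ = trans (at-setAt l′ (toℕ k) y (subst (toℕ k ℕ.<_) (sym (length-setAt l _ x)) (bound k))) ey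
      ... | no kJ | yes refl = trans (at-setAt-other l′ (toℕ J) (toℕ k) y (λ e → kJ (sym (FinP.toℕ-injective e)))) (trans (at-setAt l (toℕ k) x (bound k)) (trans ex (cong (ev (V l)) (sym (t-a (pos k) b)))))
      ... | no kJ | no kI = trans (at-setAt-other l′ (toℕ J) (toℕ k) y (λ e → kJ (sym (FinP.toℕ-injective e)))) (trans (at-setAt-other l (toℕ I) (toℕ k) x (λ e → kI (sym (FinP.toℕ-injective e))))
          (sym (trans (cong (ev (V l)) (t-f (pos I) b (λ e → kI (pos-injective e)) (nb Jb) (λ ()) (nob Jb))) (ev-V l k))))
        where
        nb : pos J ≡ b ⊎ pos J ≡ opp b → pos k ≢ b
        nb (inj₁ e) q = kJ (pos-injective (trans q (sym e)))
        nb (inj₂ e) q with trans (cong opp q) (sym e)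
        ... | ()
        nob : pos J ≡ b ⊎ pos J ≡ opp b → pos k ≢ opp b
        nob (inj₁ e) q with trans q (cong opp (sym e))
        ... | ()
        nob (inj₂ e) q = kJ (pos-injective (trans q (sym e)))

    V-swap : ∀ I J → I ≢ J → V {N} (setAt (setAt l (suc (toℕ I)) (at l (suc (toℕ J)))) (suc (toℕ J)) (at l (suc (toℕ I)))) ≡ V l · t (pos I) (pos J)
    V-swap I J ne = V-set₂ I J (pos J) _ _ ne (sym (ev-V l J)) (sym (trans (cong (ev (V l)) (t-b (pos I) (pos J))) (ev-V l I))) (inj₁ refl)

    V-rmulPair : ∀ I J → I ≢ J → V {N} (rmulPair l (suc (toℕ I)) (suc (toℕ J))) ≡ V l · t (pos I) (neg J)
    V-rmulPair I J ne = V-set₂ I J (neg J) _ _ ne (cong ℤ.-_ (sym (ev-V l J))) (sym (trans (cong (ev (V l)) (t-ob (pos I) (neg J))) (cong ℤ.-_ (ev-V l I)))) (inj₂ refl)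

  data Ascent (l : List ℤ) : Maybe ℕ → Set where
    ascent-0   : + 0 ℤ.< at l 1 → Ascent l (just 0)
    ascent-suc : ∀ k → suc k ℕ.< length l → at l (suc k) ℤ.< at l (suc (suc k)) → Ascent l (just (suc k))
    no-ascent  : ¬ (+ 0 ℤ.< at l 1) → (∀ k → suc k ℕ.< length l → ¬ (at l (suc k) ℤ.< at l (suc (suc k)))) → Ascent l nothing

  Scan : ℕ → List ℤ → Maybe ℕ → Set
  Scan i ys (just k) = Σ ℕ λ j → k ≡ i ℕ.+ j × suc j ℕ.< length ys × at ys (suc j) ℤ.< at ys (suc (suc j))
  Scan i ys nothing  = ∀ j → suc j ℕ.< length ys → ¬ (at ys (suc j) ℤ.< at ys (suc (suc j)))

  record Scanner (g : ℕ → List ℤ → Maybe ℕ) : Set where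
    field
      two-or-more : ∀ i a b ys → g i (a ∷ b ∷ ys) ≡ (if does (a ℤ.<? b) then just i else g (suc i) (b ∷ ys))
      single      : ∀ i a → g i (a ∷ []) ≡ nothing
      empty       : ∀ i → g i [] ≡ nothing
  open Scanner

  scanner-spec : ∀ g → Scanner g → ∀ i ys → Scan i ys (g i ys)
  scanner-spec g sc i [] = subst (Scan i []) (sym (sc .empty i)) (λ j ())
  scanner-spec g sc i (a ∷ []) = subst (Scan i (a ∷ [])) (sym (sc .single i a)) (λ { j (s≤s ()) })
  scanner-spec g sc i (a ∷ b ∷ ys) = subst (Scan i (a ∷ b ∷ ys)) (sym (sc .two-or-more i a b ys)) (go (a ℤ.<? b) (scanner-spec g sc (suc i) (b ∷ ys)))
    where
    shift : ∀ m → ¬ (a ℤ.< b) → Scan (suc i) (b ∷ ys) m → Scan i (a ∷ b ∷ ys) m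
    shift (just k) _ (j , e , p , q) = suc j , trans e (sym (ℕP.+-suc i j)) , s≤s p , q
    shift nothing ¬p h zero p = ¬p
    shift nothing ¬p h (suc j) (s≤s p) = h j p
    go : (d : Dec (a ℤ.< b)) → Scan (suc i) (b ∷ ys) (g (suc i) (b ∷ ys)) → Scan i (a ∷ b ∷ ys) (if does d then just i else g (suc i) (b ∷ ys))
    go (yes p) _ = 0 , sym (ℕP.+-identityʳ i) , s≤s (s≤s z≤n) , p
    go (no ¬p) r = shift (g (suc i) (b ∷ ys)) ¬p r

  -- The scanning function local to firstAscent has no name here: it is the
  -- solution of the underscore, found by abstracting its arguments below.
  module _ (x : ℤ) (xs : List ℤ) (P : ℕ → List ℤ → Maybe ℕ → Set) (h : ∀ g → Scanner g → ∀ i ys → P i ys (g i ys)) where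
    mutual
      firstAscent-go : ∀ i ys → P i ys _
      firstAscent-go = h _ (record { two-or-more = λ _ _ _ _ → refl ; single = λ _ _ → refl ; empty = λ _ → refl })

      firstAscent-scan : does (+ 0 ℤ.<? x) ≡ false → P 1 (x ∷ xs) (firstAscent (x ∷ xs))
      firstAscent-scan eq with does (+ 0 ℤ.<? x)
      ... | false with 1 | x ∷ xs
      ...   | i | ys = firstAscent-go i ys

  firstAscent-positive : ∀ x xs → does (+ 0 ℤ.<? x) ≡ true → firstAscent (x ∷ xs) ≡ just 0
  firstAscent-positive x xs eq with does (+ 0 ℤ.<? x)
  ... | true = refl

  firstAscent-spec : ∀ x xs → Ascent (x ∷ xs) (firstAscent (x ∷ xs))
  firstAscent-spec x xs = go (+ 0 ℤ.<? x)
    where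
    conv : ∀ m → ¬ (+ 0 ℤ.< x) → Scan 1 (x ∷ xs) m → Ascent (x ∷ xs) m
    conv (just k) _ (j , refl , p , q) = ascent-suc j p q
    conv nothing ¬p h = no-ascent ¬p h
    go : Dec (+ 0 ℤ.< x) → Ascent (x ∷ xs) (firstAscent (x ∷ xs))
    go (yes p) = subst (Ascent (x ∷ xs)) (sym (firstAscent-positive x xs (dec-true (+ 0 ℤ.<? x) p))) (ascent-0 p)
    go (no ¬p) = conv (firstAscent (x ∷ xs)) ¬p (firstAscent-scan x xs Scan scanner-spec (dec-false (+ 0 ℤ.<? x) ¬p))

-- Schubert polynomials act on the unit as multiples of indicator functions.

module SchubertClasses where

  open SignedIndices
  open SignedPermutations
  open ChevalleyOperators
  open SimpleReflections
  open PolynomialAction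
  open DividedDifferences
  open InvariantIdeal
  open LongestElement
  open OneLineNotation
  open LengthFormula
  open ListReflections
  open RationalField

  at-applyUpTo : ∀ (f : ℕ → ℤ) N i → i ℕ.< N → at (applyUpTo f N) (suc i) ≡ f i
  at-applyUpTo f (suc N) zero p = refl
  at-applyUpTo f (suc N) (suc i) (s≤s p) = at-applyUpTo (f ∘ suc) N i p

  module Schubert (ty : RootType) {n : ℕ} where
    open Point {n} ty public

    private
      N = suc n

    idW-Valid : Valid {N} idW
    idW-Valid = subst Valid eq (FromPerm.valid l sp)
      where
      l = map +_ (oneToN N)
      sp : IsSPerm N l
      sp = ↭-reflexive (trans (sym (ListP.map-∘ (oneToN N))) (ListP.map-id (oneToN N)))
      eq : V l ≡ idW
      eq = VecP.tabulate-cong (λ i → trans (cong (λ z → at z (suc (toℕ i))) (trans (sym (ListP.map-∘ {g = +_} {f = suc} (upTo N))) (ListP.map-applyUpTo id (λ k → + suc k) N))) (at-applyUpTo (λ k → + suc k) N (toℕ i) (FinP.toℕ<n i)))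

    κ≢0 : κ₀ ≢ 0#
    κ≢0 = κ₀≢0 idW-Valid

    D-δ : ∀ s u → Up u (lo s) (hi s) → D s (δ (u · refl-of s)) ≐ δ u
    D-δ s u up w v with VecP.≡-dec ℤP._≟_ w u
    ... | yes refl = trans (cong₂ _*_ (ℚSum.iv-yes (L w ℤ.<? L (w · refl-of s)) (Up-L w (lo s) (hi s) (lo≢hi s) up)) (δ-self (w · refl-of s))) (one-* 1#)
    ... | no ne = trans (cong (asc w s *_) (δ-other (λ e → ne (trans (sym (·-t-t w (lo s) (hi s))) (trans (cong (_· refl-of s) e) (·-t-t u (lo s) (hi s))))))) (zeroʳ _)

    D-δ-zero : ∀ s u → Up u (lo s) (hi s) → D s (δ u) ≐ 𝟘
    D-δ-zero s u up w v = go (VecP.≡-dec ℤP._≟_ (w · refl-of s) u)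
      where
      go : Dec (w · refl-of s ≡ u) → D s (δ u) w ≡ 0#
      go (no ne) = trans (cong (asc w s *_) (δ-other ne)) (zeroʳ _)
      go (yes refl) = trans (cong (_* δ (w · refl-of s) (w · refl-of s)) (ℚSum.iv-no (L w ℤ.<? L (w · refl-of s))
        (λ p → ℤP.<-asym p (subst (λ z → L (w · refl-of s) ℤ.< L z) (·-t-t w (lo s) (hi s)) (Up-L (w · refl-of s) (lo s) (hi s) (lo≢hi s) up))))) (zeroˡ _)

    len-up : ∀ l l′ s → length l ≡ N → length l′ ≡ N → Valid {N} (V l) → V l′ ≡ V l · refl-of s → Up (V l) (lo s) (hi s) → len l′ ≡ suc (len l)
    len-up l l′ s e e′ v eq up = ℤP.+-injective (ℤP.*-cancelˡ-≡ (+ 2) (+ len l′) (+ suc (len l)) (begin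
      + 2 ℤ.* + len l′ ≡⟨ L-len l′ e′ (subst Valid (sym eq) (Valid-t (lo s) (hi s) v)) ⟩
      L (V l′) ≡⟨ trans (cong L eq) (L-simple-Up s (V l) up) ⟩
      L (V l) ℤ.+ + 2 ≡⟨ cong (ℤ._+ + 2) (sym (L-len l e v)) ⟩
      + 2 ℤ.* + len l ℤ.+ + 2 ≡⟨ r (+ len l) ⟩
      + 2 ℤ.* + suc (len l) ∎))
      where
      open ≡-Reasoning
      r : ∀ x → + 2 ℤ.* x ℤ.+ + 2 ≡ + 2 ℤ.* (+ 1 ℤ.+ x)
      r = ℤSolver.solve-∀

    Up-s₀ : ∀ l → + 0 ℤ.< at l 1 → Up (V {N} l) (lo (s₀ {n})) (hi (s₀ {n}))
    Up-s₀ l p = Up-intro (V l) (neg zero) (pos zero) (λ _ → positive (at l 1) p) (λ ())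
      where
      positive : ∀ z → + 0 ℤ.< z → ℤ.- z ℤ.< z
      positive (+ suc m) _ = -<+
      positive (+ 0) (+<+ ())

    module At (i : ℕ) (p : suc i ℕ.< N) where
      I J : Fin N
      I = fromℕ< (ℕP.<-trans (ℕP.n<1+n i) p)
      J = fromℕ< p
      toI : toℕ I ≡ i
      toI = FinP.toℕ-fromℕ< (ℕP.<-trans (ℕP.n<1+n i) p)
      toJ : toℕ J ≡ suc i
      toJ = FinP.toℕ-fromℕ< p
      adjIJ : toℕ J ≡ suc (toℕ I)
      adjIJ = trans toJ (cong suc (sym toI))
      s : Simple {N}
      s = sᵢ I J adjIJ

      Up-s : ∀ l → at l (suc i) ℤ.< at l (suc (suc i)) → Up (V {N} l) (lo s) (hi s)
      Up-s l q = Up-intro (V l) (pos I) (pos J)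
        (λ _ → subst₂ ℤ._<_ (sym (trans (ev-V l I) (cong (λ z → at l (suc z)) toI))) (sym (trans (ev-V l J) (cong (λ z → at l (suc z)) toJ))) q)
        (λ r → ⊥-elim (ℤP.<-asym r (lo<hi s)))

    -- Without ascents in w, all steps of -w are ascents: equality is excluded by injectivity, and 0
    -- is not a value. The criterion for increasing vectors then applies to -w.
    decreasing-list : ∀ l → length l ≡ N → Valid {N} (V l) → ¬ (+ 0 ℤ.< at l 1) → (∀ k → suc k ℕ.< length l → ¬ (at l (suc k) ℤ.< at l (suc (suc k)))) → Decreasing (V {N} l)
    decreasing-list l e v ¬0 ¬k x y p = subst₂ ℤ._<_ (flip y) (flip x) (ℤP.neg-mono-< (inc x y p))
      where
      w = V {N} l
      w⁻ : W {N}
      w⁻ = tabulate (λ i → ℤ.- ev w (pos i))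
      ev⁻ : ∀ x → ev w⁻ x ≡ ℤ.- ev w x
      ev⁻ (pos i) = VecP.lookup∘tabulate (λ i → ℤ.- ev w (pos i)) i
      ev⁻ (neg i) = cong ℤ.-_ (VecP.lookup∘tabulate (λ i → ℤ.- ev w (pos i)) i)
      flip : ∀ x → ℤ.- ev w⁻ x ≡ ev w x
      flip x = trans (cong ℤ.-_ (ev⁻ x)) (ℤP.neg-involutive _)
      first : + 0 ℤ.< ev w⁻ (pos zero)
      first = subst (+ 0 ℤ.<_) (sym (ev⁻ (pos zero))) (negative (ev w (pos zero)) (λ q → ¬0 (subst (+ 0 ℤ.<_) (ev-V {N} l zero) q)) (λ q → opp-≢ {N} (pos zero) (v .inj (neg zero) (pos zero) (trans (cong ℤ.-_ q) (sym q)))))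
        where
        negative : ∀ z → ¬ (+ 0 ℤ.< z) → z ≢ + 0 → + 0 ℤ.< ℤ.- z
        negative (+ 0) _ q = ⊥-elim (q refl)
        negative (+ suc m) q _ = ⊥-elim (q (+<+ (s≤s z≤n)))
        negative -[1+ m ] _ _ = +<+ (s≤s z≤n)
      step : ∀ j → ev w⁻ (pos (inject₁ j)) ℤ.< ev w⁻ (pos (suc j))
      step j = subst₂ ℤ._<_ (sym (ev⁻ (pos (inject₁ j)))) (sym (ev⁻ (pos (suc j)))) (ℤP.neg-mono-< (ge (ℤP.<-cmp (ev w (pos (inject₁ j))) (ev w (pos (suc j))))))
        where
        ge : _ → ev w (pos (suc j)) ℤ.< ev w (pos (inject₁ j))
        ge (tri< a _ _) = ⊥-elim (¬k (toℕ j) (subst (suc (toℕ j) ℕ.<_) (sym e) (s≤s (FinP.toℕ<n j)))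
          (subst₂ ℤ._<_ (trans (ev-V l (inject₁ j)) (cong (λ z → at l (suc z)) (FinP.toℕ-inject₁ j))) (ev-V l (suc j)) a))
        ge (tri≈ _ q _) = ⊥-elim (ℕP.<-irrefl (cong toℕ (pos-injective (v .inj (pos (inject₁ j)) (pos (suc j)) q))) (s≤s (ℕP.≤-reflexive (FinP.toℕ-inject₁ j))))
        ge (tri> _ _ a) = a
      inc : Increasing w⁻
      inc = pos-increasing w⁻ first (mono-Fin (λ i → ev w⁻ (pos i)) step)

    -- k is the distance N² - ℓ to w₀. It reaches 0 exactly at w₀, where `top-δ` applies; a list
    -- without ascent has length N² and cannot occur earlier. At an ascent the polynomial divided
    -- difference becomes D because D kills `𝟙`.
    schubertGo-δ : ∀ k l → length l ≡ N → Valid {N} (V l) → k ℕ.+ len l ≡ N ℕ.* N → act (schubertGo ty N k l) 𝟙 ≐ κ₀ ⊙ δ (V l)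
    schubertGo-δ zero l e v q = top-δ (V l) v (trans (sym (L-len l e v)) (trans (cong (λ z → + 2 ℤ.* + z) q) (sym total-level)))
    schubertGo-δ (suc k) [] () v q
    schubertGo-δ (suc k) (x ∷ xs) e v q with firstAscent (x ∷ xs) | firstAscent-spec x xs
    ... | nothing | no-ascent ¬0 ¬k = ⊥-elim (ℕP.<-irrefl (sym q) (subst (λ z → z ℕ.< suc k ℕ.+ len l) lenN (s≤s (ℕP.m≤n+m (len l) k))))
      where
      l = x ∷ xs
      lenN : len l ≡ N ℕ.* N
      lenN = ℤP.+-injective (ℤP.*-cancelˡ-≡ (+ 2) (+ len l) (+ (N ℕ.* N)) (trans (L-len l e v) (trans (decreasing-max (V l) (decreasing-list l e v ¬0 ¬k)) total-level)))
    ... | just 0 | ascent-0 p = ≐-trans (divDiff-0 𝟙 (D-𝟙 s₀) (schubertGo ty N k l′)) (≐-trans (D-cong s₀ (schubertGo-δ k l′ e′ v′ q′))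
        (λ w vw → trans (D-⊙ s₀ κ₀ (δ (V l′)) w) (cong (κ₀ *_) (trans (cong (λ z → D s₀ (δ z) w) eq) (D-δ s₀ (V l) (Up-s₀ l p) w vw)))))
      where
      l = x ∷ xs
      l′ = rmulS l 0
      e′ : length l′ ≡ N
      e′ = e
      eq : V {N} l′ ≡ V l · refl-of (s₀ {n})
      eq = trans (V-rmulNeg {N} l e zero) (·-cong (V l) (t-sym (pos zero) (neg zero)))
      v′ : Valid {N} (V l′)
      v′ = subst Valid (sym eq) (Valid-t (neg zero) (pos zero) v)
      q′ : k ℕ.+ len l′ ≡ N ℕ.* N
      q′ = trans (cong (k ℕ.+_) (len-up l l′ s₀ e e′ v eq (Up-s₀ l p))) (trans (ℕP.+-suc k (len l)) q)
    ... | just (suc i) | ascent-suc .i p r = ≐-trans (divDiff-suc i pN I J toI toJ adjIJ 𝟙 (D-𝟙 s) (schubertGo ty N k l′)) (≐-trans (D-cong s (schubertGo-δ k l′ e′ v′ q′))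
        (λ w vw → trans (D-⊙ s κ₀ (δ (V l′)) w) (cong (κ₀ *_) (trans (cong (λ z → D s (δ z) w) eq) (D-δ s (V l) (Up-s l r) w vw)))))
      where
      l = x ∷ xs
      pN : suc i ℕ.< N
      pN = subst (suc i ℕ.<_) e p
      open At i pN
      l′ = rmulS l (suc i)
      e′ : length l′ ≡ N
      e′ = trans (length-setAt (setAt l (suc i) (at l (suc (suc i)))) (suc (suc i)) (at l (suc i))) (trans (length-setAt l (suc i) (at l (suc (suc i)))) e)
      eq : V {N} l′ ≡ V l · refl-of s
      eq = trans (cong₂ (λ a b → V {N} (setAt (setAt l (suc a) (at l (suc b))) (suc b) (at l (suc a)))) (sym toI) (sym toJ))
        (V-swap {N} l e I J (λ z → ℕP.<-irrefl (cong toℕ z) (ℕP.≤-reflexive (sym adjIJ))))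
      v′ : Valid {N} (V l′)
      v′ = subst Valid (sym eq) (Valid-t (lo s) (hi s) v)
      q′ : k ℕ.+ len l′ ≡ N ℕ.* N
      q′ = trans (cong (k ℕ.+_) (len-up l l′ s e e′ v eq (Up-s l r))) (trans (ℕP.+-suc k (len l)) q)

    schubert-δ : ∀ l → length l ≡ N → Valid {N} (V l) → act (schubert ty N l) 𝟙 ≐ κ₀ ⊙ δ (V l)
    schubert-δ l e v = schubertGo-δ (N ℕ.* N ∸ len l) l e v (ℕP.m∸n+n≡m bound)
      where
      bound : len l ℕ.≤ N ℕ.* N
      bound = ℤP.drop‿+≤+ (ℤP.*-cancelˡ-≤-pos (+ len l) (+ (N ℕ.* N)) (+ 2) (subst₂ ℤ._≤_ (sym (L-len l e v)) total-level (L-bound (V l))))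

-- Every signed permutation is enumerated exactly once.

module Enumeration where

  open import Data.Nat using (_+_)
  open import Data.List.Relation.Binary.Permutation.Propositional using (prep; swap)
  open import Data.List.Relation.Binary.Permutation.Propositional.Properties using (shift)
  open OneLineNotation using (Unique-resp-↭)

  infix 4 _≟L_
  _≟L_ : (l l′ : List ℤ) → Dec (l ≡ l′)
  _≟L_ = ListP.≡-dec ℤP._≟_

  ind : ∀ {P : Set} → Dec P → ℕ
  ind d = if does d then 1 else 0

  ind-yes : ∀ {P : Set} (d : Dec P) → P → ind d ≡ 1
  ind-yes d p = cong (λ b → if b then 1 else 0) (dec-true d p)

  ind-no : ∀ {P : Set} (d : Dec P) → ¬ P → ind d ≡ 0
  ind-no d p = cong (λ b → if b then 1 else 0) (dec-false d p)

  ind-cong : ∀ {P Q : Set} (d : Dec P) (e : Dec Q) → (P → Q) → (Q → P) → ind d ≡ ind e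
  ind-cong (yes p) e f g = sym (ind-yes e (f p))
  ind-cong (no ¬p) e f g = sym (ind-no e (λ q → ¬p (g q)))

  occ : List ℤ → List (List ℤ) → ℕ
  occ W [] = 0
  occ W (l ∷ ls) = ind (l ≟L W) + occ W ls

  occ-++ : ∀ W ls ls′ → occ W (ls ++ ls′) ≡ occ W ls + occ W ls′
  occ-++ W [] ls′ = refl
  occ-++ W (l ∷ ls) ls′ = trans (cong (_+_ (ind (l ≟L W))) (occ-++ W ls ls′)) (sym (ℕP.+-assoc (ind (l ≟L W)) _ _))

  occ-map-same : ∀ x W ls → occ (x ∷ W) (map (x ∷_) ls) ≡ occ W ls
  occ-map-same x W [] = refl
  occ-map-same x W (l ∷ ls) = cong₂ _+_ (ind-cong ((x ∷ l) ≟L (x ∷ W)) (l ≟L W) ListP.∷-injectiveʳ (cong (x ∷_))) (occ-map-same x W ls)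

  occ-map-other : ∀ x y W ls → x ≢ y → occ (y ∷ W) (map (x ∷_) ls) ≡ 0
  occ-map-other x y W [] ne = refl
  occ-map-other x y W (l ∷ ls) ne = cong₂ _+_ (ind-no ((x ∷ l) ≟L (y ∷ W)) (λ e → ne (ListP.∷-injectiveˡ e))) (occ-map-other x y W ls ne)

  Small : ℕ → List ℤ → Set
  Small M = All (λ z → ∣ z ∣ ≢ M)

  -- The letter of absolute value M occurs once in a ++ y ∷ b and not in w, so an insertion can
  -- match only at the place of y, with the same sign and with w = a ++ b.
  occ-insert : ∀ M a y b y′ w → Small M a → Small M b → Small M w → ∣ y ∣ ≡ M → ∣ y′ ∣ ≡ M →
               occ (a ++ y ∷ b) (insertEverywhere y′ w) ≡ ind (y′ ℤP.≟ y) ℕ.* ind (w ≟L (a ++ b))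
  occ-insert M [] y b y′ [] sa sb sw ey ey′ = trans (ℕP.+-identityʳ _) (both (y′ ℤP.≟ y))
    where
    both : Dec (y′ ≡ y) → ind ((y′ ∷ []) ≟L (y ∷ b)) ≡ ind (y′ ℤP.≟ y) ℕ.* ind ([] ≟L b)
    both (no ne) = trans (ind-no ((y′ ∷ []) ≟L (y ∷ b)) (λ e → ne (ListP.∷-injectiveˡ e))) (sym (cong (ℕ._* ind ([] ≟L b)) (ind-no (y′ ℤP.≟ y) ne)))
    both (yes refl) = trans (ind-cong ((y ∷ []) ≟L (y ∷ b)) ([] ≟L b) ListP.∷-injectiveʳ (cong (y ∷_))) (sym (trans (cong (ℕ._* ind ([] ≟L b)) (ind-yes (y ℤP.≟ y) refl)) (ℕP.+-identityʳ _)))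
  occ-insert M [] y b y′ (x ∷ w) sa sb (x≢ ∷ sw) ey ey′ = trans (cong₂ _+_ (both (y′ ℤP.≟ y)) (occ-map-other x y b (insertEverywhere y′ w) (λ e → x≢ (trans (cong ∣_∣ e) ey)))) (ℕP.+-identityʳ _)
    where
    both : Dec (y′ ≡ y) → ind ((y′ ∷ x ∷ w) ≟L (y ∷ b)) ≡ ind (y′ ℤP.≟ y) ℕ.* ind ((x ∷ w) ≟L b)
    both (no ne) = trans (ind-no ((y′ ∷ x ∷ w) ≟L (y ∷ b)) (λ e → ne (ListP.∷-injectiveˡ e))) (sym (cong (ℕ._* ind ((x ∷ w) ≟L b)) (ind-no (y′ ℤP.≟ y) ne)))
    both (yes refl) = trans (ind-cong ((y ∷ x ∷ w) ≟L (y ∷ b)) ((x ∷ w) ≟L b) ListP.∷-injectiveʳ (cong (y ∷_))) (sym (trans (cong (ℕ._* ind ((x ∷ w) ≟L b)) (ind-yes (y ℤP.≟ y) refl)) (ℕP.+-identityʳ _)))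
  occ-insert M (c ∷ a) y b y′ [] (c≢ ∷ sa) sb sw ey ey′ = trans (ℕP.+-identityʳ _) (trans (ind-no ((y′ ∷ []) ≟L (c ∷ a ++ y ∷ b)) (λ e → c≢ (trans (cong ∣_∣ (sym (ListP.∷-injectiveˡ e))) ey′)))
    (sym (trans (cong (ind (y′ ℤP.≟ y) ℕ.*_) (ind-no ([] ≟L (c ∷ a ++ b)) (λ ()))) (ℕP.*-zeroʳ (ind (y′ ℤP.≟ y))))))
  occ-insert M (c ∷ a) y b y′ (x ∷ w) (c≢ ∷ sa) sb (x≢ ∷ sw) ey ey′ =
    trans (cong (_+ occ (c ∷ a ++ y ∷ b) (map (x ∷_) (insertEverywhere y′ w))) (ind-no ((y′ ∷ x ∷ w) ≟L (c ∷ a ++ y ∷ b)) (λ e → c≢ (trans (cong ∣_∣ (sym (ListP.∷-injectiveˡ e))) ey′)))) (go (x ℤP.≟ c))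
    where
    go : Dec (x ≡ c) → occ (c ∷ a ++ y ∷ b) (map (x ∷_) (insertEverywhere y′ w)) ≡ ind (y′ ℤP.≟ y) ℕ.* ind ((x ∷ w) ≟L (c ∷ a ++ b))
    go (yes refl) = trans (occ-map-same x (a ++ y ∷ b) (insertEverywhere y′ w)) (trans (occ-insert M a y b y′ w sa sb sw ey ey′)
      (cong (ind (y′ ℤP.≟ y) ℕ.*_) (ind-cong (w ≟L (a ++ b)) ((x ∷ w) ≟L (x ∷ a ++ b)) (cong (x ∷_)) ListP.∷-injectiveʳ)))
    go (no ne) = trans (occ-map-other x c (a ++ y ∷ b) (insertEverywhere y′ w) ne)
      (sym (trans (cong (ind (y′ ℤP.≟ y) ℕ.*_) (ind-no ((x ∷ w) ≟L (c ∷ a ++ b)) (λ e → ne (ListP.∷-injectiveˡ e)))) (ℕP.*-zeroʳ (ind (y′ ℤP.≟ y)))))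

  occ-insert± : ∀ N a y b w → Small (suc N) a → Small (suc N) b → Small (suc N) w → ∣ y ∣ ≡ suc N →
                occ (a ++ y ∷ b) (insertEverywhere (+ suc N) w ++ insertEverywhere -[1+ N ] w) ≡ ind (w ≟L (a ++ b))
  occ-insert± N a y b w sa sb sw ey = trans (occ-++ _ (insertEverywhere (+ suc N) w) _)
    (trans (cong₂ _+_ (occ-insert (suc N) a y b (+ suc N) w sa sb sw ey refl) (occ-insert (suc N) a y b -[1+ N ] w sa sb sw ey refl))
      (trans (sym (ℕP.*-distribʳ-+ (ind (w ≟L (a ++ b))) (ind (+ suc N ℤP.≟ y)) (ind (-[1+ N ] ℤP.≟ y)))) (trans (cong (ℕ._* ind (w ≟L (a ++ b))) (sign y ey)) (ℕP.+-identityʳ _))))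
    where
    sign : ∀ y → ∣ y ∣ ≡ suc N → ind (+ suc N ℤP.≟ y) + ind (-[1+ N ] ℤP.≟ y) ≡ 1
    sign (+ .(suc N)) refl = cong₂ _+_ (ind-yes (+ suc N ℤP.≟ + suc N) refl) (ind-no (-[1+ N ] ℤP.≟ + suc N) λ ())
    sign -[1+ .N ] refl = cong₂ _+_ (ind-no (+ suc N ℤP.≟ -[1+ N ]) λ ()) (ind-yes (-[1+ N ] ℤP.≟ -[1+ N ]) refl)

  occ-concatMap : ∀ W W′ (f : List ℤ → List (List ℤ)) ws → All (λ w → occ W (f w) ≡ ind (w ≟L W′)) ws → occ W (concatMap f ws) ≡ occ W′ ws
  occ-concatMap W W′ f [] [] = refl
  occ-concatMap W W′ f (w ∷ ws) (p ∷ ps) = trans (occ-++ W (f w) (concatMap f ws)) (cong₂ _+_ p (occ-concatMap W W′ f ws ps))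

  oneToN-suc : ∀ N → oneToN (suc N) ↭ suc N ∷ oneToN N
  oneToN-suc N = ↭-trans (↭-reflexive (trans (cong (map suc) (sym (ListP.upTo-∷ʳ N))) (ListP.map-++ suc (upTo N) (N ∷ [])))) (++-comm (oneToN N) (suc N ∷ []))

  insert-↭ : ∀ y w → All (λ l → map ∣_∣ l ↭ ∣ y ∣ ∷ map ∣_∣ w) (insertEverywhere y w)
  insert-↭ y [] = ↭-refl ∷ []
  insert-↭ y (x ∷ w) = ↭-refl ∷ AllP.map⁺ (All.map (λ p → ↭-trans (prep ∣ x ∣ p) (swap ∣ x ∣ ∣ y ∣ ↭-refl)) (insert-↭ y w))

  signedPerms-IsSPerm : ∀ N → All (IsSPerm N) (signedPerms N)
  signedPerms-IsSPerm zero = ↭-refl ∷ []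
  signedPerms-IsSPerm (suc N) = AllP.concat⁺ (AllP.map⁺ (All.map (λ {w} p → AllP.++⁺ (ext p (+ suc N) refl) (ext p -[1+ N ] refl)) (signedPerms-IsSPerm N)))
    where
    ext : ∀ {w} → IsSPerm N w → ∀ y → ∣ y ∣ ≡ suc N → All (IsSPerm (suc N)) (insertEverywhere y w)
    ext {w} p y e = All.map (λ q → ↭-trans q (↭-trans (subst (λ z → z ∷ map ∣_∣ w ↭ suc N ∷ oneToN N) (sym e) (prep (suc N) p)) (↭-sym (oneToN-suc N)))) (insert-↭ y w)

  IsSPerm-Small : ∀ N w → IsSPerm N w → Small (suc N) w
  IsSPerm-Small N w p = All.tabulate (λ {z} q e → bound (∈-map⁻ suc (∈-resp-↭ p (∈-map⁺ ∣_∣ q))) e)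
    where
    bound : ∀ {k} → Σ ℕ (λ j → j ∈ upTo N × k ≡ suc j) → k ≢ suc N
    bound (j , q , refl) e = ℕP.<⇒≢ (∈-upTo⁻ q) (ℕP.suc-injective e)

  IsSPerm-split : ∀ N W → IsSPerm (suc N) W → Σ (List ℤ) λ a → Σ ℤ λ y → Σ (List ℤ) λ b →
                  W ≡ a ++ y ∷ b × ∣ y ∣ ≡ suc N × IsSPerm N (a ++ b)
  IsSPerm-split N W p with ∈-map⁻ ∣_∣ (∈-resp-↭ (↭-sym p) (∈-resp-↭ (↭-sym (oneToN-suc N)) (here refl)))
  ... | y , q , e with ∈-∃++ q
  ...   | a , b , refl = a , y , b , refl , sym e , drop-∷ (↭-trans (↭-sym moved) (↭-trans p (oneToN-suc N)))
    where
    moved : map ∣_∣ (a ++ y ∷ b) ↭ suc N ∷ map ∣_∣ (a ++ b)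
    moved = subst₂ (λ u v → u ↭ suc N ∷ v) (sym (ListP.map-++ ∣_∣ a (y ∷ b))) (sym (ListP.map-++ ∣_∣ a b)) (subst (λ z → map ∣_∣ a ++ z ∷ map ∣_∣ b ↭ suc N ∷ (map ∣_∣ a ++ map ∣_∣ b)) e (shift (suc N) (map ∣_∣ a) (map ∣_∣ b)))

  -- Deleting the letter ±(N+1) of W recovers the only smaller permutation from which W is produced,
  -- in one place and with one sign.
  occ-signedPerms : ∀ N W → IsSPerm N W → occ W (signedPerms N) ≡ 1
  occ-signedPerms zero [] p = refl
  occ-signedPerms zero (x ∷ W) p with ∈-resp-↭ p (here refl)
  ... | ()
  occ-signedPerms (suc N) W p with IsSPerm-split N W p
  ... | a , y , b , refl , e , q = trans (occ-concatMap (a ++ y ∷ b) (a ++ b) _ (signedPerms N)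
      (All.map (λ {w} r → occ-insert± N a y b w (AllP.++⁻ˡ a small) (AllP.++⁻ʳ a small) (IsSPerm-Small N w r) e) (signedPerms-IsSPerm N))) (occ-signedPerms N (a ++ b) q)
    where
    small = IsSPerm-Small N (a ++ b) q

-- Structure constants as matrix coefficients.

module StructureConstants where

  open SignedIndices
  open SignedPermutations
  open ChevalleyOperators
  open PolynomialAction
  open InvariantIdeal
  open TopMonomials
  open OneLineNotation
  open SchubertClasses
  open Enumeration
  open RationalField
  open import Tactic.RingSolver using (solve-∀)

  opaque
    unfolding _+_

    occ-hit : ∀ c κ m → c * (κ * 1#) + m * (κ * c) ≡ (1# + m) * (κ * c)
    occ-hit = solve-∀ ring

    occ-miss : ∀ c κ m → c * (κ * 0#) + m ≡ m
    occ-miss = solve-∀ ring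

    natq-one : ∀ x → (1# + 0#) * x ≡ x
    natq-one = solve-∀ ring

    minus-zero-eq : ∀ x y → x + - y ≡ 0# → x ≡ y
    minus-zero-eq x y e = trans (r x y) (trans (cong (_+ y) e) (r′ y))
      where
      r : ∀ x y → x ≡ (x + - y) + y
      r = solve-∀ ring
      r′ : ∀ y → 0# + y ≡ y
      r′ = solve-∀ ring

  module Expansion (ty : RootType) {n : ℕ} where
    open Schubert ty {n} public

    private
      N = suc n

    rest : (List ℤ → ℚ) → List (List ℤ) → Poly N
    rest c ls = sumP (map (λ w → scaleP (c w) (schubert ty N w)) ls)

    -- Over an arbitrary list ls the coefficient at W appears as often as W occurs; over the full
    -- enumeration this is once by `occ-signedPerms`.
    act-sum : ∀ (c : List ℤ → ℚ) W → length W ≡ N → Valid {N} (V W) → ∀ ls → All (IsSPerm N) ls →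
      act (rest c ls) 𝟙 (V W) ≡ natq (occ W ls) * (κ₀ * c W)
    act-sum c W e vW [] [] = sym (zeroˡ _)
    act-sum c W e vW (l ∷ ls) (p ∷ ps) with IsSPerm-V
      where
      IsSPerm-V : Valid {N} (V l) × length l ≡ N
      IsSPerm-V = FromPerm.valid l p , FromPerm.len-l l p
    ... | v , el with l ≟L W
    ...   | yes refl = trans (ev-++ pos (scaleP (c l) (schubert ty N l)) (rest c ls) 𝟙 (V l))
              (trans (cong₂ _+_ (trans (ev-scale pos (c l) (schubert ty N l) 𝟙 (V l)) (cong (c l *_) (trans (schubert-δ l el v (V l) v) (cong (κ₀ *_) (δ-self (V l)))))) (act-sum c l e vW ls ps)) (occ-hit (c l) κ₀ _))
    ...   | no ne = trans (ev-++ pos (scaleP (c l) (schubert ty N l)) (rest c ls) 𝟙 (V W)) (trans (cong₂ _+_ (trans (ev-scale pos (c l) (schubert ty N l) 𝟙 (V W)) (cong (c l *_) (trans (schubert-δ l el v (V W) vW) (cong (κ₀ *_) (δ-other (λ q → ne (sym (V-injective W l e el q)))))))) (act-sum c W e vW ls ps)) (occ-miss (c l) κ₀ _))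

    -- Apply the expansion to 𝟙: the ideal kills it, and 𝔖_w maps it to κ₀ δ_w.
    expansion-coeff : ∀ u v (c : List ℤ → ℚ) W → length u ≡ N → Valid {N} (V u) → length v ≡ N → Valid {N} (V v) → IsSPerm N W →
      IsExpansion ty N u v c → c W ≡ act (schubert ty N v) (δ (V u)) (V W)
    expansion-coeff u v c W eu vu ev′ vv pW ex = *-cancelˡ κ₀ κ≢0 (begin
      κ₀ * c W ≡⟨ sym (natq-one (κ₀ * c W)) ⟩
      (1# + 0#) * (κ₀ * c W) ≡⟨ cong (λ k → natq k * (κ₀ * c W)) (sym (occ-signedPerms N W pW)) ⟩
      natq (occ W (signedPerms N)) * (κ₀ * c W) ≡⟨ sym (act-sum c W (FromPerm.len-l W pW) vW (signedPerms N) (signedPerms-IsSPerm N)) ⟩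
      act rhs 𝟙 (V W) ≡⟨ sym (minus-zero-eq _ _ (trans (trans (cong (_+_ (act lhs 𝟙 (V W))) (sym (ev-neg pos rhs 𝟙 (V W)))) (sym (ev-++ pos lhs (-ᴾ rhs) 𝟙 (V W)))) (ideal-𝟙 (lhs -ᴾ rhs) ex (V W) vW))) ⟩
      act lhs 𝟙 (V W) ≡⟨ ev-* pos (schubert ty N u) (schubert ty N v) 𝟙 (V W) vW ⟩
      act (schubert ty N u) (act (schubert ty N v) 𝟙) (V W) ≡⟨ act-comm (schubert ty N u) (schubert ty N v) 𝟙 (V W) vW ⟩
      act (schubert ty N v) (act (schubert ty N u) 𝟙) (V W) ≡⟨ act-cong (schubert ty N v) (schubert-δ u eu vu) (V W) vW ⟩
      act (schubert ty N v) (κ₀ ⊙ δ (V u)) (V W) ≡⟨ ev-Linear pos (schubert ty N v) .⊙-hom κ₀ (δ (V u)) (V W) vW ⟩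
      κ₀ * act (schubert ty N v) (δ (V u)) (V W) ∎)
      where
      open ≡-Reasoning
      vW = FromPerm.valid W pW
      lhs = schubert ty N u *ᴾ schubert ty N v
      rhs = rest c (signedPerms N)

-- Deleting a position: order, length and rank statistics.

module DeletedPosition where

  open SignedIndices
  open SignedPermutations
  open LongestElement using (Valid-bounded)
  open ℤSum

  -- Closes the gap left by the removed value Q. It is strictly increasing off Q but takes the value
  -- Q at both Q and Q + 1, whence the inequalities required of its arguments.
  sh : ℕ → ℕ → ℕ
  sh Q m = if does (Q ℕ.<? m) then m ∸ 1 else m

  sh-> : ∀ {Q m} → Q ℕ.< m → sh Q m ≡ m ∸ 1
  sh-> {Q} {m} p = cong (λ b → if b then m ∸ 1 else m) (dec-true (Q ℕ.<? m) p)

  sh-≤ : ∀ {Q m} → ¬ (Q ℕ.< m) → sh Q m ≡ m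
  sh-≤ {Q} {m} p = cong (λ b → if b then m ∸ 1 else m) (dec-false (Q ℕ.<? m) p)

  shrink-+ : ∀ Q m → shrink Q (+ m) ≡ + sh Q m
  shrink-+ Q m with does (Q ℕ.<? m)
  ... | true = refl
  ... | false = refl

  shrink-- : ∀ Q m → shrink Q -[1+ m ] ≡ ℤ.- (+ sh Q (suc m))
  shrink-- Q m with does (Q ℕ.<? suc m)
  ... | true = refl
  ... | false = refl

  sh-mono : ∀ {Q a b} → a ≢ Q → b ≢ Q → a ℕ.< b → sh Q a ℕ.< sh Q b
  sh-mono {Q} {a} {b} a≢ b≢ p with ℕP.<-cmp Q a | ℕP.<-cmp Q b
  ... | tri≈ _ e _ | _ = ⊥-elim (a≢ (sym e))
  ... | _ | tri≈ _ e _ = ⊥-elim (b≢ (sym e))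
  ... | tri< x _ _ | tri> y _ _ = ⊥-elim (y (ℕP.<-trans x p))
  ... | tri< x _ _ | tri< y _ _ = subst₂ ℕ._<_ (sym (sh-> x)) (sym (sh-> y)) (pred< p x)
    where pred< : ∀ {a b} → a ℕ.< b → Q ℕ.< a → a ∸ 1 ℕ.< b ∸ 1
          pred< {suc a} {suc b} (s≤s r) _ = r
  ... | tri> x _ z | tri< y _ _ = subst₂ ℕ._<_ (sym (sh-≤ x)) (sym (sh-> y)) (ℕP.<-≤-trans z (ℕP.≤-pred (subst (suc Q ℕ.≤_) (sym (ℕP.suc-pred b {{ℕ.>-nonZero (ℕP.≤-<-trans z≤n y)}})) y)))
  ... | tri> x _ _ | tri> y _ _ = subst₂ ℕ._<_ (sym (sh-≤ x)) (sym (sh-≤ y)) p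

  sh-positive : ∀ {Q m} → 1 ℕ.≤ Q → 1 ℕ.≤ m → m ≢ Q → 1 ℕ.≤ sh Q m
  sh-positive {Q} {m} q p m≢ with Q ℕ.<? m
  ... | no r = subst (1 ℕ.≤_) (sym (sh-≤ r)) p
  ... | yes r = subst (1 ℕ.≤_) (sym (sh-> r)) (ℕP.≤-trans q (ℕP.≤-pred (subst (suc Q ℕ.≤_) (sym (ℕP.suc-pred m {{ℕ.>-nonZero p}})) r)))

  sh-bound : ∀ {Q m N} → m ℕ.≤ N → Q ℕ.≤ N → m ≢ Q → 1 ℕ.≤ N → sh Q m ℕ.< N
  sh-bound {Q} {m} {N} p q m≢ pN with ℕP.<-cmp Q m
  ... | tri≈ _ e _ = ⊥-elim (m≢ (sym e))
  ... | tri< r _ _ = subst (ℕ._< N) (sym (sh-> r)) (ℕP.<-≤-trans (subst (m ∸ 1 ℕ.<_) (ℕP.suc-pred m {{ℕ.>-nonZero (ℕP.≤-<-trans z≤n r)}}) (ℕP.n<1+n (m ∸ 1))) p)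
  ... | tri> r _ z = subst (ℕ._< N) (sym (sh-≤ r)) (ℕP.<-≤-trans z q)

  shrink-neg : ∀ Q z → shrink Q (ℤ.- z) ≡ ℤ.- shrink Q z
  shrink-neg Q (+ 0) = trans (shrink-+ Q 0) (sym (trans (cong ℤ.-_ (shrink-+ Q 0)) (zeros (Q ℕ.<? 0))))
    where zeros : Dec (Q ℕ.< 0) → ℤ.- (+ sh Q 0) ≡ + sh Q 0
          zeros (no p) = subst (λ k → ℤ.- (+ k) ≡ + k) (sym (sh-≤ p)) refl
  shrink-neg Q (+ suc m) = trans (shrink-- Q m) (cong ℤ.-_ (sym (shrink-+ Q (suc m))))
  shrink-neg Q -[1+ m ] = trans (shrink-+ Q (suc m)) (sym (trans (cong ℤ.-_ (shrink-- Q m)) (ℤP.neg-involutive _)))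

  shrink-mono : ∀ {Q} → 1 ℕ.≤ Q → ∀ x y → ∣ x ∣ ≢ Q → ∣ y ∣ ≢ Q → x ℤ.< y → shrink Q x ℤ.< shrink Q y
  shrink-mono {Q} q (+ a) (+ b) x≢ y≢ (+<+ p) = subst₂ ℤ._<_ (sym (shrink-+ Q a)) (sym (shrink-+ Q b)) (+<+ (sh-mono x≢ y≢ p))
  shrink-mono {Q} q -[1+ a ] -[1+ b ] x≢ y≢ (-<- p) = subst₂ ℤ._<_ (sym (shrink-- Q a)) (sym (shrink-- Q b)) (ℤP.neg-mono-< (+<+ (sh-mono y≢ x≢ (s≤s p))))
  shrink-mono {Q} q -[1+ a ] (+ b) x≢ y≢ -<+ = subst₂ ℤ._<_ (sym (shrink-- Q a)) (sym (shrink-+ Q b)) (negative (sh-positive q (s≤s z≤n) x≢))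
    where negative : ∀ {k m} → 1 ℕ.≤ k → ℤ.- (+ k) ℤ.< + m
          negative (s≤s _) = -<+

  shrink-reflect : ∀ {Q} → 1 ℕ.≤ Q → ∀ x y → ∣ x ∣ ≢ Q → ∣ y ∣ ≢ Q → shrink Q x ℤ.< shrink Q y → x ℤ.< y
  shrink-reflect {Q} q x y x≢ y≢ p with ℤP.<-cmp x y
  ... | tri< r _ _ = r
  ... | tri≈ _ refl _ = ⊥-elim (ℤP.<-irrefl refl p)
  ... | tri> _ _ r = ⊥-elim (ℤP.<-asym p (shrink-mono q y x y≢ x≢ r))

  shrink-injective : ∀ {Q} → 1 ℕ.≤ Q → ∀ x y → ∣ x ∣ ≢ Q → ∣ y ∣ ≢ Q → shrink Q x ≡ shrink Q y → x ≡ y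
  shrink-injective {Q} q x y x≢ y≢ e with ℤP.<-cmp x y
  ... | tri< r _ _ = ⊥-elim (ℤP.<-irrefl e (shrink-mono q x y x≢ y≢ r))
  ... | tri≈ _ r _ = r
  ... | tri> _ _ r = ⊥-elim (ℤP.<-irrefl (sym e) (shrink-mono q y x y≢ x≢ r))

  shrink-below : ∀ {Q N} x → ∣ x ∣ ℕ.≤ N → Q ℕ.≤ N → ∣ x ∣ ≢ Q → 1 ℕ.≤ N → shrink Q x ℤ.< + N
  shrink-below {Q} {N} (+ m) p q ne pN = subst (ℤ._< + N) (sym (shrink-+ Q m)) (+<+ (sh-bound p q ne pN))
  shrink-below {Q} {suc N} -[1+ m ] p q ne pN = subst (ℤ._< + suc N) (sym (shrink-- Q m)) (negative (sh Q (suc m)))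
    where negative : ∀ k → ℤ.- (+ k) ℤ.< + suc N
          negative zero = +<+ (s≤s z≤n)
          negative (suc k) = -<+

  -- Rearrangement inequality: pairing x with its image τ x under the reflection writes twice the
  -- difference as the sum of (f(x) - f(τ x)) (g(w(x)) - g(w(τ x))). The two factors never have
  -- opposite signs, because a shortening reflection joins inverted indices.
  rank-mono : ∀ {N} (f : SI N → ℤ) (g : ℤ → ℤ) → (∀ x y → loc x ℤ.< loc y → f x ℤ.≤ f y) → (∀ a b → a ℤ.< b → g b ℤ.≤ g a) →
              ∀ w a b → Down w a b → sumS (λ x → f x ℤ.* g (ev (w · t a b) x)) ℤ.≤ sumS (λ x → f x ℤ.* g (ev w x))
  rank-mono f g fm gm w a b down = 0≤m-n (half-nonneg _ (subst (+ 0 ℤ.≤_) eq (sumS-nonneg (λ x → (f x ℤ.- f (τ x)) ℤ.* (g (ev w x) ℤ.- g (ev w (τ x)))) term)))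
    where
    τ = t a b
    A B : _ → ℤ
    A x = f x ℤ.* g (ev w x)
    B x = f x ℤ.* g (ev w (τ x))
    expand : ∀ f f′ g g′ → (f ℤ.- f′) ℤ.* (g ℤ.- g′) ≡ (f ℤ.* g ℤ.- f ℤ.* g′) ℤ.+ (f′ ℤ.* g′ ℤ.- f′ ℤ.* g)
    expand = ℤSolver.solve-∀
    double : ∀ x → x ℤ.+ x ≡ + 2 ℤ.* x
    double = ℤSolver.solve-∀
    eq : sumS (λ x → (f x ℤ.- f (τ x)) ℤ.* (g (ev w x) ℤ.- g (ev w (τ x)))) ≡ + 2 ℤ.* (sumS A ℤ.- sumS (λ x → f x ℤ.* g (ev (w · t a b) x)))
    eq = trans (sumS-cong (λ x → expand (f x) (f (τ x)) (g (ev w x)) (g (ev w (τ x)))))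
      (trans (sumS-+ (λ x → A x ℤ.- B x) (λ x → A (τ x) ℤ.- f (τ x) ℤ.* g (ev w x)))
      (trans (cong₂ ℤ._+_ (sumS-- A B) (trans (sumS-- (λ x → A (τ x)) (λ x → f (τ x) ℤ.* g (ev w x))) (cong₂ ℤ._-_ (sumS-t a b A)
          (trans (sumS-cong (λ x → cong (λ z → f (τ x) ℤ.* g (ev w z)) (sym (t-t a b x)))) (sumS-t a b B)))))
      (trans (double _) (cong (λ z → + 2 ℤ.* (sumS A ℤ.- z)) (sumS-cong (λ x → cong (λ z → f x ℤ.* g z) (sym (ev-t w a b x))))))))
    term : ∀ x → + 0 ℤ.≤ (f x ℤ.- f (τ x)) ℤ.* (g (ev w x) ℤ.- g (ev w (τ x)))
    term x with ℤP.<-cmp (loc x) (loc (τ x))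
    ... | tri≈ _ e _ = ℤP.≤-reflexive (sym (trans (cong (ℤ._* (g (ev w x) ℤ.- g (ev w (τ x)))) (trans (cong (λ z → f z ℤ.- f (τ x)) (loc-injective _ _ e)) (ℤP.+-inverseʳ (f (τ x))))) (ℤP.*-zeroˡ (g (ev w x) ℤ.- g (ev w (τ x))))))
    ... | tri< p _ _ = subst (+ 0 ℤ.≤_) (r (f x) (f (τ x)) (g (ev w x)) (g (ev w (τ x)))) (*-nonneg (ℤP.i≤j⇒0≤j-i (fm x (τ x) p)) (ℤP.i≤j⇒0≤j-i (gm _ _ (down x p))))
      where r : ∀ a b c d → (b ℤ.- a) ℤ.* (d ℤ.- c) ≡ (a ℤ.- b) ℤ.* (c ℤ.- d)
            r = ℤSolver.solve-∀
    ... | tri> _ _ p = *-nonneg (ℤP.i≤j⇒0≤j-i (fm (τ x) x p)) (ℤP.i≤j⇒0≤j-i (gm _ _ (subst (λ z → ev w z ℤ.< ev w (τ x)) (t-t a b x) (down (τ x) (subst (λ z → loc (τ x) ℤ.< loc z) (sym (t-t a b x)) p)))))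

  -- Relabelling that allows deletion to take place within the same N: the vacated position P
  -- becomes the last one and the others keep their order.
  record Cycle {n : ℕ} (P : Fin (suc n)) : Set where
    field
      σ ρ    : Fin (suc n) → Fin (suc n)
      σρ     : ∀ i → σ (ρ i) ≡ i
      ρσ     : ∀ i → ρ (σ i) ≡ i
      σ-last : σ (fromℕ n) ≡ P
      σ-mono : ∀ i j → i ≢ fromℕ n → j ≢ fromℕ n → toℕ i ℕ.< toℕ j → toℕ (σ i) ℕ.< toℕ (σ j)

  -- F deletes the position P together with the value q = w(P), and puts the
  -- value N at the new last position.
  module Deletion {n : ℕ} (P : Fin (suc n)) (q : ℤ) (q≥1 : 1 ℕ.≤ ∣ q ∣) (cyc : Cycle P) where
    open Cycle cyc

    private
      N = suc n
      S = SI N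

    Q : ℕ
    Q = ∣ q ∣

    ℓ p′ : S
    ℓ = pos (fromℕ n)
    p′ = pos P

    Off : S → S → Set
    Off c x = x ≢ c × x ≢ opp c

    π π⁻ : S → S
    π (pos i) = pos (σ i)
    π (neg i) = neg (σ i)
    π⁻ (pos i) = pos (ρ i)
    π⁻ (neg i) = neg (ρ i)

    ππ⁻ : ∀ x → π (π⁻ x) ≡ x
    ππ⁻ (pos i) = cong pos (σρ i)
    ππ⁻ (neg i) = cong neg (σρ i)

    π⁻π : ∀ x → π⁻ (π x) ≡ x
    π⁻π (pos i) = cong pos (ρσ i)
    π⁻π (neg i) = cong neg (ρσ i)

    π-odd : Odd π
    π-odd (pos i) = refl
    π-odd (neg i) = refl

    π⁻-odd : Odd π⁻
    π⁻-odd (pos i) = refl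
    π⁻-odd (neg i) = refl

    π-injective : ∀ {x y} → π x ≡ π y → x ≡ y
    π-injective {x} {y} e = trans (sym (π⁻π x)) (trans (cong π⁻ e) (π⁻π y))

    π⁻-injective : ∀ {x y} → π⁻ x ≡ π⁻ y → x ≡ y
    π⁻-injective {x} {y} e = trans (sym (ππ⁻ x)) (trans (cong π e) (ππ⁻ y))

    πℓ : π ℓ ≡ p′
    πℓ = cong pos σ-last

    π-off : ∀ x → Off ℓ x → Off p′ (π x)
    π-off x (a , b) = (λ e → a (π-injective (trans e (sym πℓ)))) , (λ e → b (π-injective (trans e (cong opp (sym πℓ)))))

    π⁻-off : ∀ x → Off p′ x → Off ℓ (π⁻ x)
    π⁻-off x (a , b) = (λ e → a (trans (sym (ππ⁻ x)) (trans (cong π e) πℓ))) , (λ e → b (trans (sym (ππ⁻ x)) (trans (cong π e) (cong opp πℓ))))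

    off? : ∀ c x → Off c x ⊎ (x ≡ c ⊎ x ≡ opp c)
    off? c x with x ≟S c | x ≟S opp c
    ... | yes e | _ = inj₂ (inj₁ e)
    ... | no _ | yes e = inj₂ (inj₂ e)
    ... | no a | no b = inj₁ (a , b)

    Off-opp : ∀ {c x} → Off c x → Off c (opp x)
    Off-opp {c} {x} (a , b) = (λ e → b (trans (sym (opp-opp x)) (cong opp e))) , (λ e → a (opp-injective e))

    π-mono : ∀ x y → Off ℓ x → Off ℓ y → loc x ℤ.< loc y → loc (π x) ℤ.< loc (π y)
    π-mono (pos i) (pos j) (a , _) (b , _) (+<+ (s≤s p)) = +<+ (s≤s (σ-mono i j (λ e → a (cong pos e)) (λ e → b (cong pos e)) p))
    π-mono (neg i) (neg j) (_ , a) (_ , b) (-<- p) = -<- (σ-mono j i (λ e → b (cong neg e)) (λ e → a (cong neg e)) p)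
    π-mono (neg i) (pos j) _ _ _ = -<+

    π-reflect : ∀ x y → Off ℓ x → Off ℓ y → loc (π x) ℤ.< loc (π y) → loc x ℤ.< loc y
    π-reflect x y ox oy p with ℤP.<-cmp (loc x) (loc y)
    ... | tri< r _ _ = r
    ... | tri≈ _ e _ = ⊥-elim (ℤP.<-irrefl (cong (loc ∘ π) (loc-injective x y e)) p)
    ... | tri> _ _ r = ⊥-elim (ℤP.<-asym p (π-mono y x oy ox r))

    F : W {N} → W {N}
    F w = tabulate (λ i → if does (i FinP.≟ fromℕ n) then + N else shrink Q (ev w (pos (σ i))))

    F-ℓ : ∀ w → ev (F w) ℓ ≡ + N
    F-ℓ w = trans (VecP.lookup∘tabulate (λ i → if does (i FinP.≟ fromℕ n) then + N else shrink Q (ev w (pos (σ i)))) (fromℕ n))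
      (cong (λ b → if b then + N else shrink Q (ev w (pos (σ (fromℕ n))))) (dec-true (fromℕ n FinP.≟ fromℕ n) refl))

    F-off : ∀ w x → Off ℓ x → ev (F w) x ≡ shrink Q (ev w (π x))
    F-off w (pos i) (a , _) = trans (VecP.lookup∘tabulate (λ i → if does (i FinP.≟ fromℕ n) then + N else shrink Q (ev w (pos (σ i)))) i)
      (cong (λ b → if b then + N else shrink Q (ev w (pos (σ i)))) (dec-false (i FinP.≟ fromℕ n) (λ e → a (cong pos e))))
    F-off w (neg i) o = trans (cong ℤ.-_ (F-off w (pos i) (Off-opp o))) (sym (shrink-neg Q (ev w (pos (σ i)))))

    F-oppℓ : ∀ w → ev (F w) (opp ℓ) ≡ ℤ.- (+ N)
    F-oppℓ w = cong ℤ.-_ (F-ℓ w)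

    record Good (w : W {N}) : Set where
      field
        valid : Valid w
        at-P  : ev w p′ ≡ q
    open Good public

    module _ {w : W {N}} (g : Good w) where

      off-abs : ∀ x → Off p′ x → ∣ ev w x ∣ ≢ Q
      off-abs x (a , b) e with LengthFormula.abs-≡ (ev w x) q e
      ... | inj₁ r = a (g .valid .inj x p′ (trans r (sym (g .at-P))))
      ... | inj₂ r = b (g .valid .inj x (opp p′) (trans r (sym (trans (ev-opp w p′) (cong ℤ.-_ (g .at-P))))))

      F-abs-off : ∀ x → Off ℓ x → ∣ ev w (π x) ∣ ≢ Q
      F-abs-off x o = off-abs (π x) (π-off x o)

      Q≤N : Q ℕ.≤ N
      Q≤N = subst (λ z → ∣ z ∣ ℕ.≤ N) (g .at-P) (Valid-bounded (g .valid) p′)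

      F-below : ∀ x → x ≢ ℓ → ev (F w) x ℤ.< + N
      F-below x ne with off? ℓ x
      ... | inj₁ o = subst (ℤ._< + N) (sym (F-off w x o)) (shrink-below (ev w (π x)) (Valid-bounded (g .valid) (π x)) Q≤N (F-abs-off x o) (s≤s z≤n))
      ... | inj₂ (inj₁ e) = ⊥-elim (ne e)
      ... | inj₂ (inj₂ e) = subst (ℤ._< + N) (sym (trans (cong (ev (F w)) e) (F-oppℓ w))) -<+

      F-mono : ∀ x y → Off ℓ x → Off ℓ y → ev w (π x) ℤ.< ev w (π y) → ev (F w) x ℤ.< ev (F w) y
      F-mono x y ox oy p = subst₂ ℤ._<_ (sym (F-off w x ox)) (sym (F-off w y oy)) (shrink-mono q≥1 _ _ (F-abs-off x ox) (F-abs-off y oy) p)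

      F-reflect : ∀ x y → Off ℓ x → Off ℓ y → ev (F w) x ℤ.< ev (F w) y → ev w (π x) ℤ.< ev w (π y)
      F-reflect x y ox oy p = shrink-reflect q≥1 _ _ (F-abs-off x ox) (F-abs-off y oy) (subst₂ ℤ._<_ (F-off w x ox) (F-off w y oy) p)

      F-Inj : Inj (F w)
      F-Inj x y e with off? ℓ x | off? ℓ y
      ... | inj₁ ox | inj₁ oy = π-injective (g .valid .inj _ _ (shrink-injective q≥1 _ _ (F-abs-off x ox) (F-abs-off y oy) (trans (sym (F-off w x ox)) (trans e (F-off w y oy)))))
      ... | inj₂ (inj₁ refl) | inj₂ (inj₁ refl) = refl
      ... | inj₂ (inj₂ refl) | inj₂ (inj₂ refl) = refl
      ... | inj₂ (inj₁ refl) | inj₁ oy = ⊥-elim (ℤP.<-irrefl (trans (sym e) (F-ℓ w)) (F-below y (proj₁ oy)))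
      ... | inj₁ ox | inj₂ (inj₁ refl) = ⊥-elim (ℤP.<-irrefl (trans e (F-ℓ w)) (F-below x (proj₁ ox)))
      ... | inj₂ (inj₁ refl) | inj₂ (inj₂ refl) = ⊥-elim (ℤP.<-irrefl (trans (sym e) (F-ℓ w)) (F-below (opp ℓ) (opp-≢ ℓ)))
      ... | inj₂ (inj₂ refl) | inj₂ (inj₁ refl) = ⊥-elim (ℤP.<-irrefl (trans e (F-ℓ w)) (F-below (opp ℓ) (opp-≢ ℓ)))
      ... | inj₂ (inj₂ refl) | inj₁ oy = ⊥-elim (ℤP.<-irrefl (trans (ev-opp (F w) y) (trans (cong ℤ.-_ (sym e)) (trans (cong ℤ.-_ (F-oppℓ w)) refl))) (F-below (opp y) (proj₁ (Off-opp oy))))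
      ... | inj₁ ox | inj₂ (inj₂ refl) = ⊥-elim (ℤP.<-irrefl (trans (ev-opp (F w) x) (trans (cong ℤ.-_ e) (trans (cong ℤ.-_ (F-oppℓ w)) refl))) (F-below (opp x) (proj₁ (Off-opp ox))))

      Good-t : ∀ a b → Off p′ a → Off p′ b → Good (w · t a b)
      Good-t a b oa ob .valid = Valid-t a b (g .valid)
      Good-t a b oa ob .at-P = trans (ev-t w a b p′) (trans (cong (ev w) (t-f a b (λ e → proj₁ oa (sym e)) (λ e → proj₁ ob (sym e))
        (λ e → proj₂ oa (trans (sym (opp-opp a)) (cong opp (sym e)))) (λ e → proj₂ ob (trans (sym (opp-opp b)) (cong opp (sym e)))))) (g .at-P))

    t-off : ∀ {c} a b x → Off c a → Off c b → Off c x → Off c (t a b x)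
    t-off {c} a b x oa ob ox with t-case a b x
    ... | case-a refl = subst (Off c) (sym (t-a a b)) ob
    ... | case-b refl = subst (Off c) (sym (t-b a b)) oa
    ... | case-oa refl = subst (Off c) (sym (t-oa a b)) (Off-opp ob)
    ... | case-ob refl = subst (Off c) (sym (t-ob a b)) (Off-opp oa)
    ... | case-f p r u v = subst (Off c) (sym (t-f a b p r u v)) ox

    t-fix-c : ∀ {c} a b → Off c a → Off c b → t a b c ≡ c
    t-fix-c a b oa ob = t-f a b (λ e → proj₁ oa (sym e)) (λ e → proj₁ ob (sym e))
      (λ e → proj₂ oa (trans (sym (opp-opp a)) (cong opp (sym e)))) (λ e → proj₂ ob (trans (sym (opp-opp b)) (cong opp (sym e))))

    -- The hypotheses keep P, and hence the last position after relabelling, fixed by the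
    -- reflections, so q is removed and N inserted on either side alike.
    F-t : ∀ w a b → Off p′ a → Off p′ b → F (w · t a b) ≡ F w · t (π⁻ a) (π⁻ b)
    F-t w a b oa ob = ev-ext (λ x → trans (go x (off? ℓ x)) (sym (ev-t (F w) (π⁻ a) (π⁻ b) x)))
      where
      oa′ = π⁻-off a oa
      ob′ = π⁻-off b ob
      go : ∀ x → Off ℓ x ⊎ (x ≡ ℓ ⊎ x ≡ opp ℓ) → ev (F (w · t a b)) x ≡ ev (F w) (t (π⁻ a) (π⁻ b) x)
      go x (inj₂ (inj₁ refl)) = trans (F-ℓ (w · t a b)) (sym (trans (cong (ev (F w)) (t-fix-c (π⁻ a) (π⁻ b) oa′ ob′)) (F-ℓ w)))
      go x (inj₂ (inj₂ refl)) = trans (F-oppℓ (w · t a b)) (sym (trans (cong (ev (F w)) (trans (t-odd (π⁻ a) (π⁻ b) ℓ) (cong opp (t-fix-c (π⁻ a) (π⁻ b) oa′ ob′)))) (F-oppℓ w)))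
      go x (inj₁ o) = trans (F-off (w · t a b) x o) (trans (cong (shrink Q) (trans (ev-t w a b (π x)) (cong (ev w) conj)))
        (sym (F-off w (t (π⁻ a) (π⁻ b) x) (t-off (π⁻ a) (π⁻ b) x oa′ ob′ o))))
        where
        conj : t a b (π x) ≡ π (t (π⁻ a) (π⁻ b) x)
        conj = trans (cong₂ (λ u v → t u v (π x)) (sym (ππ⁻ a)) (sym (ππ⁻ b))) (t-conj π π-odd π-injective (π⁻ a) (π⁻ b) x)

    -- gt depends on the set of values alone and is constant under reflections; s is the quantity
    -- through which the arrangement around P enters the length.
    s gt : W {N} → ℤ
    s w = sumS (λ x → iv (loc p′ ℤ.<? loc x) ℤ.* iv (ev w x ℤ.<? q))
    gt w = sumS (λ x → iv (q ℤ.<? ev w x))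

    after : ℤ
    after = sumS (λ (x : S) → iv (loc p′ ℤ.<? loc x))

    u : S → ℤ
    u x = + 1 ℤ.- (iv (x ≟S p′) ℤ.+ iv (x ≟S opp p′))

    u-off : ∀ x → Off p′ x → u x ≡ + 1
    u-off x (a , b) = cong (ℤ._-_ (+ 1)) (cong₂ ℤ._+_ (iv-no (x ≟S p′) a) (iv-no (x ≟S opp p′) b))

    u-p′ : u p′ ≡ + 0
    u-p′ = cong (ℤ._-_ (+ 1)) (cong₂ ℤ._+_ (iv-yes (p′ ≟S p′) refl) (iv-no (p′ ≟S opp p′) (λ e → opp-≢ p′ (sym e))))

    u-opp : u (opp p′) ≡ + 0
    u-opp = cong (ℤ._-_ (+ 1)) (cong₂ ℤ._+_ (iv-no (opp p′ ≟S p′) (opp-≢ p′)) (iv-yes (opp p′ ≟S opp p′) refl))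

    module Length {w : W {N}} (g : Good w) where

      f : S → S → ℤ
      f x y = wt x y ℤ.* lt x y

      -- In F w the value N at the last position, and -N at the first, form no inversion with
      -- anything. The remaining pairs keep their order in position and in value, so the sum is that
      -- of w with the factors u removing ±P.
      L-F : L (F w) ≡ sumS² (λ x y → u x ℤ.* u y ℤ.* (f x y ℤ.* inv w x y))
      L-F = trans (L-def (F w)) (trans (sym (sumS²-reindex π⁻ π π⁻π ππ⁻ (λ x y → f x y ℤ.* inv (F w) x y))) (sumS²-cong (λ x y → term x y (off? p′ x) (off? p′ y))))
        where
        not-lt : ∀ x y → ¬ (loc x ℤ.< loc y) → f x y ℤ.* inv (F w) x y ≡ + 0
        not-lt x y p = trans (cong (ℤ._* inv (F w) x y) (trans (cong (wt x y ℤ.*_) (iv-no (loc x ℤ.<? loc y) p)) (ℤP.*-zeroʳ (wt x y)))) (ℤP.*-zeroˡ (inv (F w) x y))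
        not-inv : ∀ x y → ¬ (ev (F w) y ℤ.< ev (F w) x) → f x y ℤ.* inv (F w) x y ≡ + 0
        not-inv x y p = trans (cong (f x y ℤ.*_) (iv-no (ev (F w) y ℤ.<? ev (F w) x) p)) (ℤP.*-zeroʳ (f x y))
        max-loc : ∀ y → ¬ (loc ℓ ℤ.< loc y)
        max-loc (pos j) (+<+ (s≤s p)) = ℕP.<⇒≱ p (ℕP.≤-trans (ℕP.≤-pred (FinP.toℕ<n j)) (ℕP.≤-reflexive (sym (FinP.toℕ-fromℕ n))))
        min-loc : ∀ x → ¬ (loc x ℤ.< loc (opp ℓ))
        min-loc x p = max-loc (opp x) (subst₂ ℤ._<_ (trans (cong ℤ.-_ (loc-opp ℓ)) (ℤP.neg-involutive (loc ℓ))) (sym (loc-opp x)) (ℤP.neg-mono-< p))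
        F-≤N : ∀ x → ¬ (+ N ℤ.< ev (F w) x)
        F-≤N x p with x ≟S ℓ
        ... | yes refl = ℤP.<-irrefl (sym (F-ℓ w)) p
        ... | no ne = ℤP.<-asym p (F-below g x ne)
        π⁻p′ : π⁻ p′ ≡ ℓ
        π⁻p′ = trans (cong π⁻ (sym πℓ)) (π⁻π ℓ)
        term : ∀ x y → Off p′ x ⊎ (x ≡ p′ ⊎ x ≡ opp p′) → Off p′ y ⊎ (y ≡ p′ ⊎ y ≡ opp p′) →
               f (π⁻ x) (π⁻ y) ℤ.* inv (F w) (π⁻ x) (π⁻ y) ≡ u x ℤ.* u y ℤ.* (f x y ℤ.* inv w x y)
        term x y (inj₁ ox) (inj₁ oy) = trans (cong₂ ℤ._*_ (cong₂ ℤ._*_ weq leq) geq)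
          (sym (trans (cong₂ (λ a b → a ℤ.* b ℤ.* (f x y ℤ.* inv w x y)) (u-off x ox) (u-off y oy)) (ℤP.*-identityˡ _)))
          where
          ox′ = π⁻-off x ox
          oy′ = π⁻-off y oy
          weq : wt (π⁻ x) (π⁻ y) ≡ wt x y
          weq = cong (ℤ._+_ (+ 1)) (iv-cong (π⁻ y ≟S opp (π⁻ x)) (y ≟S opp x) (λ e → π⁻-injective (trans e (sym (π⁻-odd x)))) (λ e → trans (cong π⁻ e) (π⁻-odd x)))
          leq : lt (π⁻ x) (π⁻ y) ≡ lt x y
          leq = iv-cong (loc (π⁻ x) ℤ.<? loc (π⁻ y)) (loc x ℤ.<? loc y)
            (λ p → subst₂ (λ a b → loc a ℤ.< loc b) (ππ⁻ x) (ππ⁻ y) (π-mono (π⁻ x) (π⁻ y) ox′ oy′ p))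
            (λ p → π-reflect (π⁻ x) (π⁻ y) ox′ oy′ (subst₂ (λ a b → loc a ℤ.< loc b) (sym (ππ⁻ x)) (sym (ππ⁻ y)) p))
          geq : inv (F w) (π⁻ x) (π⁻ y) ≡ inv w x y
          geq = iv-cong (ev (F w) (π⁻ y) ℤ.<? ev (F w) (π⁻ x)) (ev w y ℤ.<? ev w x)
            (λ p → subst₂ (λ a b → ev w a ℤ.< ev w b) (ππ⁻ y) (ππ⁻ x) (F-reflect g (π⁻ y) (π⁻ x) oy′ ox′ p))
            (λ p → F-mono g (π⁻ y) (π⁻ x) oy′ ox′ (subst₂ (λ a b → ev w a ℤ.< ev w b) (sym (ππ⁻ y)) (sym (ππ⁻ x)) p))
        term x y (inj₂ (inj₁ refl)) _ = trans (subst (λ z → f z (π⁻ y) ℤ.* inv (F w) z (π⁻ y) ≡ + 0) (sym π⁻p′) (not-lt ℓ (π⁻ y) (max-loc (π⁻ y))))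
          (sym (trans (cong (λ z → z ℤ.* u y ℤ.* (f p′ y ℤ.* inv w p′ y)) u-p′) (trans (cong (ℤ._* (f p′ y ℤ.* inv w p′ y)) (ℤP.*-zeroˡ (u y))) (ℤP.*-zeroˡ (f p′ y ℤ.* inv w p′ y)))))
        term x y (inj₂ (inj₂ refl)) _ = trans (subst (λ z → f z (π⁻ y) ℤ.* inv (F w) z (π⁻ y) ≡ + 0) (sym (trans (π⁻-odd p′) (cong opp π⁻p′)))
            (not-inv (opp ℓ) (π⁻ y) (λ p → F-≤N (opp (π⁻ y)) (subst₂ ℤ._<_ (trans (cong ℤ.-_ (F-oppℓ w)) refl) (sym (ev-opp (F w) (π⁻ y))) (ℤP.neg-mono-< p)))))
          (sym (trans (cong (λ z → z ℤ.* u y ℤ.* (f (opp p′) y ℤ.* inv w (opp p′) y)) u-opp) (trans (cong (ℤ._* (f (opp p′) y ℤ.* inv w (opp p′) y)) (ℤP.*-zeroˡ (u y))) (ℤP.*-zeroˡ (f (opp p′) y ℤ.* inv w (opp p′) y)))))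
        term x y (inj₁ ox) (inj₂ (inj₁ refl)) = trans (subst (λ z → f (π⁻ x) z ℤ.* inv (F w) (π⁻ x) z ≡ + 0) (sym π⁻p′) (not-inv (π⁻ x) ℓ (λ p → F-≤N (π⁻ x) (subst (ℤ._< ev (F w) (π⁻ x)) (F-ℓ w) p))))
          (sym (trans (cong (λ z → u x ℤ.* z ℤ.* (f x p′ ℤ.* inv w x p′)) u-p′) (trans (cong (ℤ._* (f x p′ ℤ.* inv w x p′)) (ℤP.*-zeroʳ (u x))) (ℤP.*-zeroˡ (f x p′ ℤ.* inv w x p′)))))
        term x y (inj₁ ox) (inj₂ (inj₂ refl)) = trans (subst (λ z → f (π⁻ x) z ℤ.* inv (F w) (π⁻ x) z ≡ + 0) (sym (trans (π⁻-odd p′) (cong opp π⁻p′))) (not-lt (π⁻ x) (opp ℓ) (min-loc (π⁻ x))))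
          (sym (trans (cong (λ z → u x ℤ.* z ℤ.* (f x (opp p′) ℤ.* inv w x (opp p′))) u-opp) (trans (cong (ℤ._* (f x (opp p′) ℤ.* inv w x (opp p′))) (ℤP.*-zeroʳ (u x))) (ℤP.*-zeroˡ (f x (opp p′) ℤ.* inv w x (opp p′))))))

      private
        fg : S → S → ℤ
        fg x y = f x y ℤ.* inv w x y
        A₁ A₂ A₃ A₄ : S → ℤ
        A₁ y = fg p′ y
        A₂ y = fg (opp p′) y
        A₃ x = u x ℤ.* fg x p′
        A₄ x = u x ℤ.* fg x (opp p′)
        c⁺ : S → ℤ
        c⁺ x = iv (loc x ℤ.<? loc p′) ℤ.* iv (q ℤ.<? ev w x)

      L-split : L w ≡ L (F w) ℤ.+ ((sumS A₁ ℤ.+ sumS A₂) ℤ.+ (sumS A₃ ℤ.+ sumS A₄))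
      L-split = begin
        L w ≡⟨ trans (L-def w) (sumS²-cong (λ x y → expand (iv (x ≟S p′)) (iv (x ≟S opp p′)) (iv (y ≟S p′)) (iv (y ≟S opp p′)) (fg x y))) ⟩
        sumS² (λ x y → u x ℤ.* u y ℤ.* fg x y ℤ.+ ((iv (x ≟S p′) ℤ.* fg x y ℤ.+ iv (x ≟S opp p′) ℤ.* fg x y) ℤ.+ (iv (y ≟S p′) ℤ.* (u x ℤ.* fg x y) ℤ.+ iv (y ≟S opp p′) ℤ.* (u x ℤ.* fg x y))))
          ≡⟨ trans (sumS²-+ B₀ (λ x y → (B₁ x y ℤ.+ B₂ x y) ℤ.+ (B₃ x y ℤ.+ B₄ x y))) (cong (ℤ._+_ (sumS² B₀)) (trans (sumS²-+ (λ x y → B₁ x y ℤ.+ B₂ x y) (λ x y → B₃ x y ℤ.+ B₄ x y)) (cong₂ ℤ._+_ (sumS²-+ B₁ B₂) (sumS²-+ B₃ B₄)))) ⟩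
        sumS² (λ x y → u x ℤ.* u y ℤ.* fg x y) ℤ.+ ((sumS² (λ x y → iv (x ≟S p′) ℤ.* fg x y) ℤ.+ sumS² (λ x y → iv (x ≟S opp p′) ℤ.* fg x y)) ℤ.+ (sumS² (λ x y → iv (y ≟S p′) ℤ.* (u x ℤ.* fg x y)) ℤ.+ sumS² (λ x y → iv (y ≟S opp p′) ℤ.* (u x ℤ.* fg x y))))
          ≡⟨ cong₂ ℤ._+_ (sym L-F) (cong₂ ℤ._+_ (cong₂ ℤ._+_ (row p′) (row (opp p′))) (cong₂ ℤ._+_ (sumS-cong (λ x → sumS-δ p′ (λ y → u x ℤ.* fg x y))) (sumS-cong (λ x → sumS-δ (opp p′) (λ y → u x ℤ.* fg x y))))) ⟩
        L (F w) ℤ.+ ((sumS A₁ ℤ.+ sumS A₂) ℤ.+ (sumS A₃ ℤ.+ sumS A₄)) ∎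
        where
        open ≡-Reasoning
        B₀ B₁ B₂ B₃ B₄ : S → S → ℤ
        B₀ x y = u x ℤ.* u y ℤ.* fg x y
        B₁ x y = iv (x ≟S p′) ℤ.* fg x y
        B₂ x y = iv (x ≟S opp p′) ℤ.* fg x y
        B₃ x y = iv (y ≟S p′) ℤ.* (u x ℤ.* fg x y)
        B₄ x y = iv (y ≟S opp p′) ℤ.* (u x ℤ.* fg x y)
        row : ∀ c → sumS² (λ x y → iv (x ≟S c) ℤ.* fg x y) ≡ sumS (fg c)
        row c = trans (sumS-cong (λ x → sumS-* (iv (x ≟S c)) (fg x))) (sumS-δ c (λ x → sumS (fg x)))
        expand : ∀ a b c d F → F ≡ (+ 1 ℤ.- (a ℤ.+ b)) ℤ.* (+ 1 ℤ.- (c ℤ.+ d)) ℤ.* F ℤ.+ ((a ℤ.* F ℤ.+ b ℤ.* F) ℤ.+ (c ℤ.* ((+ 1 ℤ.- (a ℤ.+ b)) ℤ.* F) ℤ.+ d ℤ.* ((+ 1 ℤ.- (a ℤ.+ b)) ℤ.* F)))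
        expand = ℤSolver.solve-∀

      private
        after-off : ∀ x → loc p′ ℤ.< loc x → Off p′ x
        after-off x p = (λ e → ℤP.<-irrefl (cong loc (sym e)) p) , (λ e → ℤP.<-asym {loc p′} {loc (opp p′)} (subst (λ z → loc p′ ℤ.< loc z) e p) -<+)

        s-term : S → ℤ
        s-term x = iv (loc p′ ℤ.<? loc x) ℤ.* iv (ev w x ℤ.<? q)

        sum-A₁ : sumS A₁ ≡ s w
        sum-A₁ = sumS-cong term
          where
          term : ∀ y → A₁ y ≡ s-term y
          term y with loc p′ ℤ.<? loc y
          ... | no _ = trans (cong (ℤ._* inv w p′ y) (ℤP.*-zeroʳ (wt p′ y))) (trans (ℤP.*-zeroˡ (inv w p′ y)) (sym (ℤP.*-zeroˡ (iv (ev w y ℤ.<? q)))))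
          ... | yes p = cong₂ ℤ._*_ (trans (ℤP.*-identityʳ (wt p′ y)) (cong (ℤ._+_ (+ 1)) (iv-no (y ≟S opp p′) (proj₂ (after-off y p))))) (cong (λ z → iv (ev w y ℤ.<? z)) (g .at-P))

        lt-opp : ∀ (x y : S) → lt (opp x) (opp y) ≡ lt y x
        lt-opp x y = iv-cong (loc (opp x) ℤ.<? loc (opp y)) (loc y ℤ.<? loc x) (λ p → ℤP.neg-cancel-< (subst₂ ℤ._<_ (loc-opp x) (loc-opp y) p)) (λ p → subst₂ ℤ._<_ (sym (loc-opp x)) (sym (loc-opp y)) (ℤP.neg-mono-< p))

        inv-opp : ∀ x y → inv w (opp x) (opp y) ≡ inv w y x
        inv-opp x y = iv-cong (ev w (opp y) ℤ.<? ev w (opp x)) (ev w x ℤ.<? ev w y) (λ p → ℤP.neg-cancel-< (subst₂ ℤ._<_ (ev-opp w y) (ev-opp w x) p)) (λ p → subst₂ ℤ._<_ (sym (ev-opp w y)) (sym (ev-opp w x)) (ℤP.neg-mono-< p))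

        wt-opp : ∀ (x y : S) → wt (opp x) (opp y) ≡ wt x y
        wt-opp x y = cong (ℤ._+_ (+ 1)) (iv-cong (opp y ≟S opp (opp x)) (y ≟S opp x) opp-injective (cong opp))

        fg-opp : ∀ x y → fg (opp x) (opp y) ≡ wt x y ℤ.* lt y x ℤ.* inv w y x
        fg-opp x y = trans (cong (λ z → z ℤ.* lt (opp x) (opp y) ℤ.* inv w (opp x) (opp y)) (wt-opp x y))
          (trans (cong (λ z → wt x y ℤ.* z ℤ.* inv w (opp x) (opp y)) (lt-opp x y)) (cong (wt x y ℤ.* lt y x ℤ.*_) (inv-opp x y)))

        sumS-opp : (G : S → ℤ) → sumS (λ x → G (opp x)) ≡ sumS G
        sumS-opp G = sumS-reindex opp opp opp-opp opp-opp G

        sum-A₄ : sumS A₄ ≡ s w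
        sum-A₄ = trans (sym (sumS-opp A₄)) (sumS-cong term)
          where
          term : ∀ x → A₄ (opp x) ≡ s-term x
          term x = trans (cong (u (opp x) ℤ.*_) (fg-opp x p′)) (go (loc p′ ℤ.<? loc x))
            where
            go : Dec (loc p′ ℤ.< loc x) → u (opp x) ℤ.* (wt x p′ ℤ.* lt p′ x ℤ.* inv w p′ x) ≡ s-term x
            go (no ¬p) = trans (cong (λ z → u (opp x) ℤ.* (wt x p′ ℤ.* z ℤ.* inv w p′ x)) (iv-no (loc p′ ℤ.<? loc x) ¬p))
              (trans (r (u (opp x)) (wt x p′) (inv w p′ x)) (sym (trans (cong (ℤ._* iv (ev w x ℤ.<? q)) (iv-no (loc p′ ℤ.<? loc x) ¬p)) (ℤP.*-zeroˡ (iv (ev w x ℤ.<? q))))))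
              where r : ∀ a b c → a ℤ.* (b ℤ.* + 0 ℤ.* c) ≡ + 0
                    r = ℤSolver.solve-∀
            go (yes p) = trans (cong₂ (λ a b → a ℤ.* (b ℤ.* lt p′ x ℤ.* inv w p′ x)) (u-off (opp x) (Off-opp (after-off x p)))
                (cong (ℤ._+_ (+ 1)) (iv-no (p′ ≟S opp x) (λ e → proj₂ (after-off x p) (trans (sym (opp-opp x)) (cong opp (sym e)))))))
              (trans (r (lt p′ x) (inv w p′ x)) (cong (λ z → lt p′ x ℤ.* iv (ev w x ℤ.<? z)) (g .at-P)))
              where r : ∀ b c → + 1 ℤ.* ((+ 1 ℤ.+ + 0) ℤ.* b ℤ.* c) ≡ b ℤ.* c
                    r = ℤSolver.solve-∀

        sum-A₂₃ : sumS A₂ ℤ.+ sumS A₃ ≡ + 2 ℤ.* sumS c⁺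
        sum-A₂₃ = trans (cong (ℤ._+ sumS A₃) (sym (sumS-opp A₂))) (trans (sym (sumS-+ (λ x → A₂ (opp x)) A₃)) (trans (sumS-cong term) (sumS-* (+ 2) c⁺)))
          where
          inv-p : ∀ x → inv w x p′ ≡ iv (q ℤ.<? ev w x)
          inv-p x = cong (λ z → iv (z ℤ.<? ev w x)) (g .at-P)
          term : ∀ x → A₂ (opp x) ℤ.+ A₃ x ≡ + 2 ℤ.* c⁺ x
          term x = trans (cong (ℤ._+ A₃ x) (fg-opp p′ x)) (trans (cong (λ z → wt p′ x ℤ.* lt x p′ ℤ.* z ℤ.+ u x ℤ.* (wt x p′ ℤ.* lt x p′ ℤ.* z)) (inv-p x)) (go (off? p′ x)))
            where
            G = iv (q ℤ.<? ev w x)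
            go : Off p′ x ⊎ (x ≡ p′ ⊎ x ≡ opp p′) → wt p′ x ℤ.* lt x p′ ℤ.* G ℤ.+ u x ℤ.* (wt x p′ ℤ.* lt x p′ ℤ.* G) ≡ + 2 ℤ.* (lt x p′ ℤ.* G)
            go (inj₁ o) = trans (cong₂ (λ a b → a ℤ.* lt x p′ ℤ.* G ℤ.+ u x ℤ.* (b ℤ.* lt x p′ ℤ.* G)) (cong (ℤ._+_ (+ 1)) (iv-no (x ≟S opp p′) (proj₂ o)))
                (cong (ℤ._+_ (+ 1)) (iv-no (p′ ≟S opp x) (λ e → proj₂ o (trans (sym (opp-opp x)) (cong opp (sym e)))))))
              (trans (cong (λ z → (+ 1 ℤ.+ + 0) ℤ.* lt x p′ ℤ.* G ℤ.+ z ℤ.* ((+ 1 ℤ.+ + 0) ℤ.* lt x p′ ℤ.* G)) (u-off x o)) (r (lt x p′) G))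
              where r : ∀ b c → (+ 1 ℤ.+ + 0) ℤ.* b ℤ.* c ℤ.+ + 1 ℤ.* ((+ 1 ℤ.+ + 0) ℤ.* b ℤ.* c) ≡ + 2 ℤ.* (b ℤ.* c)
                    r = ℤSolver.solve-∀
            go (inj₂ (inj₁ refl)) = trans (cong (λ z → wt p′ p′ ℤ.* z ℤ.* G ℤ.+ u p′ ℤ.* (wt p′ p′ ℤ.* z ℤ.* G)) lt0) (trans (r (wt p′ p′) (u p′) G) (sym (trans (cong (λ z → + 2 ℤ.* (z ℤ.* G)) lt0) (r′ G))))
              where
              lt0 : lt p′ p′ ≡ + 0
              lt0 = iv-no (loc p′ ℤ.<? loc p′) (ℤP.<-irrefl refl)
              r : ∀ a b c → a ℤ.* + 0 ℤ.* c ℤ.+ b ℤ.* (a ℤ.* + 0 ℤ.* c) ≡ + 0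
              r = ℤSolver.solve-∀
              r′ : ∀ c → + 2 ℤ.* (+ 0 ℤ.* c) ≡ + 0
              r′ = ℤSolver.solve-∀
            -- The pair (-P , P) has weight 2 and occurs in `A₂` only, the factor u removing it from
            -- `A₃`.
            go (inj₂ (inj₂ refl)) = trans (cong₂ (λ a b → a ℤ.* lt (opp p′) p′ ℤ.* G ℤ.+ b ℤ.* (wt (opp p′) p′ ℤ.* lt (opp p′) p′ ℤ.* G)) (cong (ℤ._+_ (+ 1)) (iv-yes (opp p′ ≟S opp p′) refl)) u-opp)
              (r (lt (opp p′) p′) (wt (opp p′) p′) G)
              where r : ∀ b d c → (+ 1 ℤ.+ + 1) ℤ.* b ℤ.* c ℤ.+ + 0 ℤ.* (d ℤ.* b ℤ.* c) ≡ + 2 ℤ.* (b ℤ.* c)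
                    r = ℤSolver.solve-∀

        -- The larger values lie before or after P, and the entries after P are larger or smaller
        -- than q: thus gt - `after` is the number of larger entries before P minus s.
        sum-c⁺ : sumS c⁺ ≡ gt w ℤ.- after ℤ.+ s w
        sum-c⁺ = trans (sumS-cong term) (trans (sumS-+ (λ x → iv (q ℤ.<? ev w x) ℤ.- iv (loc p′ ℤ.<? loc x)) s-term) (cong (ℤ._+ s w) (sumS-- (λ x → iv (q ℤ.<? ev w x)) (λ x → iv (loc p′ ℤ.<? loc x)))))
          where
          three : ∀ {a b c d e a′ b′ c′ d′ e′} → a ≡ a′ → b ≡ b′ → c ≡ c′ → d ≡ d′ → e ≡ e′ → a′ ℤ.* b′ ≡ b′ ℤ.- d′ ℤ.+ d′ ℤ.* e′ → a ℤ.* b ≡ b ℤ.- d ℤ.+ d ℤ.* e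
          three refl refl refl refl refl p = p
          term : ∀ x → c⁺ x ≡ iv (q ℤ.<? ev w x) ℤ.- iv (loc p′ ℤ.<? loc x) ℤ.+ s-term x
          term x with ℤP.<-cmp (loc x) (loc p′)
          ... | tri< a _ b = three {c = + 0} (iv-yes (loc x ℤ.<? loc p′) a) refl refl (iv-no (loc p′ ℤ.<? loc x) b) refl (r (iv (q ℤ.<? ev w x)) (iv (ev w x ℤ.<? q)))
            where r : ∀ b e → + 1 ℤ.* b ≡ b ℤ.- + 0 ℤ.+ + 0 ℤ.* e
                  r = ℤSolver.solve-∀
          ... | tri≈ a e b = three {c = + 0} (iv-no (loc x ℤ.<? loc p′) a) (iv-no (q ℤ.<? ev w x) (λ p → ℤP.<-irrefl (sym (trans (cong (ev w) (loc-injective x p′ e)) (g .at-P))) p)) refl (iv-no (loc p′ ℤ.<? loc x) b) refl (r (iv (ev w x ℤ.<? q)))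
            where r : ∀ e → + 0 ℤ.* + 0 ≡ + 0 ℤ.- + 0 ℤ.+ + 0 ℤ.* e
                  r = ℤSolver.solve-∀
          ... | tri> a _ b with ℤP.<-cmp q (ev w x)
          ...   | tri< p _ p′ = three {c = + 0} (iv-no (loc x ℤ.<? loc _) a) (iv-yes (q ℤ.<? ev w x) p) refl (iv-yes (loc _ ℤ.<? loc x) b) (iv-no (ev w x ℤ.<? q) p′) refl
          ...   | tri≈ _ e _ = ⊥-elim (proj₁ (after-off x b) (g .valid .inj x _ (trans (sym e) (sym (g .at-P)))))
          ...   | tri> p _ p′ = three {c = + 0} (iv-no (loc x ℤ.<? loc _) a) (iv-no (q ℤ.<? ev w x) p) refl (iv-yes (loc _ ℤ.<? loc x) b) (iv-yes (ev w x ℤ.<? q) p′) refl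

      -- The inversions involving ±P contribute s twice, once for each sign, and 2(gt - `after` +
      -- s). Hence, for entries rearranged with q kept at P, the lengths before and after deletion
      -- differ by a constant plus a multiple of s.
      L-formula : L w ≡ L (F w) ℤ.+ (+ 4 ℤ.* s w ℤ.+ + 2 ℤ.* (gt w ℤ.- after))
      L-formula = trans L-split (cong (ℤ._+_ (L (F w))) (trans (regroup (sumS A₁) (sumS A₂) (sumS A₃) (sumS A₄)) (trans (cong₂ ℤ._+_ (cong₂ ℤ._+_ sum-A₁ sum-A₄) (trans sum-A₂₃ (cong (+ 2 ℤ.*_) sum-c⁺))) (final (s w) (gt w ℤ.- after)))))
        where
        regroup : ∀ a b c d → (a ℤ.+ b) ℤ.+ (c ℤ.+ d) ≡ (a ℤ.+ d) ℤ.+ (b ℤ.+ c)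
        regroup = ℤSolver.solve-∀
        final : ∀ s g → (s ℤ.+ s) ℤ.+ + 2 ℤ.* (g ℤ.+ s) ≡ + 4 ℤ.* s ℤ.+ + 2 ℤ.* g
        final = ℤSolver.solve-∀

    gt-t : ∀ w a b → gt (w · t a b) ≡ gt w
    gt-t w a b = trans (sumS-cong (λ x → cong (λ z → iv (q ℤ.<? z)) (ev-t w a b x))) (sumS-t a b (λ x → iv (q ℤ.<? ev w x)))

    L-diff : ∀ {w} → Good w → ∀ a b → Off p′ a → Off p′ b → L w ℤ.- L (w · t a b) ≡ (L (F w) ℤ.- L (F (w · t a b))) ℤ.+ + 4 ℤ.* (s w ℤ.- s (w · t a b))
    L-diff {w} g a b oa ob = trans (cong₂ ℤ._-_ (Length.L-formula g) (trans (Length.L-formula (Good-t g a b oa ob)) (cong (λ z → L (F (w · t a b)) ℤ.+ (+ 4 ℤ.* s (w · t a b) ℤ.+ + 2 ℤ.* (z ℤ.- after))) (gt-t w a b))))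
      (r (L (F w)) (L (F (w · t a b))) (s w) (s (w · t a b)) (gt w ℤ.- after))
      where r : ∀ l l′ s s′ g → (l ℤ.+ (+ 4 ℤ.* s ℤ.+ + 2 ℤ.* g)) ℤ.- (l′ ℤ.+ (+ 4 ℤ.* s′ ℤ.+ + 2 ℤ.* g)) ≡ (l ℤ.- l′) ℤ.+ + 4 ℤ.* (s ℤ.- s′)
            r = ℤSolver.solve-∀

    -- On w with w(P) = q these differ from s at most by the entry at P itself; off this set they
    -- register on which side of q the value w(P) has gone.
    r≥≤ r≥< r>≤ : W {N} → ℤ
    r≥≤ w = sumS (λ x → iv (loc p′ ℤ.≤? loc x) ℤ.* iv (ev w x ℤ.≤? q))
    r≥< w = sumS (λ x → iv (loc p′ ℤ.≤? loc x) ℤ.* iv (ev w x ℤ.<? q))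
    r>≤ w = sumS (λ x → iv (loc p′ ℤ.<? loc x) ℤ.* iv (ev w x ℤ.≤? q))

    private
      iv-mono : {P R : Set} (d : Dec P) (e : Dec R) → (P → R) → iv d ℤ.≤ iv e
      iv-mono (yes p) e h = ℤP.≤-reflexive (sym (iv-yes e (h p)))
      iv-mono (no _) e h = iv-nonneg e
      f≥ : ∀ (x y : S) → loc x ℤ.< loc y → iv (loc p′ ℤ.≤? loc x) ℤ.≤ iv (loc p′ ℤ.≤? loc y)
      f≥ x y p = iv-mono (loc p′ ℤ.≤? loc x) (loc p′ ℤ.≤? loc y) (λ r → ℤP.≤-trans r (ℤP.<⇒≤ p))
      f> : ∀ (x y : S) → loc x ℤ.< loc y → iv (loc p′ ℤ.<? loc x) ℤ.≤ iv (loc p′ ℤ.<? loc y)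
      f> x y p = iv-mono (loc p′ ℤ.<? loc x) (loc p′ ℤ.<? loc y) (λ r → ℤP.<-trans r p)
      g≤ : ∀ a b → a ℤ.< b → iv (b ℤ.≤? q) ℤ.≤ iv (a ℤ.≤? q)
      g≤ a b p = iv-mono (b ℤ.≤? q) (a ℤ.≤? q) (λ r → ℤP.≤-trans (ℤP.<⇒≤ p) r)
      g< : ∀ a b → a ℤ.< b → iv (b ℤ.<? q) ℤ.≤ iv (a ℤ.<? q)
      g< a b p = iv-mono (b ℤ.<? q) (a ℤ.<? q) (λ r → ℤP.<-trans p r)
      split≥ : ∀ (G : S → ℤ) → sumS (λ x → iv (loc p′ ℤ.≤? loc x) ℤ.* G x) ≡ sumS (λ x → iv (loc p′ ℤ.<? loc x) ℤ.* G x) ℤ.+ G p′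
      split≥ G = trans (sumS-cong (λ x → trans (cong (ℤ._* G x) (pt x)) (ℤP.*-distribʳ-+ (G x) (iv (loc p′ ℤ.<? loc x)) (iv (x ≟S p′))))) (trans (sumS-+ (λ x → iv (loc p′ ℤ.<? loc x) ℤ.* G x) (λ x → iv (x ≟S p′) ℤ.* G x)) (cong (ℤ._+_ (sumS (λ x → iv (loc p′ ℤ.<? loc x) ℤ.* G x))) (sumS-δ p′ G)))
        where
        pt : ∀ x → iv (loc p′ ℤ.≤? loc x) ≡ iv (loc p′ ℤ.<? loc x) ℤ.+ iv (x ≟S p′)
        pt x with ℤP.<-cmp (loc p′) (loc x)
        ... | tri< a b c = trans (iv-yes (loc p′ ℤ.≤? loc x) (ℤP.<⇒≤ a)) (sym (cong₂ ℤ._+_ (iv-yes (loc p′ ℤ.<? loc x) a) (iv-no (x ≟S p′) (λ e → b (cong loc (sym e))))))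
        ... | tri≈ a b c = trans (iv-yes (loc p′ ℤ.≤? loc x) (ℤP.≤-reflexive b)) (sym (cong₂ ℤ._+_ (iv-no (loc p′ ℤ.<? loc x) a) (iv-yes (x ≟S p′) (sym (loc-injective p′ x b)))))
        ... | tri> a b c = trans (iv-no (loc p′ ℤ.≤? loc x) (ℤP.<⇒≱ c)) (sym (cong₂ ℤ._+_ (iv-no (loc p′ ℤ.<? loc x) a) (iv-no (x ≟S p′) (λ e → b (cong loc (sym e))))))

    s-Down : ∀ w a b → Down w a b → s (w · t a b) ℤ.≤ s w
    s-Down w a b = rank-mono (λ x → iv (loc p′ ℤ.<? loc x)) (λ z → iv (z ℤ.<? q)) f> g< w a b

    r≥≤-Down : ∀ w a b → Down w a b → r≥≤ (w · t a b) ℤ.≤ r≥≤ w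
    r≥≤-Down w a b = rank-mono (λ x → iv (loc p′ ℤ.≤? loc x)) (λ z → iv (z ℤ.≤? q)) f≥ g≤ w a b

    Good-r>≤ : ∀ {w} → Good w → r>≤ w ≡ s w
    Good-r>≤ {w} g = sumS-cong term
      where
      term : ∀ x → iv (loc p′ ℤ.<? loc x) ℤ.* iv (ev w x ℤ.≤? q) ≡ iv (loc p′ ℤ.<? loc x) ℤ.* iv (ev w x ℤ.<? q)
      term x with loc p′ ℤ.<? loc x
      ... | no _ = trans (ℤP.*-zeroˡ (iv (ev w x ℤ.≤? q))) (sym (ℤP.*-zeroˡ (iv (ev w x ℤ.<? q))))
      ... | yes p = cong (+ 1 ℤ.*_) (iv-cong (ev w x ℤ.≤? q) (ev w x ℤ.<? q) (λ r → ℤP.≤∧≢⇒< r (λ e → ℤP.<-irrefl (cong loc (sym (g .valid .inj x p′ (trans e (sym (g .at-P)))))) p)) ℤP.<⇒≤)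

    Good-r≥≤ : ∀ {w} → Good w → r≥≤ w ≡ s w ℤ.+ + 1
    Good-r≥≤ {w} g = trans (split≥ (λ x → iv (ev w x ℤ.≤? q))) (cong₂ ℤ._+_ (Good-r>≤ g) (iv-yes (ev w p′ ℤ.≤? q) (ℤP.≤-reflexive (g .at-P))))

    -- If the value at P becomes larger than q, the entry at P leaves the count `r≥≤`, and the rest
    -- is at most s. If it becomes smaller, the entry joins `r≥<`, which equalled s and cannot grow,
    -- so s itself drops. Either loss persists under further descents by monotonicity.
    drop : ∀ {w} → Good w → ∀ a b → Down w a b → ev (w · t a b) p′ ≢ q → r≥≤ (w · t a b) ℤ.< s w ℤ.+ + 1 ⊎ s (w · t a b) ℤ.< s w
    drop {w} g a b down ne with ℤP.<-cmp (ev (w · t a b) p′) q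
    ... | tri≈ _ e _ = ⊥-elim (ne e)
    ... | tri> _ _ c = inj₁ (subst (ℤ._< s w ℤ.+ + 1) (sym (trans (split≥ (λ x → iv (ev v x ℤ.≤? q))) (trans (cong (ℤ._+_ (r>≤ v)) (iv-no (ev v p′ ℤ.≤? q) (ℤP.<⇒≱ c))) (ℤP.+-identityʳ _))))
        (ℤP.≤-<-trans (subst (r>≤ v ℤ.≤_) (Good-r>≤ g) (rank-mono (λ x → iv (loc p′ ℤ.<? loc x)) (λ z → iv (z ℤ.≤? q)) f> g≤ w a b down)) (subst (ℤ._< s w ℤ.+ + 1) (ℤP.+-identityʳ (s w)) (ℤP.+-monoʳ-< (s w) (+<+ (s≤s z≤n))))))
      where v = w · t a b
    ... | tri< c _ _ = inj₂ (ℤP.<-≤-trans (subst (ℤ._< s v ℤ.+ + 1) (ℤP.+-identityʳ (s v)) (ℤP.+-monoʳ-< (s v) (+<+ (s≤s z≤n))))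
        (subst₂ ℤ._≤_ (trans (split≥ (λ x → iv (ev v x ℤ.<? q))) (cong (ℤ._+_ (s v)) (iv-yes (ev v p′ ℤ.<? q) c)))
          (trans (split≥ (λ x → iv (ev w x ℤ.<? q))) (trans (cong (ℤ._+_ (s w)) (iv-no (ev w p′ ℤ.<? q) (ℤP.<-irrefl (g .at-P)))) (ℤP.+-identityʳ _)))
          (rank-mono (λ x → iv (loc p′ ℤ.≤? loc x)) (λ z → iv (z ℤ.<? q)) f≥ g< w a b down)))
      where v = w · t a b

-- Deletion intertwines the operators.

module DeletionOfCoefficients where

  open SignedIndices
  open SignedPermutations
  open ChevalleyOperators
  open SimpleReflections
  open PolynomialAction
  open InvariantIdeal
  open DeletedPosition
  open RationalField
  open import Tactic.RingSolver using (solve-∀)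

  opaque
    unfolding _+_

    sg-zero-term : ∀ k c x → k * 0# * c * x ≡ 0#
    sg-zero-term = solve-∀ ring

  module Core (ty : RootType) {n : ℕ} (P : Fin (suc n)) (q : ℤ) (q≥1 : 1 ℕ.≤ ∣ q ∣) (cyc : Cycle P) where
    open Ideal ty {n}
    open Deletion P q q≥1 cyc
    open Cycle cyc
    open ℚSum

    private
      N = suc n
      S = SI N

    vanish : ∀ a h w b → (a ≢ b → L (w · t a b) ℤ.+ + 2 ≡ L w → h (w · t a b) ≡ 0#) → Xterm a h w b ≡ 0#
    vanish a h w b z with a ≟S b
    ... | yes refl = trans (cong (λ y → κ a a * y * cov w a a * h (w · t a a)) (sg-same (ev w a))) (sg-zero-term (κ a a) (cov w a a) (h (w · t a a)))
    ... | no ne with L (w · t a b) ℤ.+ + 2 ℤP.≟ L w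
    ...   | yes e = trans (cong (κ a b * sg (ev w a) (ev w b) * 1# *_) (z ne e)) (zeroʳ _)
    ...   | no _ = zero-coeff (κ a b) (sg (ev w a) (ev w b)) (h (w · t a b))

    X-vanish : ∀ a h w → (∀ b → a ≢ b → L (w · t a b) ℤ.+ + 2 ≡ L w → h (w · t a b) ≡ 0#) → X a h w ≡ 0#
    X-vanish a h w z = trans (X-def a h w) (sumS-zero (Xterm a h w) (λ b → vanish a h w b (z b)))

    cover-Down : ∀ {w : W {N}} → Inj w → ∀ a b → a ≢ b → L (w · t a b) ℤ.+ + 2 ≡ L w → Down w a b
    cover-Down {w} i a b ne e = Inj-L-t⇒Down i a b ne (subst (L (w · t a b) ℤ.<_) e (<+2 _))

    below-ℓ : ∀ x → x ≢ ℓ → loc x ℤ.< loc ℓ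
    below-ℓ (neg j) ne = -<+
    below-ℓ (pos j) ne = +<+ (s≤s (ℕP.≤∧≢⇒< (ℕP.≤-trans (ℕP.≤-pred (FinP.toℕ<n j)) (ℕP.≤-reflexive (sym (FinP.toℕ-fromℕ n)))) (λ e → ne (cong pos (FinP.toℕ-injective e)))))

    keeps-ℓ : ∀ {w} → Good w → ∀ a b → Down (F w) a b → ∀ x → x ≢ ℓ → t a b x ≢ ℓ
    keeps-ℓ {w} g a b down x ne e = ℤP.<-asym (F-below g x ne)
      (subst (ℤ._< ev (F w) x) (trans (cong (ev (F w)) e) (F-ℓ w)) (down x (subst (λ z → loc x ℤ.< loc z) (sym e) (below-ℓ x ne))))

    -- Moving some x to the last position shortens F w only if x carries a larger value than the
    -- last position, but the value N found there is the maximum.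
    fixes-ℓ : ∀ {w} → Good w → ∀ a b → a ≢ b → Down (F w) a b → Off ℓ a × Off ℓ b
    fixes-ℓ {w} g a b a≢b down = ((λ e → keep b (λ q → a≢b (trans e (sym q))) (trans (t-b a b) e)) , (λ e → keep (opp b) (λ q → a≢b (trans e (sym (swap q)))) (trans (t-ob a b) (swap′ e))))
        , ((λ e → keep a (λ q → a≢b (trans q (sym e))) (trans (t-a a b) e)) , (λ e → keep (opp a) (λ q → a≢b (trans (swap q) (sym e))) (trans (t-oa a b) (swap′ e))))
      where
      keep = keeps-ℓ g a b down
      swap : ∀ {x y : S} → opp x ≡ y → x ≡ opp y
      swap {x} e = trans (sym (opp-opp x)) (cong opp e)
      swap′ : ∀ {x y : S} → x ≡ opp y → opp x ≡ y
      swap′ {x} {y} e = trans (cong opp e) (opp-opp y)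

    module _ {w : W {N}} (g : Good w) (a b : S) (oa : Off p′ a) (ob : Off p′ b) where
      private
        oa′ = π⁻-off a oa
        ob′ = π⁻-off b ob
        ≤π : ∀ x y → Off p′ x → Off p′ y → loc x ℤ.< loc y → loc (π⁻ x) ℤ.< loc (π⁻ y)
        ≤π x y ox oy p = π-reflect (π⁻ x) (π⁻ y) (π⁻-off x ox) (π⁻-off y oy) (subst₂ (λ u v → loc u ℤ.< loc v) (sym (ππ⁻ x)) (sym (ππ⁻ y)) p)
        π≤ : ∀ x y → Off p′ x → Off p′ y → loc (π⁻ x) ℤ.< loc (π⁻ y) → loc x ℤ.< loc y
        π≤ x y ox oy p = subst₂ (λ u v → loc u ℤ.< loc v) (ππ⁻ x) (ππ⁻ y) (π-mono (π⁻ x) (π⁻ y) (π⁻-off x ox) (π⁻-off y oy) p)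
        F→ : ∀ x y → Off p′ x → Off p′ y → ev (F w) (π⁻ x) ℤ.< ev (F w) (π⁻ y) → ev w x ℤ.< ev w y
        F→ x y ox oy p = subst₂ (λ u v → ev w u ℤ.< ev w v) (ππ⁻ x) (ππ⁻ y) (F-reflect g (π⁻ x) (π⁻ y) (π⁻-off x ox) (π⁻-off y oy) p)
        →F : ∀ x y → Off p′ x → Off p′ y → ev w x ℤ.< ev w y → ev (F w) (π⁻ x) ℤ.< ev (F w) (π⁻ y)
        →F x y ox oy p = F-mono g (π⁻ x) (π⁻ y) (π⁻-off x ox) (π⁻-off y oy) (subst₂ (λ u v → ev w u ℤ.< ev w v) (sym (ππ⁻ x)) (sym (ππ⁻ y)) p)

      Down-F : Down (F w) (π⁻ a) (π⁻ b) → Down w a b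
      Down-F down = Down-intro w a b
        (λ p → F→ b a ob oa (subst (λ z → ev (F w) z ℤ.< ev (F w) (π⁻ a)) (t-a (π⁻ a) (π⁻ b)) (down (π⁻ a) (subst (λ z → loc (π⁻ a) ℤ.< loc z) (sym (t-a (π⁻ a) (π⁻ b))) (≤π a b oa ob p)))))
        (λ p → F→ a b oa ob (subst (λ z → ev (F w) z ℤ.< ev (F w) (π⁻ b)) (t-b (π⁻ a) (π⁻ b)) (down (π⁻ b) (subst (λ z → loc (π⁻ b) ℤ.< loc z) (sym (t-b (π⁻ a) (π⁻ b))) (≤π b a ob oa p)))))

      Up-F : Up w a b → Up (F w) (π⁻ a) (π⁻ b)
      Up-F up = Up-intro (F w) (π⁻ a) (π⁻ b)
        (λ p → →F a b oa ob (subst (λ z → ev w a ℤ.< ev w z) (t-a a b) (up a (subst (λ z → loc a ℤ.< loc z) (sym (t-a a b)) (π≤ a b oa ob p)))))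
        (λ p → →F b a ob oa (subst (λ z → ev w b ℤ.< ev w z) (t-b a b) (up b (subst (λ z → loc b ℤ.< loc z) (sym (t-b a b)) (π≤ b a ob oa p)))))

      sg-F : sg (ev w a) (ev w b) ≡ sg (ev (F w) (π⁻ a)) (ev (F w) (π⁻ b))
      sg-F = cong₂ _-_ (iv-cong (ev w a ℤ.<? ev w b) (ev (F w) (π⁻ a) ℤ.<? ev (F w) (π⁻ b)) (→F a b oa ob) (F→ a b oa ob))
                       (iv-cong (ev w b ℤ.<? ev w a) (ev (F w) (π⁻ b) ℤ.<? ev (F w) (π⁻ a)) (→F b a ob oa) (F→ b a ob oa))

      -- With s unchanged, `L-diff` says that w and F w lose the same amount of length.
      cov-F : s (w · t a b) ≡ s w → cov w a b ≡ cov (F w) (π⁻ a) (π⁻ b)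
      cov-F e = iv-cong (L (w · t a b) ℤ.+ + 2 ℤP.≟ L w) (L (F w · t (π⁻ a) (π⁻ b)) ℤ.+ + 2 ℤP.≟ L (F w))
          (λ h → from (trans (sym (same)) (to h))) (λ h → from (trans same (to h)))
        where
        same : L w ℤ.- L (w · t a b) ≡ L (F w) ℤ.- L (F w · t (π⁻ a) (π⁻ b))
        same = trans (L-diff g a b oa ob) (trans (cong (λ z → (L (F w) ℤ.- L (F (w · t a b))) ℤ.+ + 4 ℤ.* (s w ℤ.- z)) e)
          (trans (r (L (F w) ℤ.- L (F (w · t a b))) (s w)) (cong (λ z → L (F w) ℤ.- L z) (F-t w a b oa ob))))
          where r : ∀ x s → x ℤ.+ + 4 ℤ.* (s ℤ.- s) ≡ x
                r = ℤSolver.solve-∀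
        to : ∀ {x y} → x ℤ.+ + 2 ≡ y → y ℤ.- x ≡ + 2
        to {x} refl = r x
          where r : ∀ x → (x ℤ.+ + 2) ℤ.- x ≡ + 2
                r = ℤSolver.solve-∀
        from : ∀ {x y} → y ℤ.- x ≡ + 2 → x ℤ.+ + 2 ≡ y
        from {x} {y} e = trans (cong (ℤ._+_ x) (sym e)) (r x y)
          where r : ∀ x y → x ℤ.+ (y ℤ.- x) ≡ y
                r = ℤSolver.solve-∀

      -- The increase 2 of `L` is the increase for F w, positive as the reflection also lengthens F
      -- w, plus 4 times the increase of s, which is nonnegative. So s cannot increase.
      cover-s : a ≢ b → L (w · t a b) ≡ L w ℤ.+ + 2 → s (w · t a b) ≡ s w
      cover-s a≢b e = ℤP.≤-antisym (ℤP.≮⇒≥ (λ p → ℤP.<⇒≱ (big p) (ℤP.≤-refl))) s≤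
        where
        v = w · t a b
        up : Up w a b
        up = L-t⇒Up (g .valid) a b a≢b (subst (L w ℤ.<_) (sym e) (<+2 _))
        s≤ : s w ℤ.≤ s v
        s≤ = subst (λ z → s z ℤ.≤ s v) (·-t-t w a b) (s-Down v a b (Up⇒Down w a b up))
        LF< : L (F w) ℤ.< L (F v)
        LF< = subst (λ z → L (F w) ℤ.< L z) (sym (F-t w a b oa ob)) (Up-L (F w) (π⁻ a) (π⁻ b) (λ q → a≢b (π⁻-injective q)) (Up-F up))
        total-diff : (L (F v) ℤ.- L (F w)) ℤ.+ + 4 ℤ.* (s v ℤ.- s w) ≡ + 2
        total-diff = trans (r (L (F w)) (L (F v)) (s w) (s v)) (trans (cong ℤ.-_ (sym (L-diff g a b oa ob))) (trans (cong (λ z → ℤ.- (L w ℤ.- z)) e) (r′ (L w))))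
          where
          r : ∀ l l′ s s′ → (l′ ℤ.- l) ℤ.+ + 4 ℤ.* (s′ ℤ.- s) ≡ ℤ.- ((l ℤ.- l′) ℤ.+ + 4 ℤ.* (s ℤ.- s′))
          r = ℤSolver.solve-∀
          r′ : ∀ l → ℤ.- (l ℤ.- (l ℤ.+ + 2)) ≡ + 2
          r′ = ℤSolver.solve-∀
        big : s w ℤ.< s v → + 4 ℤ.< + 4
        big p = ⊥-elim (ℤP.<⇒≱ {+ 2} {+ 4} (+<+ (s≤s (s≤s (s≤s z≤n)))) (subst (+ 4 ℤ.≤_) total-diff
          (ℤP.+-mono-≤ {+ 0} {L (F v) ℤ.- L (F w)} {+ 4} {+ 4 ℤ.* (s v ℤ.- s w)} (ℤP.i≤j⇒0≤j-i (ℤP.<⇒≤ LF<)) (ℤP.*-monoˡ-≤-nonNeg (+ 4) {+ 1} {s v ℤ.- s w} (ℤP.i<j⇒suc[i]≤j (m<n⇒0<n-m p))))))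

    module _ (s₀ : ℤ) where

      -- h and h′ are compared only on w with w(P) = q and s w = s₀. `Z₁` and `Z₄` make h vanish
      -- where a descending path lands after leaving this set, and `Z′` makes h′ vanish where s has
      -- fallen; monotonicity of the statistics keeps all three true under the operators.
      record Rel (h h′ : H) : Set where
        field
          Z₁ : ∀ w → Valid w → r≥≤ w ℤ.< s₀ ℤ.+ + 1 → h w ≡ 0#
          Z₄ : ∀ w → Valid w → s w ℤ.< s₀ → h w ≡ 0#
          Z′ : ∀ w → Good w → s w ℤ.< s₀ → h′ (F w) ≡ 0#
          E  : ∀ w → Good w → s w ≡ s₀ → h w ≡ h′ (F w)
      open Rel

      -- In the comparison `E`, a summand moving ±P vanishes by `drop`, and its counterpart would
      -- move the last position of F w, which no descent does. The other summands correspond under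
      -- F.
      X-Rel : ∀ a {h h′} → Rel h h′ → Rel (X a h) (X (π⁻ a) h′)
      X-Rel a {h} {h′} r .Z₁ w v p = X-vanish a h w (λ b ne e → r .Z₁ (w · t a b) (Valid-t a b v) (ℤP.≤-<-trans (r≥≤-Down w a b (cover-Down (v .inj) a b ne e)) p))
      X-Rel a {h} {h′} r .Z₄ w v p = X-vanish a h w (λ b ne e → r .Z₄ (w · t a b) (Valid-t a b v) (ℤP.≤-<-trans (s-Down w a b (cover-Down (v .inj) a b ne e)) p))
      X-Rel a {h} {h′} r .Z′ w g p = X-vanish (π⁻ a) h′ (F w) go
        where
        go : ∀ b → π⁻ a ≢ b → L (F w · t (π⁻ a) b) ℤ.+ + 2 ≡ L (F w) → h′ (F w · t (π⁻ a) b) ≡ 0#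
        go b ne e = subst (λ z → h′ (F w · t (π⁻ a) z) ≡ 0#) (π⁻π b) (subst (λ z → h′ z ≡ 0#) (F-t w a (π b) oa ob)
            (r .Z′ (w · t a (π b)) (Good-t g a (π b) oa ob) (ℤP.≤-<-trans (s-Down w a (π b) (Down-F g a (π b) oa ob (subst (Down (F w) (π⁻ a)) (sym (π⁻π b)) down))) p)))
          where
          down = cover-Down (F-Inj g) (π⁻ a) b ne e
          offs = fixes-ℓ g (π⁻ a) b ne down
          oa : Off p′ a
          oa = subst (Off p′) (ππ⁻ a) (π-off (π⁻ a) (proj₁ offs))
          ob : Off p′ (π b)
          ob = π-off b (proj₂ offs)
      X-Rel a {h} {h′} r .E w g es = trans (X-def a h w) (trans (sumS-cong (λ b → term b (off? p′ a) (off? p′ b)))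
          (trans (sumS-reindex π⁻ π π⁻π ππ⁻ (Xterm (π⁻ a) h′ (F w))) (sym (X-def (π⁻ a) h′ (F w)))))
        where
        on-zero : ∀ b → ¬ (Off p′ a × Off p′ b) → Xterm a h w b ≡ Xterm (π⁻ a) h′ (F w) (π⁻ b)
        on-zero b ¬off = trans (vanish a h w b left) (sym (vanish (π⁻ a) h′ (F w) (π⁻ b) right))
          where
          left : a ≢ b → L (w · t a b) ℤ.+ + 2 ≡ L w → h (w · t a b) ≡ 0#
          left ne e with drop g a b down moved′
            where
            down = cover-Down (g .valid .inj) a b ne e
            moved′ : ev (w · t a b) p′ ≢ q
            moved′ q′ with off? p′ a | off? p′ b
            ... | inj₁ oa | inj₁ ob = ¬off (oa , ob)
            ... | inj₂ (inj₁ refl) | _ = ne (sym (trans (sym (t-a p′ b)) (g .valid .inj (t p′ b p′) p′ (trans (sym (ev-t w p′ b p′)) (trans q′ (sym (g .at-P)))))))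
            ... | inj₂ (inj₂ refl) | _ = ne (sym (trans (sym (opp-opp b)) (cong opp (trans (sym (t-oa (opp p′) b)) (g .valid .inj (t (opp p′) b (opp (opp p′))) p′ (trans (sym (ev-t w (opp p′) b p′)) (trans q′ (sym (g .at-P)))))))))
            ... | inj₁ _ | inj₂ (inj₁ refl) = ne (trans (sym (t-b a p′)) (g .valid .inj (t a p′ p′) p′ (trans (sym (ev-t w a p′ p′)) (trans q′ (sym (g .at-P))))))
            ... | inj₁ _ | inj₂ (inj₂ refl) = ne (trans (sym (opp-opp a)) (cong opp (trans (sym (t-ob a (opp p′))) (g .valid .inj (t a (opp p′) (opp (opp p′))) p′ (trans (sym (ev-t w a (opp p′) p′)) (trans q′ (sym (g .at-P))))))))
          ... | inj₁ p = r .Z₁ (w · t a b) (Valid-t a b (g .valid)) (subst (λ z → r≥≤ (w · t a b) ℤ.< z ℤ.+ + 1) es p)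
          ... | inj₂ p = r .Z₄ (w · t a b) (Valid-t a b (g .valid)) (subst (s (w · t a b) ℤ.<_) es p)
          right : π⁻ a ≢ π⁻ b → L (F w · t (π⁻ a) (π⁻ b)) ℤ.+ + 2 ≡ L (F w) → h′ (F w · t (π⁻ a) (π⁻ b)) ≡ 0#
          right ne e = ⊥-elim (¬off (subst (Off p′) (ππ⁻ a) (π-off (π⁻ a) (proj₁ offs)) , subst (Off p′) (ππ⁻ b) (π-off (π⁻ b) (proj₂ offs))))
            where offs = fixes-ℓ g (π⁻ a) (π⁻ b) ne (cover-Down (F-Inj g) (π⁻ a) (π⁻ b) ne e)
        product : ∀ {k k′ g g′ c c′ x x′} → k ≡ k′ → g ≡ g′ → c ≡ c′ → x ≡ x′ → k * g * c * x ≡ k′ * g′ * c′ * x′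
        product refl refl refl refl = refl
        term : ∀ b → Off p′ a ⊎ (a ≡ p′ ⊎ a ≡ opp p′) → Off p′ b ⊎ (b ≡ p′ ⊎ b ≡ opp p′) → Xterm a h w b ≡ Xterm (π⁻ a) h′ (F w) (π⁻ b)
        term b (inj₂ (inj₁ e)) _ = on-zero b (λ o → proj₁ (proj₁ o) e)
        term b (inj₂ (inj₂ e)) _ = on-zero b (λ o → proj₂ (proj₁ o) e)
        term b (inj₁ _) (inj₂ (inj₁ e)) = on-zero b (λ o → proj₁ (proj₂ o) e)
        term b (inj₁ _) (inj₂ (inj₂ e)) = on-zero b (λ o → proj₂ (proj₂ o) e)
        -- If s falls, both summands vanish by `Z₄` and `Z′`; if it rises, the reflection is no
        -- descent for w and hence none for F w.
        term b (inj₁ oa) (inj₁ ob) with ℤP.<-cmp (s (w · t a b)) s₀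
        ... | tri≈ _ e _ = product (sym (κ-σ π⁻ π⁻-odd π⁻-injective a b)) (sg-F g a b oa ob) (cov-F g a b oa ob (trans e (sym es)))
                (trans (r .E (w · t a b) (Good-t g a b oa ob) e) (cong h′ (F-t w a b oa ob)))
        ... | tri< p _ _ = trans (vanish a h w b (λ _ _ → r .Z₄ (w · t a b) (Valid-t a b (g .valid)) p))
                (sym (vanish (π⁻ a) h′ (F w) (π⁻ b) (λ _ _ → trans (cong h′ (sym (F-t w a b oa ob))) (r .Z′ (w · t a b) (Good-t g a b oa ob) p))))
        ... | tri> _ _ p = trans (vanish a h w b (λ ne e → ⊥-elim (up (cover-Down (g .valid .inj) a b ne e))))
                (sym (vanish (π⁻ a) h′ (F w) (π⁻ b) (λ ne e → ⊥-elim (up (Down-F g a b oa ob (cover-Down (F-Inj g) (π⁻ a) (π⁻ b) ne e))))))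
          where
          up : ¬ Down w a b
          up down = ℤP.<⇒≱ p (subst (s (w · t a b) ℤ.≤_) es (s-Down w a b down))

      pow-Rel : ∀ a k {h h′} → Rel h h′ → Rel (pow a k h) (pow (π⁻ a) k h′)
      pow-Rel a zero r = r
      pow-Rel a (suc k) r = X-Rel a (pow-Rel a k r)

      mev-Rel : ∀ {j} (τ : Fin j → S) m {h h′} → Rel h h′ → Rel (mev τ m h) (mev (π⁻ ∘ τ) m h′)
      mev-Rel τ [] r = r
      mev-Rel τ (e ∷ m) r = pow-Rel (τ zero) e (mev-Rel (τ ∘ suc) m r)

    F-injective : ∀ {w u} → Good w → Good u → F w ≡ F u → w ≡ u
    F-injective {w} {u} gw gu e = ev-ext (λ x → go x (off? p′ x))
      where
      go : ∀ x → Off p′ x ⊎ (x ≡ p′ ⊎ x ≡ opp p′) → ev w x ≡ ev u x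
      go x (inj₂ (inj₁ refl)) = trans (gw .at-P) (sym (gu .at-P))
      go x (inj₂ (inj₂ refl)) = cong ℤ.-_ (trans (gw .at-P) (sym (gu .at-P)))
      go x (inj₁ o) = shrink-injective q≥1 (ev w x) (ev u x) (off-abs gw x o) (off-abs gu x o)
        (subst (λ z → shrink Q (ev w z) ≡ shrink Q (ev u z)) (ππ⁻ x) (trans (sym (F-off w (π⁻ x) (π⁻-off x o))) (trans (cong (λ z → ev z (π⁻ x)) e) (F-off u (π⁻ x) (π⁻-off x o)))))

    δ-Rel : ∀ {u} → Good u → Rel (s u) (δ u) (δ (F u))
    δ-Rel {u} gu = record
      { Z₁ = λ w v p → δ-other (λ e → ℤP.<-irrefl (trans (cong r≥≤ e) (Good-r≥≤ gu)) p)
      ; Z₄ = λ w v p → δ-other (λ e → ℤP.<-irrefl (cong s e) p)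
      ; Z′ = λ w g p → δ-other (λ e → ℤP.<-irrefl (cong s (F-injective g gu e)) p)
      ; E = λ w g e → iv-cong (VecP.≡-dec ℤP._≟_ w u) (VecP.≡-dec ℤP._≟_ (F w) (F u)) (cong F) (F-injective g gu) }

    core : ∀ {u w} → Good u → Good w → s w ≡ s u → ∀ f → act f (δ u) w ≡ ev⟨ π⁻ ∘ pos ⟩ f (δ (F u)) (F w)
    core gu gw e [] = refl
    core {u} {w} gu gw e ((c , m) ∷ f) = cong₂ _+_ (cong (c *_) (Rel.E (mev-Rel (s u) pos m (δ-Rel gu)) w gw e)) (core gu gw e f)

-- Cyclic permutations of the variables and symmetry.

module CyclicPermutations where

  open SignedIndices
  open SignedPermutations
  open ChevalleyOperators
  open SimpleReflections
  open PolynomialAction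
  open InvariantIdeal
  open DeletedPosition
  open RationalField

  module _ {n : ℕ} where
    private
      N = suc n

    tr : Fin n → Fin N → Fin N
    tr j i = idx (refl-of (simple (suc j)) (pos i))

    refl-tr : ∀ j i → refl-of (simple (suc j)) (pos i) ≡ pos (tr j i)
    refl-tr j i with t-case (pos (inject₁ j)) (pos (suc j)) (pos i)
    ... | case-a refl = trans (t-a (pos (inject₁ j)) (pos (suc j))) (cong pos (sym (cong idx (t-a (pos (inject₁ j)) (pos (suc j))))))
    ... | case-b refl = trans (t-b (pos (inject₁ j)) (pos (suc j))) (cong pos (sym (cong idx (t-b (pos (inject₁ j)) (pos (suc j))))))
    ... | case-f a b c d = trans (t-f (pos (inject₁ j)) (pos (suc j)) a b c d) (cong pos (sym (cong idx (t-f (pos (inject₁ j)) (pos (suc j)) a b c d))))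

    tr-tr : ∀ j i → tr j (tr j i) ≡ i
    tr-tr j i = cong idx (trans (cong (refl-of (simple (suc j))) (sym (refl-tr j i))) (t-t (pos (inject₁ j)) (pos (suc j)) (pos i)))

    tr-hi : ∀ j → tr j (suc j) ≡ inject₁ j
    tr-hi j = cong idx (t-b (pos (inject₁ j)) (pos (suc j)))

    tr-lo : ∀ j → tr j (inject₁ j) ≡ suc j
    tr-lo j = cong idx (t-a (pos (inject₁ j)) (pos (suc j)))

    tr-fix : ∀ j i → i ≢ inject₁ j → i ≢ suc j → tr j i ≡ i
    tr-fix j i a b = cong idx (t-f (pos (inject₁ j)) (pos (suc j)) (λ e → a (pos-injective e)) (λ e → b (pos-injective e)) (λ ()) (λ ()))

    tr-mono : ∀ j i k → toℕ i ℕ.< toℕ k → k ≢ tr j i → toℕ (tr j i) ℕ.< toℕ (tr j k)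
    tr-mono j i k p ne with subst₂ (λ x y → loc x ℤ.< loc y) (refl-tr j i) (refl-tr j k)
      (simple-mono (simple (suc j)) (pos i) (pos k) (+<+ (s≤s p)) (λ e → ne (pos-injective (trans e (refl-tr j i)))))
    ... | +<+ (s≤s q) = q

    -- `generated` records the inverse cycle as a product of adjacent transpositions, in the form of
    -- an induction principle on substitutions, so that invariance is checked for one transposition
    -- at a time. `σ-low` and `σ-high` describe deletion in one-line notation.
    record CycleData (P : Fin N) : Set₁ where
      field
        cycle  : Cycle P
        σ-low  : ∀ i → toℕ i ℕ.< toℕ P → Cycle.σ cycle i ≡ i
        σ-high : ∀ i → toℕ P ℕ.≤ toℕ i → toℕ i ℕ.< n → toℕ (Cycle.σ cycle i) ≡ suc (toℕ i)
        generated : (G : (Fin N → Fin N) → Set) → (∀ j τ → G τ → G (tr j ∘ τ)) → ∀ τ → G τ → G (Cycle.ρ cycle ∘ τ)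

    last-cycle : CycleData (fromℕ n)
    last-cycle = record
      { cycle = record { σ = id ; ρ = id ; σρ = λ _ → refl ; ρσ = λ _ → refl ; σ-last = refl ; σ-mono = λ _ _ _ _ p → p }
      ; σ-low = λ _ _ → refl
      ; σ-high = λ i p r → ⊥-elim (ℕP.<⇒≱ r (ℕP.≤-trans (ℕP.≤-reflexive (sym (FinP.toℕ-fromℕ n))) p))
      ; generated = λ G _ τ g → g }

    prev-cycle : ∀ j → CycleData (suc j) → CycleData (inject₁ j)
    prev-cycle j d = record
      { cycle = record
        { σ = tr j ∘ σ ; ρ = ρ ∘ tr j
        ; σρ = λ i → trans (cong (tr j) (σρ (tr j i))) (tr-tr j i)
        ; ρσ = λ i → trans (cong ρ (tr-tr j (σ i))) (ρσ i)
        ; σ-last = trans (cong (tr j) σ-last) (tr-hi j)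
        ; σ-mono = λ i k i≢ k≢ p → tr-mono j (σ i) (σ k) (σ-mono i k i≢ k≢ p) (λ e → bad i k i≢ k≢ p e) }
      ; σ-low = λ i p → trans (cong (tr j) (σ-low i (ℕP.m≤n⇒m≤1+n (subst (toℕ i ℕ.<_) tj p)))) (tr-fix j i (λ e → ℕP.<-irrefl (cong toℕ e) p) (λ e → ℕP.<-asym (subst (toℕ i ℕ.<_) tj p) (ℕP.≤-reflexive (sym (cong toℕ e)))))
      ; σ-high = high
      ; generated = λ G st τ g → generated G st (tr j ∘ τ) (st j τ g) }
      where
      open CycleData d
      open Cycle cycle
      tj : toℕ (inject₁ j) ≡ toℕ j
      tj = FinP.toℕ-inject₁ j
      -- The transposition reverses only the pair j, j + 1, and j + 1 is the image under σ of the
      -- last position, which is not among the indices compared.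
      bad : ∀ i k → i ≢ fromℕ n → k ≢ fromℕ n → toℕ i ℕ.< toℕ k → σ k ≢ tr j (σ i)
      bad i k i≢ k≢ p e with t-case (pos (inject₁ j)) (pos (suc j)) (pos (σ i))
      ... | case-a q = k≢ (trans (sym (ρσ k)) (trans (cong ρ (trans e (trans (cong (tr j) (pos-injective q)) (trans (tr-lo j) (sym σ-last))))) (ρσ (fromℕ n))))
      ... | case-b q = i≢ (trans (sym (ρσ i)) (trans (cong ρ (trans (pos-injective q) (sym σ-last))) (ρσ (fromℕ n))))
      ... | case-f a b _ _ = ℕP.<-irrefl (cong toℕ (trans (sym (ρσ i)) (trans (cong ρ (sym (trans e (tr-fix j (σ i) (λ q → a (cong pos q)) (λ q → b (cong pos q)))))) (ρσ k)))) p
      high : ∀ i → toℕ (inject₁ j) ℕ.≤ toℕ i → toℕ i ℕ.< n → toℕ (tr j (σ i)) ≡ suc (toℕ i)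
      high i p r with ℕP.m≤n⇒m<n∨m≡n (subst (ℕ._≤ toℕ i) tj p)
      ... | inj₂ e = trans (cong toℕ (trans (cong (tr j) (trans (σ-low i (ℕP.≤-reflexive (cong suc (sym e)))) (FinP.toℕ-injective (trans (sym e) (sym tj))))) (tr-lo j))) (cong suc e)
      ... | inj₁ q = trans (cong toℕ (tr-fix j (σ i) (λ e → ℕP.<-irrefl (trans (sym tj) (trans (cong toℕ (sym e)) hi′)) (ℕP.m≤n⇒m≤1+n q)) (λ e → ℕP.<-irrefl (trans (cong toℕ (sym e)) hi′) (s≤s q)))) hi′
        where
        hi′ : toℕ (σ i) ≡ suc (toℕ i)
        hi′ = σ-high i q r

    cycle-data : ∀ P → CycleData P
    cycle-data P = go (n ℕ.∸ toℕ P) P refl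
      where
      go : ∀ k P → n ℕ.∸ toℕ P ≡ k → CycleData P
      go zero P e = subst CycleData (FinP.toℕ-injective (trans (FinP.toℕ-fromℕ n) (ℕP.≤-antisym (ℕP.m∸n≡0⇒m≤n e) (ℕP.≤-pred (FinP.toℕ<n P))))) last-cycle
      go (suc k) P e = subst CycleData inj-j (prev-cycle j (go k (suc j) (trans (cong (n ℕ.∸_) (cong suc tj)) (ℕP.suc-injective (trans (sym (ℕP.+-∸-assoc 1 P<n)) e)))))
        where
        P<n : toℕ P ℕ.< n
        P<n = ℕP.m∸n≢0⇒n<m (λ z → ℕP.1+n≢0 (trans (sym e) z))
        j : Fin n
        j = Fin.fromℕ< P<n
        tj : toℕ j ≡ toℕ P
        tj = FinP.toℕ-fromℕ< P<n
        inj-j : inject₁ j ≡ P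
        inj-j = FinP.toℕ-injective (trans (FinP.toℕ-inject₁ j) tj)

    module Symmetric (ty : RootType) where
      open Ideal ty {n}

      pow-index : ∀ {a b} → a ≡ b → ∀ k h → pow a k h ≐ pow b k h
      pow-index refl k h = ≐-refl

      mev-index : ∀ {j} {τ τ′ : Fin j → SI N} → (∀ i → τ i ≡ τ′ i) → ∀ m h → mev τ m h ≐ mev τ′ m h
      mev-index e [] h = ≐-refl
      mev-index {τ = τ} {τ′} e (x ∷ m) h = ≐-trans (pow-index (e zero) x _) (pow-Linear (τ′ zero) x .≐-cong (mev-index (e ∘ suc) m h))

      ev-index : ∀ {τ τ′ : Fin N → SI N} → (∀ i → τ i ≡ τ′ i) → ∀ f h → ev⟨ τ ⟩ f h ≐ ev⟨ τ′ ⟩ f h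
      ev-index e [] h = ≐-refl
      ev-index e ((c , m) ∷ f) h w v = cong₂ _+_ (cong (c *_) (mev-index e m h w v)) (ev-index e f h w v)

      cₕ≢0 : ∀ s → cₕ s ≢ 0#
      cₕ≢0 s e = cₕ+cₕ≢0 s (trans (cong₂ _+_ e e) (+-identityˡ 0#))

      -- Š multiplies a function killed by D s by cₕ, and it acts on evaluated polynomials by
      -- permuting the variables; cancelling cₕ removes one transposition at a time.
      permute-invariant : ∀ f → (∀ j → D (simple (suc j)) (act f 𝟙) ≐ 𝟘) → ∀ {P} (d : CycleData P) → ev⟨ pos ∘ Cycle.ρ (CycleData.cycle d) ⟩ f 𝟙 ≐ act f 𝟙
      permute-invariant f z d = CycleData.generated d (λ τ → ev⟨ pos ∘ τ ⟩ f 𝟙 ≐ act f 𝟙) step id ≐-refl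
        where
        step : ∀ j τ → ev⟨ pos ∘ τ ⟩ f 𝟙 ≐ act f 𝟙 → ev⟨ pos ∘ (tr j ∘ τ) ⟩ f 𝟙 ≐ act f 𝟙
        step j τ g w v = *-cancelˡ (cₕ s) (cₕ≢0 s) (begin
          cₕ s * ev⟨ pos ∘ (tr j ∘ τ) ⟩ f 𝟙 w ≡⟨ cong (cₕ s *_) (ev-index (λ i → sym (refl-tr j (τ i))) f 𝟙 w v) ⟩
          cₕ s * ev⟨ refl-of s ∘ pos ∘ τ ⟩ f 𝟙 w ≡⟨ sym (ev-Linear (refl-of s ∘ pos ∘ τ) f .⊙-hom (cₕ s) 𝟙 w v) ⟩
          ev⟨ refl-of s ∘ pos ∘ τ ⟩ f (cₕ s ⊙ 𝟙) w ≡⟨ sym (ev-Linear (refl-of s ∘ pos ∘ τ) f .≐-cong (Š-𝟙 s) w v) ⟩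
          ev⟨ refl-of s ∘ pos ∘ τ ⟩ f (Š s 𝟙) w ≡⟨ sym (Š-ev s (pos ∘ τ) f 𝟙 w v) ⟩
          Š s (ev⟨ pos ∘ τ ⟩ f 𝟙) w ≡⟨ Š-cong s g w v ⟩
          Š s (act f 𝟙) w ≡⟨ D-zero⇒Š s (act f 𝟙) (z j) w v ⟩
          cₕ s * act f 𝟙 w ∎)
          where
          open ≡-Reasoning
          s = simple (suc j)

-- Embedding, deletion and Grassmannian permutations as lists.

module ListCombinatorics where

  open OneLineNotation
  open ListReflections using (length-setAt)
  open SchubertClasses using (at-applyUpTo)
  open DeletedPosition using (sh; sh->; sh-≤; shrink-+; shrink--)
  open import Data.Bool using (T)
  open import Data.Nat using (_+_)
  open import Data.List.Relation.Binary.Permutation.Propositional using (prep; swap)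
  open import Data.List.Relation.Binary.Permutation.Propositional.Properties using (shift)

  at-++ˡ : ∀ l r i → i ℕ.< length l → at (l ++ r) (suc i) ≡ at l (suc i)
  at-++ˡ (x ∷ l) r zero p = refl
  at-++ˡ (x ∷ l) r (suc i) (s≤s p) = at-++ˡ l r i p

  at-++ʳ : ∀ l r j → at (l ++ r) (suc (length l + j)) ≡ at r (suc j)
  at-++ʳ [] r j = refl
  at-++ʳ (x ∷ l) r j = at-++ʳ l r j

  at-map : ∀ f l i → i ℕ.< length l → at (map f l) (suc i) ≡ f (at l (suc i))
  at-map f (x ∷ l) zero p = refl
  at-map f (x ∷ l) (suc i) (s≤s p) = at-map f l i p

  setAt-++ : ∀ l r i x → i ℕ.< length l → setAt (l ++ r) (suc i) x ≡ setAt l (suc i) x ++ r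
  setAt-++ (y ∷ l) r zero x p = refl
  setAt-++ (y ∷ l) r (suc i) x (s≤s p) = cong (y ∷_) (setAt-++ l r i x p)

  applyUpTo-cong< : ∀ {A : Set} N {f g : ℕ → A} → (∀ i → i ℕ.< N → f i ≡ g i) → applyUpTo f N ≡ applyUpTo g N
  applyUpTo-cong< zero e = refl
  applyUpTo-cong< (suc N) e = cong₂ _∷_ (e 0 (s≤s z≤n)) (applyUpTo-cong< N (λ i p → e (suc i) (s≤s p)))

  applyUpTo-+ : ∀ {A : Set} (f : ℕ → A) k m → applyUpTo f (k + m) ≡ applyUpTo f k ++ applyUpTo (λ j → f (k + j)) m
  applyUpTo-+ f zero m = refl
  applyUpTo-+ f (suc k) m = cong (f 0 ∷_) (applyUpTo-+ (f ∘ suc) k m)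

  map-upTo : ∀ {A : Set} (f : ℕ → A) N → map f (upTo N) ≡ applyUpTo f N
  map-upTo f N = ListP.map-applyUpTo id f N

  padding : ℕ → ℕ → List ℤ
  padding k N = map (λ j → + (k + suc j)) (upTo (N ∸ k))

  length-embed : ∀ N l → length l ℕ.≤ N → length (embed N l) ≡ N
  length-embed N l p = trans (ListP.length-++ l) (trans (cong (_+_ (length l)) (trans (ListP.length-map _ (upTo (N ∸ length l))) (ListP.length-upTo (N ∸ length l)))) (ℕP.m+[n∸m]≡n p))

  at-embed-low : ∀ N l i → i ℕ.< length l → at (embed N l) (suc i) ≡ at l (suc i)
  at-embed-low N l = at-++ˡ l (padding (length l) N)

  at-embed-high : ∀ N l i → length l ℕ.≤ i → i ℕ.< N → at (embed N l) (suc i) ≡ + suc i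
  at-embed-high N l i p q = trans (cong (λ z → at (embed N l) (suc z)) (sym eq)) (trans (at-++ʳ l (padding (length l) N) j)
    (trans (cong (λ z → at z (suc j)) (map-upTo (λ j → + (length l + suc j)) (N ∸ length l))) (trans (at-applyUpTo (λ j → + (length l + suc j)) (N ∸ length l) j (ℕP.∸-monoˡ-< q p)) (cong +_ (trans (ℕP.+-suc (length l) j) (cong suc eq))))))
    where
    j = i ∸ length l
    eq : length l + j ≡ i
    eq = ℕP.m+[n∸m]≡n p

  IsSPerm-length : ∀ N l → IsSPerm N l → length l ≡ N
  IsSPerm-length N l sp = FromPerm.len-l l sp

  embed-IsSPerm : ∀ N k l → IsSPerm k l → k ℕ.≤ N → IsSPerm N (embed N l)
  embed-IsSPerm N k l sp p with IsSPerm-length k l sp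
  ... | refl = ↭-trans (↭-reflexive (ListP.map-++ ∣_∣ l (padding k N))) (↭-trans (++⁺ʳ (map ∣_∣ (padding k N)) sp) (↭-reflexive eq))
    where
    open ≡-Reasoning
    eq : oneToN k ++ map ∣_∣ (padding k N) ≡ oneToN N
    eq = begin
      oneToN k ++ map ∣_∣ (padding k N) ≡⟨ cong₂ _++_ (map-upTo suc k) (trans (sym (ListP.map-∘ (upTo (N ∸ k)))) (trans (map-upTo (λ j → k + suc j) (N ∸ k)) (applyUpTo-cong< (N ∸ k) (λ j _ → ℕP.+-suc k j)))) ⟩
      applyUpTo suc k ++ applyUpTo (λ j → suc (k + j)) (N ∸ k) ≡⟨ sym (applyUpTo-+ suc k (N ∸ k)) ⟩
      applyUpTo suc (k + (N ∸ k)) ≡⟨ cong (applyUpTo suc) (ℕP.m+[n∸m]≡n p) ⟩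
      applyUpTo suc N ≡⟨ sym (map-upTo suc N) ⟩
      oneToN N ∎

  count>-++ : ∀ x l r → count> x (l ++ r) ≡ count> x l + count> x r
  count>-++ x [] r = refl
  count>-++ x (y ∷ l) r = trans (cong (_+_ c) (count>-++ x l r)) (sym (ℕP.+-assoc c (count> x l) (count> x r)))
    where c = if does (y ℤ.<? x) then 1 else 0

  count>-zero : ∀ x r → All (x ℤ.≤_) r → count> x r ≡ 0
  count>-zero x [] [] = refl
  count>-zero x (y ∷ r) (p ∷ ps) = cong₂ (λ b c → (if b then 1 else 0) + c) (dec-false (y ℤ.<? x) (ℤP.≤⇒≯ p)) (count>-zero x r ps)

  inversions-++ : ∀ l r → All (λ x → All (x ℤ.≤_) r) l → inversions (l ++ r) ≡ inversions l + inversions r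
  inversions-++ [] r [] = refl
  inversions-++ (x ∷ l) r (p ∷ ps) = trans (cong₂ _+_ (trans (count>-++ x l r) (trans (cong (_+_ (count> x l)) (count>-zero x r p)) (ℕP.+-identityʳ (count> x l)))) (inversions-++ l r ps))
    (sym (ℕP.+-assoc (count> x l) (inversions l) (inversions r)))

  inversions-zero : ∀ r → AllPairs ℤ._≤_ r → inversions r ≡ 0
  inversions-zero [] [] = refl
  inversions-zero (x ∷ r) (p ∷ ps) = cong₂ _+_ (count>-zero x r p) (inversions-zero r ps)

  negSum-++ : ∀ l r → negSum (l ++ r) ≡ negSum l + negSum r
  negSum-++ [] r = refl
  negSum-++ (x ∷ l) r = trans (cong (_+_ c) (negSum-++ l r)) (sym (ℕP.+-assoc c (negSum l) (negSum r)))
    where c = if does (x ℤ.<? + 0) then ∣ x ∣ else 0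

  negSum-zero : ∀ r → All (+ 0 ℤ.≤_) r → negSum r ≡ 0
  negSum-zero [] [] = refl
  negSum-zero (x ∷ r) (p ∷ ps) = cong₂ (λ b c → (if b then ∣ x ∣ else 0) + c) (dec-false (x ℤ.<? + 0) (ℤP.≤⇒≯ p)) (negSum-zero r ps)

  Bounded : ℕ → List ℤ → Set
  Bounded k = All (λ z → ∣ z ∣ ℕ.≤ k)

  ≤-∣∣ : ∀ z → z ℤ.≤ + ∣ z ∣
  ≤-∣∣ (+ m) = ℤP.≤-refl
  ≤-∣∣ -[1+ m ] = ℤ.-≤+

  -- The padding increases and exceeds the absolute values of all entries, so it creates neither
  -- inversions nor negative entries.
  len-embed : ∀ N l → Bounded (length l) l → len (embed N l) ≡ len l
  len-embed N l b = cong₂ _+_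
    (trans (inversions-++ l r (All.map (λ {x} p → AllP.map⁺ (All.universal (λ j → ℤP.≤-trans (≤-∣∣ x) (+≤+ (ℕP.≤-trans p (ℕP.m≤m+n k (suc j))))) (upTo (N ∸ k)))) b))
      (trans (cong (_+_ (inversions l)) (inversions-zero r increasing)) (ℕP.+-identityʳ _)))
    (trans (negSum-++ l r) (trans (cong (_+_ (negSum l)) (negSum-zero r (AllP.map⁺ (All.universal (λ j → +≤+ z≤n) (upTo (N ∸ k)))))) (ℕP.+-identityʳ _)))
    where
    k = length l
    r = padding k N
    increasing : AllPairs ℤ._≤_ r
    increasing = AllPairsP.map⁺ (AllPairsP.applyUpTo⁺₁ id (N ∸ k) (λ i<j _ → +≤+ (ℕP.+-monoʳ-≤ k (s≤s (ℕP.<⇒≤ i<j)))))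

  removeAt-↭ : ∀ l i → i ℕ.< length l → map ∣_∣ l ↭ ∣ at l (suc i) ∣ ∷ map ∣_∣ (removeAt l (suc i))
  removeAt-↭ (x ∷ l) zero p = ↭-refl
  removeAt-↭ (x ∷ l) (suc i) (s≤s p) = ↭-trans (prep ∣ x ∣ (removeAt-↭ l i p)) (swap ∣ x ∣ ∣ at l (suc i) ∣ ↭-refl)

  at-removeAt-low : ∀ l P i → i ℕ.< P → at (removeAt l (suc P)) (suc i) ≡ at l (suc i)
  at-removeAt-low [] P i p = refl
  at-removeAt-low (x ∷ l) (suc P) zero p = refl
  at-removeAt-low (x ∷ l) (suc P) (suc i) (s≤s p) = at-removeAt-low l P i p

  at-removeAt-high : ∀ l P i → P ℕ.≤ i → at (removeAt l (suc P)) (suc i) ≡ at l (suc (suc i))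
  at-removeAt-high [] P i p = refl
  at-removeAt-high (x ∷ l) zero i p = refl
  at-removeAt-high (x ∷ l) (suc P) (suc i) (s≤s p) = at-removeAt-high l P i p

  ∣shrink∣ : ∀ Q z → ∣ shrink Q z ∣ ≡ sh Q ∣ z ∣
  ∣shrink∣ Q (+ m) = cong ∣_∣ (shrink-+ Q m)
  ∣shrink∣ Q -[1+ m ] = trans (cong ∣_∣ (shrink-- Q m)) (ℤP.∣-i∣≡∣i∣ (+ sh Q (suc m)))

  -- Writing 1, ..., m + 1 as the values below Q, Q itself and the values above it, `sh` fixes the
  -- first block and shifts the last one down.
  sh-↭ : ∀ m Q xs → Q ∷ xs ↭ oneToN (suc m) → map (sh Q) xs ↭ oneToN m
  sh-↭ m Q xs p with ∈-map⁻ suc (∈-resp-↭ p (here refl))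
  ... | a , a∈ , refl = ↭-trans (map⁺ (sh (suc a)) xs↭) (↭-reflexive (begin
      map (sh (suc a)) (low ++ high) ≡⟨ ListP.map-++ (sh (suc a)) low high ⟩
      map (sh (suc a)) low ++ map (sh (suc a)) high ≡⟨ cong₂ _++_
         (trans (ListP.map-applyUpTo suc (sh (suc a)) a) (applyUpTo-cong< a (λ i i<a → sh-≤ (ℕP.<⇒≯ (s≤s i<a)))))
         (trans (ListP.map-applyUpTo (λ j → suc (a + suc j)) (sh (suc a)) (m ∸ a)) (applyUpTo-cong< (m ∸ a) (λ j _ → trans (sh-> (s≤s (ℕP.m<m+n a (s≤s z≤n)))) (ℕP.+-suc a j)))) ⟩
      applyUpTo suc a ++ applyUpTo (λ j → suc (a + j)) (m ∸ a) ≡⟨ sym (applyUpTo-+ suc a (m ∸ a)) ⟩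
      applyUpTo suc (a + (m ∸ a)) ≡⟨ cong (applyUpTo suc) (ℕP.m+[n∸m]≡n a≤m) ⟩
      applyUpTo suc m ≡⟨ sym (map-upTo suc m) ⟩
      oneToN m ∎))
    where
    open ≡-Reasoning
    a≤m : a ℕ.≤ m
    a≤m = ℕP.≤-pred (∈-upTo⁻ a∈)
    low = applyUpTo suc a
    high = applyUpTo (λ j → suc (a + suc j)) (m ∸ a)
    split : oneToN (suc m) ≡ low ++ suc a ∷ high
    split = trans (map-upTo suc (suc m)) (trans (cong (applyUpTo suc) (sym (trans (ℕP.+-suc a (m ∸ a)) (cong suc (ℕP.m+[n∸m]≡n a≤m)))))
      (trans (applyUpTo-+ suc a (suc (m ∸ a))) (cong (λ z → low ++ suc z ∷ high) (ℕP.+-identityʳ a))))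
    xs↭ : xs ↭ low ++ high
    xs↭ = drop-∷ (↭-trans p (↭-trans (↭-reflexive split) (shift (suc a) low high)))

  delete-IsSPerm : ∀ m u i → i ℕ.< length u → IsSPerm (suc m) u → IsSPerm m (delete/ u (suc i))
  delete-IsSPerm m u i p sp = ↭-trans (↭-reflexive (trans (sym (ListP.map-∘ xs)) (trans (ListP.map-cong (∣shrink∣ Q) xs) (ListP.map-∘ xs))))
    (sh-↭ m Q (map ∣_∣ xs) (↭-trans (↭-sym (removeAt-↭ u i p)) sp))
    where
    Q = ∣ at u (suc i) ∣
    xs = removeAt u (suc i)

  elemᵇ-sound : ∀ k l → elemᵇ k l ≡ true → k ∈ l
  elemᵇ-sound k (x ∷ l) e with k ℕ.≟ x
  ... | yes refl = here refl
  ... | no ne = there (elemᵇ-sound k l (subst (λ b → b ∨ elemᵇ k l ≡ true) (dec-false (k ℕ.≟ x) ne) e))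

  elemᵇ-complete : ∀ k l → k ∈ l → elemᵇ k l ≡ true
  elemᵇ-complete k (x ∷ l) (here e) = cong (_∨ elemᵇ k l) (dec-true (k ℕ.≟ x) e)
  elemᵇ-complete k (x ∷ l) (there p) with does (k ℕ.≟ x)
  ... | true = refl
  ... | false = elemᵇ-complete k l p

  module Grassmannian (N : ℕ) (λ′ : List ℕ) (sp : StrictPartition λ′) (bd : All (ℕ._≤ N) λ′) where

    notIn : ℕ → Bool
    notIn k = not (elemᵇ k λ′)

    rest : List ℕ
    rest = filterᵇ notIn (oneToN N)

    decreasing : AllPairs ℕ._>_ λ′
    decreasing = LinkedP.Linked⇒AllPairs (λ p q → ℕP.<-trans q p) (proj₁ sp)

    oneToN-increasing : AllPairs ℕ._<_ (oneToN N)
    oneToN-increasing = AllPairsP.map⁺ (AllPairsP.applyUpTo⁺₁ id N (λ i<j _ → s≤s i<j))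

    -- -λ₁ < -λ₂ < ⋯ < 0 is followed by the missing values in order: v(λ) has no descent among
    -- positive positions, the property that makes its class symmetric.
    grass-increasing : AllPairs ℤ._<_ (grass N λ′)
    grass-increasing = AllPairsP.++⁺ (AllPairsP.map⁺ (AllPairs.map (λ p → ℤP.neg-mono-< (+<+ p)) decreasing))
      (AllPairsP.map⁺ (AllPairs.map +<+ (AllPairsP.filter⁺ (T? ∘ notIn) oneToN-increasing)))
      (AllP.map⁺ (All.map (λ { {suc k} p → AllP.map⁺ (All.universal (λ _ → -<+) rest) }) (proj₂ sp)))

    unique : Unique (λ′ ++ rest)
    unique = UniqueP.++⁺ (AllPairs.map (λ p e → ℕP.<-irrefl (sym e) p) decreasing)
      (UniqueP.filter⁺ (T? ∘ notIn) (UniqueP.map⁺ ℕP.suc-injective (UniqueP.upTo⁺ N)))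
      (λ { (a , b) → no-T (elemᵇ-complete _ λ′ a) (proj₂ (∈-filter⁻ (T? ∘ notIn) {xs = oneToN N} b)) })
      where
      no-T : ∀ {b} → b ≡ true → ¬ T (not b)
      no-T refl ()

    grass-↭ : λ′ ++ rest ↭ oneToN N
    grass-↭ = ∼bag⇒↭ (unique∧set⇒bag unique (UniqueP.map⁺ ℕP.suc-injective (UniqueP.upTo⁺ N)) (mk⇔ to from))
      where
      to : ∀ {x} → x ∈ λ′ ++ rest → x ∈ oneToN N
      to {x} p with ∈-++⁻ λ′ p
      ... | inj₁ q = range x (All.lookup (proj₂ sp) q) (All.lookup bd q)
        where
        range : ∀ x → 0 ℕ.< x → x ℕ.≤ N → x ∈ oneToN N
        range (suc x) _ p = ∈-map⁺ suc (∈-upTo⁺ p)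
      ... | inj₂ q = proj₁ (∈-filter⁻ (T? ∘ notIn) {xs = oneToN N} q)
      from : ∀ {x} → x ∈ oneToN N → x ∈ λ′ ++ rest
      from {x} p with elemᵇ x λ′ in eq
      ... | true = ∈-++⁺ˡ (elemᵇ-sound x λ′ eq)
      ... | false = ∈-++⁺ʳ λ′ (∈-filter⁺ (T? ∘ notIn) p (subst (T ∘ not) (sym eq) tt))

    grass-IsSPerm : IsSPerm N (grass N λ′)
    grass-IsSPerm = ↭-trans (↭-reflexive (trans (ListP.map-++ ∣_∣ (map (λ l → ℤ.- (+ l)) λ′) (map +_ rest))
      (cong₂ _++_ (trans (sym (ListP.map-∘ λ′)) (trans (ListP.map-cong (λ k → ℤP.∣-i∣≡∣i∣ (+ k)) λ′) (ListP.map-id λ′))) (trans (sym (ListP.map-∘ rest)) (ListP.map-id rest))))) grass-↭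

  AllPairs-at : ∀ l → AllPairs ℤ._<_ l → ∀ i → suc i ℕ.< length l → at l (suc i) ℤ.< at l (suc (suc i))
  AllPairs-at (x ∷ []) _ zero (s≤s ())
  AllPairs-at (x ∷ y ∷ l) ((p ∷ _) ∷ _) zero _ = p
  AllPairs-at (x ∷ l) (_ ∷ ps) (suc i) (s≤s q) = AllPairs-at l ps i q

-- Chains in the 0-Bruhat order.

module BruhatChains where

  open SignedIndices
  open SignedPermutations
  open ChevalleyOperators
  open OneLineNotation
  open LengthFormula
  open ListReflections
  open DeletedPosition
  open DeletionOfCoefficients
  open ListCombinatorics
  open RationalField
  open import Relation.Binary.Construct.Closure.Transitive using ([_]; _∷_)

  Bounded-setAt : ∀ {k} l i x → Bounded k l → ∣ x ∣ ℕ.≤ k → Bounded k (setAt l i x)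
  Bounded-setAt [] i x [] p = []
  Bounded-setAt (y ∷ l) zero x b p = b
  Bounded-setAt (y ∷ l) (suc zero) x (_ ∷ b) p = p ∷ b
  Bounded-setAt (y ∷ l) (suc (suc i)) x (q ∷ b) p = q ∷ Bounded-setAt l (suc i) x b p

  Bounded-at : ∀ {k} l i → Bounded k l → ∣ at l i ∣ ℕ.≤ k
  Bounded-at [] i b = z≤n
  Bounded-at (x ∷ l) zero b = z≤n
  Bounded-at (x ∷ l) (suc zero) (p ∷ b) = p
  Bounded-at (x ∷ l) (suc (suc i)) (_ ∷ b) = Bounded-at l (suc i) b

  Bounded-neg-at : ∀ {k} l i → Bounded k l → ∣ ℤ.- at l i ∣ ℕ.≤ k
  Bounded-neg-at {k} l i b = subst (ℕ._≤ k) (sym (ℤP.∣-i∣≡∣i∣ (at l i))) (Bounded-at l i b)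

  embed-setAt : ∀ N l i x → i ℕ.< length l → embed N (setAt l (suc i) x) ≡ setAt (embed N l) (suc i) x
  embed-setAt N l i x p = trans (cong (λ k → setAt l (suc i) x ++ padding k N) (length-setAt l (suc i) x)) (sym (setAt-++ l (padding (length l) N) i x p))

  embed-rmulNeg : ∀ N l i → i ℕ.< length l → embed N (rmulNeg l (suc i)) ≡ rmulNeg (embed N l) (suc i)
  embed-rmulNeg N l i p = trans (embed-setAt N l i _ p) (cong (λ z → setAt (embed N l) (suc i) (ℤ.- z)) (sym (at-embed-low N l i p)))

  embed-rmulPair : ∀ N l i j → i ℕ.< length l → j ℕ.< length l → embed N (rmulPair l (suc i) (suc j)) ≡ rmulPair (embed N l) (suc i) (suc j)
  embed-rmulPair N l i j p q = trans (embed-setAt N (setAt l (suc i) (ℤ.- at l (suc j))) j _ (subst (j ℕ.<_) (sym (length-setAt l (suc i) _)) q))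
    (trans (cong (λ z → setAt z (suc j) (ℤ.- at l (suc i))) (embed-setAt N l i _ p))
    (cong₂ (λ x y → setAt (setAt (embed N l) (suc i) (ℤ.- x)) (suc j) (ℤ.- y)) (sym (at-embed-low N l j q)) (sym (at-embed-low N l i p))))

  module Chain {N k : ℕ} (k≤N : k ℕ.≤ N) where

    -- Facts that pass from u to w along a cover directly, whereas `IsSPerm` would require
    -- rebuilding the rearrangement of 1, ..., k at every step.
    record Element (l : List ℤ) : Set where
      field
        size    : length l ≡ k
        bounded : Bounded k l
        valid   : Valid {N} (V (embed N l))
    open Element

    ê : List ℤ → W {N}
    ê l = V (embed N l)

    IsSPerm-Element : ∀ l → IsSPerm k l → Element l
    IsSPerm-Element l sp = record
      { size = FromPerm.len-l l sp
      ; bounded = All.tabulate (λ p → proj₂ (FromPerm.bounds l sp (∈-map⁺ ∣_∣ p)))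
      ; valid = FromPerm.valid (embed N l) (embed-IsSPerm N k l sp k≤N) }

    size-embed : ∀ {l} → Element l → length (embed N l) ≡ N
    size-embed {l} e = length-embed N l (subst (ℕ._≤ N) (sym (e .size)) k≤N)

    L-ê : ∀ {l} → Element l → L (ê l) ≡ + 2 ℤ.* + len l
    L-ê {l} e = trans (sym (L-len (embed N l) (size-embed e) (e .valid))) (cong (λ z → + 2 ℤ.* + z) (len-embed N l (subst (λ z → Bounded z l) (sym (e .size)) (e .bounded))))

    -- Both kinds of cover are multiplications by the reflection of I with -J, a sign change being
    -- the case I = J.
    record Step (u w : List ℤ) : Set where
      field
        I J      : Fin N
        reflect  : ê w ≡ ê u · t (pos I) (neg J)
        level    : L (ê u · t (pos I) (neg J)) ≡ L (ê u) ℤ.+ + 2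

    step : ∀ {u w} → u ⋖₀ w → Element u → Element w × Step u w
    step {u} {w} c e = go c
      where
      index : ∀ i → i ℕ.< length u → Σ (Fin N) λ I → toℕ I ≡ i
      index i p = fromℕ< p′ , FinP.toℕ-fromℕ< p′
        where p′ = ℕP.<-≤-trans (subst (i ℕ.<_) (e .size) p) k≤N
      double : ∀ x → + 2 ℤ.* (+ 1 ℤ.+ x) ≡ + 2 ℤ.* x ℤ.+ + 2
      double = ℤSolver.solve-∀
      finish : ∀ I J → length w ≡ k → Bounded k w → ê w ≡ ê u · t (pos I) (neg J) → len w ≡ suc (len u) → Element w × Step u w
      finish I J s b r l = ew , record { I = I ; J = J ; reflect = r
          ; level = trans (cong L (sym r)) (trans (L-ê ew) (trans (cong (λ z → + 2 ℤ.* + z) l) (trans (double (+ len u)) (cong (ℤ._+ + 2) (sym (L-ê e)))))) }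
        where ew = record { size = s ; bounded = b ; valid = subst Valid (sym r) (Valid-t (pos I) (neg J) (e .valid)) }
      go : u ⋖₀ w → Element w × Step u w
      go (cover-neg (suc i) _ p refl l) with index i p
      ... | I , refl = finish I I (trans (length-setAt u _ _) (e .size)) (Bounded-setAt u (suc i) _ (e .bounded) (Bounded-neg-at u (suc i) (e .bounded)))
        (trans (cong V (embed-rmulNeg N u i p)) (V-rmulNeg (embed N u) (size-embed e) I)) l
      go (cover-pair (suc i) (suc j) _ (s≤s i<j) q refl l) with index i (ℕP.<-trans i<j q) | index j q
      ... | I , refl | J , refl = finish I J (trans (length-setAt (setAt u (suc i) _) (suc j) _) (trans (length-setAt u (suc i) _) (e .size)))
        (Bounded-setAt _ (suc j) _ (Bounded-setAt u (suc i) _ (e .bounded) (Bounded-neg-at u (suc j) (e .bounded))) (Bounded-neg-at u (suc i) (e .bounded)))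
        (trans (cong V (embed-rmulPair N u i j (ℕP.<-trans i<j q) q)) (V-rmulPair (embed N u) (size-embed e) I J (λ z → ℕP.<-irrefl (cong toℕ z) i<j))) l

    module _ {u w : List ℤ} (e : Element u) (st : Step u w) where
      open Step st

      -- A lengthening reflection t has values increasing from t x to x when t x lies to the left,
      -- so x receives a smaller value. The partners of I and J are negative positions, so both
      -- values drop.
      decreases : ∀ x → loc (t (pos I) (neg J) x) ℤ.< loc x → ev (ê w) x ℤ.< ev (ê u) x
      decreases x p = subst₂ ℤ._<_ (sym (trans (cong (λ z → ev z x) reflect) (ev-t (ê u) (pos I) (neg J) x))) (cong (ev (ê u)) (t-t (pos I) (neg J) x))
        (L-t⇒Up (e .valid) (pos I) (neg J) (λ ()) (subst (L (ê u) ℤ.<_) (sym level) (<+2 _)) (t (pos I) (neg J) x) (subst (λ z → loc (t (pos I) (neg J) x) ℤ.< loc z) (sym (t-t (pos I) (neg J) x)) p))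

      moved-I : ev (ê w) (pos I) ℤ.< ev (ê u) (pos I)
      moved-I = decreases (pos I) (subst (λ z → loc z ℤ.< loc (pos I)) (sym (t-a (pos I) (neg J))) -<+)

      moved-J : ev (ê w) (pos J) ℤ.< ev (ê u) (pos J)
      moved-J = decreases (pos J) (subst (λ z → loc z ℤ.< loc (pos J)) (sym (t-ob (pos I) (neg J))) -<+)

      lowers : ∀ K → ev (ê w) (pos K) ℤ.≤ ev (ê u) (pos K)
      lowers K with t-case (pos I) (neg J) (pos K)
      ... | case-a refl = ℤP.<⇒≤ moved-I
      ... | case-ob refl = ℤP.<⇒≤ moved-J
      ... | case-f a b c d = ℤP.≤-reflexive (trans (cong (λ z → ev z (pos K)) reflect) (trans (ev-t (ê u) (pos I) (neg J) (pos K)) (cong (ev (ê u)) (t-f (pos I) (neg J) a b c d))))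

    chain : ∀ {u w} → u <₀ w → Element u → Element w × (∀ K → ev (ê w) (pos K) ℤ.≤ ev (ê u) (pos K))
    chain [ c ] e with step c e
    ... | ew , st = ew , lowers e st
    chain (c ∷ cs) e with step c e
    ... | ev′ , st with chain cs ev′
    ...   | ew , le = ew , λ K → ℤP.≤-trans (le K) (lowers e st K)

  module _ (ty : RootType) {n : ℕ} (P : Fin (suc n)) (q : ℤ) (q≥1 : 1 ℕ.≤ ∣ q ∣) (cyc : Cycle P) {k : ℕ} (k≤N : k ℕ.≤ suc n) where
    open Deletion P q q≥1 cyc
    open Core ty P q q≥1 cyc using (cover-s)
    open Chain k≤N

    -- A cover strictly lowers the values at I and J, so constancy at P means that P is neither of
    -- them, which is what `cover-s` asks.
    step-s : ∀ {u w} → Element u → Step u w → ev (ê u) p′ ≡ q → ev (ê w) p′ ≡ q → s (ê w) ≡ s (ê u)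
    step-s {u} {w} e st a b = trans (cong s reflect) (cover-s (record { valid = Element.valid e ; at-P = a }) (pos I) (neg J)
        ((λ z → moved-P (moved-I e st) (pos-injective z)) , λ ()) ((λ ()) , λ { refl → moved-P (moved-J e st) refl }) (λ ()) level)
      where
      open Step st
      moved-P : ∀ {K} → ev (ê w) (pos K) ℤ.< ev (ê u) (pos K) → K ≢ P
      moved-P r refl = ℤP.<-irrefl (trans b (sym a)) r

    -- The values at P decrease weakly from q to q, so they equal q at every intermediate element
    -- and `step-s` applies to each cover.
    chain-s : ∀ {u w} → u <₀ w → Element u → ev (ê u) p′ ≡ q → ev (ê w) p′ ≡ q → s (ê w) ≡ s (ê u)
    chain-s [ c ] e a b = step-s e (proj₂ (step c e)) a b
    chain-s (_∷_ {y = v} c cs) e a b with step c e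
    ... | e′ , st = trans (chain-s cs e′ v-q b) (step-s e st a v-q)
      where
      v-q : ev (ê v) p′ ≡ q
      v-q = ℤP.≤-antisym (ℤP.≤-trans (lowers e st P) (ℤP.≤-reflexive a)) (ℤP.≤-trans (ℤP.≤-reflexive (sym b)) (proj₂ (chain cs e′) P))

-- Comparison of the coefficients.

module Conclusion where

  open SignedIndices
  open SignedPermutations
  open ChevalleyOperators
  open SimpleReflections
  open PolynomialAction
  open InvariantIdeal
  open LongestElement
  open OneLineNotation
  open SchubertClasses
  open StructureConstants
  open DeletedPosition
  open DeletionOfCoefficients
  open CyclicPermutations
  open ListCombinatorics
  open RationalField
  open BruhatChains

  length-delete : ∀ m u i → i ℕ.< length u → IsSPerm (suc m) u → length (delete/ u (suc i)) ≡ m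
  length-delete m u i p sp = FromPerm.len-l (delete/ u (suc i)) (delete-IsSPerm m u i p sp)

  length-removeAt : ∀ m u i → i ℕ.< length u → IsSPerm (suc m) u → length (removeAt u (suc i)) ≡ m
  length-removeAt m u i p sp = trans (sym (ListP.length-map (shrink ∣ at u (suc i) ∣) (removeAt u (suc i)))) (length-delete m u i p sp)

  module _ {n : ℕ} (P : Fin (suc n)) (q : ℤ) (q≥1 : 1 ℕ.≤ ∣ q ∣) (d : CycleData P) where
    open CycleData d
    open Deletion P q q≥1 cycle
    open Cycle cycle

    private
      N = suc n

    -- Three ranges: positions before P are unchanged, those from P on come from one further right,
    -- and in the padding both lists continue with consecutive values. The last position holds N on
    -- both sides.
    V-delete : ∀ m u → suc m ℕ.≤ N → IsSPerm (suc m) u → toℕ P ℕ.< suc m → at u (suc (toℕ P)) ≡ q →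
      V {N} (embed N (delete/ u (suc (toℕ P)))) ≡ F (V (embed N u))
    V-delete m u m<N sp P<m eq = VecP.tabulate-cong (λ i → go i (i FinP.≟ fromℕ n))
      where
      p = suc (toℕ P)
      size : length u ≡ suc m
      size = FromPerm.len-l u sp
      P<u : toℕ P ℕ.< length u
      P<u = subst (toℕ P ℕ.<_) (sym size) P<m
      d/ = delete/ u p
      size/ : length d/ ≡ m
      size/ = length-delete m u (toℕ P) P<u sp
      Q≤ : Q ℕ.≤ suc m
      Q≤ = subst (λ z → ∣ z ∣ ℕ.≤ suc m) eq (Bounded-at u p (Chain.Element.bounded (Chain.IsSPerm-Element m<N u sp)))
      kept : ∀ i → i ℕ.< m → at (embed N d/) (suc i) ≡ shrink Q (at (removeAt u p) (suc i))
      kept i i<m = trans (at-embed-low N d/ i (subst (i ℕ.<_) (sym size/) i<m))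
        (trans (at-map (shrink ∣ at u p ∣) (removeAt u p) i (subst (i ℕ.<_) (sym (length-removeAt m u (toℕ P) P<u sp)) i<m))
        (cong (λ z → shrink ∣ z ∣ (at (removeAt u p) (suc i))) eq))
      image : ∀ i {j} → toℕ (σ i) ≡ j → at (embed N u) (suc j) ≡ ev (V {N} (embed N u)) (pos (σ i))
      image i refl = sym (ev-V {N} (embed N u) (σ i))
      off : ∀ i → toℕ i ℕ.< n → at (embed N d/) (suc (toℕ i)) ≡ shrink Q (ev (V {N} (embed N u)) (pos (σ i)))
      off i i<n with toℕ i ℕ.<? toℕ P | toℕ i ℕ.<? m
      ... | yes i<P | _ = trans (kept (toℕ i) (ℕP.<-≤-trans i<P (ℕP.≤-pred P<m))) (cong (shrink Q)
            (trans (at-removeAt-low u (toℕ P) (toℕ i) i<P) (trans (sym (at-embed-low N u (toℕ i) (ℕP.<-trans i<P P<u))) (image i (cong toℕ (σ-low i i<P))))))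
      ... | no i≮P | yes i<m = trans (kept (toℕ i) i<m) (cong (shrink Q)
            (trans (at-removeAt-high u (toℕ P) (toℕ i) (ℕP.≮⇒≥ i≮P)) (trans (sym (at-embed-low N u (suc (toℕ i)) (subst (suc (toℕ i) ℕ.<_) (sym size) (s≤s i<m)))) (image i (σ-high i (ℕP.≮⇒≥ i≮P) i<n)))))
      -- With i for `toℕ i`, the relevant entry of u is i + 2, which exceeds |q| ≤ m + 1, so
      -- `shrink` lowers it to the entry i + 1 of the deleted list.
      ... | no i≮P | no i≮m = trans (at-embed-high N d/ (toℕ i) (subst (ℕ._≤ toℕ i) (sym size/) m≤i) (ℕP.m≤n⇒m≤1+n i<n))
            (trans (sym (trans (shrink-+ Q (suc (suc (toℕ i)))) (cong +_ (sh-> (s≤s (ℕP.≤-trans Q≤ (s≤s m≤i)))))))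
            (cong (shrink Q) (trans (sym (at-embed-high N u (suc (toℕ i)) (subst (ℕ._≤ suc (toℕ i)) (sym size) (s≤s m≤i)) (s≤s i<n))) (image i (σ-high i (ℕP.≮⇒≥ i≮P) i<n)))))
        where m≤i = ℕP.≮⇒≥ i≮m
      go : ∀ i (c : Dec (i ≡ fromℕ n)) → at (embed N d/) (suc (toℕ i)) ≡ (if does c then + N else shrink Q (ev (V {N} (embed N u)) (pos (σ i))))
      go i (yes refl) = trans (cong (λ z → at (embed N d/) (suc z)) (FinP.toℕ-fromℕ n)) (at-embed-high N d/ n (subst (ℕ._≤ n) (sym size/) (ℕP.≤-pred m<N)) (ℕP.n<1+n n))
      go i (no i≢) = off i (ℕP.≤∧≢⇒< (ℕP.≤-pred (FinP.toℕ<n i)) (λ z → i≢ (FinP.toℕ-injective (trans z (sym (FinP.toℕ-fromℕ n))))))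

  module _ (ty : RootType) {n : ℕ} where
    open Expansion ty {n}
    open Symmetric {n} ty

    private
      N = suc n

    -- As g is increasing, D kills 𝔖_g for s₁, s₂, …, so 𝔖_g is symmetric modulo the ideal.
    grass-permute : ∀ g → length g ≡ N → Valid {N} (V g) → (∀ i → suc i ℕ.< length g → at g (suc i) ℤ.< at g (suc (suc i))) →
      ∀ {P} (d : CycleData P) → ev⟨ pos ∘ Cycle.ρ (CycleData.cycle d) ⟩ (schubert ty N g) 𝟙 ≐ act (schubert ty N g) 𝟙
    grass-permute g size vg inc = permute-invariant (schubert ty N g) vanishing
      where
      vanishing : ∀ j → D (simple (suc j)) (act (schubert ty N g) 𝟙) ≐ 𝟘
      vanishing j w v = trans (D-cong s (schubert-δ g size vg) w v) (trans (D-⊙ s κ₀ (δ (V g)) w) (trans (cong (κ₀ *_) (D-δ-zero s (V g) up w v)) (zeroʳ κ₀)))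
        where
        s = simple (suc j)
        up : Up (V g) (lo s) (hi s)
        up = Up-intro (V g) (pos (inject₁ j)) (pos (suc j))
          (λ _ → subst₂ ℤ._<_ (sym (trans (ev-V g (inject₁ j)) (cong (λ z → at g (suc z)) (FinP.toℕ-inject₁ j)))) (sym (ev-V g (suc j))) (inc (toℕ j) (subst (suc (toℕ j) ℕ.<_) (sym size) (s≤s (FinP.toℕ<n j)))))
          (λ r → ⊥-elim (ℤP.<-asym r (lo<hi s)))

    -- κ₀ δ_u is 𝔖_u applied to `𝟙`, and 𝔖_u commutes with any evaluated polynomial; so invariance
    -- on `𝟙` propagates to δ_u, and κ₀ is cancelled.
    permuted-coeff : ∀ f τ → ev⟨ τ ⟩ f 𝟙 ≐ act f 𝟙 → ∀ u → length u ≡ N → Valid {N} (V u) → ev⟨ τ ⟩ f (δ (V u)) ≐ act f (δ (V u))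
    permuted-coeff f τ inv u size vu w v = *-cancelˡ κ₀ κ≢0 (begin
      κ₀ * ev⟨ τ ⟩ f (δ (V u)) w ≡⟨ sym (ev-Linear τ f .⊙-hom κ₀ (δ (V u)) w v) ⟩
      ev⟨ τ ⟩ f (κ₀ ⊙ δ (V u)) w ≡⟨ sym (ev-Linear τ f .≐-cong (schubert-δ u size vu) w v) ⟩
      ev⟨ τ ⟩ f (act g 𝟙) w ≡⟨ sym (ev-comm (ev-Linear pos g) τ f 𝟙 w v) ⟩
      act g (ev⟨ τ ⟩ f 𝟙) w ≡⟨ act-cong g inv w v ⟩
      act g (act f 𝟙) w ≡⟨ act-comm g f 𝟙 w v ⟩
      act f (act g 𝟙) w ≡⟨ act-cong f (schubert-δ u size vu) w v ⟩
      act f (κ₀ ⊙ δ (V u)) w ≡⟨ ev-Linear pos f .⊙-hom κ₀ (δ (V u)) w v ⟩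
      κ₀ * act f (δ (V u)) w ∎)
      where
      open ≡-Reasoning
      g = schubert ty N u

    coeff-delete : ∀ m (u w : List ℤ) (P : Fin N) → IsSPerm (suc m) u → IsSPerm (suc m) w → u <₀ w →
      toℕ P ℕ.< suc m → at u (suc (toℕ P)) ≡ at w (suc (toℕ P)) →
      (λ′ : List ℕ) → StrictPartition λ′ → suc m ℕ.≤ N → All (ℕ._≤ N) λ′ → (c c′ : List ℤ → ℚ) →
      IsExpansion ty N (embed N u) (grass N λ′) c → IsExpansion ty N (embed N (delete/ u (suc (toℕ P)))) (grass N λ′) c′ →
      c (embed N w) ≡ c′ (embed N (delete/ w (suc (toℕ P))))
    coeff-delete m u w P spu spw u<w P<m eq λ′ sp m<N bd c c′ ex ex′ = begin
      c (embed N w) ≡⟨ expansion-coeff (embed N u) v c (embed N w) (FromPerm.len-l _ su) (FromPerm.valid _ su) (FromPerm.len-l _ sv) (FromPerm.valid _ sv) sw ex ⟩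
      act f (δ (V (embed N u))) (V (embed N w)) ≡⟨ core gu gw (chain-s ty P q q≥1 cycle m<N u<w (IsSPerm-Element u spu) at-u at-w) f ⟩
      ev⟨ π⁻ ∘ pos ⟩ f (δ (F (V (embed N u)))) (F (V (embed N w)))
        ≡⟨ cong₂ (λ x y → ev⟨ π⁻ ∘ pos ⟩ f (δ x) y) (sym (V-delete P q q≥1 d m u m<N spu P<m refl)) (sym (V-delete P q q≥1 d m w m<N spw P<m (sym eq))) ⟩
      ev⟨ π⁻ ∘ pos ⟩ f (δ (V u/)) (V w/)
        ≡⟨ permuted-coeff f (π⁻ ∘ pos) (grass-permute v (FromPerm.len-l _ sv) (FromPerm.valid _ sv) (AllPairs-at v grass-increasing) d) u/ (FromPerm.len-l _ su/) (FromPerm.valid _ su/) (V w/) (FromPerm.valid _ sw/) ⟩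
      act f (δ (V u/)) (V w/) ≡⟨ sym (expansion-coeff u/ v c′ w/ (FromPerm.len-l _ su/) (FromPerm.valid _ su/) (FromPerm.len-l _ sv) (FromPerm.valid _ sv) sw/ ex′) ⟩
      c′ w/ ∎
      where
      open ≡-Reasoning
      open Chain m<N using (IsSPerm-Element)
      open Grassmannian N λ′ sp bd
      p = suc (toℕ P)
      q = at u p
      v = grass N λ′
      f = schubert ty N v
      u/ = embed N (delete/ u p)
      w/ = embed N (delete/ w p)
      su = embed-IsSPerm N (suc m) u spu m<N
      sw = embed-IsSPerm N (suc m) w spw m<N
      sv = grass-IsSPerm
      P<_ : ∀ {l} → IsSPerm (suc m) l → toℕ P ℕ.< length l
      P<_ {l} s = subst (toℕ P ℕ.<_) (sym (FromPerm.len-l l s)) P<m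
      su/ = embed-IsSPerm N m (delete/ u p) (delete-IsSPerm m u (toℕ P) (P< spu) spu) (ℕP.<⇒≤ m<N)
      sw/ = embed-IsSPerm N m (delete/ w p) (delete-IsSPerm m w (toℕ P) (P< spw) spw) (ℕP.<⇒≤ m<N)
      at-u : ev (V {N} (embed N u)) (pos P) ≡ q
      at-u = trans (ev-V (embed N u) P) (at-embed-low N u (toℕ P) (P< spu))
      at-w : ev (V {N} (embed N w)) (pos P) ≡ q
      at-w = trans (ev-V (embed N w) P) (trans (at-embed-low N w (toℕ P) (P< spw)) (sym eq))
      q≥1 : 1 ℕ.≤ ∣ q ∣
      q≥1 = subst (λ z → 1 ℕ.≤ ∣ z ∣) at-u (proj₁ (FromPerm.∣w∣-bounds (embed N u) su (pos P)))
      d = cycle-data P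
      open CycleData d using (cycle)
      open Deletion P q q≥1 cycle using (F; π⁻; Good)
      open Core ty P q q≥1 cycle using (core)
      gu : Good (V (embed N u))
      gu = record { valid = FromPerm.valid _ su ; at-P = at-u }
      gw : Good (V (embed N w))
      gw = record { valid = FromPerm.valid _ sw ; at-P = at-w }

open Conclusion
open import Data.Nat using (_≤_)

theorem4p7 : (n : ℕ) (u w : List ℤ) (p : ℕ) (q : ℤ) →
    IsSPerm (suc n) u → IsSPerm (suc n) w → u <₀ w →
    1 ≤ p → p ≤ suc n → at u p ≡ q → at w p ≡ q →
    (λ′ : List ℕ) → StrictPartition λ′ →
    (N : ℕ) → suc n ≤ N → All (_≤ N) λ′ →
    ((b b′ : List ℤ → ℚ) →
    IsBCoeffs N (embed N u) λ′ b →
    IsBCoeffs N (embed N (delete/ u p)) λ′ b′ →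
    b (embed N w) ≡ b′ (embed N (delete/ w p)))
    ×
    ((c c′ : List ℤ → ℚ) →
    IsCCoeffs N (embed N u) λ′ c →
    IsCCoeffs N (embed N (delete/ u p)) λ′ c′ →
    c (embed N w) ≡ c′ (embed N (delete/ w p)))
theorem4p7 n u w (suc i) q spu spw u<w _ (s≤s i≤n) eu ew λ′ sp (suc m) n<N bd
  with fromℕ< (ℕP.≤-trans (s≤s i≤n) n<N) | FinP.toℕ-fromℕ< (ℕP.≤-trans (s≤s i≤n) n<N)
... | P | refl = coeff-delete typeB n u w P spu spw u<w (s≤s i≤n) (trans eu (sym ew)) λ′ sp n<N bd
               , coeff-delete typeC n u w P spu spw u<w (s≤s i≤n) (trans eu (sym ew)) λ′ sp n<N bd
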